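{- Let $\alpha$ be a quadratic irrational real algebraic number. Then there is a constant $K$ depending only on $\alpha$ such that deciding $\exists^{6}\forall^{4}\exists^{11}$ $\alpha$-PA sentences with at most $K$ inequalities is $\mathsf{PSPACE}$-hard. Furthermore, for $\alpha = \sqrt{2}$ one can take $K = 10^6$.
   Context: For a real number $\alpha$, an $\alpha$-PA sentence ($\alpha$-Presburger sentence) is a statement $Q_1 \mathbf{x}_1 \in \mathbb{Z}^{n_1} \dots Q_r \mathbf{x}_r \in \mathbb{Z}^{n_r}\ \Phi(\mathbf{x}_1,\dots,\mathbf{x}_r)$, where $Q_1,\dots,Q_r \in \{\forall,\exists\}$ are $r$ alternating quantifiers, $\mathbf{x}_1,\dots,\mathbf{x}_r$ are blocks of integer variables, and $\Phi$ is a Boolean combination of linear inequalities in $\mathbf{x}_1,\dots,\mathbf{x}_r$ with coefficients and constant terms in $\mathbb{Z}[\alpha]$. Deciding a sentence means determining whether it is true. An $\exists^{6}\forall^{4}\exists^{11}$ sentence is one with three quantifier blocks $\exists,\forall,\exists$ having $6$, $4$ and $11$ integer variables respectively. The number of inequalities is the number of linear inequalities (atoms) in $\Phi$. A real algebraic number $\alpha$ is quadratic if it has degree $2$. For quadratic $\alpha$, elements of $\mathbb{Z}[\alpha]$ are represented as $c_0 + c_1\alpha$ with $c_0,c_1 \in \mathbb{Z}$, and the input size of a sentence is the total bit length of all its symbols, with integer coefficients and constants written in binary. -}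

module Defs where

open import Algebra.Bundles using (CommutativeMonoid)
import Algebra.Properties.CommutativeSemigroup as CommutativeSemigroupₚ
open import Data.Bool using (Bool; true; false)
open import Data.Digit using (Bit; toDigits)
open import Data.Fin using (Fin; zero; suc)
open import Data.Integer using (ℤ; +_; -[1+_]; 0ℤ; ∣_∣)
open import Data.List using (List; []; _∷_; _++_; [_]; length; map; concatMap; replicate)
open import Data.Maybe using (Maybe; just; nothing)
import Data.Maybe as Maybe
open import Data.Nat using (ℕ; zero; suc; _+_; _^_; _≤_; _<_; _⊔_)
open import Data.Nat.ListAction using (sum)
import Data.Nat.Properties as ℕₚ
open import Data.Product using (_×_; _,_; ∃; proj₁)
open import Data.Rational using (ℚ; 0ℚ; 1ℚ; ½; Positive; positive; 1/_)
import Data.Rational as ℚ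
import Data.Rational.Properties as ℚₚ
open import Data.Sum using (_⊎_)
open import Data.Vec using (Vec; []; _∷_)
import Data.Vec as Vec
open import Function.Bundles using (_⇔_)
open import Relation.Binary.PropositionalEquality
  using (_≡_; _≢_; refl; sym; trans; cong; cong₂; subst;
         module ≡-Reasoning)
open import Relation.Nullary using (¬_)

Cauchy : (ℕ → ℚ) → Set
Cauchy x = ∀ {ε} → 0ℚ ℚ.< ε →
  ∃ λ N → ∀ m n → N ≤ m → N ≤ n → ℚ.∣ x m ℚ.- x n ∣ ℚ.< ε

record ℝ : Set where
  constructor real
  field
    seq    : ℕ → ℚ
    cauchy : Cauchy seq

open ℝ public

infix  4 _≃ᴿ_ _≤ᴿ_
infixl 6 _+ᴿ_
infixl 7 _*ᴿ_

-- ℝ is a setoid: its equality is _≃ᴿ_, not _≡_.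
_≃ᴿ_ : ℝ → ℝ → Set
x ≃ᴿ y = ∀ {ε} → 0ℚ ℚ.< ε → ∃ λ N → ∀ n → N ≤ n → ℚ.∣ seq x n ℚ.- seq y n ∣ ℚ.< ε

_≤ᴿ_ : ℝ → ℝ → Set
x ≤ᴿ y = ∀ {ε} → 0ℚ ℚ.< ε → ∃ λ N → ∀ n → N ≤ n → seq x n ℚ.< seq y n ℚ.+ ε

module ℚ-lemmas where
  split : ∀ a b → a ≡ b ℚ.+ (a ℚ.- b)
  split a b = begin
    a                    ≡⟨ ℚₚ.+-identityʳ a ⟨
    a ℚ.+ 0ℚ             ≡⟨ cong (a ℚ.+_) (ℚₚ.+-inverseˡ b) ⟨
    a ℚ.+ (ℚ.- b ℚ.+ b)  ≡⟨ ℚₚ.+-assoc a (ℚ.- b) b ⟨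
    (a ℚ.- b) ℚ.+ b      ≡⟨ ℚₚ.+-comm (a ℚ.- b) b ⟩
    b ℚ.+ (a ℚ.- b)      ∎
    where open ≡-Reasoning

  telescope : ∀ a b c → (a ℚ.- b) ℚ.+ (b ℚ.- c) ≡ a ℚ.- c
  telescope a b c = begin
    (a ℚ.- b) ℚ.+ (b ℚ.- c)  ≡⟨ ℚₚ.+-assoc (a ℚ.- b) b (ℚ.- c) ⟨
    (a ℚ.- b) ℚ.+ b ℚ.- c    ≡⟨ cong (ℚ._- c) (trans (ℚₚ.+-comm (a ℚ.- b) b) (sym (split a b))) ⟩
    a ℚ.- c                  ∎
    where open ≡-Reasoning

  sum-difference : ∀ a b c d → (a ℚ.+ b) ℚ.- (c ℚ.+ d) ≡ (a ℚ.- c) ℚ.+ (b ℚ.- d)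
  sum-difference a b c d =
    trans (cong ((a ℚ.+ b) ℚ.+_) (ℚₚ.neg-distrib-+ c d)) (interchange a b (ℚ.- c) (ℚ.- d))
    where
    open CommutativeSemigroupₚ
      (CommutativeMonoid.commutativeSemigroup ℚₚ.+-0-commutativeMonoid)

  scaled-difference : ∀ a b c → a ℚ.* (b ℚ.- c) ≡ a ℚ.* b ℚ.- a ℚ.* c
  scaled-difference a b c =
    trans (ℚₚ.*-distribˡ-+ a b (ℚ.- c)) (cong (a ℚ.* b ℚ.+_) (sym (ℚₚ.neg-distribʳ-* a c)))

  product-difference : ∀ a b c d →
    a ℚ.* b ℚ.- c ℚ.* d ≡ a ℚ.* (b ℚ.- d) ℚ.+ d ℚ.* (a ℚ.- c)
  product-difference a b c d = sym (begin
    a ℚ.* (b ℚ.- d) ℚ.+ d ℚ.* (a ℚ.- c)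
      ≡⟨ cong₂ ℚ._+_ (scaled-difference a b d) (scaled-difference d a c) ⟩
    (a ℚ.* b ℚ.- a ℚ.* d) ℚ.+ (d ℚ.* a ℚ.- d ℚ.* c)
      ≡⟨ cong₂ (λ p q → (a ℚ.* b ℚ.- a ℚ.* d) ℚ.+ (p ℚ.- q)) (ℚₚ.*-comm d a) (ℚₚ.*-comm d c) ⟩
    (a ℚ.* b ℚ.- a ℚ.* d) ℚ.+ (a ℚ.* d ℚ.- c ℚ.* d)
      ≡⟨ telescope (a ℚ.* b) (a ℚ.* d) (c ℚ.* d) ⟩
    a ℚ.* b ℚ.- c ℚ.* d ∎)
    where open ≡-Reasoning

module Cauchy-lemmas where
  open ℚ-lemmas

  half-pos : ∀ {ε} → 0ℚ ℚ.< ε → 0ℚ ℚ.< ½ ℚ.* ε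
  half-pos {ε} 0<ε = subst (ℚ._< ½ ℚ.* ε) (ℚₚ.*-zeroʳ ½) (ℚₚ.*-monoʳ-<-pos ½ 0<ε)

  halves : ∀ ε → ½ ℚ.* ε ℚ.+ ½ ℚ.* ε ≡ ε
  halves ε = begin
    ½ ℚ.* ε ℚ.+ ½ ℚ.* ε  ≡⟨ ℚₚ.*-distribʳ-+ ε ½ ½ ⟨
    1ℚ ℚ.* ε             ≡⟨ ℚₚ.*-identityˡ ε ⟩
    ε                    ∎
    where open ≡-Reasoning

  +-cauchy : ∀ x y → Cauchy x → Cauchy y → Cauchy (λ n → x n ℚ.+ y n)
  +-cauchy x y cx cy {ε} 0<ε with cx (half-pos 0<ε) | cy (half-pos 0<ε)
  ... | M , p | N , q = M ⊔ N , λ m n ≤m ≤n → begin-strict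
      ℚ.∣ (x m ℚ.+ y m) ℚ.- (x n ℚ.+ y n) ∣
        ≡⟨ cong ℚ.∣_∣ (sum-difference (x m) (y m) (x n) (y n)) ⟩
      ℚ.∣ (x m ℚ.- x n) ℚ.+ (y m ℚ.- y n) ∣
        ≤⟨ ℚₚ.∣p+q∣≤∣p∣+∣q∣ (x m ℚ.- x n) (y m ℚ.- y n) ⟩
      ℚ.∣ x m ℚ.- x n ∣ ℚ.+ ℚ.∣ y m ℚ.- y n ∣
        <⟨ ℚₚ.+-mono-< (p m n (ℕₚ.m⊔n≤o⇒m≤o M N ≤m) (ℕₚ.m⊔n≤o⇒m≤o M N ≤n))
                       (q m n (ℕₚ.m⊔n≤o⇒n≤o M N ≤m) (ℕₚ.m⊔n≤o⇒n≤o M N ≤n)) ⟩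
      ½ ℚ.* ε ℚ.+ ½ ℚ.* ε
        ≡⟨ halves ε ⟩
      ε ∎
    where open ℚₚ.≤-Reasoning

  bounded : ∀ x → Cauchy x → ∃ λ B → Positive B × ∃ λ N → ∀ n → N ≤ n → ℚ.∣ x n ∣ ℚ.≤ B
  bounded x cx with cx (ℚₚ.positive⁻¹ 1ℚ)
  ... | N , p = B , positive (ℚₚ.+-mono-≤-< (ℚₚ.0≤∣p∣ (x N)) (ℚₚ.positive⁻¹ 1ℚ)) , N ,
    λ n N≤n → begin
      ℚ.∣ x n ∣
        ≡⟨ cong ℚ.∣_∣ (split (x n) (x N)) ⟩
      ℚ.∣ x N ℚ.+ (x n ℚ.- x N) ∣
        ≤⟨ ℚₚ.∣p+q∣≤∣p∣+∣q∣ (x N) (x n ℚ.- x N) ⟩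
      ℚ.∣ x N ∣ ℚ.+ ℚ.∣ x n ℚ.- x N ∣
        ≤⟨ ℚₚ.+-monoʳ-≤ ℚ.∣ x N ∣ (ℚₚ.<⇒≤ (p n N N≤n ℕₚ.≤-refl)) ⟩
      B ∎
    where
    B = ℚ.∣ x N ∣ ℚ.+ 1ℚ
    open ℚₚ.≤-Reasoning

  quotient : ∀ B {ε} → Positive B → 0ℚ ℚ.< ε → ∃ λ δ → 0ℚ ℚ.< δ × B ℚ.* δ ≡ ε
  quotient B {ε} B>0 0<ε = 1/B ℚ.* ε , pos , (begin
      B ℚ.* (1/B ℚ.* ε)  ≡⟨ ℚₚ.*-assoc B 1/B ε ⟨
      B ℚ.* 1/B ℚ.* ε    ≡⟨ cong (ℚ._* ε) (ℚₚ.*-inverseʳ B) ⟩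
      1ℚ ℚ.* ε           ≡⟨ ℚₚ.*-identityˡ ε ⟩
      ε                  ∎)
    where
    instance
      _ = B>0
      _ = ℚₚ.pos⇒nonZero B
    1/B = 1/ B
    open ≡-Reasoning
    pos : 0ℚ ℚ.< 1/B ℚ.* ε
    pos = subst (ℚ._< 1/B ℚ.* ε) (ℚₚ.*-zeroʳ 1/B)
            (ℚₚ.*-monoʳ-<-pos 1/B {{ℚₚ.1/pos⇒pos B}} 0<ε)

  scale : ∀ B a d {δ} → Positive B → ℚ.∣ a ∣ ℚ.≤ B → ℚ.∣ d ∣ ℚ.< δ →
          ℚ.∣ a ℚ.* d ∣ ℚ.< B ℚ.* δ
  scale B a d {δ} B>0 a≤B d<δ = begin-strict
      ℚ.∣ a ℚ.* d ∣         ≡⟨ ℚₚ.∣p*q∣≡∣p∣*∣q∣ a d ⟩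
      ℚ.∣ a ∣ ℚ.* ℚ.∣ d ∣   ≤⟨ ℚₚ.*-monoʳ-≤-nonNeg ℚ.∣ d ∣ {{ℚₚ.∣-∣-nonNeg d}} a≤B ⟩
      B ℚ.* ℚ.∣ d ∣         <⟨ ℚₚ.*-monoʳ-<-pos B {{B>0}} d<δ ⟩
      B ℚ.* δ               ∎
    where open ℚₚ.≤-Reasoning

  *-cauchy : ∀ x y → Cauchy x → Cauchy y → Cauchy (λ n → x n ℚ.* y n)
  *-cauchy x y cx cy {ε} 0<ε with bounded x cx | bounded y cy
  ... | A , A>0 , K , ≤A | B , B>0 , L , ≤B
      with quotient A A>0 (half-pos 0<ε) | quotient B B>0 (half-pos 0<ε)
  ... | δ , 0<δ , Aδ≡ | η , 0<η , Bη≡ with cy 0<δ | cx 0<η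
  ... | M , p | N , q = K ⊔ L ⊔ (M ⊔ N) , λ m n ≤m ≤n →
    let KL≤m = ℕₚ.m⊔n≤o⇒m≤o (K ⊔ L) (M ⊔ N) ≤m
        KL≤n = ℕₚ.m⊔n≤o⇒m≤o (K ⊔ L) (M ⊔ N) ≤n
        MN≤m = ℕₚ.m⊔n≤o⇒n≤o (K ⊔ L) (M ⊔ N) ≤m
        MN≤n = ℕₚ.m⊔n≤o⇒n≤o (K ⊔ L) (M ⊔ N) ≤n
    in begin-strict
      ℚ.∣ x m ℚ.* y m ℚ.- x n ℚ.* y n ∣
        ≡⟨ cong ℚ.∣_∣ (product-difference (x m) (y m) (x n) (y n)) ⟩
      ℚ.∣ x m ℚ.* (y m ℚ.- y n) ℚ.+ y n ℚ.* (x m ℚ.- x n) ∣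
        ≤⟨ ℚₚ.∣p+q∣≤∣p∣+∣q∣ (x m ℚ.* (y m ℚ.- y n)) (y n ℚ.* (x m ℚ.- x n)) ⟩
      ℚ.∣ x m ℚ.* (y m ℚ.- y n) ∣ ℚ.+ ℚ.∣ y n ℚ.* (x m ℚ.- x n) ∣
        <⟨ ℚₚ.+-mono-<
             (scale A (x m) (y m ℚ.- y n) A>0 (≤A m (ℕₚ.m⊔n≤o⇒m≤o K L KL≤m))
                (p m n (ℕₚ.m⊔n≤o⇒m≤o M N MN≤m) (ℕₚ.m⊔n≤o⇒m≤o M N MN≤n)))
             (scale B (y n) (x m ℚ.- x n) B>0 (≤B n (ℕₚ.m⊔n≤o⇒n≤o K L KL≤n))
                (q m n (ℕₚ.m⊔n≤o⇒n≤o M N MN≤m) (ℕₚ.m⊔n≤o⇒n≤o M N MN≤n))) ⟩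
      A ℚ.* δ ℚ.+ B ℚ.* η
        ≡⟨ cong (ℚ._+ B ℚ.* η) Aδ≡ ⟩
      ½ ℚ.* ε ℚ.+ B ℚ.* η
        ≡⟨ cong (½ ℚ.* ε ℚ.+_) Bη≡ ⟩
      ½ ℚ.* ε ℚ.+ ½ ℚ.* ε
        ≡⟨ halves ε ⟩
      ε ∎
    where open ℚₚ.≤-Reasoning

open Cauchy-lemmas using (+-cauchy; *-cauchy)

fromℚ : ℚ → ℝ
fromℚ q = real (λ _ → q) λ {ε} 0<ε →
  0 , λ _ _ _ _ → subst (λ p → ℚ.∣ p ∣ ℚ.< ε) (sym (ℚₚ.+-inverseʳ q)) 0<ε

fromℤ : ℤ → ℝ
fromℤ i = fromℚ (i ℚ./ 1)

0ᴿ : ℝ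
0ᴿ = fromℤ 0ℤ

_+ᴿ_ : ℝ → ℝ → ℝ
x +ᴿ y = real (λ n → seq x n ℚ.+ seq y n) (+-cauchy (seq x) (seq y) (cauchy x) (cauchy y))

_*ᴿ_ : ℝ → ℝ → ℝ
x *ᴿ y = real (λ n → seq x n ℚ.* seq y n) (*-cauchy (seq x) (seq y) (cauchy x) (cauchy y))

-- An integer polynomial of formal degree d, constant coefficient first.
Polynomial : ℕ → Set
Polynomial d = Vec ℤ (suc d)

evaluate : ∀ {n} → Vec ℤ n → ℝ → ℝ
evaluate []       α = 0ᴿ
evaluate (c ∷ cs) α = fromℤ c +ᴿ α *ᴿ evaluate cs α

_RootOfDegree_ : ℝ → ℕ → Set
α RootOfDegree d = ∃ λ (p : Polynomial d) → Vec.last p ≢ 0ℤ × evaluate p α ≃ᴿ 0ᴿ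

AlgebraicOfDegree : ℕ → ℝ → Set
AlgebraicOfDegree d α = α RootOfDegree d × (∀ e → e < d → ¬ α RootOfDegree e)

-- In particular irrational, since not a root of a polynomial of degree 1.
Quadratic : ℝ → Set
Quadratic = AlgebraicOfDegree 2

-- The pair (c₀ , c₁) stands for c₀ + c₁ α.
ℤ[α] : Set
ℤ[α] = ℤ × ℤ

⟦_⟧ : ℤ[α] → ℝ → ℝ
⟦ c₀ , c₁ ⟧ α = fromℤ c₀ +ᴿ fromℤ c₁ *ᴿ α

infix  7 _≤ᶠ_
infixr 6 _∧ᶠ_
infixr 5 _∨ᶠ_

-- The atom a ≤ᶠ b is the inequality a₁ x₁ + … + aₙ xₙ ≤ b; the strict and the
-- reversed inequalities arise by negation and by changing signs.
data Formula (n : ℕ) : Set where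
  _≤ᶠ_      : Vec ℤ[α] n → ℤ[α] → Formula n
  ¬ᶠ_       : Formula n → Formula n
  _∧ᶠ_ _∨ᶠ_ : Formula n → Formula n → Formula n

#inequalities : ∀ {n} → Formula n → ℕ
#inequalities (a ≤ᶠ b) = 1
#inequalities (¬ᶠ φ)   = #inequalities φ
#inequalities (φ ∧ᶠ ψ) = #inequalities φ + #inequalities ψ
#inequalities (φ ∨ᶠ ψ) = #inequalities φ + #inequalities ψ

linear : ∀ {n} → ℝ → Vec ℤ[α] n → Vec ℤ n → ℝ
linear α []       []       = 0ᴿ
linear α (a ∷ as) (x ∷ xs) = ⟦ a ⟧ α *ᴿ fromℤ x +ᴿ linear α as xs

Holds : ∀ {n} → ℝ → Formula n → Vec ℤ n → Set
Holds α (a ≤ᶠ b) x = linear α a x ≤ᴿ ⟦ b ⟧ α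
Holds α (¬ᶠ φ)   x = ¬ Holds α φ x
Holds α (φ ∧ᶠ ψ) x = Holds α φ x × Holds α ψ x
Holds α (φ ∨ᶠ ψ) x = Holds α φ x ⊎ Holds α ψ x

data Quantifier : Set where
  ∀′ ∃′ : Quantifier

dual : Quantifier → Quantifier
dual ∀′ = ∃′
dual ∃′ = ∀′

Quantify : Quantifier → (n : ℕ) → (Vec ℤ n → Set) → Set
Quantify ∀′ n P = ∀ (x : Vec ℤ n) → P x
Quantify ∃′ n P = ∃ λ (x : Vec ℤ n) → P x

Alternate : Quantifier → (ns : List ℕ) → (Vec ℤ (sum ns) → Set) → Set
Alternate Q []       P = P []
Alternate Q (n ∷ ns) P =
  Quantify Q n λ x → Alternate (dual Q) ns λ y → P (x Vec.++ y)

-- Prenex sentences whose alternating quantifier blocks have lengths ns, the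
-- first block being quantified by Q.
record Sentence (Q : Quantifier) (ns : List ℕ) : Set where
  constructor sentence
  field
    matrix : Formula (sum ns)

open Sentence public

IsTrue : ∀ {Q ns} → ℝ → Sentence Q ns → Set
IsTrue {Q} {ns} α φ = Alternate Q ns (Holds α (matrix φ))

Word : Set
Word = List Bool

Language : Set₁
Language = Word → Set

data Token : Set where
  allᵗ someᵗ notᵗ andᵗ orᵗ leqᵗ minusᵗ zeroᵗ oneᵗ endᵗ : Token

-- A code of constant width, so that the words below have length proportional
-- to the number of tokens.
code : Token → Word
code allᵗ   = false ∷ false ∷ false ∷ false ∷ []
code someᵗ  = false ∷ false ∷ false ∷ true  ∷ []
code notᵗ   = false ∷ false ∷ true  ∷ false ∷ []
code andᵗ   = false ∷ false ∷ true  ∷ true  ∷ []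
code orᵗ    = false ∷ true  ∷ false ∷ false ∷ []
code leqᵗ   = false ∷ true  ∷ false ∷ true  ∷ []
code minusᵗ = false ∷ true  ∷ true  ∷ false ∷ []
code zeroᵗ  = false ∷ true  ∷ true  ∷ true  ∷ []
code oneᵗ   = true  ∷ false ∷ false ∷ false ∷ []
code endᵗ   = true  ∷ false ∷ false ∷ true  ∷ []

digitToken : Bit → Token
digitToken zero       = zeroᵗ
digitToken (suc zero) = oneᵗ

-- Least significant digit first.
binary : ℕ → List Token
binary n = map digitToken (proj₁ (toDigits 2 n))

integerTokens : ℤ → List Token
integerTokens (+ n)        = binary n ++ [ endᵗ ]
integerTokens i@(-[1+ _ ]) = minusᵗ ∷ binary ∣ i ∣ ++ [ endᵗ ]

scalarTokens : ℤ[α] → List Token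
scalarTokens (c₀ , c₁) = integerTokens c₀ ++ integerTokens c₁

-- Polish notation; the number of coefficients in an atom is known from the
-- quantifier prefix.
formulaTokens : ∀ {n} → Formula n → List Token
formulaTokens (a ≤ᶠ b) = leqᵗ ∷ concatMap scalarTokens (Vec.toList a) ++ scalarTokens b
formulaTokens (¬ᶠ φ)   = notᵗ ∷ formulaTokens φ
formulaTokens (φ ∧ᶠ ψ) = andᵗ ∷ formulaTokens φ ++ formulaTokens ψ
formulaTokens (φ ∨ᶠ ψ) = orᵗ ∷ formulaTokens φ ++ formulaTokens ψ

quantifierToken : Quantifier → Token
quantifierToken ∀′ = allᵗ
quantifierToken ∃′ = someᵗ

-- Block lengths are in unary: each variable contributes a symbol.
prefixTokens : Quantifier → List ℕ → List Token
prefixTokens Q []       = []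
prefixTokens Q (n ∷ ns) =
  quantifierToken Q ∷ replicate n oneᵗ ++ [ endᵗ ] ++ prefixTokens (dual Q) ns

encode : ∀ {Q ns} → Sentence Q ns → Word
encode {Q} {ns} φ = concatMap code (prefixTokens Q ns ++ formulaTokens (matrix φ))

-- The problem of deciding those α-PA sentences with prefix Q , ns that have
-- at most K inequalities.
Deciding : ℝ → Quantifier → List ℕ → ℕ → Language
Deciding α Q ns K w = ∃ λ (φ : Sentence Q ns) →
  w ≡ encode φ × #inequalities (matrix φ) ≤ K × IsTrue α φ

data Move : Set where
  left stay right : Move

data Symbol (g : ℕ) : Set where
  blank : Symbol g
  bit   : Bool → Symbol g
  aux   : Fin g → Symbol g

-- Deterministic, with 1 + m two-way infinite tapes; the first holds the input
-- and the last the output. The machine halts where δ gives nothing.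
record TM : Set where
  field
    m g states : ℕ
    start      : Fin states
    accepting  : Fin states → Bool
    δ          : Fin states → Vec (Symbol g) (suc m) →
                 Maybe (Fin states × Vec (Symbol g × Move) (suc m))

-- The cells outside the two lists are blank; before is listed from the head
-- outwards.
record Tape (g : ℕ) : Set where
  constructor tape
  field
    before : List (Symbol g)
    head   : Symbol g
    after  : List (Symbol g)

module _ {g : ℕ} where

  blankTape : Tape g
  blankTape = tape [] blank []

  inputTape : Word → Tape g
  inputTape []       = blankTape
  inputTape (b ∷ bs) = tape [] (bit b) (map bit bs)

  write : Symbol g → Tape g → Tape g
  write s (tape ls _ rs) = tape ls s rs

  move : Move → Tape g → Tape g
  move stay  t                    = t
  move left  (tape []       h rs) = tape [] blank (h ∷ rs)
  move left  (tape (l ∷ ls) h rs) = tape ls l (h ∷ rs)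
  move right (tape ls h [])       = tape (h ∷ ls) blank []
  move right (tape ls h (r ∷ rs)) = tape (h ∷ ls) r rs

  act : Symbol g × Move → Tape g → Tape g
  act (s , d) t = move d (write s t)

  -- No move drops a cell, so this counts the cells visited so far or
  -- occupied by the input.
  cells : Tape g → ℕ
  cells (tape ls _ rs) = length ls + suc (length rs)

  bits : List (Symbol g) → Word
  bits (bit b ∷ ss) = b ∷ bits ss
  bits (blank ∷ _)  = []
  bits (aux _ ∷ _)  = []
  bits []           = []

  -- The word that begins under the head and extends to the first non-bit.
  content : Tape g → Word
  content (tape _ h rs) = bits (h ∷ rs)

module Run (M : TM) where
  open TM M

  record Configuration : Set where
    constructor ⟨_,_⟩
    field
      state : Fin states
      tapes : Vec (Tape g) (suc m)

  open Configuration public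

  initial : Word → Configuration
  initial w = ⟨ start , inputTape w ∷ Vec.replicate m blankTape ⟩

  step : Configuration → Maybe Configuration
  step ⟨ q , ts ⟩ = Maybe.map (λ (q′ , as) → ⟨ q′ , Vec.zipWith act as ts ⟩)
                              (δ q (Vec.map Tape.head ts))

  run : ℕ → Configuration → Configuration
  run zero    c = c
  run (suc t) c = Maybe.maybe (run t) c (step c)

  after : ℕ → Word → Configuration
  after t w = run t (initial w)

  Halted : Configuration → Set
  Halted c = step c ≡ nothing

  Accepting : Configuration → Set
  Accepting c = accepting (state c) ≡ true

  output : Configuration → Word
  output c = content (Vec.last (tapes c))

  space : Configuration → ℕ
  space c = Vec.sum (Vec.map cells (tapes c))

-- Every polynomial in n is at most n ^ k + k for some k.
poly : ℕ → ℕ → ℕ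
poly k n = n ^ k + k

Decides : TM → Language → Set
Decides M L = ∀ w → ∃ λ t → Halted (after t w) × (L w ⇔ Accepting (after t w))
  where open Run M

PSPACE : Language → Set
PSPACE L = ∃ λ M → Decides M L × ∃ λ k → ∀ w t →
  Run.space M (Run.after M t w) ≤ poly k (length w)

PolyTimeComputable : (Word → Word) → Set
PolyTimeComputable f = ∃ λ M → let open Run M in
  ∃ λ k → ∀ w → ∃ λ t → t ≤ poly k (length w) ×
    Halted (after t w) × output (after t w) ≡ f w

infix 4 _≤ₚ_

_≤ₚ_ : Language → Language → Set
L ≤ₚ L′ = ∃ λ f → PolyTimeComputable f × (∀ w → L w ⇔ L′ (f w))

PSPACE-Hard : Language → Set₁
PSPACE-Hard L′ = ∀ (L : Language) → PSPACE L → L ≤ₚ L′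

{-# OPTIONS --safe #-}

-- Pell's equation, solved by Conway's river, gives θ = e₀ + e₁ α ≥ 0 with θ² = a² − 1 for a large integer a,
-- so that ε = a + θ is a unit of ℤ[θ] with conjugate ε⁻¹. Linear inequalities over ℤ[α] compare elements of
-- ℤ[θ] and also their conjugates. In this double order, a number u ≥ 1 with positive conjugate is a power of ε
-- unless it strictly dominates another positive number. A string d₀ d₁ … of digits is coded by X = Σ dᵢ εⁱ:
-- its digit at u = εⁱ is the unique small c for which X = L + c u + H with L small compared to u and the
-- conjugate of H small compared to that of u. Multiplication by a fixed power ε^s is linear, so a sentence
-- ∃ X ∀ u ∃ … can relate the digits at i and at i + s, for four shifts s that are written into its
-- coefficients, and can compare X with a prescribed string C. This suffices to say that X codes the transcript
-- of an accepting run of a deterministic machine in polynomial space: C holds the rules of the machine, which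
-- the relations on digits repeat periodically and apply to rows of bits that hold the configurations. The
-- coefficients have polynomially many binary digits and are computed by Horner's rule.

module Submission where

open import Data.Empty using (⊥; ⊥-elim)
open import Data.Product using (_×_; _,_; ∃; ∃₂; proj₁; proj₂)
open import Data.Sum using (_⊎_; inj₁; inj₂)
open import Relation.Binary.PropositionalEquality hiding ([_])
open import Relation.Nullary using (¬_; Dec; yes; no; does)
open import Function using (_∘_)
open import Data.Bool using (Bool; true; false; if_then_else_)
open import Data.Fin as Fin using (Fin; toℕ)
open import Data.Integer as ℤ using (ℤ; -[1+_]; 0ℤ; 1ℤ; -1ℤ)
open import Data.List as List using (List; []; _∷_; _++_)
open import Data.List.Relation.Unary.All as All using (All; []; _∷_)
open import Data.Maybe as Maybe using (Maybe; just; nothing)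
open import Data.Nat as ℕ using (ℕ; zero; suc; z≤n; s≤s)
open import Data.Rational as ℚ using (ℚ)
open import Data.Vec as Vec using (Vec; []; _∷_; lookup)
import Defs
import Data.Fin.Properties as Finₚ
import Data.Integer.Properties as ℤₚ
import Data.Integer.Tactic.RingSolver as ℤSolver
import Data.List.Properties as Listₚ
import Data.List.Relation.Unary.All.Properties as Allₚ
import Data.Nat.Properties as ℕₚ
import Data.Rational.Properties as ℚₚ
import Data.Vec.Properties as Vecₚ
import Tactic.RingSolver as Solver

module Reals where

 open import Defs using (ℝ; seq; cauchy; _+ᴿ_; _*ᴿ_; fromℤ; fromℚ; _≤ᴿ_; _≃ᴿ_; module Cauchy-lemmas)
 open import Algebra.Bundles using (CommutativeRing)
 open import Data.Integer using (+_)
 open import Data.Nat using (_≤_; _⊔_)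
 open import Data.Rational using (0ℚ; 1ℚ; ½; Positive; positive)
 import Data.Rational.Unnormalised as ℚᵘ
 import Data.Rational.Unnormalised.Properties as ℚᵘₚ
 open import Level using (0ℓ)
 import Tactic.RingSolver.Core.AlmostCommutativeRing as ACR

 ℚ-ring : ACR.AlmostCommutativeRing 0ℓ 0ℓ
 ℚ-ring = ACR.fromCommutativeRing ℚₚ.+-*-commutativeRing zero?
   where
   zero? : ∀ q → Maybe (0ℚ ≡ q)
   zero? q with 0ℚ ℚ.≟ q
   ... | yes eq = just eq
   ... | no _   = nothing

 ι : ℤ → ℚ
 ι i = i ℚ./ 1

 private
   ι≃ : ∀ i → ℚ.toℚᵘ (ι i) ℚᵘ.≃ ℚᵘ.mkℚᵘ i 0
   ι≃ i = ℚₚ.toℚᵘ-fromℚᵘ (ℚᵘ.mkℚᵘ i 0)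

 ι-+ : ∀ i j → ι (i ℤ.+ j) ≡ ι i ℚ.+ ι j
 ι-+ i j = ℚₚ.toℚᵘ-injective (ℚᵘₚ.≃-trans (ι≃ (i ℤ.+ j)) (ℚᵘₚ.≃-sym
   (ℚᵘₚ.≃-trans (ℚₚ.toℚᵘ-homo-+ (ι i) (ι j)) (ℚᵘₚ.≃-trans (ℚᵘₚ.+-cong (ι≃ i) (ι≃ j))
     (ℚᵘ.*≡* (cong (ℤ._* 1ℤ) (cong₂ ℤ._+_ (ℤₚ.*-identityʳ i) (ℤₚ.*-identityʳ j))))))))

 ι-* : ∀ i j → ι (i ℤ.* j) ≡ ι i ℚ.* ι j
 ι-* i j = ℚₚ.toℚᵘ-injective (ℚᵘₚ.≃-trans (ι≃ (i ℤ.* j)) (ℚᵘₚ.≃-sym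
   (ℚᵘₚ.≃-trans (ℚₚ.toℚᵘ-homo-* (ι i) (ι j)) (ℚᵘₚ.≃-trans (ℚᵘₚ.*-cong (ι≃ i) (ι≃ j))
     (ℚᵘ.*≡* refl)))))

 ι-neg : ∀ i → ι (ℤ.- i) ≡ ℚ.- ι i
 ι-neg i = begin
   ι (ℤ.- i)                          ≡⟨ lemma (ι (ℤ.- i)) (ι i) ⟩
   (ι (ℤ.- i) ℚ.+ ι i) ℚ.- ι i        ≡⟨ cong (ℚ._- ι i) (ι-+ (ℤ.- i) i) ⟨
   ι (ℤ.- i ℤ.+ i) ℚ.- ι i            ≡⟨ cong (λ k → ι k ℚ.- ι i) (ℤₚ.+-inverseˡ i) ⟩
   0ℚ ℚ.- ι i                         ≡⟨ ℚₚ.+-identityˡ (ℚ.- ι i) ⟩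
   ℚ.- ι i                            ∎
   where
   open ≡-Reasoning
   lemma : ∀ p q → p ≡ (p ℚ.+ q) ℚ.- q
   lemma = Solver.solve-∀ ℚ-ring

 ι-nonneg : ∀ n → 0ℚ ℚ.≤ ι (+ n)
 ι-nonneg n = ℚₚ.toℚᵘ-cancel-≤ (ℚᵘₚ.≤-trans (ℚᵘ.*≤* (subst (0ℤ ℤ.≤_) (sym (ℤₚ.*-identityʳ (+ n))) (ℤ.+≤+ ℕ.z≤n))) (ℚᵘₚ.≤-reflexive (ℚᵘₚ.≃-sym (ι≃ (+ n)))))
   where import Data.Nat as ℕ

 ι-neg-≤ : ∀ n → ι -[1+ n ] ℚ.≤ ℚ.- 1ℚ
 ι-neg-≤ n = ℚₚ.toℚᵘ-cancel-≤ (ℚᵘₚ.≤-trans (ℚᵘₚ.≤-reflexive (ι≃ -[1+ n ])) (ℚᵘ.*≤* (subst (ℤ._≤ -[1+ 0 ]) (sym (ℤₚ.*-identityʳ -[1+ n ])) (ℤ.-≤- ℕ.z≤n))))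
   where import Data.Nat as ℕ

 0<½ : 0ℚ ℚ.< ½
 0<½ = ℚₚ.positive⁻¹ ½

 open Cauchy-lemmas using (half-pos; halves; bounded; quotient)

 NonNeg : ℝ → Set
 NonNeg x = ∀ ε → 0ℚ ℚ.< ε → ∃ λ N → ∀ n → N ≤ n → 0ℚ ℚ.< seq x n ℚ.+ ε

 infix 8 -ᴿ_
 -ᴿ_ : ℝ → ℝ
 -ᴿ x = fromℤ -[1+ 0 ] *ᴿ x

 module NonNeg-lemmas where

   ≗-nn : ∀ x y → (∀ n → seq x n ≡ seq y n) → NonNeg x → NonNeg y
   ≗-nn x y eq p ε 0<ε with p ε 0<ε
   ... | N , h = N , λ n N≤n → subst (λ q → 0ℚ ℚ.< q ℚ.+ _) (eq n) (h n N≤n)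

   +-nn : ∀ x y → NonNeg x → NonNeg y → NonNeg (x +ᴿ y)
   +-nn x y p q ε 0<ε with p _ (half-pos 0<ε) | q _ (half-pos 0<ε)
   ... | M , f | N , g = M ⊔ N , λ n le →
     subst (0ℚ ℚ.<_) (trans (lemma (seq x n) (seq y n) (½ ℚ.* ε)) (cong ((seq x n ℚ.+ seq y n) ℚ.+_) (halves ε)))
       (ℚₚ.+-mono-< (f n (ℕₚ.m⊔n≤o⇒m≤o M N le)) (g n (ℕₚ.m⊔n≤o⇒n≤o M N le)))
     where
     lemma : ∀ a b e → (a ℚ.+ e) ℚ.+ (b ℚ.+ e) ≡ (a ℚ.+ b) ℚ.+ (e ℚ.+ e)
     lemma = Solver.solve-∀ ℚ-ring

   const-nn : ∀ n → NonNeg (fromℤ (+ n))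
   const-nn k ε 0<ε = 0 , λ n _ → ℚₚ.+-mono-≤-< (ι-nonneg k) 0<ε

   ≤∣_∣ : ∀ p → p ℚ.≤ ℚ.∣ p ∣
   ≤∣ p ∣ with ℚₚ.∣p∣≡p∨∣p∣≡-p p
   ... | inj₁ eq = ℚₚ.≤-reflexive (sym eq)
   ... | inj₂ eq with ℚₚ.≤-total 0ℚ p
   ...   | inj₁ 0≤p = ℚₚ.≤-reflexive (sym (ℚₚ.0≤p⇒∣p∣≡p 0≤p))
   ...   | inj₂ p≤0 = ℚₚ.≤-trans p≤0 (ℚₚ.0≤∣p∣ p)

   pos-* : ∀ {p q} → 0ℚ ℚ.< p → 0ℚ ℚ.< q → 0ℚ ℚ.< p ℚ.* q
   pos-* {p} {q} 0<p 0<q = subst (ℚ._< p ℚ.* q) (ℚₚ.*-zeroʳ p) (ℚₚ.*-monoʳ-<-pos p {{positive 0<p}} 0<q)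

   -- With δ < 1 and B bounding x + y + 1: (x + δ)(y + δ) > 0 gives x y + B δ > 0.
   *-nn : ∀ x y → NonNeg x → NonNeg y → NonNeg (x *ᴿ y)
   *-nn x y p q ε 0<ε = from-bounds (bounded (seq x) (cauchy x)) (bounded (seq y) (cauchy y))
     where
     Goal : Set
     Goal = ∃ λ N → ∀ n → N ≤ n → 0ℚ ℚ.< seq x n ℚ.* seq y n ℚ.+ ε
     expand : ∀ a b d → (a ℚ.+ d) ℚ.* (b ℚ.+ d) ≡ a ℚ.* b ℚ.+ (a ℚ.+ b ℚ.+ d) ℚ.* d
     expand = Solver.solve-∀ ℚ-ring
     from-bounds : (∃ λ A → Positive A × ∃ λ K → ∀ n → K ≤ n → ℚ.∣ seq x n ∣ ℚ.≤ A) →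
                   (∃ λ B → Positive B × ∃ λ L → ∀ n → L ≤ n → ℚ.∣ seq y n ∣ ℚ.≤ B) → Goal
     from-bounds (A , A>0 , K , ≤A) (B , B>0 , L , ≤B) = from-quotient (quotient C (positive 0<C) 0<ε)
       where
       C = A ℚ.+ B ℚ.+ 1ℚ
       0<C : 0ℚ ℚ.< C
       0<C = ℚₚ.+-mono-< (ℚₚ.+-mono-< (ℚₚ.positive⁻¹ A {{A>0}}) (ℚₚ.positive⁻¹ B {{B>0}})) (ℚₚ.positive⁻¹ 1ℚ)
       with-δ : ∀ δ → 0ℚ ℚ.< δ → δ ℚ.≤ 1ℚ → C ℚ.* δ ℚ.≤ ε → Goal
       with-δ δ 0<δ δ≤1 Cδ≤ε with p δ 0<δ | q δ 0<δ
       ... | M , f | N , g = K ⊔ L ⊔ (M ⊔ N) , λ n le →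
         let le₁ = ℕₚ.m⊔n≤o⇒m≤o (K ⊔ L) (M ⊔ N) le
             le₂ = ℕₚ.m⊔n≤o⇒n≤o (K ⊔ L) (M ⊔ N) le
             xb = ℚₚ.≤-trans ≤∣ seq x n ∣ (≤A n (ℕₚ.m⊔n≤o⇒m≤o K L le₁))
             yb = ℚₚ.≤-trans ≤∣ seq y n ∣ (≤B n (ℕₚ.m⊔n≤o⇒n≤o K L le₁))
         in begin-strict
           0ℚ
             <⟨ pos-* (f n (ℕₚ.m⊔n≤o⇒m≤o M N le₂)) (g n (ℕₚ.m⊔n≤o⇒n≤o M N le₂)) ⟩
           (seq x n ℚ.+ δ) ℚ.* (seq y n ℚ.+ δ)
             ≡⟨ expand (seq x n) (seq y n) δ ⟩
           seq x n ℚ.* seq y n ℚ.+ (seq x n ℚ.+ seq y n ℚ.+ δ) ℚ.* δ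
             ≤⟨ ℚₚ.+-monoʳ-≤ (seq x n ℚ.* seq y n) (ℚₚ.*-monoʳ-≤-nonNeg δ {{ℚ.nonNegative (ℚₚ.<⇒≤ 0<δ)}} (ℚₚ.+-mono-≤ (ℚₚ.+-mono-≤ xb yb) δ≤1)) ⟩
           seq x n ℚ.* seq y n ℚ.+ C ℚ.* δ
             ≤⟨ ℚₚ.+-monoʳ-≤ (seq x n ℚ.* seq y n) Cδ≤ε ⟩
           seq x n ℚ.* seq y n ℚ.+ ε ∎
         where open ℚₚ.≤-Reasoning
       from-quotient : (∃ λ δ → 0ℚ ℚ.< δ × C ℚ.* δ ≡ ε) → Goal
       from-quotient (δ , 0<δ , eq) with ℚₚ.≤-total δ 1ℚ
       ... | inj₁ δ≤1 = with-δ δ 0<δ δ≤1 (ℚₚ.≤-reflexive eq)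
       ... | inj₂ 1≤δ = with-δ 1ℚ (ℚₚ.positive⁻¹ 1ℚ) ℚₚ.≤-refl
         (ℚₚ.≤-trans (ℚₚ.*-monoˡ-≤-nonNeg C {{ℚ.nonNegative (ℚₚ.<⇒≤ 0<C)}} 1≤δ) (ℚₚ.≤-reflexive eq))

   cancel-nn : ∀ x y → NonNeg (x +ᴿ fromℤ -[1+ 0 ]) → NonNeg (x *ᴿ y) → NonNeg y
   cancel-nn x y p q ε 0<ε with p ½ 0<½ | q _ (half-pos 0<ε)
   ... | M , f | N , g = M ⊔ N , λ n le →
     let ½<x = ½<_ {seq x n} (f n (ℕₚ.m⊔n≤o⇒m≤o M N le))
         0<x = ℚₚ.<-trans 0<½ ½<x
     in ℚₚ.*-cancelˡ-<-nonNeg (seq x n) {{ℚ.nonNegative (ℚₚ.<⇒≤ 0<x)}} (begin-strict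
       seq x n ℚ.* 0ℚ
         ≡⟨ ℚₚ.*-zeroʳ (seq x n) ⟩
       0ℚ
         <⟨ g n (ℕₚ.m⊔n≤o⇒n≤o M N le) ⟩
       seq x n ℚ.* seq y n ℚ.+ ½ ℚ.* ε
         <⟨ ℚₚ.+-monoʳ-< (seq x n ℚ.* seq y n) (ℚₚ.*-monoˡ-<-pos ε {{positive 0<ε}} ½<x) ⟩
       seq x n ℚ.* seq y n ℚ.+ seq x n ℚ.* ε
         ≡⟨ ℚₚ.*-distribˡ-+ (seq x n) (seq y n) ε ⟨
       seq x n ℚ.* (seq y n ℚ.+ ε) ∎)
     where
     open ℚₚ.≤-Reasoning
     ½<_ : ∀ {a} → 0ℚ ℚ.< (a ℚ.+ ι -[1+ 0 ]) ℚ.+ ½ → ½ ℚ.< a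
     ½<_ {a} h = subst₂ ℚ._<_ (ℚₚ.+-identityˡ ½) (trans (lemma a) (ℚₚ.+-identityʳ a)) (ℚₚ.+-monoˡ-< ½ h)
       where
       lemma : ∀ a → ((a ℚ.+ ι -[1+ 0 ]) ℚ.+ ½) ℚ.+ ½ ≡ a ℚ.+ 0ℚ
       lemma a = trans (ℚₚ.+-assoc (a ℚ.+ ι -[1+ 0 ]) ½ ½) (ℚₚ.+-assoc a (ι -[1+ 0 ]) 1ℚ)

   ¬const-nn : ∀ n → ¬ NonNeg (fromℤ -[1+ n ])
   ¬const-nn k p with p ½ 0<½
   ... | N , h = ℚₚ.<-irrefl refl (ℚₚ.<-≤-trans (h N ℕₚ.≤-refl)
     (ℚₚ.≤-trans (ℚₚ.+-monoˡ-≤ ½ (ι-neg-≤ k)) (ℚₚ.nonPositive⁻¹ (ℚ.- ½))))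

   neg-seq : ∀ x n → seq (-ᴿ x) n ≡ ℚ.- seq x n
   neg-seq x n = trans (sym (ℚₚ.neg-distribˡ-* 1ℚ (seq x n))) (cong ℚ.-_ (ℚₚ.*-identityˡ (seq x n)))

   ≤⇒nn : ∀ x y → x ≤ᴿ y → NonNeg (y +ᴿ -ᴿ x)
   ≤⇒nn x y p ε 0<ε with p 0<ε
   ... | N , h = N , λ n N≤n → subst₂ ℚ._<_ (ℚₚ.+-inverseʳ (seq x n))
       (trans (lemma (seq x n) (seq y n) ε) (cong (λ z → seq y n ℚ.+ z ℚ.+ ε) (sym (neg-seq x n))))
       (ℚₚ.+-monoˡ-< (ℚ.- seq x n) (h n N≤n))
     where
     lemma : ∀ a b e → (b ℚ.+ e) ℚ.- a ≡ (b ℚ.+ (ℚ.- a)) ℚ.+ e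
     lemma = Solver.solve-∀ ℚ-ring

   nn⇒≤ : ∀ x y → NonNeg (y +ᴿ -ᴿ x) → x ≤ᴿ y
   nn⇒≤ x y p {ε} 0<ε with p ε 0<ε
   ... | N , h = N , λ n N≤n → subst₂ ℚ._<_ (ℚₚ.+-identityˡ (seq x n))
       (trans (cong (λ z → (seq y n ℚ.+ z) ℚ.+ ε ℚ.+ seq x n) (neg-seq x n)) (lemma (seq x n) (seq y n) ε))
       (ℚₚ.+-monoˡ-< (seq x n) (h n N≤n))
     where
     lemma : ∀ a b e → (b ℚ.+ (ℚ.- a)) ℚ.+ e ℚ.+ a ≡ b ℚ.+ e
     lemma = Solver.solve-∀ ℚ-ring

   ≃⇒nn : ∀ x y → x ≃ᴿ y → NonNeg (x +ᴿ -ᴿ y)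
   ≃⇒nn x y p ε 0<ε with p 0<ε
   ... | N , h = N , λ n N≤n →
     let d = seq x n ℚ.- seq y n in
     subst₂ ℚ._<_ (ℚₚ.+-inverseʳ d) (cong (λ z → seq x n ℚ.+ z ℚ.+ ε) (sym (neg-seq y n)))
       (ℚₚ.+-monoʳ-< d (ℚₚ.≤-<-trans ≤∣ ℚ.- d ∣ (subst (ℚ._< ε) (sym (ℚₚ.∣-p∣≡∣p∣ d)) (h n N≤n))))

   ≃-sym : ∀ x y → x ≃ᴿ y → y ≃ᴿ x
   ≃-sym x y p {ε} 0<ε with p 0<ε
   ... | N , h = N , λ n N≤n → subst (ℚ._< ε)
       (trans (sym (ℚₚ.∣-p∣≡∣p∣ (seq x n ℚ.- seq y n))) (cong ℚ.∣_∣ (lemma (seq x n) (seq y n)))) (h n N≤n)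
     where
     lemma : ∀ a b → ℚ.- (a ℚ.- b) ≡ b ℚ.- a
     lemma = Solver.solve-∀ ℚ-ring

   nn⇒≃ : ∀ x y → NonNeg (x +ᴿ -ᴿ y) → NonNeg (y +ᴿ -ᴿ x) → x ≃ᴿ y
   nn⇒≃ x y p q {ε} 0<ε with p ε 0<ε | q ε 0<ε
   ... | M , f | N , g = M ⊔ N , λ n le → bound n (f n (ℕₚ.m⊔n≤o⇒m≤o M N le)) (g n (ℕₚ.m⊔n≤o⇒n≤o M N le))
     where
     lemma₁ : ∀ a b e → (b ℚ.+ (ℚ.- a)) ℚ.+ e ℚ.+ (a ℚ.- b) ≡ e
     lemma₁ = Solver.solve-∀ ℚ-ring
     lemma₂ : ∀ a b e → (a ℚ.+ (ℚ.- b)) ℚ.+ e ℚ.+ (ℚ.- (a ℚ.- b)) ≡ e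
     lemma₂ = Solver.solve-∀ ℚ-ring
     bound : ∀ n → 0ℚ ℚ.< (seq x n ℚ.+ seq (-ᴿ y) n) ℚ.+ ε → 0ℚ ℚ.< (seq y n ℚ.+ seq (-ᴿ x) n) ℚ.+ ε →
             ℚ.∣ seq x n ℚ.- seq y n ∣ ℚ.< ε
     bound n f g rewrite neg-seq x n | neg-seq y n with ℚₚ.∣p∣≡p∨∣p∣≡-p (seq x n ℚ.- seq y n)
     ... | inj₁ eq = subst₂ ℚ._<_ (trans (ℚₚ.+-identityˡ _) (sym eq)) (lemma₁ (seq x n) (seq y n) ε)
                       (ℚₚ.+-monoˡ-< (seq x n ℚ.- seq y n) g)
     ... | inj₂ eq = subst₂ ℚ._<_ (trans (ℚₚ.+-identityˡ _) (sym eq)) (lemma₂ (seq x n) (seq y n) ε)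
                       (ℚₚ.+-monoˡ-< (ℚ.- (seq x n ℚ.- seq y n)) f)

   Null : ℝ → Set
   Null x = NonNeg x × NonNeg (-ᴿ x)

   neg-seq′ : ∀ x n {q} → q ≡ ℚ.- seq x n → q ≡ seq (-ᴿ x) n
   neg-seq′ x n eq = trans eq (sym (neg-seq x n))

   null-≗ : ∀ x y → (∀ n → seq x n ≡ seq y n) → Null x → Null y
   null-≗ x y eq (p , q) = ≗-nn x y eq p , ≗-nn (-ᴿ x) (-ᴿ y) (λ n → neg-seq′ y n (trans (neg-seq x n) (cong ℚ.-_ (eq n)))) q

   ≃⇒null : ∀ x y → x ≃ᴿ y → Null (x +ᴿ -ᴿ y)
   ≃⇒null x y x≃y = ≃⇒nn x y x≃y , ≗-nn (y +ᴿ -ᴿ x) (-ᴿ (x +ᴿ -ᴿ y))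
     (λ n → neg-seq′ (x +ᴿ -ᴿ y) n (trans (cong (λ z → seq y n ℚ.+ z) (neg-seq x n)) (trans (lemma (seq x n) (seq y n)) (cong (λ z → ℚ.- (seq x n ℚ.+ z)) (sym (neg-seq y n))))))
     (≃⇒nn y x (≃-sym x y x≃y))
     where
     lemma : ∀ a b → b ℚ.+ ℚ.- a ≡ ℚ.- (a ℚ.+ ℚ.- b)
     lemma = Solver.solve-∀ ℚ-ring

   null⇒≃ : ∀ x y → Null (x +ᴿ -ᴿ y) → x ≃ᴿ y
   null⇒≃ x y (p , q) = nn⇒≃ x y p (≗-nn (-ᴿ (x +ᴿ -ᴿ y)) (y +ᴿ -ᴿ x)
     (λ n → trans (neg-seq (x +ᴿ -ᴿ y) n) (trans (cong (λ z → ℚ.- (seq x n ℚ.+ z)) (neg-seq y n)) (trans (lemma (seq x n) (seq y n)) (cong (λ z → seq y n ℚ.+ z) (sym (neg-seq x n)))))) q)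
     where
     lemma : ∀ a b → ℚ.- (a ℚ.+ ℚ.- b) ≡ b ℚ.+ ℚ.- a
     lemma = Solver.solve-∀ ℚ-ring

   null-* : ∀ k x → Null x → Null (fromℤ k *ᴿ x)
   null-* (+ n) x (p , q) = *-nn (fromℤ (+ n)) x (const-nn n) p ,
     ≗-nn (fromℤ (+ n) *ᴿ -ᴿ x) (-ᴿ (fromℤ (+ n) *ᴿ x)) (λ i → neg-seq′ (fromℤ (+ n) *ᴿ x) i (trans (cong (λ z → ι (+ n) ℚ.* z) (neg-seq x i)) (lemma (ι (+ n)) (seq x i))))
       (*-nn (fromℤ (+ n)) (-ᴿ x) (const-nn n) q)
     where
     lemma : ∀ a b → a ℚ.* ℚ.- b ≡ ℚ.- (a ℚ.* b)
     lemma = Solver.solve-∀ ℚ-ring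
   null-* -[1+ n ] x (p , q) =
     ≗-nn (fromℤ (+ suc n) *ᴿ -ᴿ x) (fromℤ -[1+ n ] *ᴿ x) (λ i → trans (cong (λ z → ι (+ suc n) ℚ.* z) (neg-seq x i)) (trans (lemma (ι (+ suc n)) (seq x i)) (cong (λ z → z ℚ.* seq x i) (sym (ι-neg (+ suc n))))))
       (*-nn (fromℤ (+ suc n)) (-ᴿ x) (const-nn (suc n)) q) ,
     ≗-nn (fromℤ (+ suc n) *ᴿ x) (-ᴿ (fromℤ -[1+ n ] *ᴿ x)) (λ i → neg-seq′ (fromℤ -[1+ n ] *ᴿ x) i (trans (lemma′ (ι (+ suc n)) (seq x i)) (cong (λ z → ℚ.- (z ℚ.* seq x i)) (sym (ι-neg (+ suc n))))))
       (*-nn (fromℤ (+ suc n)) x (const-nn (suc n)) p)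
     where
     lemma : ∀ a b → a ℚ.* ℚ.- b ≡ ℚ.- a ℚ.* b
     lemma = Solver.solve-∀ ℚ-ring
     lemma′ : ∀ a b → a ℚ.* b ≡ ℚ.- (ℚ.- a ℚ.* b)
     lemma′ = Solver.solve-∀ ℚ-ring

module Pairs where

 open import Defs using (ℝ; seq; _+ᴿ_; _*ᴿ_; fromℤ; _≃ᴿ_; ⟦_⟧; ℤ[α])
 open Reals
 open import Data.Integer using (+_; _+_; _*_; -_; _-_)
 open import Data.Integer.Tactic.RingSolver using (solve-∀)
 open import Relation.Nullary using (contradiction)

 infixl 6 _⊕_
 infixl 7 _·_
 infix  8 ⊝_

 -- Pairs (x , y) stand for x + y θ where θ² = D.
 _⊕_ : ℤ[α] → ℤ[α] → ℤ[α]
 (x , y) ⊕ (u , v) = x + u , y + v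

 ⊝_ : ℤ[α] → ℤ[α]
 ⊝ (x , y) = - x , - y

 _·_ : ℤ → ℤ[α] → ℤ[α]
 k · (x , y) = k * x , k * y

 conj : ℤ[α] → ℤ[α]
 conj (x , y) = x , - y

 0ᴱ 1ᴱ : ℤ[α]
 0ᴱ = 0ℤ , 0ℤ
 1ᴱ = 1ℤ , 0ℤ

 pair : ∀ {x y u v : ℤ} → x ≡ u → y ≡ v → (x , y) ≡ (u , v)
 pair = cong₂ _,_

 module Unit (a : ℕ) where
   D : ℤ
   D = + a * + a - 1ℤ

   infixl 7 _⊗_
   _⊗_ : ℤ[α] → ℤ[α] → ℤ[α]
   (x , y) ⊗ (u , v) = x * u + D * (y * v) , x * v + y * u

   -- ε = a + θ and ε⁻¹ = a − θ.
   ε· ε⁻¹· : ℤ[α] → ℤ[α]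
   ε· (x , y)   = + a * x + D * y , x + + a * y
   ε⁻¹· (x , y) = + a * x - D * y , + a * y - x

   ε⁻¹ε : ∀ z → ε⁻¹· (ε· z) ≡ z
   ε⁻¹ε (x , y) = pair (lemma₁ (+ a) x y) (lemma₂ (+ a) x y)
     where
     lemma₁ : ∀ a x y → a * (a * x + (a * a - 1ℤ) * y) - (a * a - 1ℤ) * (x + a * y) ≡ x
     lemma₁ = solve-∀
     lemma₂ : ∀ a x y → a * (x + a * y) - (a * x + (a * a - 1ℤ) * y) ≡ y
     lemma₂ = solve-∀

   εε⁻¹ : ∀ z → ε· (ε⁻¹· z) ≡ z
   εε⁻¹ (x , y) = pair (lemma₁ (+ a) x y) (lemma₂ (+ a) x y)
     where
     lemma₁ : ∀ a x y → a * (a * x - (a * a - 1ℤ) * y) + (a * a - 1ℤ) * (a * y - x) ≡ x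
     lemma₁ = solve-∀
     lemma₂ : ∀ a x y → (a * x - (a * a - 1ℤ) * y) + a * (a * y - x) ≡ y
     lemma₂ = solve-∀

   conj-ε : ∀ z → conj (ε· z) ≡ ε⁻¹· (conj z)
   conj-ε (x , y) = pair (lemma₁ (+ a) D x y) (lemma₂ (+ a) x y)
     where
     lemma₁ : ∀ a d x y → a * x + d * y ≡ a * x - d * - y
     lemma₁ = solve-∀
     lemma₂ : ∀ a x y → - (x + a * y) ≡ a * - y - x
     lemma₂ = solve-∀

   conj-ε⁻¹ : ∀ z → conj (ε⁻¹· z) ≡ ε· (conj z)
   conj-ε⁻¹ (x , y) = pair (lemma₁ (+ a) D x y) (lemma₂ (+ a) x y)
     where
     lemma₁ : ∀ a d x y → a * x - d * y ≡ a * x + d * - y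
     lemma₁ = solve-∀
     lemma₂ : ∀ a x y → - (a * y - x) ≡ x + a * - y
     lemma₂ = solve-∀

 module Cone (a : ℕ) (2≤a : 2 ℕ.≤ a) (θ : ℝ) (0≤θ : NonNeg θ)
             (θ²≃D : θ *ᴿ θ ≃ᴿ fromℤ (Unit.D a)) where
   open Unit a public
   open NonNeg-lemmas

   record P (c : ℤ[α]) : Set where
     constructor nonneg
     field nn : NonNeg (⟦ c ⟧ θ)

   open P public

   private
     module _ where
       rearrange-+ : ∀ x y u v t → (x ℚ.+ y ℚ.* t) ℚ.+ (u ℚ.+ v ℚ.* t) ≡ (x ℚ.+ u) ℚ.+ (y ℚ.+ v) ℚ.* t
       rearrange-+ = Solver.solve-∀ ℚ-ring
       rearrange-* : ∀ x y u v t d →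
         (x ℚ.+ y ℚ.* t) ℚ.* (u ℚ.+ v ℚ.* t) ℚ.+ (y ℚ.* v) ℚ.* (d ℚ.+ ℚ.- (t ℚ.* t))
         ≡ (x ℚ.* u ℚ.+ d ℚ.* (y ℚ.* v)) ℚ.+ (x ℚ.* v ℚ.+ y ℚ.* u) ℚ.* t
       rearrange-* = Solver.solve-∀ ℚ-ring

     null : ℝ
     null = fromℤ D +ᴿ -ᴿ (θ *ᴿ θ)

     scaled-null : ∀ k → NonNeg (fromℤ k *ᴿ null)
     scaled-null k = proj₁ (null-* k null (≃⇒null (fromℤ D) (θ *ᴿ θ) (≃-sym (θ *ᴿ θ) (fromℤ D) θ²≃D)))

   P-⊕ : ∀ c d → P c → P d → P (c ⊕ d)
   P-⊕ c@(x , y) d@(u , v) (nonneg p) (nonneg q) = nonneg (≗-nn (⟦ c ⟧ θ +ᴿ ⟦ d ⟧ θ) (⟦ c ⊕ d ⟧ θ)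
     (λ n → trans (rearrange-+ (ι x) (ι y) (ι u) (ι v) (seq θ n))
                  (cong₂ (λ p q → p ℚ.+ q ℚ.* seq θ n) (sym (ι-+ x u)) (sym (ι-+ y v))))
     (+-nn (⟦ c ⟧ θ) (⟦ d ⟧ θ) p q))

   ⊗-seq : ∀ x y u v n → seq (⟦ x , y ⟧ θ *ᴿ ⟦ u , v ⟧ θ +ᴿ fromℤ (y * v) *ᴿ null) n ≡ seq (⟦ (x , y) ⊗ (u , v) ⟧ θ) n
   ⊗-seq x y u v n = begin
     (X ℚ.+ Y ℚ.* t) ℚ.* (U ℚ.+ V ℚ.* t) ℚ.+ ι (y * v) ℚ.* (ι D ℚ.+ seq (-ᴿ (θ *ᴿ θ)) n)
       ≡⟨ cong₂ (λ p q → (X ℚ.+ Y ℚ.* t) ℚ.* (U ℚ.+ V ℚ.* t) ℚ.+ p ℚ.* (ι D ℚ.+ q)) (ι-* y v) (neg-seq (θ *ᴿ θ) n) ⟩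
     (X ℚ.+ Y ℚ.* t) ℚ.* (U ℚ.+ V ℚ.* t) ℚ.+ (Y ℚ.* V) ℚ.* (ι D ℚ.+ ℚ.- (t ℚ.* t))
       ≡⟨ rearrange-* X Y U V t (ι D) ⟩
     (X ℚ.* U ℚ.+ ι D ℚ.* (Y ℚ.* V)) ℚ.+ (X ℚ.* V ℚ.+ Y ℚ.* U) ℚ.* t
       ≡⟨ cong₂ (λ p q → p ℚ.+ q ℚ.* t) (fold₁ x u D y v) (fold₂ x v y u) ⟨
     ι (x * u + D * (y * v)) ℚ.+ ι (x * v + y * u) ℚ.* t ∎
     where
     open ≡-Reasoning
     X = ι x
     Y = ι y
     U = ι u
     V = ι v
     t = seq θ n
     fold₂ : ∀ x v y u → ι (x * v + y * u) ≡ ι x ℚ.* ι v ℚ.+ ι y ℚ.* ι u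
     fold₂ x v y u = trans (ι-+ (x * v) (y * u)) (cong₂ ℚ._+_ (ι-* x v) (ι-* y u))
     fold₁ : ∀ x u d y v → ι (x * u + d * (y * v)) ≡ ι x ℚ.* ι u ℚ.+ ι d ℚ.* (ι y ℚ.* ι v)
     fold₁ x u d y v = trans (fold₂ x u d (y * v)) (cong (λ z → ι x ℚ.* ι u ℚ.+ ι d ℚ.* z) (ι-* y v))

   P-⊗ : ∀ c d → P c → P d → P (c ⊗ d)
   P-⊗ c@(x , y) d@(u , v) (nonneg p) (nonneg q) = nonneg (≗-nn (⟦ c ⟧ θ *ᴿ ⟦ d ⟧ θ +ᴿ fromℤ (y * v) *ᴿ null) (⟦ c ⊗ d ⟧ θ) (⊗-seq x y u v)
     (+-nn (⟦ c ⟧ θ *ᴿ ⟦ d ⟧ θ) (fromℤ (y * v) *ᴿ null)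
       (*-nn (⟦ c ⟧ θ) (⟦ d ⟧ θ) p q) (scaled-null (y * v))))

   private
     ℤ-seq : ∀ m n → seq (fromℤ m) n ≡ seq (⟦ m , 0ℤ ⟧ θ) n
     ℤ-seq m n = sym (trans (cong (ι m ℚ.+_) (ℚₚ.*-zeroˡ (seq θ n))) (ℚₚ.+-identityʳ (ι m)))

   P-ℤ : ∀ {m} → 0ℤ ℤ.≤ m → P (m , 0ℤ)
   P-ℤ {+ n} _ = nonneg (≗-nn (fromℤ (+ n)) (⟦ + n , 0ℤ ⟧ θ) (ℤ-seq (+ n)) (const-nn n))

   P-ℤ⁻¹ : ∀ {m} → P (m , 0ℤ) → 0ℤ ℤ.≤ m
   P-ℤ⁻¹ {+ n}    p = ℤ.+≤+ z≤n
   P-ℤ⁻¹ { -[1+ n ]} p = ⊥-elim (¬const-nn n (≗-nn (⟦ -[1+ n ] , 0ℤ ⟧ θ) (fromℤ -[1+ n ]) (λ k → sym (ℤ-seq -[1+ n ] k)) (nn p)))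

   P-θ : ∀ n → P (0ℤ , + n)
   P-θ n = nonneg (≗-nn (fromℤ (+ n) *ᴿ θ) (⟦ 0ℤ , + n ⟧ θ) (λ k → sym (ℚₚ.+-identityˡ _))
     (*-nn (fromℤ (+ n)) θ (const-nn n) 0≤θ))

   P-ℕ : ∀ m n → P (+ m , + n)
   P-ℕ m n = subst P (pair (ℤₚ.+-identityʳ (+ m)) refl) (P-⊕ (+ m , 0ℤ) (0ℤ , + n) (P-ℤ (ℤ.+≤+ z≤n)) (P-θ n))

   private
     -- The element (1 + m) + n θ is at least 1, so it may be cancelled.
     cancel : ∀ m n d → P ((+ suc m , + n) ⊗ d) → P d
     cancel m n d@(u , v) (nonneg p) = nonneg (cancel-nn (⟦ c ⟧ θ) (⟦ d ⟧ θ)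
       (≗-nn (⟦ + m , + n ⟧ θ) (⟦ c ⟧ θ +ᴿ fromℤ -1ℤ)
         (λ k → trans (cong (λ z → z ℚ.+ ι (+ n) ℚ.* seq θ k) (ι-+ (+ suc m) -1ℤ)) (lemma (ι (+ suc m)) (ι -1ℤ) (ι (+ n) ℚ.* seq θ k)))
         (nn (P-ℕ m n)))
       (≗-nn (⟦ c ⊗ d ⟧ θ +ᴿ fromℤ (- (+ n * v)) *ᴿ null) (⟦ c ⟧ θ *ᴿ ⟦ d ⟧ θ)
         (λ k → trans (cong₂ (λ p q → p ℚ.+ q ℚ.* seq null k) (sym (⊗-seq (+ suc m) (+ n) u v k)) (ι-neg (+ n * v)))
                      (lemma₂ (seq (⟦ c ⟧ θ *ᴿ ⟦ d ⟧ θ) k) (ι (+ n * v)) (seq null k)))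
         (+-nn (⟦ c ⊗ d ⟧ θ) (fromℤ (- (+ n * v)) *ᴿ null) p (scaled-null (- (+ n * v))))))
       where
       c = + suc m , + n
       lemma : ∀ a b c → (a ℚ.+ b) ℚ.+ c ≡ (a ℚ.+ c) ℚ.+ b
       lemma = Solver.solve-∀ ℚ-ring
       lemma₂ : ∀ a b c → (a ℚ.+ b ℚ.* c) ℚ.+ (ℚ.- b) ℚ.* c ≡ a
       lemma₂ = Solver.solve-∀ ℚ-ring

     norm : ∀ x m → (x , m) ⊗ (x , - m) ≡ (x * x - D * (m * m) , 0ℤ)
     norm x m = pair (lemma₁ x m D) (lemma₂ x m)
       where
       lemma₁ : ∀ x m d → x * x + d * (m * - m) ≡ x * x - d * (m * m)
       lemma₁ = solve-∀
       lemma₂ : ∀ x m → x * - m + m * x ≡ 0ℤ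
       lemma₂ = solve-∀

     norm⁻ : ∀ x m → (x , m) ⊗ (- x , m) ≡ (D * (m * m) - x * x , 0ℤ)
     norm⁻ x m = pair (lemma₁ x m D) (lemma₂ x m)
       where
       lemma₁ : ∀ x m d → x * - x + d * (m * m) ≡ d * (m * m) - x * x
       lemma₁ = solve-∀
       lemma₂ : ∀ x m → x * m + m * - x ≡ 0ℤ
       lemma₂ = solve-∀

   private
     mixed : ∀ m n → P (+ suc m , - (+ n)) ⊎ (¬ P (+ suc m , - (+ n)) × P (-[1+ m ] , + n))
     mixed m n with (D * (+ n * + n)) ℤ.≤? (+ suc m * + suc m)
     ... | yes le = inj₁ (cancel m n _ (subst P (sym (norm (+ suc m) (+ n))) (P-ℤ (ℤₚ.i≤j⇒0≤j-i le))))
     ... | no ¬le = inj₂ ((λ p → ¬le (ℤₚ.0≤i-j⇒j≤i (P-ℤ⁻¹ (subst P (norm (+ suc m) (+ n))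
                                 (P-⊗ (+ suc m , + n) (+ suc m , - (+ n)) (P-ℕ (suc m) n) p))))) ,
                          cancel m n _ (subst P (sym (norm⁻ (+ suc m) (+ n))) (P-ℤ (ℤₚ.i≤j⇒0≤j-i (ℤₚ.<⇒≤ (ℤₚ.≰⇒> ¬le))))))

     mixed⁻ : ∀ m n → P (-[1+ m ] , + n) ⊎ (¬ P (-[1+ m ] , + n) × P (+ suc m , - (+ n)))
     mixed⁻ m n with (+ suc m * + suc m) ℤ.≤? (D * (+ n * + n))
     ... | yes le = inj₁ (cancel m n _ (subst P (sym (norm⁻ (+ suc m) (+ n))) (P-ℤ (ℤₚ.i≤j⇒0≤j-i le))))
     ... | no ¬le = inj₂ ((λ p → ¬le (ℤₚ.0≤i-j⇒j≤i (P-ℤ⁻¹ (subst P (norm⁻ (+ suc m) (+ n))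
                                 (P-⊗ (+ suc m , + n) (-[1+ m ] , + n) (P-ℕ (suc m) n) p))))) ,
                          cancel m n _ (subst P (sym (norm (+ suc m) (+ n))) (P-ℤ (ℤₚ.i≤j⇒0≤j-i (ℤₚ.<⇒≤ (ℤₚ.≰⇒> ¬le))))))

   0<D : 0ℤ ℤ.< D
   0<D = ℤₚ.<-≤-trans (ℤ.+<+ {0} {1} (s≤s z≤n)) (ℤₚ.+-monoˡ-≤ -1ℤ {+ 2} {+ a * + a} (subst (+ 2 ℤ.≤_) (ℤₚ.pos-* a a) (ℤ.+≤+ (ℕₚ.*-mono-≤ {1} {a} {2} {a} (ℕₚ.≤-trans (s≤s z≤n) 2≤a) 2≤a))))

   private
     ¬P-neg-θ : ∀ n → ¬ P (0ℤ , -[1+ n ])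
     ¬P-neg-θ n p = ℤₚ.<⇒≱ (negative D n 0<D) (P-ℤ⁻¹ (subst P (pair (lemma₁ D -[1+ n ]) (lemma₂ -[1+ n ]))
                      (P-⊗ (0ℤ , 1ℤ) (0ℤ , -[1+ n ]) (P-ℕ 0 1) p)))
       where
       lemma₁ : ∀ d v → 0ℤ * 0ℤ + d * (1ℤ * v) ≡ d * v
       lemma₁ = solve-∀
       lemma₂ : ∀ v → 0ℤ * v + 1ℤ * 0ℤ ≡ 0ℤ
       lemma₂ = solve-∀
       negative : ∀ d n → 0ℤ ℤ.< d → d * -[1+ n ] ℤ.< 0ℤ
       negative (+ suc d) n _ = ℤ.-<+
       negative (+ zero)  n (ℤ.+<+ ())

     ¬P-neg : ∀ m n → ¬ P (-[1+ m ] , - (+ n))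
     ¬P-neg m n p = absurd (P-ℤ⁻¹ (subst P (pair (ℤₚ.+-identityʳ -[1+ m ]) (ℤₚ.+-inverseˡ (+ n)))
                      (P-⊕ (-[1+ m ] , - (+ n)) (0ℤ , + n) p (P-θ n))))
       where
       absurd : ¬ (0ℤ ℤ.≤ -[1+ m ])
       absurd ()

   P-cmp : ∀ c → P c ⊎ (¬ P c × P (⊝ c))
   P-cmp (+ m , + n)           = inj₁ (P-ℕ m n)
   P-cmp (+ suc m , -[1+ n ])  = mixed m (suc n)
   P-cmp (-[1+ m ] , + n)      = mixed⁻ m n
   P-cmp (+ zero , -[1+ n ])   = inj₂ (¬P-neg-θ n , P-ℕ 0 (suc n))
   P-cmp (-[1+ m ] , -[1+ n ]) = inj₂ (¬P-neg m (suc n) , P-ℕ (suc m) (suc n))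

   P? : ∀ c → Dec (P c)
   P? c with P-cmp c
   ... | inj₁ p       = yes p
   ... | inj₂ (¬p , _) = no ¬p

   P-total : ∀ c → ¬ P c → P (⊝ c)
   P-total c ¬p with P-cmp c
   ... | inj₁ p       = contradiction p ¬p
   ... | inj₂ (_ , q) = q

   P-· : ∀ n c → P c → P (+ n · c)
   P-· n c@(x , y) p = subst P (pair (lemma₁ (+ n) x y D) (lemma₂ (+ n) x y)) (P-⊗ (+ n , 0ℤ) c (P-ℕ n 0) p)
     where
     lemma₁ : ∀ n x y d → n * x + d * (0ℤ * y) ≡ n * x
     lemma₁ = solve-∀
     lemma₂ : ∀ n x y → n * y + 0ℤ * x ≡ n * y
     lemma₂ = solve-∀

   private
     predecessor : ∃ λ b → + a ≡ 1ℤ + + suc b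
     predecessor = lemma 2≤a
       where
       lemma : ∀ {a} → 2 ℕ.≤ a → ∃ λ b → + a ≡ 1ℤ + + suc b
       lemma {suc zero} (s≤s ())
       lemma {suc (suc b)} _ = b , refl

   P-θ-[a-1] : P (1ℤ - + a , 1ℤ)
   P-θ-[a-1] = let b , eq = predecessor in
     cancel b 1 _ (subst P (pair (lemma₁ (+ a) (+ suc b) eq) (lemma₂ (+ a) (+ suc b) eq)) (P-ℕ (suc b ℕ.+ suc b) 0))
     where
     lemma₁ : ∀ a c → a ≡ 1ℤ + c → c + c ≡ c * (1ℤ - a) + (a * a - 1ℤ) * (1ℤ * 1ℤ)
     lemma₁ a c refl = lemma c
       where
       lemma : ∀ c → c + c ≡ c * (1ℤ - (1ℤ + c)) + ((1ℤ + c) * (1ℤ + c) - 1ℤ) * (1ℤ * 1ℤ)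
       lemma = solve-∀
     lemma₂ : ∀ a c → a ≡ 1ℤ + c → 0ℤ ≡ c * 1ℤ + 1ℤ * (1ℤ - a)
     lemma₂ a c refl = lemma c
       where
       lemma : ∀ c → 0ℤ ≡ c * 1ℤ + 1ℤ * (1ℤ - (1ℤ + c))
       lemma = solve-∀

   ¬P-[a-1]-θ : ¬ P (+ a - 1ℤ , -1ℤ)
   ¬P-[a-1]-θ p = let b , eq = predecessor in
     absurd b (P-ℤ⁻¹ (subst P (pair (lemma₁ (+ a) (+ suc b) eq) (lemma₂ (+ a) (+ suc b) eq))
       (P-⊗ (+ suc b , 1ℤ) (+ a - 1ℤ , -1ℤ) (P-ℕ (suc b) 1) p)))
     where
     lemma₁ : ∀ a c → a ≡ 1ℤ + c → c * (a - 1ℤ) + (a * a - 1ℤ) * (1ℤ * -1ℤ) ≡ - (c + c)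
     lemma₁ a c refl = lemma c
       where
       lemma : ∀ c → c * ((1ℤ + c) - 1ℤ) + ((1ℤ + c) * (1ℤ + c) - 1ℤ) * (1ℤ * -1ℤ) ≡ - (c + c)
       lemma = solve-∀
     lemma₂ : ∀ a c → a ≡ 1ℤ + c → c * -1ℤ + 1ℤ * (a - 1ℤ) ≡ 0ℤ
     lemma₂ a c refl = lemma c
       where
       lemma : ∀ c → c * -1ℤ + 1ℤ * ((1ℤ + c) - 1ℤ) ≡ 0ℤ
       lemma = solve-∀
     absurd : ∀ b → ¬ (0ℤ ℤ.≤ - (+ suc b + + suc b))
     absurd b ()

   P-a-θ : P (+ a , -1ℤ)
   P-a-θ = let b , eq = predecessor in
     cancel (suc b) 1 _ (subst P (pair (lemma₁ (+ a) (+ suc (suc b)) eq) (lemma₂ (+ a) (+ suc (suc b)) eq)) (P-ℕ 1 0))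
     where
     lemma₁ : ∀ a c → a ≡ c → 1ℤ ≡ c * a + (a * a - 1ℤ) * (1ℤ * -1ℤ)
     lemma₁ a c refl = lemma a
       where
       lemma : ∀ a → 1ℤ ≡ a * a + (a * a - 1ℤ) * (1ℤ * -1ℤ)
       lemma = solve-∀
     lemma₂ : ∀ a c → a ≡ c → 0ℤ ≡ c * -1ℤ + 1ℤ * a
     lemma₂ a c refl = lemma a
       where
       lemma : ∀ a → 0ℤ ≡ a * -1ℤ + 1ℤ * a
       lemma = solve-∀

   P-ε : ∀ z → P z → P (ε· z)
   P-ε z@(x , y) p = subst P (pair (lemma₁ (+ a) D x y) (lemma₂ (+ a) x y)) (P-⊗ (+ a , 1ℤ) z (P-ℕ a 1) p)
     where
     lemma₁ : ∀ a d x y → a * x + d * (1ℤ * y) ≡ a * x + d * y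
     lemma₁ = solve-∀
     lemma₂ : ∀ a x y → a * y + 1ℤ * x ≡ x + a * y
     lemma₂ = solve-∀

   P-ε⁻¹ : ∀ z → P z → P (ε⁻¹· z)
   P-ε⁻¹ z@(x , y) p = subst P (pair (lemma₁ (+ a) D x y) (lemma₂ (+ a) x y)) (P-⊗ (+ a , -1ℤ) z P-a-θ p)
     where
     lemma₁ : ∀ a d x y → a * x + d * (-1ℤ * y) ≡ a * x - d * y
     lemma₁ = solve-∀
     lemma₂ : ∀ a x y → a * y + -1ℤ * x ≡ a * y - x
     lemma₂ = solve-∀

   -- θ ≥ a − 1 turns a bound n θ ≤ m into an integral one.
   P⇒≤ : ∀ m n → P (m , - (+ n)) → + n * (+ a - 1ℤ) ℤ.≤ m
   P⇒≤ m n p = ℤₚ.0≤i-j⇒j≤i (P-ℤ⁻¹ (subst P (pair (lemma₁ m (+ n) (+ a)) (lemma₂ (+ n)))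
     (P-⊕ (m , - (+ n)) (+ n · (1ℤ - + a , 1ℤ)) p (P-· n _ P-θ-[a-1]))))
     where
     lemma₁ : ∀ m n a → m + n * (1ℤ - a) ≡ m - n * (a - 1ℤ)
     lemma₁ = solve-∀
     lemma₂ : ∀ n → - n + n * 1ℤ ≡ 0ℤ
     lemma₂ = solve-∀

module Digits where

 open import Defs using (ℝ; _*ᴿ_; fromℤ; _≃ᴿ_; ℤ[α])
 open Reals
 open Pairs
 open import Data.Integer using (+_; _+_; _*_; -_; _-_)
 open import Data.Integer.Tactic.RingSolver using (solve-∀)
 import Data.Product.Properties as Productₚ
 open import Relation.Nullary using (contradiction)

 -- One digit for each of the 13 · 2³ letters of a transcript, besides 0.
 maxDigit : ℕ
 maxDigit = 104

 digit : List ℕ → ℕ → ℕ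
 digit []       _       = 0
 digit (d ∷ _)  zero    = d
 digit (_ ∷ ds) (suc i) = digit ds i

 module Powers (a : ℕ) where
   open Unit a

   act act⁻ : ℕ → ℤ[α] → ℤ[α]
   act zero    z = z
   act (suc i) z = ε· (act i z)
   act⁻ zero    z = z
   act⁻ (suc i) z = act⁻ i (ε⁻¹· z)

   pow : ℕ → ℤ[α]
   pow i = act i 1ᴱ

   eval : List ℕ → ℤ[α]
   eval []       = 0ᴱ
   eval (d ∷ ds) = (+ d , 0ℤ) ⊕ ε· (eval ds)

   act⁻-act : ∀ i z → act⁻ i (act i z) ≡ z
   act⁻-act zero    z = refl
   act⁻-act (suc i) z = trans (cong (act⁻ i) (ε⁻¹ε (act i z))) (act⁻-act i z)

   act-act⁻ : ∀ i z → act i (act⁻ i z) ≡ z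
   act-act⁻ zero    z = refl
   act-act⁻ (suc i) z = trans (cong ε·_ (act-act⁻ i (ε⁻¹· z))) (εε⁻¹ z)
     where
     ε·_ = ε·

   ε⁻¹-linear : ∀ z k w → ε⁻¹· (z ⊕ k · w) ≡ ε⁻¹· z ⊕ k · ε⁻¹· w
   ε⁻¹-linear (x , y) k (u , v) = pair (lemma₁ (+ a) D x y k u v) (lemma₂ (+ a) x y k u v)
     where
     lemma₁ : ∀ a d x y k u v → a * (x + k * u) - d * (y + k * v) ≡ (a * x - d * y) + k * (a * u - d * v)
     lemma₁ = solve-∀
     lemma₂ : ∀ a x y k u v → a * (y + k * v) - (x + k * u) ≡ (a * y - x) + k * (a * v - u)
     lemma₂ = solve-∀

   act⁻-linear : ∀ i z k w → act⁻ i (z ⊕ k · w) ≡ act⁻ i z ⊕ k · act⁻ i w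
   act⁻-linear zero    z k w = refl
   act⁻-linear (suc i) z k w = trans (cong (act⁻ i) (ε⁻¹-linear z k w)) (act⁻-linear i (ε⁻¹· z) k (ε⁻¹· w))

   act⁻-⊝ : ∀ i z → act⁻ i (⊝ z) ≡ ⊝ act⁻ i z
   act⁻-⊝ zero    z       = refl
   act⁻-⊝ (suc i) (x , y) = trans (cong (act⁻ i) (pair (lemma₁ (+ a) D x y) (lemma₂ (+ a) x y))) (act⁻-⊝ i (ε⁻¹· (x , y)))
     where
     lemma₁ : ∀ a d x y → a * - x - d * - y ≡ - (a * x - d * y)
     lemma₁ = solve-∀
     lemma₂ : ∀ a x y → a * - y - - x ≡ - (a * y - x)
     lemma₂ = solve-∀

   conj-linear : ∀ z k w → conj (z ⊕ k · w) ≡ conj z ⊕ k · conj w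
   conj-linear (x , y) k (u , v) = pair refl (lemma y k v)
     where
     lemma : ∀ y k v → - (y + k * v) ≡ - y + k * - v
     lemma = solve-∀

   ε·-pow-act : ∀ i z → act i (ε· z) ≡ ε· (act i z)
   ε·-pow-act zero    z = refl
   ε·-pow-act (suc i) z = cong ε· (ε·-pow-act i z)

   pow-+ : ∀ s i → pow (s ℕ.+ i) ≡ act s (pow i)
   pow-+ zero    i = refl
   pow-+ (suc s) i = cong ε· (pow-+ s i)

   act-⊗ : ∀ s x y → act s (x , y) ≡ pow s ⊗ (x , y)
   act-⊗ zero    x y = pair (lemma₁ D x y) (lemma₂ x y)
     where
     lemma₁ : ∀ d x y → x ≡ 1ℤ * x + d * (0ℤ * y)
     lemma₁ = solve-∀
     lemma₂ : ∀ x y → y ≡ 1ℤ * y + 0ℤ * x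
     lemma₂ = solve-∀
   act-⊗ (suc s) x y = trans (cong ε· (act-⊗ s x y)) (assoc (pow s))
     where
     assoc : ∀ z → ε· (z ⊗ (x , y)) ≡ ε· z ⊗ (x , y)
     assoc (u , v) = pair (lemma₁ (+ a) D u v x y) (lemma₂ (+ a) D u v x y)
       where
       lemma₁ : ∀ a d u v x y → a * (u * x + d * (v * y)) + d * (u * y + v * x) ≡ (a * u + d * v) * x + d * ((u + a * v) * y)
       lemma₁ = solve-∀
       lemma₂ : ∀ a d u v x y → (u * x + d * (v * y)) + a * (u * y + v * x) ≡ (a * u + d * v) * y + (u + a * v) * x
       lemma₂ = solve-∀

 -- z + (−1) w is the shape to which the linearity lemmas apply.
 infixl 6 _⊖_
 _⊖_ : ℤ[α] → ℤ[α] → ℤ[α]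
 z ⊖ w = z ⊕ -1ℤ · w

 module Reading (a : ℕ) (500≤a : 500 ℕ.≤ a) (θ : ℝ) (0≤θ : NonNeg θ)
                (θ²≃D : θ *ᴿ θ ≃ᴿ fromℤ (Unit.D a)) where

   open Powers a public
   open Cone a (ℕₚ.≤-trans (ℕₚ.≤ᵇ⇒≤ 2 500 _) 500≤a) θ 0≤θ θ²≃D public

   abstract
     to : ∀ {x y u v} → P (x , y) → x ≡ u → y ≡ v → P (u , v)
     to p refl refl = p

   P-act⁻ : ∀ i z → P z → P (act⁻ i z)
   P-act⁻ zero    z p = p
   P-act⁻ (suc i) z p = P-act⁻ i _ (P-ε⁻¹ z p)

   P-act : ∀ i z → P z → P (act i z)
   P-act zero    z p = p
   P-act (suc i) z p = P-ε _ (P-act i z p)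

   P-act⁻⁻¹ : ∀ i z → P (act⁻ i z) → P z
   P-act⁻⁻¹ i z p = subst P (act-act⁻ i z) (P-act i _ p)

   conj-act⁻ : ∀ i z → conj (act⁻ i z) ≡ act i (conj z)
   conj-act⁻ zero    z = refl
   conj-act⁻ (suc i) z = trans (conj-act⁻ i (ε⁻¹· z)) (trans (cong (act i) (conj-ε⁻¹ z)) (ε·-pow-act i (conj z)))

   P-conj-act⁻ : ∀ i z → P (conj z) → P (conj (act⁻ i z))
   P-conj-act⁻ i z p = subst P (sym (conj-act⁻ i z)) (P-act i _ p)

   P-conj-act⁻⁻¹ : ∀ i z → P (conj (act⁻ i z)) → P (conj z)
   P-conj-act⁻⁻¹ i z p = subst P (act⁻-act i (conj z)) (P-act⁻ i _ (subst P (conj-act⁻ i z) p))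

   private
     499≤ : + 499 ℤ.≤ + a - 1ℤ
     499≤ = ℤₚ.+-monoˡ-≤ -1ℤ (ℤ.+≤+ 500≤a)

   θ-large : ∀ m n → P (m , -[1+ n ]) → + 499 ℤ.≤ m
   θ-large m n p = ℤₚ.≤-trans 499≤ (ℤₚ.≤-trans step (P⇒≤ m (suc n) p))
     where
     nonneg-a : ∀ x → + 499 ℤ.≤ x → x ℤ.≤ + suc n * x
     nonneg-a (+ x) _ = subst (+ x ℤ.≤_) (ℤₚ.pos-* (suc n) x) (ℤ.+≤+ (ℕₚ.m≤m+n x _))
     step : + a - 1ℤ ℤ.≤ + suc n * (+ a - 1ℤ)
     step = nonneg-a (+ a - 1ℤ) 499≤

   private
     small : ∀ {m} k → + 499 ℤ.≤ m → m ℤ.≤ + k → k ℕ.≤ 498 → ⊥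
     small k p q r = ℕₚ.<-irrefl refl (ℕₚ.≤-trans (ℤₚ.drop‿+≤+ (ℤₚ.≤-trans p q)) r)

     0≰-1 : ¬ (0ℤ ℤ.≤ -1ℤ)
     0≰-1 ()

   ⊝⊝ : ∀ z → P (⊝ (⊝ z)) → P z
   ⊝⊝ (x , y) p = to p (ℤₚ.neg-involutive x) (ℤₚ.neg-involutive y)

   unit-minimal : ∀ w → ¬ P (⊝ w) → P (1ᴱ ⊖ w) → ¬ P (⊝ conj w) → P (1ᴱ ⊖ conj w) → w ≡ 1ᴱ
   unit-minimal (x , y) ¬p q ¬p′ q′ = cases y refl
     where
     p = ⊝⊝ _ (P-total _ ¬p)
     p′ = ⊝⊝ _ (P-total _ ¬p′)
     cases : ∀ z → y ≡ z → (x , y) ≡ 1ᴱ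
     cases (+ suc n) refl = ⊥-elim (small 1 (θ-large 1ℤ (n ℕ.+ suc n) (to (P-⊕ _ _ q p′) (lemma x) (lemma′ (+ suc n)))) ℤₚ.≤-refl (ℕₚ.≤ᵇ⇒≤ 1 498 _))
       where
       lemma : ∀ x → (1ℤ + -1ℤ * x) + x ≡ 1ℤ
       lemma = solve-∀
       lemma′ : ∀ y → (0ℤ + -1ℤ * y) + (- y) ≡ - (y + y)
       lemma′ = solve-∀
     cases -[1+ n ] refl = ⊥-elim (small 1 (θ-large 1ℤ (suc (n ℕ.+ n)) (to (P-⊕ _ _ p q′) (lemma x) (lemma′ -[1+ n ]))) ℤₚ.≤-refl (ℕₚ.≤ᵇ⇒≤ 1 498 _))
       where
       lemma : ∀ x → x + (1ℤ + -1ℤ * x) ≡ 1ℤ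
       lemma = solve-∀
       lemma′ : ∀ y → y + (0ℤ + -1ℤ * - y) ≡ y + y
       lemma′ = solve-∀
     cases (+ zero) refl = pair (ℤₚ.≤-antisym x≤1 1≤x) refl
       where
       x≤1 : x ℤ.≤ 1ℤ
       x≤1 = ℤₚ.0≤i-j⇒j≤i (subst (0ℤ ℤ.≤_) (cong (λ z → 1ℤ + z) (ℤₚ.-1*i≡-i x)) (P-ℤ⁻¹ q))
       1≤x : 1ℤ ℤ.≤ x
       1≤x with 1ℤ ℤ.≤? x
       ... | yes le = le
       ... | no ¬le = contradiction (P-ℤ (ℤₚ.neg-mono-≤ (ℤₚ.i<j⇒i≤pred[j] (ℤₚ.≰⇒> ¬le)))) ¬p

   -- Powers of ε dominate no other totally positive element; this is how they are recognized.
   power-minimal : ∀ i v → ¬ P (⊝ v) → P (pow i ⊖ v) → ¬ P (⊝ conj v) → P (conj (pow i) ⊖ conj v) → v ≡ pow i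
   power-minimal i v ¬p q ¬p′ q′ = trans (sym (act-act⁻ i v)) (cong (act i) (unit-minimal (act⁻ i v)
     (λ p → ¬p (P-act⁻⁻¹ i (⊝ v) (subst P (sym (act⁻-⊝ i v)) p)))
     (subst P back (P-act⁻ i _ q))
     (λ p → ¬p′ (P-conj-act⁻⁻¹ i (⊝ v) (subst (λ z → P (conj z)) (sym (act⁻-⊝ i v)) p)))
     (subst P (trans (cong conj back) (conj-linear 1ᴱ -1ℤ (act⁻ i v)))
       (P-conj-act⁻ i _ (subst P (sym (conj-linear (pow i) -1ℤ v)) q′)))))
     where
     back : act⁻ i (pow i ⊖ v) ≡ 1ᴱ ⊖ act⁻ i v
     back = trans (act⁻-linear i (pow i) -1ℤ v) (cong (_⊖ act⁻ i v) (act⁻-act i 1ᴱ))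

   ⊖-flip : ∀ z w → P (⊝ (z ⊖ w)) → P (w ⊖ z)
   ⊖-flip (x , y) (u , v) p = to p (lemma x u) (lemma y v)
     where
     lemma : ∀ x u → - (x + -1ℤ * u) ≡ u + -1ℤ * x
     lemma = solve-∀

   ⊖-trans : ∀ x y z → P (x ⊖ y) → P (y ⊖ z) → P (x ⊖ z)
   ⊖-trans (x , x′) (y , y′) (z , z′) p q = to (P-⊕ _ _ p q) (lemma x y z) (lemma x′ y′ z′)
     where
     lemma : ∀ x y z → (x + -1ℤ * y) + (y + -1ℤ * z) ≡ x + -1ℤ * z
     lemma = solve-∀

   conj-at-least-1 : ∀ β → P (β ⊖ 1ᴱ) → ¬ P (β ⊖ ε· 1ᴱ) → ¬ P (⊝ conj β) → P (conj β ⊖ 1ᴱ)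
   conj-at-least-1 β@(x , y) p ¬q ¬r with P? (conj β ⊖ 1ᴱ)
   ... | yes s = s
   ... | no ¬s = ⊥-elim (cases y refl)
     where
     q : P (ε· 1ᴱ ⊖ β)
     q = ⊖-flip β (ε· 1ᴱ) (P-total _ ¬q)
     r : P (conj β)
     r = ⊝⊝ _ (P-total _ ¬r)
     s : P (1ᴱ ⊖ conj β)
     s = ⊖-flip (conj β) 1ᴱ (P-total _ ¬s)
     ε₁ : + a * 1ℤ + D * 0ℤ ≡ + a
     ε₁ = trans (cong₂ _+_ (ℤₚ.*-identityʳ (+ a)) (ℤₚ.*-zeroʳ D)) (ℤₚ.+-identityʳ (+ a))
     ε₂ : 1ℤ + + a * 0ℤ ≡ 1ℤ
     ε₂ = cong (λ z → 1ℤ + z) (ℤₚ.*-zeroʳ (+ a))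
     cases : ∀ z → y ≡ z → ⊥
     cases -[1+ n ] refl = small 0 (θ-large 0ℤ (suc (n ℕ.+ n)) (to (P-⊕ _ _ p s) (lemma x) (lemma′ -[1+ n ]))) ℤₚ.≤-refl (ℕₚ.≤ᵇ⇒≤ 0 498 _)
       where
       lemma : ∀ x → (x + -1ℤ * 1ℤ) + (1ℤ + -1ℤ * x) ≡ 0ℤ
       lemma = solve-∀
       lemma′ : ∀ y → (y + -1ℤ * 0ℤ) + (0ℤ + -1ℤ * - y) ≡ y + y
       lemma′ = solve-∀
     cases (+ zero) refl = ¬s p
     cases (+ suc zero) refl = ¬P-[a-1]-θ (to (P-⊕ _ _ (P-ℤ x≤a-1) r) (lemma x (+ a)) refl)
       where
       lemma : ∀ x a → ((a - 1ℤ) - x) + x ≡ a - 1ℤ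
       lemma = solve-∀
       x<a : x ℤ.< + a
       x<a = ℤₚ.≰⇒> (λ a≤x → ¬q (to (P-ℤ (ℤₚ.i≤j⇒0≤j-i a≤x)) (sym (trans (cong (λ z → x + -1ℤ * z) ε₁) (lemma′ x (+ a)))) (sym (cong (λ z → 1ℤ + -1ℤ * z) ε₂))))
         where
         lemma′ : ∀ x a → x + -1ℤ * a ≡ x - a
         lemma′ = solve-∀
       x≤a-1 : 0ℤ ℤ.≤ (+ a - 1ℤ) - x
       x≤a-1 = ℤₚ.i≤j⇒0≤j-i (subst (x ℤ.≤_) (ℤₚ.+-comm -1ℤ (+ a)) (ℤₚ.i<j⇒i≤pred[j] x<a))
     cases (+ suc (suc n)) refl = small 1 499≤ a-1≤1 (ℕₚ.≤ᵇ⇒≤ 1 498 _)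
       where
       lemma₁ : ∀ a x z → ((a + -1ℤ * x) + x) + z * 0ℤ ≡ a
       lemma₁ = solve-∀
       lemma₂ : ∀ n → ((1ℤ + -1ℤ * (+ 2 + n)) + - (+ 2 + n)) + (1ℤ + n + n) * 1ℤ ≡ - (+ 2)
       lemma₂ = solve-∀
       bound : + 2 * (+ a - 1ℤ) ℤ.≤ + a
       bound = P⇒≤ (+ a) 2 (to (P-⊕ _ _ (P-⊕ _ _ q r) (P-· (suc (n ℕ.+ n)) (0ℤ , 1ℤ) (P-θ 1)))
         (trans (lemma₁ (+ a * 1ℤ + D * 0ℤ) x (+ suc (n ℕ.+ n))) ε₁)
         (trans (cong (λ z → ((z + -1ℤ * (+ suc (suc n))) + - (+ suc (suc n))) + + suc (n ℕ.+ n) * 1ℤ) ε₂) (lemma₂ (+ n))))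
       a-1≤1 : + a - 1ℤ ℤ.≤ 1ℤ
       a-1≤1 = ℤₚ.0≤i-j⇒j≤i (subst (0ℤ ℤ.≤_) (lemma₃ (+ a)) (ℤₚ.i≤j⇒0≤j-i bound))
         where
         lemma₃ : ∀ a → a - + 2 * (a - 1ℤ) ≡ 1ℤ - (a - 1ℤ)
         lemma₃ = solve-∀

   P-refl : ∀ z → P (z ⊖ z)
   P-refl (x , y) = to (P-ℤ {0ℤ} (ℤ.+≤+ z≤n)) (sym (lemma x)) (sym (lemma y))
     where
     lemma : ∀ x → x + -1ℤ * x ≡ 0ℤ
     lemma = solve-∀

   pow-grows : ∀ J → P (pow J ⊖ (+ suc J , 0ℤ))
   pow-grows zero    = P-refl 1ᴱ
   pow-grows (suc J) = go (pow J) (pow-grows J)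
     where
     go : ∀ z → P (z ⊖ (+ suc J , 0ℤ)) → P (ε· z ⊖ (+ suc (suc J) , 0ℤ))
     go (x , y) p = to (P-⊕ _ _ (P-ε _ p) (P-⊕ _ _ (P-ℤ J≤) (P-θ (suc J)))) (lemma₁ (+ a) D x y (+ J)) (lemma₂ (+ a) x y (+ J))
       where
       J≤ : 0ℤ ℤ.≤ + suc J * + a - + suc (suc J)
       J≤ = ℤₚ.i≤j⇒0≤j-i (subst (+ suc (suc J) ℤ.≤_) (ℤₚ.pos-* (suc J) a) (ℤ.+≤+ (ℕₚ.≤-trans (s≤s (s≤s (ℕₚ.m≤m*n J 2)))
         (ℕₚ.*-mono-≤ (ℕₚ.≤-refl {suc J}) (ℕₚ.≤-trans (ℕₚ.≤ᵇ⇒≤ 2 500 _) 500≤a)))))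
       lemma₁ : ∀ a d x y j → (a * (x + -1ℤ * (1ℤ + j)) + d * (y + -1ℤ * 0ℤ)) + (((1ℤ + j) * a - (+ 2 + j)) + 0ℤ)
                ≡ (a * x + d * y) + -1ℤ * (+ 2 + j)
       lemma₁ = solve-∀
       lemma₂ : ∀ a x y j → ((x + -1ℤ * (1ℤ + j)) + a * (y + -1ℤ * 0ℤ)) + (0ℤ + (1ℤ + j)) ≡ (x + a * y) + -1ℤ * 0ℤ
       lemma₂ = solve-∀

   bounded-by-ℕ : ∀ u → ∃ λ M → P ((+ M , 0ℤ) ⊖ u)
   bounded-by-ℕ (x , y) = let M , p = integral x
                              N , q = irrational y in
     M ℕ.+ N , to (P-⊕ _ _ p q) (lemma (+ M) x (+ N)) (lemma′ y)
     where
     lemma : ∀ m x n → (m + -1ℤ * x) + n ≡ (m + n) + -1ℤ * x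
     lemma = solve-∀
     lemma′ : ∀ y → 0ℤ + - y ≡ 0ℤ + -1ℤ * y
     lemma′ = solve-∀
     integral : ∀ x → ∃ λ M → P (+ M + -1ℤ * x , 0ℤ)
     integral (+ n)    = n , to (P-ℤ (ℤ.+≤+ z≤n)) (sym (lemma″ (+ n))) refl
       where
       lemma″ : ∀ x → x + -1ℤ * x ≡ 0ℤ
       lemma″ = solve-∀
     integral -[1+ n ] = 0 , P-ℤ (ℤ.+≤+ z≤n)
     irrational : ∀ y → ∃ λ N → P (+ N , - y)
     irrational -[1+ n ] = 0 , P-θ (suc n)
     irrational (+ n)    = n ℕ.* a , to (P-· n _ P-a-θ) (sym (ℤₚ.pos-* n a)) (lemma″ (+ n))
       where
       lemma″ : ∀ n → n * -1ℤ ≡ - n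
       lemma″ = solve-∀

   beyond : ∀ u → ∃ λ J → ¬ P (u ⊖ pow J)
   beyond u = go (bounded-by-ℕ u)
     where
     lemma : ∀ m → m + -1ℤ * (1ℤ + m) ≡ -1ℤ
     lemma = solve-∀
     go : (∃ λ M → P ((+ M , 0ℤ) ⊖ u)) → ∃ λ J → ¬ P (u ⊖ pow J)
     go (M , q) = M , λ p → 0≰-1 (P-ℤ⁻¹ (to
       (⊖-trans (+ M , 0ℤ) (pow M) (+ suc M , 0ℤ) (⊖-trans (+ M , 0ℤ) u (pow M) q p) (pow-grows M)) (lemma (+ M)) refl))

   largest-power : ∀ u J → P (u ⊖ 1ᴱ) → ¬ P (u ⊖ pow J) → ∃ λ j → P (u ⊖ pow j) × ¬ P (u ⊖ pow (suc j))
   largest-power u zero    p ¬q = contradiction p ¬q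
   largest-power u (suc J) p ¬q with P? (u ⊖ pow J)
   ... | yes q = J , q , ¬q
   ... | no ¬r = largest-power u J p ¬r

   ¬⊝pow : ∀ j → ¬ P (⊝ pow j)
   ¬⊝pow j p = 0≰-1 (P-ℤ⁻¹ (to (P-⊕ (⊝ pow j) _ p (P-⊕ (pow j ⊖ (+ suc j , 0ℤ)) (+ j , 0ℤ) (pow-grows j) (P-ℤ {+ j} (ℤ.+≤+ z≤n)))) (lemma (proj₁ (pow j)) (+ j)) (lemma′ (proj₂ (pow j)))))
     where
     lemma : ∀ x j → - x + ((x + -1ℤ * (1ℤ + j)) + j) ≡ -1ℤ
     lemma = solve-∀
     lemma′ : ∀ y → - y + ((y + -1ℤ * 0ℤ) + 0ℤ) ≡ 0ℤ
     lemma′ = solve-∀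

   act⁻-pow : ∀ i → act⁻ i (pow i) ≡ 1ᴱ
   act⁻-pow i = act⁻-act i 1ᴱ

   ¬⊝conj-pow : ∀ j → ¬ P (⊝ conj (pow j))
   ¬⊝conj-pow j p = 0≰-1 (P-ℤ⁻¹ (P-act⁻⁻¹′ j p))
     where
     act-⊝ : ∀ i z → act i (⊝ z) ≡ ⊝ act i z
     act-⊝ zero    z = refl
     act-⊝ (suc i) z = trans (cong ε· (act-⊝ i z)) (ε·-⊝ (act i z))
       where
       ε·-⊝ : ∀ z → ε· (⊝ z) ≡ ⊝ ε· z
       ε·-⊝ (x , y) = pair (lemma₁ (+ a) D x y) (lemma₂ (+ a) x y)
         where
         lemma₁ : ∀ a d x y → a * - x + d * - y ≡ - (a * x + d * y)
         lemma₁ = solve-∀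
         lemma₂ : ∀ a x y → - x + a * - y ≡ - (x + a * y)
         lemma₂ = solve-∀
     P-act⁻⁻¹′ : ∀ j → P (⊝ conj (pow j)) → P (⊝ 1ᴱ)
     P-act⁻⁻¹′ j p = subst P (trans (cong (act j) (cong ⊝_ refl)) (trans (act-⊝ j (conj (pow j)))
       (cong ⊝_ (trans (sym (conj-act⁻ j (pow j))) (cong conj (act⁻-pow j)))))) (P-act j _ p)

   power-or-dominated : ∀ u → P (u ⊖ 1ᴱ) → ¬ P (⊝ conj u) →
     (∃ λ j → u ≡ pow j) ⊎ (∃ λ j → u ≢ pow j × P (u ⊖ pow j) × P (conj u ⊖ conj (pow j)))
   power-or-dominated u p ¬q = let J , ¬r = beyond u in go (largest-power u J p ¬r)
     where
     go : (∃ λ j → P (u ⊖ pow j) × ¬ P (u ⊖ pow (suc j))) → _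
     go (j , r , ¬s) = decide (Productₚ.≡-dec ℤ._≟_ ℤ._≟_ u (pow j))
       where
       β = act⁻ j u
       back : ∀ k z → act⁻ k (u ⊖ z) ≡ act⁻ k u ⊖ act⁻ k z
       back k z = act⁻-linear k u -1ℤ z
       β≥1 : P (β ⊖ 1ᴱ)
       β≥1 = subst P (trans (back j (pow j)) (cong (β ⊖_) (act⁻-pow j))) (P-act⁻ j _ r)
       β<ε : ¬ P (β ⊖ ε· 1ᴱ)
       β<ε s = ¬s (P-act⁻⁻¹ j _ (subst P (sym (trans (back j (pow (suc j)))
         (cong (β ⊖_) (trans (cong (act⁻ j) (sym (ε·-pow-act j 1ᴱ))) (act⁻-act j (ε· 1ᴱ)))))) s))
       conj-β : ¬ P (⊝ conj β)
       conj-β s = ¬q (subst P (lemma j) (P-act⁻ j _ s))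
         where
         lemma : ∀ j → act⁻ j (⊝ conj (act⁻ j u)) ≡ ⊝ conj u
         lemma j = trans (act⁻-⊝ j _) (cong ⊝_ (trans (cong (act⁻ j) (conj-act⁻ j u)) (act⁻-act j (conj u))))
       dominated : P (conj u ⊖ conj (pow j))
       dominated = subst P (conj-linear u -1ℤ (pow j)) (P-conj-act⁻⁻¹ j _
         (subst P (sym (trans (cong conj (trans (back j (pow j)) (cong (β ⊖_) (act⁻-pow j)))) (conj-linear β -1ℤ 1ᴱ)))
           (conj-at-least-1 β β≥1 β<ε conj-β)))
       decide : Dec (u ≡ pow j) → _
       decide (yes eq) = inj₁ (j , eq)
       decide (no neq) = inj₂ (j , neq , r , dominated)

   -- The part of X above the digit c at u when the part below is L.
   above : ℕ → ℤ[α] → ℤ[α] → ℤ[α] → ℤ[α]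
   above c X u L = X ⊖ L ⊕ (- (+ c)) · u

   record Reads (c : ℕ) (X u L : ℤ[α]) : Set where
     constructor reads
     field
       low≥0  : P L
       low≤   : P (u ⊕ (- (+ 2)) · L)
       high≥0 : P (conj (above c X u L))
       high≤  : P (conj (u ⊕ (- (+ 2)) · above c X u L))

   private
     between : ∀ x → + 499 ℤ.≤ x → ∀ c d → c ℕ.≤ maxDigit → x ℤ.≤ + 2 + + 2 * (+ c - + d) → ⊥
     between x p c d c≤ q = small 210 p (ℤₚ.≤-trans q (ℤₚ.+-monoʳ-≤ (+ 2) (ℤₚ.*-monoˡ-≤-nonNeg (+ 2)
       {+ c - + d} {+ 104} (ℤₚ.≤-trans (ℤₚ.i≤j⇒i-k≤j {+ c} (+ d) (ℤ.+≤+ c≤)) ℤₚ.≤-refl)))) (ℕₚ.≤ᵇ⇒≤ 210 498 _)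
     twice : ∀ x → 0ℤ ℤ.≤ 1ℤ - + 2 * x → 0ℤ ℤ.≤ 1ℤ + + 2 * x → x ≡ 0ℤ
     twice (+ zero)      p q = refl
     twice (+ suc zero)  () q
     twice (+ suc (suc n)) () q
     twice -[1+ zero ]   p ()
     twice -[1+ suc n ]  p ()

   private
     read-1-unique : ∀ c c′ X L L′ → c ℕ.≤ maxDigit → c′ ℕ.≤ maxDigit →
                     Reads c X 1ᴱ L → Reads c′ X 1ᴱ L′ → c ≡ c′
     read-1-unique c c′ (X , Y) L@(p , q) L′@(p′ , q′) c≤ c′≤ (reads l₁ l₂ h₁ h₂) (reads l₁′ l₂′ h₁′ h₂′) = cases (q - q′) refl
       where
       A : P (1ℤ - + 2 * (p - p′) , - (+ 2 * (q - q′)))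
       A = to (P-⊕ _ _ l₂ (P-· 2 _ l₁′)) (lemma₁ p p′) (lemma₂ q q′)
         where
         lemma₁ : ∀ p p′ → (1ℤ + - (+ 2) * p) + + 2 * p′ ≡ 1ℤ - + 2 * (p - p′)
         lemma₁ = solve-∀
         lemma₂ : ∀ q q′ → (0ℤ + - (+ 2) * q) + + 2 * q′ ≡ - (+ 2 * (q - q′))
         lemma₂ = solve-∀
       A′ : P (1ℤ + + 2 * (p - p′) , + 2 * (q - q′))
       A′ = to (P-⊕ _ _ l₂′ (P-· 2 _ l₁)) (lemma₁ p p′) (lemma₂ q q′)
         where
         lemma₁ : ∀ p p′ → (1ℤ + - (+ 2) * p′) + + 2 * p ≡ 1ℤ + + 2 * (p - p′)
         lemma₁ = solve-∀
         lemma₂ : ∀ q q′ → (0ℤ + - (+ 2) * q′) + + 2 * q ≡ + 2 * (q - q′)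
         lemma₂ = solve-∀
       B : P (1ℤ + + 2 * (p - p′) + + 2 * (+ c - + c′) , - (+ 2 * (q - q′)))
       B = to (P-⊕ _ _ h₂ (P-· 2 _ h₁′)) (lemma₁ X p p′ (+ c) (+ c′)) (lemma₂ Y q q′ (+ c) (+ c′))
         where
         lemma₁ : ∀ X p p′ c c′ → (1ℤ + - (+ 2) * ((X + -1ℤ * p) + - c * 1ℤ)) + + 2 * ((X + -1ℤ * p′) + - c′ * 1ℤ)
                  ≡ 1ℤ + + 2 * (p - p′) + + 2 * (c - c′)
         lemma₁ = solve-∀
         lemma₂ : ∀ Y q q′ c c′ → - (0ℤ + - (+ 2) * ((Y + -1ℤ * q) + - c * 0ℤ)) + + 2 * - ((Y + -1ℤ * q′) + - c′ * 0ℤ)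
                  ≡ - (+ 2 * (q - q′))
         lemma₂ = solve-∀
       B′ : P (1ℤ - + 2 * (p - p′) - + 2 * (+ c - + c′) , + 2 * (q - q′))
       B′ = to (P-⊕ _ _ h₂′ (P-· 2 _ h₁)) (lemma₁ X p p′ (+ c) (+ c′)) (lemma₂ Y q q′ (+ c) (+ c′))
         where
         lemma₁ : ∀ X p p′ c c′ → (1ℤ + - (+ 2) * ((X + -1ℤ * p′) + - c′ * 1ℤ)) + + 2 * ((X + -1ℤ * p) + - c * 1ℤ)
                  ≡ 1ℤ - + 2 * (p - p′) - + 2 * (c - c′)
         lemma₁ = solve-∀
         lemma₂ : ∀ Y q q′ c c′ → - (0ℤ + - (+ 2) * ((Y + -1ℤ * q′) + - c′ * 0ℤ)) + + 2 * - ((Y + -1ℤ * q) + - c * 0ℤ)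
                  ≡ + 2 * (q - q′)
         lemma₂ = solve-∀
       A+B : P (+ 2 + + 2 * (+ c - + c′) , - (+ 4 * (q - q′)))
       A+B = to (P-⊕ _ _ A B) (lemma₁ (p - p′) (+ c - + c′)) (lemma₂ (q - q′))
         where
         lemma₁ : ∀ p c → (1ℤ - + 2 * p) + (1ℤ + + 2 * p + + 2 * c) ≡ + 2 + + 2 * c
         lemma₁ = solve-∀
         lemma₂ : ∀ q → - (+ 2 * q) + - (+ 2 * q) ≡ - (+ 4 * q)
         lemma₂ = solve-∀
       A′+B′ : P (+ 2 + + 2 * (+ c′ - + c) , + 4 * (q - q′))
       A′+B′ = to (P-⊕ _ _ A′ B′) (lemma₁ (p - p′) (+ c) (+ c′)) (lemma₂ (q - q′))
         where
         lemma₁ : ∀ p c c′ → (1ℤ + + 2 * p) + (1ℤ - + 2 * p - + 2 * (c - c′)) ≡ + 2 + + 2 * (c′ - c)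
         lemma₁ = solve-∀
         lemma₂ : ∀ q → (+ 2 * q) + (+ 2 * q) ≡ + 4 * q
         lemma₂ = solve-∀
       cases : ∀ z → q - q′ ≡ z → c ≡ c′
       cases (+ suc n) eq = ⊥-elim (between _ (θ-large _ _ (subst (λ z → P (+ 2 + + 2 * (+ c - + c′) , - (+ 4 * z))) eq A+B)) c c′ c≤ ℤₚ.≤-refl)
       cases -[1+ n ]  eq = ⊥-elim (between _ (θ-large _ _ (subst (λ z → P (+ 2 + + 2 * (+ c′ - + c) , + 4 * z)) eq A′+B′)) c′ c c′≤ ℤₚ.≤-refl)
       cases (+ zero)  eq = ℤₚ.+-injective (ℤₚ.i-j≡0⇒i≡j (+ c) (+ c′) (twice (+ c - + c′)
         (P-ℤ⁻¹ (to B′ (trans (cong (λ z → 1ℤ - + 2 * z - + 2 * (+ c - + c′)) p≡p′) refl) (cong (λ z → + 2 * z) eq)))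
         (P-ℤ⁻¹ (to B (trans (cong (λ z → 1ℤ + + 2 * z + + 2 * (+ c - + c′)) p≡p′) refl) (cong (λ z → - (+ 2 * z)) eq)))))
         where
         p≡p′ : p - p′ ≡ 0ℤ
         p≡p′ = twice (p - p′)
           (P-ℤ⁻¹ (to A refl (cong (λ z → - (+ 2 * z)) eq)))
           (P-ℤ⁻¹ (to A′ refl (cong (λ z → + 2 * z) eq)))

   act⁻-above : ∀ i c X u L → act⁻ i (above c X u L) ≡ above c (act⁻ i X) (act⁻ i u) (act⁻ i L)
   act⁻-above i c X u L = trans (act⁻-linear i (X ⊖ L) (- (+ c)) u)
     (cong (_⊕ (- (+ c)) · act⁻ i u) (act⁻-linear i X -1ℤ L))

   reads-unique : ∀ i c c′ X L L′ → c ℕ.≤ maxDigit → c′ ℕ.≤ maxDigit →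
                  Reads c X (pow i) L → Reads c′ X (pow i) L′ → c ≡ c′
   reads-unique i c c′ X L L′ c≤ c′≤ r r′ =
     read-1-unique c c′ (act⁻ i X) (act⁻ i L) (act⁻ i L′) c≤ c′≤ (transport c L r) (transport c′ L′ r′)
     where
     transport : ∀ c L → Reads c X (pow i) L → Reads c (act⁻ i X) 1ᴱ (act⁻ i L)
     transport c L (reads l₁ l₂ h₁ h₂) = reads (P-act⁻ i L l₁)
       (subst P (trans (act⁻-linear i (pow i) (- (+ 2)) L) (cong (_⊕ (- (+ 2)) · act⁻ i L) (act⁻-pow i))) (P-act⁻ i _ l₂))
       (subst (λ z → P (conj z)) eq (P-conj-act⁻ i _ h₁))
       (subst (λ z → P (conj z)) (trans (act⁻-linear i (pow i) (- (+ 2)) (above c X (pow i) L))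
         (cong₂ (λ y z → y ⊕ (- (+ 2)) · z) (act⁻-pow i) eq)) (P-conj-act⁻ i _ h₂))
       where
       eq : act⁻ i (above c X (pow i) L) ≡ above c (act⁻ i X) 1ᴱ (act⁻ i L)
       eq = trans (act⁻-above i c X (pow i) L) (cong (λ u → above c (act⁻ i X) u (act⁻ i L)) (act⁻-pow i))

   private
     digit-room : ∀ d k → d ℕ.≤ maxDigit → k ℕ.≤ 1 → 0ℤ ℤ.≤ + a - + k - + 2 * + d
     digit-room d k d≤ k≤ = subst (0ℤ ℤ.≤_) (lemma (+ a) (+ k) (+ d)) (ℤₚ.i≤j⇒0≤j-i
       (subst (ℤ._≤ + a) (cong (λ z → + k + z) (ℤₚ.pos-* 2 d)) (ℤ.+≤+ (ℕₚ.≤-trans (ℕₚ.+-mono-≤ k≤ (ℕₚ.*-monoʳ-≤ 2 d≤)) (ℕₚ.≤-trans (ℕₚ.≤ᵇ⇒≤ 209 500 _) 500≤a)))))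
       where
       lemma : ∀ a k d → a - (k + + 2 * d) ≡ a - k - + 2 * d
       lemma = solve-∀

   eval-conj≥0 : ∀ ds → P (conj (eval ds))
   eval-conj≥0 []       = P-ℤ (ℤ.+≤+ z≤n)
   eval-conj≥0 (d ∷ ds) = subst P (sym (trans (split (ε· (eval ds))) (cong ((+ d , 0ℤ) ⊕_) (conj-ε (eval ds)))))
     (P-⊕ _ _ (P-ℤ {+ d} (ℤ.+≤+ z≤n)) (P-ε⁻¹ _ (eval-conj≥0 ds)))
     where
     split : ∀ z → conj ((+ d , 0ℤ) ⊕ z) ≡ (+ d , 0ℤ) ⊕ conj z
     split (x , y) = pair refl (lemma y)
       where
       lemma : ∀ y → - (0ℤ + y) ≡ 0ℤ + - y
       lemma = solve-∀

   eval-conj≤ : ∀ ds → All (ℕ._≤ maxDigit) ds → P ((+ a , 1ℤ) ⊕ (- (+ 2)) · conj (eval ds))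
   eval-conj≤ []       _         = to (P-ℕ a 1) (sym (lemma (+ a))) refl
     where
     lemma : ∀ a → a + - (+ 2) * 0ℤ ≡ a
     lemma = solve-∀
   eval-conj≤ (d ∷ ds) (d≤ ∷ ds≤) = go (eval ds) (eval-conj≤ ds ds≤)
     where
     go : ∀ z → P ((+ a , 1ℤ) ⊕ (- (+ 2)) · conj z) → P ((+ a , 1ℤ) ⊕ (- (+ 2)) · conj ((+ d , 0ℤ) ⊕ ε· z))
     go (x , y) p = to (P-⊕ _ _ (P-⊕ _ _ (P-ℤ (digit-room d 1 d≤ ℕₚ.≤-refl)) (P-θ 1)) (P-ε⁻¹ _ p))
       (lemma₁ (+ a) x y (+ d)) (lemma₂ (+ a) x y)
       where
       lemma₁ : ∀ a x y d → ((a - 1ℤ - + 2 * d) + 0ℤ) + (a * (a + - (+ 2) * x) - (a * a - 1ℤ) * (1ℤ + - (+ 2) * - y))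
                ≡ a + - (+ 2) * (d + (a * x + (a * a - 1ℤ) * y))
       lemma₁ = solve-∀
       lemma₂ : ∀ a x y → (0ℤ + 1ℤ) + (a * (1ℤ + - (+ 2) * - y) - (a + - (+ 2) * x)) ≡ 1ℤ + - (+ 2) * - (0ℤ + (x + a * y))
       lemma₂ = solve-∀

   pow-conj≥0 : ∀ i → P (conj (pow i))
   pow-conj≥0 i = ⊝⊝ _ (P-total _ (¬⊝conj-pow i))

   pow≥1 : ∀ i → P (pow i ⊖ 1ᴱ)
   pow≥1 i = go (pow i) (pow-grows i)
     where
     go : ∀ z → P (z ⊖ (+ suc i , 0ℤ)) → P (z ⊖ 1ᴱ)
     go (x , y) p = to (P-⊕ _ _ p (P-ℤ {+ i} (ℤ.+≤+ z≤n))) (lemma x (+ i)) (lemma′ y)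
       where
       lemma : ∀ x i → (x + -1ℤ * (1ℤ + i)) + i ≡ x + -1ℤ * 1ℤ
       lemma = solve-∀
       lemma′ : ∀ y → (y + -1ℤ * 0ℤ) + 0ℤ ≡ y + -1ℤ * 0ℤ
       lemma′ = solve-∀

   -- Strengthening of Reads by 1 in the bound on the lower part, so that it survives a shift.
   record ReadsStrictly (c : ℕ) (X u L : ℤ[α]) : Set where
     field
       low≥0  : P L
       low<   : P (u ⊖ 1ᴱ ⊕ (- (+ 2)) · L)
       high≥0 : P (conj (above c X u L))
       high≤  : P (conj (u ⊕ (- (+ 2)) · above c X u L))

   private
     nothing-to-read : ∀ i → ReadsStrictly 0 0ᴱ (pow i) 0ᴱ
     nothing-to-read i = record
       { low≥0  = P-ℤ (ℤ.+≤+ z≤n)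
       ; low<   = subst P (drop (pow i ⊖ 1ᴱ)) (pow≥1 i)
       ; high≥0 = P-ℤ (ℤ.+≤+ z≤n)
       ; high≤  = subst (λ z → P (conj z)) (drop (pow i)) (pow-conj≥0 i)
       }
       where
       drop : ∀ z → z ≡ z ⊕ (- (+ 2)) · 0ᴱ
       drop (x , y) = pair (lemma x) (lemma y)
         where
         lemma : ∀ x → x ≡ x + - (+ 2) * 0ℤ
         lemma = solve-∀

     read-first : ∀ d ds → All (ℕ._≤ maxDigit) (d ∷ ds) → ReadsStrictly d (eval (d ∷ ds)) 1ᴱ 0ᴱ
     read-first d ds (_ ∷ ds≤) = record
       { low≥0  = P-ℤ (ℤ.+≤+ z≤n)
       ; low<   = P-ℤ (ℤ.+≤+ z≤n)
       ; high≥0 = subst (λ z → P (conj z)) (tail (ε· (eval ds))) (subst P (sym (conj-ε (eval ds))) (P-ε⁻¹ _ (eval-conj≥0 ds)))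
       ; high≤  = go (eval ds) (eval-conj≤ ds ds≤)
       }
       where
       tail : ∀ z → z ≡ above d ((+ d , 0ℤ) ⊕ z) 1ᴱ 0ᴱ
       tail (x , y) = pair (lemma (+ d) x) (lemma′ (+ d) y)
         where
         lemma : ∀ d x → x ≡ ((d + x) + -1ℤ * 0ℤ) + - d * 1ℤ
         lemma = solve-∀
         lemma′ : ∀ d y → y ≡ ((0ℤ + y) + -1ℤ * 0ℤ) + - d * 0ℤ
         lemma′ = solve-∀
       go : ∀ z → P ((+ a , 1ℤ) ⊕ (- (+ 2)) · conj z) → P (conj (1ᴱ ⊕ (- (+ 2)) · above d ((+ d , 0ℤ) ⊕ ε· z) 1ᴱ 0ᴱ))
       go z@(x , y) p = subst (λ w → P (conj (1ᴱ ⊕ (- (+ 2)) · w))) (tail (ε· z))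
         (to (P-ε⁻¹ _ p) (lemma₁ (+ a) x y) (lemma₂ (+ a) x y))
         where
         lemma₁ : ∀ a x y → a * (a + - (+ 2) * x) - (a * a - 1ℤ) * (1ℤ + - (+ 2) * - y) ≡ 1ℤ + - (+ 2) * (a * x + (a * a - 1ℤ) * y)
         lemma₁ = solve-∀
         lemma₂ : ∀ a x y → a * (1ℤ + - (+ 2) * - y) - (a + - (+ 2) * x) ≡ - (0ℤ + - (+ 2) * (x + a * y))
         lemma₂ = solve-∀

     read-shift : ∀ d c X u L → d ℕ.≤ maxDigit → ReadsStrictly c X u L →
                  ReadsStrictly c ((+ d , 0ℤ) ⊕ ε· X) (ε· u) ((+ d , 0ℤ) ⊕ ε· L)
     read-shift d c X u L d≤ r = record
       { low≥0  = P-⊕ _ _ (P-ℤ {+ d} (ℤ.+≤+ z≤n)) (P-ε _ low≥0)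
       ; low<   = to (P-⊕ _ _ (P-⊕ _ _ (P-ℤ (digit-room d 1 d≤ ℕₚ.≤-refl)) (P-θ 1)) (P-ε _ low<))
                    (lemma₁ (+ a) (+ d) (proj₁ u) (proj₂ u) (proj₁ L) (proj₂ L))
                    (lemma₂ (+ a) (proj₁ u) (proj₂ u) (proj₁ L) (proj₂ L))
       ; high≥0 = subst (λ z → P (conj z)) (sym (shift X u L)) (subst P (sym (conj-ε _)) (P-ε⁻¹ _ high≥0))
       ; high≤  = subst (λ z → P (conj z)) (sym (trans (cong (λ z → ε· u ⊕ (- (+ 2)) · z) (shift X u L)) (linear u (above c X u L))))
                    (subst P (sym (conj-ε _)) (P-ε⁻¹ _ high≤))
       }
       where
       open ReadsStrictly r
       lemma₁ : ∀ a d x y p q → ((a - 1ℤ - + 2 * d) + 0ℤ) + (a * ((x + -1ℤ * 1ℤ) + - (+ 2) * p) + (a * a - 1ℤ) * ((y + -1ℤ * 0ℤ) + - (+ 2) * q))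
                ≡ ((a * x + (a * a - 1ℤ) * y) + -1ℤ * 1ℤ) + - (+ 2) * (d + (a * p + (a * a - 1ℤ) * q))
       lemma₁ = solve-∀
       lemma₂ : ∀ a x y p q → (0ℤ + 1ℤ) + (((x + -1ℤ * 1ℤ) + - (+ 2) * p) + a * ((y + -1ℤ * 0ℤ) + - (+ 2) * q))
                ≡ ((x + a * y) + -1ℤ * 0ℤ) + - (+ 2) * (0ℤ + (p + a * q))
       lemma₂ = solve-∀
       linear : ∀ z w → ε· z ⊕ (- (+ 2)) · ε· w ≡ ε· (z ⊕ (- (+ 2)) · w)
       linear (x , y) (p , q) = pair (lemma₃ (+ a) D x y p q) (lemma₄ (+ a) x y p q)
         where
         lemma₃ : ∀ a d x y p q → (a * x + d * y) + - (+ 2) * (a * p + d * q) ≡ a * (x + - (+ 2) * p) + d * (y + - (+ 2) * q)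
         lemma₃ = solve-∀
         lemma₄ : ∀ a x y p q → (x + a * y) + - (+ 2) * (p + a * q) ≡ (x + - (+ 2) * p) + a * (y + - (+ 2) * q)
         lemma₄ = solve-∀
       shift : ∀ X u L → above c ((+ d , 0ℤ) ⊕ ε· X) (ε· u) ((+ d , 0ℤ) ⊕ ε· L) ≡ ε· (above c X u L)
       shift (X , Y) (x , y) (p , q) = pair (lemma₃ (+ a) D (+ c) (+ d) X Y x y p q) (lemma₄ (+ a) (+ c) X Y x y p q)
         where
         lemma₃ : ∀ a D c d X Y x y p q → ((d + (a * X + D * Y)) + -1ℤ * (d + (a * p + D * q))) + - c * (a * x + D * y)
                  ≡ a * ((X + -1ℤ * p) + - c * x) + D * ((Y + -1ℤ * q) + - c * y)
         lemma₃ = solve-∀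
         lemma₄ : ∀ a c X Y x y p q → ((0ℤ + (X + a * Y)) + -1ℤ * (0ℤ + (p + a * q))) + - c * (x + a * y)
                  ≡ ((X + -1ℤ * p) + - c * x) + a * ((Y + -1ℤ * q) + - c * y)
         lemma₄ = solve-∀

   eval-reads-strictly : ∀ ds → All (ℕ._≤ maxDigit) ds → ∀ i → ∃ λ L → ReadsStrictly (digit ds i) (eval ds) (pow i) L
   eval-reads-strictly []       _          i       = 0ᴱ , nothing-to-read i
   eval-reads-strictly (d ∷ ds) ds≤        zero    = 0ᴱ , read-first d ds ds≤
   eval-reads-strictly (d ∷ ds) (d≤ ∷ ds≤) (suc i) = let L , r = eval-reads-strictly ds ds≤ i in
     (+ d , 0ℤ) ⊕ ε· L , read-shift d (digit ds i) (eval ds) (pow i) L d≤ r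

   eval-reads : ∀ ds → All (ℕ._≤ maxDigit) ds → ∀ i → ∃ λ L → Reads (digit ds i) (eval ds) (pow i) L
   eval-reads ds ds≤ i = let L , r = eval-reads-strictly ds ds≤ i in L , reads (low≥0 r) (relax (pow i) L (low< r)) (high≥0 r) (high≤ r)
     where
     open ReadsStrictly
     relax : ∀ u L → P (u ⊖ 1ᴱ ⊕ (- (+ 2)) · L) → P (u ⊕ (- (+ 2)) · L)
     relax (x , y) (p , q) h = to (P-⊕ _ _ h (P-ℤ {1ℤ} (ℤ.+≤+ z≤n))) (lemma x p) (lemma′ y q)
       where
       lemma : ∀ x p → ((x + -1ℤ * 1ℤ) + - (+ 2) * p) + 1ℤ ≡ x + - (+ 2) * p
       lemma = solve-∀
       lemma′ : ∀ y q → ((y + -1ℤ * 0ℤ) + - (+ 2) * q) + 0ℤ ≡ y + - (+ 2) * q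
       lemma′ = solve-∀

module StackPrograms where

 open import Defs using (Word; Symbol; blank; bit; aux; Move; left; stay; right; Tape; tape; blankTape; inputTape; TM; module Run; PolyTimeComputable; poly)
 open import Data.Fin using (zero; suc)
 open import Data.Maybe using (maybe′; fromMaybe)
 open import Data.Nat using (_+_; _*_; _≤_)
 open import Data.Unit using (⊤; tt)
 open import Data.Vec.Relation.Binary.Pointwise.Inductive as PW using (Pointwise; []; _∷_)

 record Finite (A : Set) : Set where
   field
     size     : ℕ
     index    : A → Fin size
     at       : Fin size → A
     at-index : ∀ x → at (index x) ≡ x
     index-at : ∀ i → index (at i) ≡ i

 open Finite

 module Finiteness where

   ⊤-finite : Finite ⊤
   ⊤-finite = record { size = 1 ; index = λ _ → zero ; at = λ _ → tt ; at-index = λ _ → refl ; index-at = λ { zero → refl } }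

   Fin-finite : ∀ n → Finite (Fin n)
   Fin-finite n = record { size = n ; index = λ i → i ; at = λ i → i ; at-index = λ _ → refl ; index-at = λ _ → refl }

   ⊎-finite : ∀ {A B} → Finite A → Finite B → Finite (A ⊎ B)
   ⊎-finite {A} {B} F G = record
     { size     = size F + size G
     ; index    = encode
     ; at       = λ i → decode (Fin.splitAt (size F) i)
     ; at-index = λ { (inj₁ x) → trans (cong decode (Finₚ.splitAt-↑ˡ (size F) (index F x) (size G))) (cong inj₁ (at-index F x))
                    ; (inj₂ y) → trans (cong decode (Finₚ.splitAt-↑ʳ (size F) (size G) (index G y))) (cong inj₂ (at-index G y)) }
     ; index-at = λ i → trans (encode-decode (Fin.splitAt (size F) i)) (Finₚ.join-splitAt (size F) (size G) i)
     }
     where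
     encode : A ⊎ B → Fin (size F + size G)
     encode (inj₁ x) = index F x Fin.↑ˡ size G
     encode (inj₂ y) = size F Fin.↑ʳ index G y
     decode : Fin (size F) ⊎ Fin (size G) → A ⊎ B
     decode (inj₁ i) = inj₁ (at F i)
     decode (inj₂ j) = inj₂ (at G j)
     encode-decode : ∀ p → encode (decode p) ≡ Fin.join (size F) (size G) p
     encode-decode (inj₁ i) = cong (Fin._↑ˡ size G) (index-at F i)
     encode-decode (inj₂ j) = cong (size F Fin.↑ʳ_) (index-at G j)

   ×-finite : ∀ {A B} → Finite A → Finite B → Finite (A × B)
   ×-finite {A} {B} F G = record
     { size     = size F * size G
     ; index    = λ (x , y) → Fin.combine (index F x) (index G y)
     ; at       = λ i → decode (Fin.remQuot (size G) i)
     ; at-index = λ (x , y) → trans (cong decode (Finₚ.remQuot-combine (index F x) (index G y))) (cong₂ _,_ (at-index F x) (at-index G y))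
     ; index-at = λ i → trans (cong₂ Fin.combine (index-at F _) (index-at G _)) (Finₚ.combine-remQuot {size F} (size G) i)
     }
     where
     decode : Fin (size F) × Fin (size G) → A × B
     decode (i , j) = at F i , at G j

   transport : ∀ {A B : Set} (f : A → B) (g : B → A) → (∀ x → g (f x) ≡ x) → (∀ y → f (g y) ≡ y) → Finite B → Finite A
   transport f g gf fg F = record
     { size = size F ; index = index F ∘ f ; at = g ∘ at F
     ; at-index = λ x → trans (cong g (at-index F (f x))) (gf x)
     ; index-at = λ i → trans (cong (index F) (fg (at F i))) (index-at F i) }

   Maybe-finite : ∀ {A} → Finite A → Finite (Maybe A)
   Maybe-finite F = transport (λ { nothing → inj₁ tt ; (just x) → inj₂ x }) (λ { (inj₁ _) → nothing ; (inj₂ x) → just x })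
     (λ { nothing → refl ; (just x) → refl }) (λ { (inj₁ _) → refl ; (inj₂ _) → refl }) (⊎-finite ⊤-finite F)

   Bool-finite : Finite Bool
   Bool-finite = transport (λ { false → zero ; true → suc zero }) (λ { zero → false ; (suc _) → true })
     (λ { false → refl ; true → refl }) (λ { zero → refl ; (suc zero) → refl }) (Fin-finite 2)

   Symbol-finite : ∀ g → Finite (Symbol g)
   Symbol-finite g = transport
     (λ { blank → inj₁ tt ; (bit b) → inj₂ (inj₁ b) ; (aux i) → inj₂ (inj₂ i) })
     (λ { (inj₁ _) → blank ; (inj₂ (inj₁ b)) → bit b ; (inj₂ (inj₂ i)) → aux i })
     (λ { blank → refl ; (bit b) → refl ; (aux i) → refl })
     (λ { (inj₁ _) → refl ; (inj₂ (inj₁ _)) → refl ; (inj₂ (inj₂ _)) → refl })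
     (⊎-finite ⊤-finite (⊎-finite Bool-finite (Fin-finite g)))

   Vec-finite : ∀ {A} → Finite A → ∀ n → Finite (Vec A n)
   Vec-finite F zero    = transport (λ _ → tt) (λ _ → []) (λ { [] → refl }) (λ _ → refl) ⊤-finite
   Vec-finite F (suc n) = transport (λ { (x ∷ xs) → x , xs }) (λ (x , xs) → x ∷ xs) (λ { (x ∷ xs) → refl }) (λ _ → refl)
     (×-finite F (Vec-finite F n))

 open Finiteness

 data Act (g : ℕ) : Set where
   keep pop : Act g
   push set : Symbol g → Act g

 -- A machine with 1 + m stacks over the alphabet Symbol g, given by structured programs whose
 -- tests and operations see the tops of all the stacks; the top of the empty stack is blank.
 module StackMachine (g m : ℕ) where

   Stack : Set
   Stack = List (Symbol g)

   Tops : Set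
   Tops = Vec (Symbol g) (suc m)

   top : Stack → Symbol g
   top []      = blank
   top (x ∷ _) = x

   tops : ∀ {h} → Vec Stack h → Vec (Symbol g) h
   tops = Vec.map top

   perform : Act g → Stack → Stack
   perform keep     σ       = σ
   perform pop      []      = []
   perform pop      (_ ∷ σ) = σ
   perform (push x) σ       = x ∷ σ
   perform (set x)  []      = x ∷ []
   perform (set x)  (_ ∷ σ) = x ∷ σ

   infixr 4 _︔_
   data Program : Set where
     op    : (Tops → Vec (Act g) (suc m)) → Program
     _︔_   : Program → Program → Program
     while : (Tops → Bool) → Program → Program
     if    : (Tops → Bool) → Program → Program → Program

   Stacks : Set
   Stacks = Vec Stack (suc m)

   data Runs : Program → Stacks → ℕ → Stacks → Set where
     op   : ∀ {f s} → Runs (op f) s 1 (Vec.zipWith perform (f (tops s)) s)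
     seq  : ∀ {p q s s′ s″ t t′} → Runs p s t s′ → Runs q s′ t′ s″ → Runs (p ︔ q) s (t + t′) s″
     stop : ∀ {b p s} → b (tops s) ≡ false → Runs (while b p) s 1 s
     loop : ∀ {b p s s′ s″ t t′} → b (tops s) ≡ true → Runs p s t s′ → Runs (while b p) s′ t′ s″ →
            Runs (while b p) s (suc (t + t′)) s″
     then : ∀ {b p q s s′ t} → b (tops s) ≡ true → Runs p s t s′ → Runs (if b p q) s (suc t) s′
     else : ∀ {b p q s s′ t} → b (tops s) ≡ false → Runs q s t s′ → Runs (if b p q) s (suc t) s′

   Point : Program → Set
   Point (op f)      = ⊤
   Point (p ︔ q)     = Point p ⊎ Point q
   Point (while b p) = ⊤ ⊎ Point p
   Point (if b p q)  = ⊤ ⊎ (Point p ⊎ Point q)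

   Point-finite : ∀ p → Finite (Point p)
   Point-finite (op f)      = ⊤-finite
   Point-finite (p ︔ q)     = ⊎-finite (Point-finite p) (Point-finite q)
   Point-finite (while b p) = ⊎-finite ⊤-finite (Point-finite p)
   Point-finite (if b p q)  = ⊎-finite ⊤-finite (⊎-finite (Point-finite p) (Point-finite q))

   entry : ∀ p → Point p
   entry (op f)      = tt
   entry (p ︔ q)     = inj₁ (entry p)
   entry (while b p) = inj₁ tt
   entry (if b p q)  = inj₁ tt

   idle : Vec (Act g) (suc m)
   idle = Vec.replicate (suc m) keep

   Outcome : Set → Set
   Outcome Q = Maybe Q × Vec (Act g) (suc m)

   embed : ∀ {P Q : Set} → (P → Q) → Maybe Q → Outcome P → Outcome Q
   embed f e (c , as) = maybe′ (just ∘ f) e c , as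

   next : ∀ p → Point p → Tops → Outcome (Point p)
   next (op f)      _               ts = nothing , f ts
   next (p ︔ q)     (inj₁ c)        ts = embed inj₁ (just (inj₂ (entry q))) (next p c ts)
   next (p ︔ q)     (inj₂ c)        ts = embed inj₂ nothing (next q c ts)
   next (while b p) (inj₁ _)        ts with b ts
   ... | true  = just (inj₂ (entry p)) , idle
   ... | false = nothing , idle
   next (while b p) (inj₂ c)        ts = embed inj₂ (just (inj₁ tt)) (next p c ts)
   next (if b p q)  (inj₁ _)        ts with b ts
   ... | true  = just (inj₂ (inj₁ (entry p))) , idle
   ... | false = just (inj₂ (inj₂ (entry q))) , idle
   next (if b p q)  (inj₂ (inj₁ c)) ts = embed (inj₂ ∘ inj₁) nothing (next p c ts)
   next (if b p q)  (inj₂ (inj₂ c)) ts = embed (inj₂ ∘ inj₂) nothing (next q c ts)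

   perform-idle : ∀ {h} (s : Vec Stack h) → Vec.zipWith perform (Vec.replicate h keep) s ≡ s
   perform-idle []      = refl
   perform-idle (σ ∷ s) = cong (σ ∷_) (perform-idle s)

   module Compilation (P : Program) where

     data Steps : ℕ → Maybe (Point P) → Stacks → Maybe (Point P) → Stacks → Set where
       done : ∀ {c s} → Steps 0 c s c s
       more : ∀ {t c s c′ s′} → Steps t (proj₁ (next P c (tops s))) (Vec.zipWith perform (proj₂ (next P c (tops s))) s) c′ s′ →
              Steps (suc t) (just c) s c′ s′

     _⟫_ : ∀ {t t′ c s c′ s′ c″ s″} → Steps t c s c′ s′ → Steps t′ c′ s′ c″ s″ → Steps (t + t′) c s c″ s″
     done   ⟫ y = y
     more x ⟫ y = more (x ⟫ y)

     one : ∀ {t c s c′ c″ s″ as} → next P c (tops s) ≡ (c′ , as) → Steps t c′ (Vec.zipWith perform as s) c″ s″ →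
           Steps (suc t) (just c) s c″ s″
     one eq x = more (subst (λ (c , as) → Steps _ c (Vec.zipWith perform as _) _ _) (sym eq) x)

     quiet : ∀ {t c s c′ c″ s″} → next P c (tops s) ≡ (c′ , idle) → Steps t c′ s c″ s″ → Steps (suc t) (just c) s c″ s″
     quiet {s = s} eq x = one eq (subst (λ s → Steps _ _ s _ _) (sym (perform-idle s)) x)

     Hosted : ∀ p → (Point p → Point P) → Maybe (Point P) → Set
     Hosted p host exit = ∀ c ts → next P (host c) ts ≡ embed host exit (next p c ts)

     embed-embed : ∀ {A B : Set} (f : A → B) e (host : B → Point P) exit (o : Outcome A) →
                   embed host exit (embed f e o) ≡ embed (host ∘ f) (maybe′ (just ∘ host) exit e) o
     embed-embed f e host exit (just c , as)  = refl
     embed-embed f e host exit (nothing , as) = refl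

     execute : ∀ {p s t s′} → Runs p s t s′ → ∀ host exit → Hosted p host exit → Steps t (just (host (entry p))) s exit s′
     execute op host exit H = one (H tt _) done
     execute {p ︔ q} (seq r r′) host exit H =
       execute r (host ∘ inj₁) (just (host (inj₂ (entry q)))) (λ c ts → trans (H (inj₁ c) ts) (embed-embed inj₁ _ host exit (next p c ts)))
       ⟫ execute r′ (host ∘ inj₂) exit (λ c ts → trans (H (inj₂ c) ts) (embed-embed inj₂ _ host exit (next q c ts)))
     execute {while b p} {s} (stop eq) host exit H = quiet (trans (H (inj₁ tt) (tops s)) (cong (embed host exit) (test eq))) done
       where
       test : ∀ {ts} → b ts ≡ false → next (while b p) (inj₁ tt) ts ≡ (nothing , idle)
       test eq rewrite eq = refl
     execute {while b p} {s} (loop eq r r′) host exit H =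
       quiet (trans (H (inj₁ tt) (tops s)) (cong (embed host exit) (test eq)))
         (execute r (host ∘ inj₂) (just (host (inj₁ tt))) (λ c ts → trans (H (inj₂ c) ts) (embed-embed inj₂ _ host exit (next p c ts)))
          ⟫ execute r′ host exit H)
       where
       test : ∀ {ts} → b ts ≡ true → next (while b p) (inj₁ tt) ts ≡ (just (inj₂ (entry p)) , idle)
       test eq rewrite eq = refl
     execute {if b p q} {s} (then eq r) host exit H =
       quiet (trans (H (inj₁ tt) (tops s)) (cong (embed host exit) (test eq)))
         (execute r (host ∘ inj₂ ∘ inj₁) exit (λ c ts → trans (H (inj₂ (inj₁ c)) ts) (embed-embed _ _ host exit (next p c ts))))
       where
       test : ∀ {ts} → b ts ≡ true → next (if b p q) (inj₁ tt) ts ≡ (just (inj₂ (inj₁ (entry p))) , idle)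
       test eq rewrite eq = refl
     execute {if b p q} {s} (else eq r) host exit H =
       quiet (trans (H (inj₁ tt) (tops s)) (cong (embed host exit) (test eq)))
         (execute r (host ∘ inj₂ ∘ inj₂) exit (λ c ts → trans (H (inj₂ (inj₂ c)) ts) (embed-embed _ _ host exit (next q c ts))))
       where
       test : ∀ {ts} → b ts ≡ false → next (if b p q) (inj₁ tt) ts ≡ (just (inj₂ (inj₂ (entry q))) , idle)
       test eq rewrite eq = refl

     steps : ∀ {s t s′} → Runs P s t s′ → Steps t (just (entry P)) s nothing s′
     steps r = execute r (λ c → c) nothing (λ c ts → sym (embed-id (next P c ts)))
       where
       embed-id : ∀ (o : Outcome (Point P)) → embed (λ c → c) nothing o ≡ o
       embed-id (just c , as)  = refl
       embed-id (nothing , as) = refl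

     -- A step of a program takes two moves of the machine, since a push has to move first;
     -- the second component holds the symbols that remain to be written.
     State : Set
     State = Maybe (Point P) × Maybe (Vec (Maybe (Symbol g)) (suc m))

     State-finite : Finite State
     State-finite = ×-finite (Maybe-finite (Point-finite P)) (Maybe-finite (Vec-finite (Maybe-finite (Symbol-finite g)) (suc m)))

     first : Act g → Symbol g → Symbol g × Move
     first keep     s = s , stay
     first pop      s = blank , right
     first (push x) s = s , left
     first (set x)  s = x , stay

     second : Act g → Maybe (Symbol g)
     second (push x) = just x
     second _        = nothing

     finish : Maybe (Symbol g) → Symbol g → Symbol g × Move
     finish w s = fromMaybe s w , stay

     encode : State → Fin (size State-finite)
     encode = index State-finite

     transition : State → Tops → Maybe (Fin (size State-finite) × Vec (Symbol g × Move) (suc m))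
     transition (c , just ws)      ts = just (encode (c , nothing) , Vec.zipWith finish ws ts)
     transition (nothing , nothing) ts = nothing
     transition (just c , nothing)  ts =
       just (encode (proj₁ (next P c ts) , just (Vec.map second (proj₂ (next P c ts)))) ,
             Vec.zipWith first (proj₂ (next P c ts)) ts)

     machine : TM
     machine = record
       { m = m ; g = g ; states = size State-finite
       ; start = encode (just (entry P) , nothing)
       ; accepting = λ _ → false
       ; δ = λ q → transition (at State-finite q) }

     open Run machine

     Represents : Stack → Tape g → Set
     Represents σ (tape _ h r) = ∃ λ k → h ∷ r ≡ σ ++ List.replicate k blank

     represents-top : ∀ {σ T} → Represents σ T → Tape.head T ≡ top σ
     represents-top {[]}    (suc k , refl) = refl
     represents-top {x ∷ σ} (k , refl)     = refl

     Tape-head = Tape.head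

     perform-represents : ∀ a {σ T} → Represents σ T →
       Represents (perform a σ) (Defs.act (finish (second a) (Tape-head (Defs.act (first a (Tape-head T)) T))) (Defs.act (first a (Tape-head T)) T))
     perform-represents keep r = r
     perform-represents (set x) {[]}    (suc k , refl) = k , refl
     perform-represents (set x) {_ ∷ σ} (k , refl) = k , refl
     perform-represents (push x) {σ} {tape [] h r}      (k , eq) = k , cong (x ∷_) eq
     perform-represents (push x) {σ} {tape (_ ∷ _) h r} (k , eq) = k , cong (x ∷_) eq
     perform-represents pop {[]}    {tape l h []}      (suc k , eq)   = 1 , refl
     perform-represents pop {[]}    {tape l h (_ ∷ r)} (suc k , eq)   = k , Listₚ.∷-injectiveʳ eq
     perform-represents pop {x ∷ σ} {tape l h (_ ∷ r)} (k , eq)       = k , Listₚ.∷-injectiveʳ eq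
     perform-represents pop {x ∷ []}    {tape l h []} (k , eq) = 1 , refl
     perform-represents pop {x ∷ _ ∷ σ} {tape l h []} (k , ())

     RepresentsAll : ∀ {h} → Vec Stack h → Vec (Tape g) h → Set
     RepresentsAll = Pointwise Represents

     represents-tops : ∀ {h} {s : Vec Stack h} {T} → RepresentsAll s T → Vec.map Tape.head T ≡ tops s
     represents-tops []       = refl
     represents-tops {s = σ ∷ _} {T ∷ _} (r ∷ rs) = cong₂ _∷_ (represents-top {σ} {T} r) (represents-tops rs)

     halfway : ∀ {h} → Vec (Act g) h → Vec (Tape g) h → Vec (Tape g) h
     halfway as T = Vec.zipWith Defs.act (Vec.zipWith first as (Vec.map Tape.head T)) T

     finished : ∀ {h} → Vec (Act g) h → Vec (Tape g) h → Vec (Tape g) h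
     finished as T = Vec.zipWith Defs.act (Vec.zipWith finish (Vec.map second as) (Vec.map Tape.head (halfway as T))) (halfway as T)

     perform-all : ∀ {h} (as : Vec (Act g) h) {s : Vec Stack h} {T} → RepresentsAll s T →
                   RepresentsAll (Vec.zipWith perform as s) (finished as T)
     perform-all []       []       = []
     perform-all (a ∷ as) {σ ∷ _} {T ∷ _} (r ∷ rs) = perform-represents a {σ} {T} r ∷ perform-all as rs

     at-encode : ∀ q → at State-finite (encode q) ≡ q
     at-encode = at-index State-finite

     run-step : ∀ t c {c′} → step c ≡ just c′ → run (suc t) c ≡ run t c′
     run-step t c eq rewrite eq = refl

     config : Maybe (Point P) → Vec (Tape g) (suc m) → Configuration
     config c T = ⟨ encode (c , nothing) , T ⟩

     step-first : ∀ c T ts → Vec.map Tape.head T ≡ ts → step (config (just c) T) ≡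
       just ⟨ encode (proj₁ (next P c ts) , just (Vec.map second (proj₂ (next P c ts)))) , halfway (proj₂ (next P c ts)) T ⟩
     step-first c T ts refl rewrite at-encode (just c , nothing) = refl

     step-second : ∀ c ws T → step ⟨ encode (c , just ws) , T ⟩ ≡ just (config c (Vec.zipWith Defs.act (Vec.zipWith finish ws (Vec.map Tape.head T)) T))
     step-second c ws T rewrite at-encode (c , just ws) = refl

     simulate : ∀ {t c s c′ s′ T} → Steps t c s c′ s′ → RepresentsAll s T →
                ∃ λ T′ → run (t * 2) (config c T) ≡ config c′ T′ × RepresentsAll s′ T′
     simulate {T = T} done R = T , refl , R
     simulate {suc t} {just c} {s} {T = T} (more x) R =
       let as = proj₂ (next P c (tops s))
           T′ , eq , R′ = simulate x (perform-all as R)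
       in T′ , trans (run-step (suc (t * 2)) (config (just c) T) (step-first c T (tops s) (represents-tops R)))
               (trans (run-step (t * 2) ⟨ encode (proj₁ (next P c (tops s)) , just (Vec.map second as)) , halfway as T ⟩ (step-second (proj₁ (next P c (tops s))) (Vec.map second as) (halfway as T))) eq) , R′

     halted : ∀ T → Halted (config nothing T)
     halted T rewrite at-encode (nothing , nothing) = refl

     initial-represents : ∀ w → RepresentsAll (List.map bit w ∷ Vec.replicate m []) (tapes (initial w))
     initial-represents w = input w ∷ blanks m
       where
       input : ∀ w → Represents (List.map bit w) (inputTape w)
       input []       = 1 , refl
       input (b ∷ bs) = 0 , sym (Listₚ.++-identityʳ (List.map bit (b ∷ bs)))
       blanks : ∀ n → RepresentsAll (Vec.replicate n []) (Vec.replicate n blankTape)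
       blanks zero    = []
       blanks (suc n) = (1 , refl) ∷ blanks n

     last-represents : ∀ {h s σ T} → RepresentsAll {suc h} s T → Vec.last s ≡ σ → Represents σ (Vec.last T)
     last-represents (r ∷ [])         refl = r
     last-represents (r ∷ (r′ ∷ rs)) eq   = last-represents (r′ ∷ rs) eq

     content-of : ∀ w T → Represents (List.map bit w) T → Defs.content T ≡ w
     content-of w (tape _ h r) (k , eq) = trans (cong Defs.bits eq) (bits-map w)
       where
       bits-blank : ∀ k → Defs.bits {g} (List.replicate k blank) ≡ []
       bits-blank zero    = refl
       bits-blank (suc k) = refl
       bits-map : ∀ w → Defs.bits {g} (List.map bit w ++ List.replicate k blank) ≡ w
       bits-map []      = bits-blank k
       bits-map (b ∷ w) = cong (b ∷_) (bits-map w)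

   computable : ∀ P {f : Word → Word} k →
     (∀ w → ∃ λ t → t * 2 ≤ poly k (List.length w) × ∃ λ s → Runs P (List.map bit w ∷ Vec.replicate m []) t s × Vec.last s ≡ List.map bit (f w)) →
     PolyTimeComputable f
   computable P {f} k spec = machine , k , λ w →
     let t , t≤ , s , r , out = spec w
         T , eq , R = simulate (steps r) (initial-represents w)
     in t * 2 , t≤ , subst Halted (sym eq) (halted T) ,
        trans (cong output eq) (content-of (f w) (Vec.last T) (last-represents R out))
     where
     open Compilation P
     open Run machine

module Binary where

 open import Data.Digit using (Bit; toDigits; fromDigits)
 open import Data.Fin using (zero; suc)
 open import Data.List using (map)
 open import Data.Nat using (_+_; _*_; _<′_; <′-base; ≤′-step; _≤_)
 open import Data.Nat.DivMod using (_divMod_; result)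
 open import Data.Nat.Induction using (acc; <′-wellFounded; <′-wellFounded′)
 open import Induction.WellFounded using (module Some)

 wellFounded′-irrelevant : ∀ n {m} (m<n : m <′ n) → <′-wellFounded′ n m<n ≡ <′-wellFounded m
 wellFounded′-irrelevant (suc n) <′-base       = refl
 wellFounded′-irrelevant (suc n) (≤′-step m<n) = wellFounded′-irrelevant n m<n

 divMod-2-unique : ∀ (r s : Bit) x y → toℕ r + x * 2 ≡ toℕ s + y * 2 → r ≡ s × x ≡ y
 divMod-2-unique zero       zero       zero    zero    eq = refl , refl
 divMod-2-unique (suc zero) (suc zero) zero    zero    eq = refl , refl
 divMod-2-unique zero       zero       (suc x) (suc y) eq with divMod-2-unique zero zero x y (ℕₚ.suc-injective (ℕₚ.suc-injective eq))
 ... | p , q = p , cong suc q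
 divMod-2-unique (suc zero) (suc zero) (suc x) (suc y) eq with divMod-2-unique zero zero x y (ℕₚ.suc-injective (ℕₚ.suc-injective (ℕₚ.suc-injective eq)))
 ... | p , q = refl , cong suc q
 divMod-2-unique zero       (suc zero) (suc x) (suc y) eq with divMod-2-unique zero (suc zero) x y (ℕₚ.suc-injective (ℕₚ.suc-injective eq))
 ... | () , _
 divMod-2-unique (suc zero) zero       (suc x) (suc y) eq with divMod-2-unique (suc zero) zero x y (ℕₚ.suc-injective (ℕₚ.suc-injective eq))
 ... | () , _
 divMod-2-unique zero       (suc zero) (suc zero)    zero ()
 divMod-2-unique zero       (suc zero) (suc (suc x)) zero ()
 divMod-2-unique zero       (suc zero) zero zero ()
 divMod-2-unique zero       (suc zero) zero (suc y) ()
 divMod-2-unique (suc zero) zero       zero zero ()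
 divMod-2-unique (suc zero) zero       (suc x) zero ()
 divMod-2-unique (suc zero) zero       zero (suc zero) ()
 divMod-2-unique (suc zero) zero       zero (suc (suc y)) ()
 divMod-2-unique zero       zero       zero (suc y) ()
 divMod-2-unique zero       zero       (suc x) zero ()
 divMod-2-unique (suc zero) (suc zero) zero (suc y) ()
 divMod-2-unique (suc zero) (suc zero) (suc x) zero ()

 private
   builder-irrelevant : ∀ {f : ∀ n → (∀ {m} → m <′ n → ∃ λ (ds : List Bit) → fromDigits ds ≡ m) → ∃ λ (ds : List Bit) → fromDigits ds ≡ n}
     n {m} (c : suc m ≤ n → m <′ n) (m<n : suc m ≤ n) {k} (k<m : k <′ m) →
     Some.wfRecBuilder _ f m (<′-wellFounded′ n (c m<n)) k<m ≡ Some.wfRecBuilder _ f m (<′-wellFounded m) k<m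
   builder-irrelevant n c m<n k<m rewrite wellFounded′-irrelevant n (c m<n) = refl

 digits : ℕ → List Bit
 digits n = proj₁ (toDigits 2 n)

 -- Matching also on the second division exposes the accessibility proof that the recursion of
 -- toDigits passes on; it is abstracted as c so that unification finds the remaining arguments.
 digits-double : ∀ n (r : Bit) x → n ≡ toℕ r + suc x * 2 → digits n ≡ r ∷ digits (suc x)
 digits-double n r x eq with n divMod 2
 ... | result zero s eq′ with divMod-2-unique s r 0 (suc x) (trans (sym eq′) eq)
 ...   | _ , ()
 digits-double n r x eq | result (suc y) s refl with divMod-2-unique s r (suc y) (suc x) eq
 ... | refl , refl with ℕₚ.≤⇒≤′ {suc (suc y)} {toℕ s + suc y * 2} | suc y divMod 2
 ...   | c | result zero t eq″ = refl
 ...   | c | result (suc z) zero refl = cong (λ v → r ∷ zero ∷ proj₁ v) (builder-irrelevant _ c _ _)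
 ...   | c | result (suc z) (suc zero) refl = cong (λ v → r ∷ suc zero ∷ proj₁ v) (builder-irrelevant _ c _ _)

 bitValue : Bool → ℕ
 bitValue false = 0
 bitValue true  = 1

 toBit : Bool → Bit
 toBit false = zero
 toBit true  = suc zero

 -- Canonical binary expansions, least significant digit first.
 data Bin : List Bool → ℕ → Set where
   []    : Bin [] 0
   one   : Bin (true ∷ []) 1
   twice : ∀ b {bs v} → Bin bs (suc v) → Bin (b ∷ bs) (bitValue b + suc v * 2)

 Bin-digits : ∀ {bs n} → Bin bs n → n ≢ 0 → digits n ≡ map toBit bs
 Bin-digits []          n≢0 = ⊥-elim (n≢0 refl)
 Bin-digits one         _   = refl
 Bin-digits (twice b {bs} {v} B) _ = trans (digits-double (bitValue b + suc v * 2) (toBit b) v (value b v))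
   (cong (toBit b ∷_) (Bin-digits B λ ()))
   where
   value : ∀ b v → bitValue b + suc v * 2 ≡ toℕ (toBit b) + suc v * 2
   value false v = refl
   value true  v = refl

module Encoding where

 open import Defs using (Word; Token; code; allᵗ; someᵗ; notᵗ; andᵗ; orᵗ; leqᵗ; minusᵗ; zeroᵗ; oneᵗ; endᵗ; digitToken; binary; integerTokens; scalarTokens; formulaTokens; prefixTokens; encode; Formula; _≤ᶠ_; ¬ᶠ_; _∧ᶠ_; _∨ᶠ_; #inequalities; ℤ[α]; Quantifier; Sentence; sentence; matrix)
 open Binary
 open import Data.Digit using (Bit; toDigits; fromDigits)
 open import Data.Fin using (zero; suc)
 open import Data.Integer using (+_)
 open import Data.List using ([_]; map; concatMap)
 open import Data.Nat using (_+_)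
 open import Data.Nat.ListAction using (sum)

 private
   token : Bool → Bool → Bool → Bool → Token
   token false false false false = allᵗ
   token false false false true  = someᵗ
   token false false true  false = notᵗ
   token false false true  true  = andᵗ
   token false true  false false = orᵗ
   token false true  false true  = leqᵗ
   token false true  true  false = minusᵗ
   token false true  true  true  = zeroᵗ
   token true  false false false = oneᵗ
   token true  _     _     _     = endᵗ

   decode : Word → List Token
   decode (a ∷ b ∷ c ∷ d ∷ w) = token a b c d ∷ decode w
   decode _                   = []

   decode-code : ∀ ts → decode (concatMap code ts) ≡ ts
   decode-code []            = refl
   decode-code (allᵗ ∷ ts)   = cong (_ ∷_) (decode-code ts)
   decode-code (someᵗ ∷ ts)  = cong (_ ∷_) (decode-code ts)
   decode-code (notᵗ ∷ ts)   = cong (_ ∷_) (decode-code ts)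
   decode-code (andᵗ ∷ ts)   = cong (_ ∷_) (decode-code ts)
   decode-code (orᵗ ∷ ts)    = cong (_ ∷_) (decode-code ts)
   decode-code (leqᵗ ∷ ts)   = cong (_ ∷_) (decode-code ts)
   decode-code (minusᵗ ∷ ts) = cong (_ ∷_) (decode-code ts)
   decode-code (zeroᵗ ∷ ts)  = cong (_ ∷_) (decode-code ts)
   decode-code (oneᵗ ∷ ts)   = cong (_ ∷_) (decode-code ts)
   decode-code (endᵗ ∷ ts)   = cong (_ ∷_) (decode-code ts)

 concatMap-code-injective : ∀ ts us → concatMap code ts ≡ concatMap code us → ts ≡ us
 concatMap-code-injective ts us eq = trans (sym (decode-code ts)) (trans (cong decode eq) (decode-code us))

 PrefixFree : ∀ {A : Set} → (A → List Token) → Set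
 PrefixFree f = ∀ x y r s → f x ++ r ≡ f y ++ s → x ≡ y × r ≡ s

 private
   digits-prefixFree : ∀ (ds es : List Bit) r s → map digitToken ds ++ endᵗ ∷ r ≡ map digitToken es ++ endᵗ ∷ s → ds ≡ es × r ≡ s
   digits-prefixFree []              []              r s refl = refl , refl
   digits-prefixFree []              (zero ∷ es)     r s ()
   digits-prefixFree []              (suc zero ∷ es) r s ()
   digits-prefixFree (zero ∷ ds)     []              r s ()
   digits-prefixFree (suc zero ∷ ds) []              r s ()
   digits-prefixFree (zero ∷ ds)     (zero ∷ es)     r s eq with digits-prefixFree ds es r s (Listₚ.∷-injectiveʳ eq)
   ... | refl , r≡s = refl , r≡s
   digits-prefixFree (suc zero ∷ ds) (suc zero ∷ es) r s eq with digits-prefixFree ds es r s (Listₚ.∷-injectiveʳ eq)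
   ... | refl , r≡s = refl , r≡s
   digits-prefixFree (zero ∷ ds)     (suc zero ∷ es) r s ()
   digits-prefixFree (suc zero ∷ ds) (zero ∷ es)     r s ()

   fromDigits-digits : ∀ n → fromDigits (digits n) ≡ n
   fromDigits-digits n = proj₂ (toDigits 2 n)

   binary-prefixFree : PrefixFree (λ n → binary n ++ [ endᵗ ])
   binary-prefixFree m n r s eq with digits-prefixFree (digits m) (digits n) r s
     (trans (sym (Listₚ.++-assoc (binary m) [ endᵗ ] r)) (trans eq (Listₚ.++-assoc (binary n) [ endᵗ ] s)))
   ... | ds≡es , r≡s = trans (sym (fromDigits-digits m)) (trans (cong fromDigits ds≡es) (fromDigits-digits n)) , r≡s

   no-minus : ∀ (ds : List Bit) r s → map digitToken ds ++ endᵗ ∷ r ≢ minusᵗ ∷ s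
   no-minus []              r s ()
   no-minus (zero ∷ ds)     r s ()
   no-minus (suc zero ∷ ds) r s ()

 integerTokens-prefixFree : PrefixFree integerTokens
 integerTokens-prefixFree (+ m) (+ n) r s eq with binary-prefixFree m n r s eq
 ... | refl , r≡s = refl , r≡s
 integerTokens-prefixFree -[1+ m ] -[1+ n ] r s eq with binary-prefixFree (suc m) (suc n) r s (Listₚ.∷-injectiveʳ eq)
 ... | refl , r≡s = refl , r≡s
 integerTokens-prefixFree (+ m) -[1+ n ] r s eq =
   ⊥-elim (no-minus (digits m) r _ (trans (sym (Listₚ.++-assoc (binary m) [ endᵗ ] r)) eq))
 integerTokens-prefixFree -[1+ m ] (+ n) r s eq =
   ⊥-elim (no-minus (digits n) s _ (trans (sym (Listₚ.++-assoc (binary n) [ endᵗ ] s)) (sym eq)))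

 scalarTokens-prefixFree : PrefixFree scalarTokens
 scalarTokens-prefixFree (a , b) (c , d) r s eq
   with integerTokens-prefixFree a c _ _ (trans (sym (Listₚ.++-assoc (integerTokens a) _ r)) (trans eq (Listₚ.++-assoc (integerTokens c) _ s)))
 ... | refl , eq′ with integerTokens-prefixFree b d r s eq′
 ...   | refl , r≡s = refl , r≡s

 private
   atom-prefixFree : ∀ {n} (as bs : Vec ℤ[α] n) a b r s →
     (concatMap scalarTokens (Vec.toList as) ++ scalarTokens a) ++ r ≡ (concatMap scalarTokens (Vec.toList bs) ++ scalarTokens b) ++ s →
     as ≡ bs × a ≡ b × r ≡ s
   atom-prefixFree []       []       a b r s eq with scalarTokens-prefixFree a b r s eq
   ... | a≡b , r≡s = refl , a≡b , r≡s
   atom-prefixFree (x ∷ as) (y ∷ bs) a b r s eq with scalarTokens-prefixFree x y _ _ (trans (sym (reassoc x as a r)) (trans eq (reassoc y bs b s)))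
     where
     reassoc : ∀ {n} x (as : Vec ℤ[α] n) a r →
       ((scalarTokens x ++ concatMap scalarTokens (Vec.toList as)) ++ scalarTokens a) ++ r
       ≡ scalarTokens x ++ ((concatMap scalarTokens (Vec.toList as) ++ scalarTokens a) ++ r)
     reassoc x as a r = trans (cong (_++ r) (Listₚ.++-assoc (scalarTokens x) _ (scalarTokens a))) (Listₚ.++-assoc (scalarTokens x) _ r)
   ... | refl , eq′ with atom-prefixFree as bs a b r s eq′
   ...   | refl , a≡b , r≡s = refl , a≡b , r≡s

 formulaTokens-prefixFree : ∀ {n} → PrefixFree (formulaTokens {n})
 formulaTokens-prefixFree (a ≤ᶠ b) (c ≤ᶠ d) r s eq with atom-prefixFree a c b d r s (Listₚ.∷-injectiveʳ eq)
 ... | refl , refl , r≡s = refl , r≡s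
 formulaTokens-prefixFree (¬ᶠ φ) (¬ᶠ ψ) r s eq with formulaTokens-prefixFree φ ψ r s (Listₚ.∷-injectiveʳ eq)
 ... | refl , r≡s = refl , r≡s
 formulaTokens-prefixFree (φ ∧ᶠ φ′) (ψ ∧ᶠ ψ′) r s eq
   with formulaTokens-prefixFree φ ψ _ _ (trans (sym (Listₚ.++-assoc (formulaTokens φ) _ r)) (trans (Listₚ.∷-injectiveʳ eq) (Listₚ.++-assoc (formulaTokens ψ) _ s)))
 ... | refl , eq′ with formulaTokens-prefixFree φ′ ψ′ r s eq′
 ...   | refl , r≡s = refl , r≡s
 formulaTokens-prefixFree (φ ∨ᶠ φ′) (ψ ∨ᶠ ψ′) r s eq
   with formulaTokens-prefixFree φ ψ _ _ (trans (sym (Listₚ.++-assoc (formulaTokens φ) _ r)) (trans (Listₚ.∷-injectiveʳ eq) (Listₚ.++-assoc (formulaTokens ψ) _ s)))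
 ... | refl , eq′ with formulaTokens-prefixFree φ′ ψ′ r s eq′
 ...   | refl , r≡s = refl , r≡s
 formulaTokens-prefixFree (_ ≤ᶠ _) (¬ᶠ _)   _ _ ()
 formulaTokens-prefixFree (_ ≤ᶠ _) (_ ∧ᶠ _) _ _ ()
 formulaTokens-prefixFree (_ ≤ᶠ _) (_ ∨ᶠ _) _ _ ()
 formulaTokens-prefixFree (¬ᶠ _)   (_ ≤ᶠ _) _ _ ()
 formulaTokens-prefixFree (¬ᶠ _)   (_ ∧ᶠ _) _ _ ()
 formulaTokens-prefixFree (¬ᶠ _)   (_ ∨ᶠ _) _ _ ()
 formulaTokens-prefixFree (_ ∧ᶠ _) (_ ≤ᶠ _) _ _ ()
 formulaTokens-prefixFree (_ ∧ᶠ _) (¬ᶠ _)   _ _ ()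
 formulaTokens-prefixFree (_ ∧ᶠ _) (_ ∨ᶠ _) _ _ ()
 formulaTokens-prefixFree (_ ∨ᶠ _) (_ ≤ᶠ _) _ _ ()
 formulaTokens-prefixFree (_ ∨ᶠ _) (¬ᶠ _)   _ _ ()
 formulaTokens-prefixFree (_ ∨ᶠ _) (_ ∧ᶠ _) _ _ ()

 encode-injective : ∀ {Q ns} (φ ψ : Sentence Q ns) → encode φ ≡ encode ψ → φ ≡ ψ
 encode-injective {Q} {ns} φ ψ eq = cong sentence (proj₁ (formulaTokens-prefixFree (matrix φ) (matrix ψ) [] [] (cong (_++ [])
   (Listₚ.++-cancelˡ (prefixTokens Q ns) _ _ (concatMap-code-injective _ _ eq)))))

 -- Formulas in which some integers are left open; a hole is written together with its sign.
 module Templates (Hole : Set) where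

   data Coefficient : Set where
     constant    : ℤ → Coefficient
     plus minus  : Hole → Coefficient

   infix  7 _≤ᵗ_
   infixr 6 _∧ᵗ_
   infixr 5 _∨ᵗ_

   data Template (n : ℕ) : Set where
     _≤ᵗ_      : Vec (Coefficient × Coefficient) n → Coefficient × Coefficient → Template n
     ¬ᵗ_       : Template n → Template n
     _∧ᵗ_ _∨ᵗ_ : Template n → Template n → Template n

   fill : (Hole → ℕ) → Coefficient → ℤ
   fill ρ (constant i) = i
   fill ρ (plus h)     = + ρ h
   fill ρ (minus h)    = ℤ.- (+ ρ h)

   fill₂ : (Hole → ℕ) → Coefficient × Coefficient → ℤ[α]
   fill₂ ρ (c , d) = fill ρ c , fill ρ d

   instantiate : (Hole → ℕ) → ∀ {n} → Template n → Formula n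
   instantiate ρ (a ≤ᵗ b) = Vec.map (fill₂ ρ) a ≤ᶠ fill₂ ρ b
   instantiate ρ (¬ᵗ φ)   = ¬ᶠ instantiate ρ φ
   instantiate ρ (φ ∧ᵗ ψ) = instantiate ρ φ ∧ᶠ instantiate ρ ψ
   instantiate ρ (φ ∨ᵗ ψ) = instantiate ρ φ ∨ᶠ instantiate ρ ψ

   data Piece : Set where
     fixed : Token → Piece
     digitsOf : Hole → Piece

   flatten : (Hole → ℕ) → List Piece → List Token
   flatten ρ []                = []
   flatten ρ (fixed t ∷ ps)    = t ∷ flatten ρ ps
   flatten ρ (digitsOf h ∷ ps) = binary (ρ h) ++ flatten ρ ps

   coefficientPieces : Coefficient → List Piece
   coefficientPieces (constant i) = map fixed (integerTokens i)
   coefficientPieces (plus h)     = digitsOf h ∷ fixed endᵗ ∷ []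
   coefficientPieces (minus h)    = fixed minusᵗ ∷ digitsOf h ∷ fixed endᵗ ∷ []

   coefficientPieces₂ : Coefficient × Coefficient → List Piece
   coefficientPieces₂ (c , d) = coefficientPieces c ++ coefficientPieces d

   pieces : ∀ {n} → Template n → List Piece
   pieces (a ≤ᵗ b) = fixed leqᵗ ∷ concatMap coefficientPieces₂ (Vec.toList a) ++ coefficientPieces₂ b
   pieces (¬ᵗ φ)   = fixed notᵗ ∷ pieces φ
   pieces (φ ∧ᵗ ψ) = fixed andᵗ ∷ pieces φ ++ pieces ψ
   pieces (φ ∨ᵗ ψ) = fixed orᵗ ∷ pieces φ ++ pieces ψ

   sentencePieces : Quantifier → ∀ ns → Template (sum ns) → List Piece
   sentencePieces Q ns φ = map fixed (prefixTokens Q ns) ++ pieces φ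

   module _ (ρ : Hole → ℕ) (ρ≢0 : ∀ h → ρ h ≢ 0) where

     flatten-++ : ∀ ps qs → flatten ρ (ps ++ qs) ≡ flatten ρ ps ++ flatten ρ qs
     flatten-++ []                qs = refl
     flatten-++ (fixed t ∷ ps)    qs = cong (t ∷_) (flatten-++ ps qs)
     flatten-++ (digitsOf h ∷ ps) qs = trans (cong (binary (ρ h) ++_) (flatten-++ ps qs)) (sym (Listₚ.++-assoc (binary (ρ h)) _ _))

     flatten-fixed : ∀ ts → flatten ρ (map fixed ts) ≡ ts
     flatten-fixed []       = refl
     flatten-fixed (t ∷ ts) = cong (t ∷_) (flatten-fixed ts)

     flatten-coefficient : ∀ c → flatten ρ (coefficientPieces c) ≡ integerTokens (fill ρ c)
     flatten-coefficient (constant i) = flatten-fixed (integerTokens i)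
     flatten-coefficient (plus h)     = refl
     flatten-coefficient (minus h) with ρ h | ρ≢0 h
     ... | zero  | ≢0 = ⊥-elim (≢0 refl)
     ... | suc n | _  = refl

     flatten-coefficient₂ : ∀ c → flatten ρ (coefficientPieces₂ c) ≡ scalarTokens (fill₂ ρ c)
     flatten-coefficient₂ (c , d) = trans (flatten-++ (coefficientPieces c) (coefficientPieces d))
       (cong₂ _++_ (flatten-coefficient c) (flatten-coefficient d))

     flatten-vector : ∀ {n} (a : Vec (Coefficient × Coefficient) n) →
       flatten ρ (concatMap coefficientPieces₂ (Vec.toList a)) ≡ concatMap scalarTokens (Vec.toList (Vec.map (fill₂ ρ) a))
     flatten-vector []      = refl
     flatten-vector (c ∷ a) = trans (flatten-++ (coefficientPieces₂ c) _) (cong₂ _++_ (flatten-coefficient₂ c) (flatten-vector a))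

     flatten-pieces : ∀ {n} (φ : Template n) → flatten ρ (pieces φ) ≡ formulaTokens (instantiate ρ φ)
     flatten-pieces (a ≤ᵗ b) = cong (leqᵗ ∷_) (trans (flatten-++ (concatMap coefficientPieces₂ (Vec.toList a)) _)
       (cong₂ _++_ (flatten-vector a) (flatten-coefficient₂ b)))
     flatten-pieces (¬ᵗ φ)   = cong (notᵗ ∷_) (flatten-pieces φ)
     flatten-pieces (φ ∧ᵗ ψ) = cong (andᵗ ∷_) (trans (flatten-++ (pieces φ) (pieces ψ)) (cong₂ _++_ (flatten-pieces φ) (flatten-pieces ψ)))
     flatten-pieces (φ ∨ᵗ ψ) = cong (orᵗ ∷_) (trans (flatten-++ (pieces φ) (pieces ψ)) (cong₂ _++_ (flatten-pieces φ) (flatten-pieces ψ)))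

     encode-instantiate : ∀ {Q ns} (φ : Template (sum ns)) →
       concatMap code (flatten ρ (sentencePieces Q ns φ)) ≡ encode {Q} {ns} (sentence (instantiate ρ φ))
     encode-instantiate {Q} {ns} φ = cong (concatMap code) (trans (flatten-++ (map fixed (prefixTokens Q ns)) (pieces φ))
       (cong₂ _++_ (flatten-fixed (prefixTokens Q ns)) (flatten-pieces φ)))

module Sentences where

 open import Defs using (ℝ; seq; _+ᴿ_; _*ᴿ_; fromℤ; _≃ᴿ_; _≤ᴿ_; ℤ[α]; ⟦_⟧; linear; Holds; #inequalities; Sentence; sentence; IsTrue; ∃′)
 open Reals
 open Pairs
 open Digits
 open Encoding
 open import Data.Fin using (zero; suc; #_)
 open import Data.Integer using (+_; _+_; _*_; -_; _-_)
 open import Data.Integer.Tactic.RingSolver using (solve-∀)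
 open import Data.Vec using (_[_]≔_; replicate)

 -- ε^s = U s + V s θ for the four shifts s, and C₁ + C₂ θ is the number whose digits are prescribed.
 data Hole : Set where
   U V   : Fin 4 → Hole
   C₁ C₂ : Hole

 open Templates Hole public

 private
   n = 21

 -- An element variable is the pair of indices of its coordinates.
 Variable : Set
 Variable = Fin n × Fin n

 X u L L′ w v : Variable
 X  = # 0 , # 1
 u  = # 6 , # 7
 L  = # 10 , # 11
 L′ = # 12 , # 13
 w  = # 14 , # 15
 v  = # 17 , # 18

 t z : Fin n
 t = # 8
 z = # 16

 ElementForm IntegerForm : Set
 ElementForm = List (ℤ × Variable)
 IntegerForm = List (Coefficient × Fin n)

 opposite : Coefficient → Coefficient
 opposite (constant i) = constant (- i)
 opposite (plus h)     = minus h
 opposite (minus h)    = plus h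

 negative : IntegerForm → IntegerForm
 negative = List.map λ (k , i) → opposite k , i

 falseᵗ : ∀ {n} → Template n
 falseᵗ {n} = ¬ᵗ (replicate n (constant 0ℤ , constant 0ℤ) ≤ᵗ (constant 0ℤ , constant 0ℤ))

 ⋁ : ∀ {n} m → (Fin m → Template n) → Template n
 ⋁ zero    φ = falseᵗ
 ⋁ (suc m) φ = φ zero ∨ᵗ ⋁ m (λ i → φ (suc i))

 integerVector : IntegerForm → Vec (Coefficient × Coefficient) n
 integerVector []            = replicate n (constant 0ℤ , constant 0ℤ)
 integerVector ((k , i) ∷ f) = integerVector f [ i ]≔ (k , constant 0ℤ)

 infix 7 _≤ⁱ_ _≐_
 _≤ⁱ_ _≐_ : IntegerForm → Coefficient → Template n
 f ≤ⁱ c = integerVector f ≤ᵗ (c , constant 0ℤ)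
 f ≐ c  = f ≤ⁱ c ∧ᵗ negative f ≤ⁱ opposite c

 k₊ : ℤ → Coefficient
 k₊ = constant

 same : Variable → Variable → Template n
 same (i , j) (k , l) = ((k₊ 1ℤ , i) ∷ (k₊ -1ℤ , k) ∷ []) ≐ k₊ 0ℤ ∧ᵗ ((k₊ 1ℤ , j) ∷ (k₊ -1ℤ , l) ∷ []) ≐ k₊ 0ℤ

 -- The real number θ = e₀ + e₁ α turns x + y θ into x + y e₀ + y e₁ α.
 module Building (a : ℕ) (e₀ e₁ : ℤ) (radix : ℕ) where
   open Unit a using (D)

   realize : ℤ[α] → Coefficient × Coefficient
   realize (x , y) = constant (x + y * e₀) , constant (y * e₁)

   elementVector : Bool → ElementForm → Vec ℤ[α] n
   elementVector σ []                  = replicate n 0ᴱ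
   elementVector σ ((k , i , j) ∷ f) =
     Vec.zipWith _⊕_ (replicate n 0ᴱ [ i ]≔ (- k , 0ℤ))
       (Vec.zipWith _⊕_ (replicate n 0ᴱ [ j ]≔ (0ℤ , (if σ then k else - k))) (elementVector σ f))

   -- The atom saying that a linear combination of elements plus a constant, conjugated if σ, is nonnegative.
   positive : Bool → ElementForm → ℤ[α] → Template n
   positive σ f c = Vec.map realize (elementVector σ f) ≤ᵗ realize c

   reading : ℕ → Variable → Variable → Variable → Template n
   reading c X u L =
     positive false ((1ℤ , L) ∷ []) 0ᴱ ∧ᵗ
     positive false ((1ℤ , u) ∷ (- (+ 2) , L) ∷ []) 0ᴱ ∧ᵗ
     positive true  ((1ℤ , X) ∷ (-1ℤ , L) ∷ (- (+ c) , u) ∷ []) 0ᴱ ∧ᵗ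
     positive true  ((1ℤ , u) ∷ (- (+ 2) , X) ∷ (+ 2 , L) ∷ (+ 2 * + c , u) ∷ []) 0ᴱ

   windowFor : (ℕ → ℕ → Bool) → Variable → Variable → Variable → Variable → Fin radix → Fin radix → Template n
   windowFor R X u Y y c d = if R (toℕ c) (toℕ d) then reading (toℕ c) X u L ∧ᵗ reading (toℕ d) Y y L′ else falseᵗ

   window : (ℕ → ℕ → Bool) → Variable → Variable → Variable → Variable → Template n
   window R X u Y y = ⋁ radix λ c → ⋁ radix λ d → windowFor R X u Y y c d

   excuse : Template n
   excuse =
     ¬ᵗ positive false ((1ℤ , u) ∷ []) (-1ℤ , 0ℤ) ∨ᵗ
     positive true ((-1ℤ , u) ∷ []) 0ᴱ ∨ᵗ
     (¬ᵗ positive false ((-1ℤ , v) ∷ []) 0ᴱ ∧ᵗ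
      positive false ((1ℤ , u) ∷ (-1ℤ , v) ∷ []) 0ᴱ ∧ᵗ
      ¬ᵗ positive true ((-1ℤ , v) ∷ []) 0ᴱ ∧ᵗ
      positive true ((1ℤ , u) ∷ (-1ℤ , v) ∷ []) 0ᴱ ∧ᵗ
      ¬ᵗ same u v)

   module _ (R₀ : ℕ → ℕ → Bool) (R : Fin 4 → ℕ → ℕ → Bool) where

     check : Fin 5 → Template n
     check zero    =
       ((k₊ 1ℤ , proj₁ w) ∷ []) ≐ plus C₁ ∧ᵗ
       ((k₊ 1ℤ , proj₂ w) ∷ []) ≐ plus C₂ ∧ᵗ
       window R₀ X u w u
     check (suc i) =
       ((k₊ 1ℤ , z) ∷ (k₊ (- D) , proj₂ u) ∷ []) ≐ k₊ 0ℤ ∧ᵗ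
       ((k₊ -1ℤ , proj₁ w) ∷ (plus (U i) , proj₁ u) ∷ (plus (V i) , z) ∷ []) ≐ k₊ 0ℤ ∧ᵗ
       ((k₊ -1ℤ , proj₂ w) ∷ (plus (V i) , proj₁ u) ∷ (plus (U i) , proj₂ u) ∷ []) ≐ k₊ 0ℤ ∧ᵗ
       window (R i) X u X w

     selected : Fin 5 → Template n
     selected i = ((k₊ 1ℤ , t) ∷ []) ≐ k₊ (+ toℕ i) ∧ᵗ check i

     whole : Template n
     whole = excuse ∨ᵗ ¬ᵗ (((k₊ -1ℤ , t) ∷ []) ≤ⁱ k₊ 0ℤ) ∨ᵗ ¬ᵗ (((k₊ 1ℤ , t) ∷ []) ≤ⁱ k₊ (+ 4)) ∨ᵗ
       ⋁ 5 selected

     module _ (ρ : Hole → ℕ) where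
       private
         count : ∀ {n} → Template n → ℕ
         count φ = #inequalities (instantiate ρ φ)

         count-⋁ : ∀ {n} m (φ : Fin m → Template n) k → (∀ i → count (φ i) ℕ.≤ k) → count (⋁ m φ) ℕ.≤ m ℕ.* k ℕ.+ 1
         count-⋁ zero    φ k φ≤ = ℕₚ.≤-refl
         count-⋁ (suc m) φ k φ≤ = ℕₚ.≤-trans (ℕₚ.+-mono-≤ (φ≤ zero) (count-⋁ m (λ i → φ (suc i)) k (λ i → φ≤ (suc i))))
           (ℕₚ.≤-reflexive (sym (ℕₚ.+-assoc k (m ℕ.* k) 1)))

         windowSize : ℕ
         windowSize = radix ℕ.* (radix ℕ.* 8 ℕ.+ 1) ℕ.+ 1

         count-window : ∀ R X u Y y → count (window R X u Y y) ℕ.≤ windowSize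
         count-window R X u Y y = count-⋁ radix (λ c → ⋁ radix (windowFor R X u Y y c)) (radix ℕ.* 8 ℕ.+ 1)
           λ c → count-⋁ radix (windowFor R X u Y y c) 8 (λ d → pick (R (toℕ c) (toℕ d)) c d)
           where
           pick : ∀ b c d → count (if b then reading (toℕ c) X u L ∧ᵗ reading (toℕ d) Y y L′ else falseᵗ) ℕ.≤ 8
           pick false c d = ℕₚ.≤ᵇ⇒≤ 1 8 _
           pick true  c d = ℕₚ.≤-refl

         count-check : ∀ i → count (check i) ℕ.≤ 6 ℕ.+ windowSize
         count-check zero    = ℕₚ.+-mono-≤ (ℕₚ.≤ᵇ⇒≤ 4 6 _) (count-window R₀ X u w u)
         count-check (suc i) = ℕₚ.+-monoʳ-≤ 6 (count-window (R i) X u X w)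

       count-whole : #inequalities (instantiate ρ whole) ℕ.≤ 12 ℕ.+ (5 ℕ.* (8 ℕ.+ (radix ℕ.* (radix ℕ.* 8 ℕ.+ 1) ℕ.+ 1)) ℕ.+ 1)
       count-whole = ℕₚ.+-monoʳ-≤ 12 (count-⋁ 5 selected (8 ℕ.+ windowSize) λ i → ℕₚ.+-monoʳ-≤ 2 (count-check i))

 module Semantics (α : ℝ) (e₀ e₁ : ℤ) (a : ℕ) (500≤a : 500 ℕ.≤ a) (0≤θ : NonNeg (⟦ e₀ , e₁ ⟧ α))
                  (θ²≃D : ⟦ e₀ , e₁ ⟧ α *ᴿ ⟦ e₀ , e₁ ⟧ α ≃ᴿ fromℤ (Unit.D a)) (ρ : Hole → ℕ) where
   open NonNeg-lemmas

   θ : ℝ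
   θ = ⟦ e₀ , e₁ ⟧ α

   open Reading a 500≤a θ 0≤θ θ²≃D

   τ : ℤ[α] → ℤ[α]
   τ (x , y) = x + y * e₀ , y * e₁

   dot : ∀ {n} → Vec ℤ[α] n → Vec ℤ n → ℤ[α]
   dot []       []       = 0ᴱ
   dot (c ∷ cs) (x ∷ xs) = x · c ⊕ dot cs xs

   τ-seq : ∀ c n → seq (⟦ τ c ⟧ α) n ≡ seq (⟦ c ⟧ θ) n
   τ-seq (x , y) n = trans (cong₂ (λ p q → p ℚ.+ q ℚ.* seq α n) (trans (ι-+ x (y * e₀)) (cong (ι x ℚ.+_) (ι-* y e₀))) (ι-* y e₁))
     (rearrange (ι x) (ι y) (ι e₀) (ι e₁) (seq α n))
     where
     rearrange : ∀ x y e f t → (x ℚ.+ y ℚ.* e) ℚ.+ (y ℚ.* f) ℚ.* t ≡ x ℚ.+ y ℚ.* (e ℚ.+ f ℚ.* t)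
     rearrange = Solver.solve-∀ ℚ-ring

   linear-seq : ∀ {k} (cs : Vec ℤ[α] k) xs n → seq (linear α (Vec.map τ cs) xs) n ≡ seq (⟦ dot cs xs ⟧ θ) n
   linear-seq []             []       n = sym (trans (ℚₚ.+-identityˡ _) (ℚₚ.*-zeroˡ (seq θ n)))
   linear-seq (c@(p , q) ∷ cs) (x ∷ xs) n = trans
     (cong₂ (λ s t → s ℚ.* ι x ℚ.+ t) (τ-seq c n) (linear-seq cs xs n))
     (trans (rearrange (ι p) (ι q) (ι x) (ι r) (ι s) (seq θ n))
       (cong₂ (λ s t → s ℚ.+ t ℚ.* seq θ n) (fold p r) (fold q s)))
     where
     r = proj₁ (dot cs xs)
     s = proj₂ (dot cs xs)
     rearrange : ∀ p q x r s t → (p ℚ.+ q ℚ.* t) ℚ.* x ℚ.+ (r ℚ.+ s ℚ.* t) ≡ (x ℚ.* p ℚ.+ r) ℚ.+ (x ℚ.* q ℚ.+ s) ℚ.* t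
     rearrange = Solver.solve-∀ ℚ-ring
     fold : ∀ p r → ι x ℚ.* ι p ℚ.+ ι r ≡ ι (x * p + r)
     fold p r = sym (trans (ι-+ (x * p) r) (cong (ℚ._+ ι r) (ι-* x p)))

   private
     difference-seq : ∀ {k} (cs : Vec ℤ[α] k) b xs n →
       seq (⟦ τ b ⟧ α +ᴿ -ᴿ linear α (Vec.map τ cs) xs) n ≡ seq (⟦ b ⊖ dot cs xs ⟧ θ) n
     difference-seq cs b@(b₁ , b₂) xs n = trans (cong₂ ℚ._+_ (τ-seq b n)
         (trans (neg-seq (linear α (Vec.map τ cs) xs) n) (cong ℚ.-_ (linear-seq cs xs n))))
       (trans (rearrange (ι b₁) (ι b₂) (ι p) (ι q) (seq θ n))
         (cong₂ (λ s t → s ℚ.+ t ℚ.* seq θ n) (fold b₁ p) (fold b₂ q)))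
       where
       p = proj₁ (dot cs xs)
       q = proj₂ (dot cs xs)
       rearrange : ∀ b c p q t → (b ℚ.+ c ℚ.* t) ℚ.+ ℚ.- (p ℚ.+ q ℚ.* t) ≡ (b ℚ.+ ℚ.- p) ℚ.+ (c ℚ.+ ℚ.- q) ℚ.* t
       rearrange = Solver.solve-∀ ℚ-ring
       fold : ∀ b p → ι b ℚ.+ ℚ.- ι p ≡ ι (b + -1ℤ * p)
       fold b p = sym (trans (ι-+ b (-1ℤ * p)) (cong (ι b ℚ.+_) (trans (cong ι (ℤₚ.-1*i≡-i p)) (ι-neg p))))

   module _ {k} (cs : Vec ℤ[α] k) (b : ℤ[α]) (xs : Vec ℤ k) where

     atom⇒P : linear α (Vec.map τ cs) xs ≤ᴿ ⟦ τ b ⟧ α → P (b ⊖ dot cs xs)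
     atom⇒P h = nonneg (≗-nn (⟦ τ b ⟧ α +ᴿ -ᴿ linear α (Vec.map τ cs) xs) (⟦ b ⊖ dot cs xs ⟧ θ)
       (difference-seq cs b xs) (≤⇒nn (linear α (Vec.map τ cs) xs) (⟦ τ b ⟧ α) h))

     P⇒atom : P (b ⊖ dot cs xs) → linear α (Vec.map τ cs) xs ≤ᴿ ⟦ τ b ⟧ α
     P⇒atom (nonneg h) = nn⇒≤ (linear α (Vec.map τ cs) xs) (⟦ τ b ⟧ α)
       (≗-nn (⟦ b ⊖ dot cs xs ⟧ θ) (⟦ τ b ⟧ α +ᴿ -ᴿ linear α (Vec.map τ cs) xs) (λ n → sym (difference-seq cs b xs n)) h)

   dot-0 : ∀ {k} (xs : Vec ℤ k) → dot (replicate k 0ᴱ) xs ≡ 0ᴱ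
   dot-0 []       = refl
   dot-0 (x ∷ xs) = trans (cong (x · 0ᴱ ⊕_) (dot-0 xs)) (pair (lemma x) (lemma x))
     where
     lemma : ∀ x → x * 0ℤ + 0ℤ ≡ 0ℤ
     lemma = solve-∀

   dot-⊕ : ∀ {k} (cs ds : Vec ℤ[α] k) xs → dot (Vec.zipWith _⊕_ cs ds) xs ≡ dot cs xs ⊕ dot ds xs
   dot-⊕ []             []             []       = refl
   dot-⊕ ((p , q) ∷ cs) ((r , s) ∷ ds) (x ∷ xs) = trans (cong (x · (p + r , q + s) ⊕_) (dot-⊕ cs ds xs))
     (pair (lemma x p r _ _) (lemma x q s _ _))
     where
     lemma : ∀ x p r c d → x * (p + r) + (c + d) ≡ (x * p + c) + (x * r + d)
     lemma = solve-∀

   dot-≔ : ∀ {k} (cs : Vec ℤ[α] k) i c xs → lookup cs i ≡ 0ᴱ → dot (cs [ i ]≔ c) xs ≡ lookup xs i · c ⊕ dot cs xs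
   dot-≔ (_ ∷ cs) zero    (p , q) (x ∷ xs) refl = pair (lemma x p _) (lemma x q _)
     where
     lemma : ∀ x p c → x * p + c ≡ x * p + (x * 0ℤ + c)
     lemma = solve-∀
   dot-≔ ((r , s) ∷ cs) (suc i) c@(p , q) (x ∷ xs) eq = trans (cong (x · (r , s) ⊕_) (dot-≔ cs i c xs eq))
     (pair (lemma x r (lookup xs i) p _) (lemma x s (lookup xs i) q _))
     where
     lemma : ∀ x r y p c → x * r + (y * p + c) ≡ y * p + (x * r + c)
     lemma = solve-∀

   module Atoms (radix : ℕ) where
     open Building a e₀ e₁ radix

     Sat : Template 21 → Vec ℤ 21 → Set
     Sat φ xs = Holds α (instantiate ρ φ) xs

     at : Variable → Vec ℤ 21 → ℤ[α]
     at (i , j) xs = lookup xs i , lookup xs j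

     value : ElementForm → Vec ℤ 21 → ℤ[α]
     value []            xs = 0ᴱ
     value ((k , X) ∷ f) xs = k · at X xs ⊕ value f xs

     conjugate : Bool → ℤ[α] → ℤ[α]
     conjugate false x = x
     conjugate true  x = conj x

     dot-element : ∀ σ f xs → dot (elementVector σ f) xs ≡ ⊝ conjugate σ (value f xs)
     dot-element false []                xs = dot-0 xs
     dot-element true  []                xs = dot-0 xs
     dot-element σ     ((k , i , j) ∷ f) xs = trans (dot-⊕ (replicate 21 0ᴱ [ i ]≔ (- k , 0ℤ)) _ xs)
       (trans (cong₂ _⊕_ (single i (- k , 0ℤ)) (trans (dot-⊕ (replicate 21 0ᴱ [ j ]≔ (0ℤ , (if σ then k else - k))) _ xs)
         (cong₂ _⊕_ (single j (0ℤ , (if σ then k else - k))) (dot-element σ f xs))))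
         (collect σ (lookup xs i) (lookup xs j) (value f xs)))
       where
       single : ∀ i c → dot (replicate 21 0ᴱ [ i ]≔ c) xs ≡ lookup xs i · c
       single i c@(p , q) = trans (dot-≔ (replicate 21 0ᴱ) i c xs (Vecₚ.lookup-replicate i 0ᴱ))
         (trans (cong (lookup xs i · c ⊕_) (dot-0 xs)) (pair (ℤₚ.+-identityʳ _) (ℤₚ.+-identityʳ _)))
       lemma : ∀ k x y p → x * - k + (y * 0ℤ + - p) ≡ - (k * x + p)
       lemma = solve-∀
       collect : ∀ σ x y z → x · (- k , 0ℤ) ⊕ (y · (0ℤ , (if σ then k else - k)) ⊕ ⊝ conjugate σ z) ≡ ⊝ conjugate σ (k · (x , y) ⊕ z)
       collect false x y (p , q) = pair (lemma k x y p) (lemma′ k x y q)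
         where
         lemma′ : ∀ k x y q → x * 0ℤ + (y * - k + - q) ≡ - (k * y + q)
         lemma′ = solve-∀
       collect true x y (p , q) = pair (lemma k x y p) (lemma′ k x y q)
         where
         lemma′ : ∀ k x y q → x * 0ℤ + (y * k + - - q) ≡ - - (k * y + q)
         lemma′ = solve-∀

     ⊖⊝ : ∀ c d → c ⊖ ⊝ d ≡ c ⊕ d
     ⊖⊝ (p , q) (r , s) = pair (lemma p r) (lemma q s)
       where
       lemma : ∀ p r → p + -1ℤ * - r ≡ p + r
       lemma = solve-∀

     module _ (σ : Bool) (f : ElementForm) (c : ℤ[α]) (xs : Vec ℤ 21) where
       private
         vector-eq : Vec.map (fill₂ ρ) (Vec.map realize (elementVector σ f)) ≡ Vec.map τ (elementVector σ f)
         vector-eq = sym (Vecₚ.map-∘ (fill₂ ρ) realize (elementVector σ f))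
         value-eq : c ⊖ dot (elementVector σ f) xs ≡ c ⊕ conjugate σ (value f xs)
         value-eq = trans (cong (c ⊖_) (dot-element σ f xs)) (⊖⊝ c _)

       positive⇒ : Sat (positive σ f c) xs → P (c ⊕ conjugate σ (value f xs))
       positive⇒ h = subst P value-eq (atom⇒P (elementVector σ f) c xs (subst (λ cs → linear α cs xs ≤ᴿ ⟦ τ c ⟧ α) vector-eq h))

       ⇒positive : P (c ⊕ conjugate σ (value f xs)) → Sat (positive σ f c) xs
       ⇒positive h = subst (λ cs → linear α cs xs ≤ᴿ ⟦ τ c ⟧ α) (sym vector-eq) (P⇒atom (elementVector σ f) c xs (subst P (sym value-eq) h))

     integers : IntegerForm → Vec ℤ[α] 21
     integers []            = replicate 21 0ᴱ
     integers ((k , i) ∷ f) = integers f [ i ]≔ (fill ρ k , 0ℤ)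

     total : IntegerForm → Vec ℤ 21 → ℤ
     total []            xs = 0ℤ
     total ((k , i) ∷ f) xs = fill ρ k * lookup xs i + total f xs

     data Distinct : IntegerForm → Set where
       []  : Distinct []
       _∷_ : ∀ {k i f} → lookup (integers f) i ≡ 0ᴱ → Distinct f → Distinct ((k , i) ∷ f)

     private
       τ-ℤ : ∀ k → τ (k , 0ℤ) ≡ (k , 0ℤ)
       τ-ℤ k = pair (lemma k e₀) (ℤₚ.*-zeroˡ e₁)
         where
         lemma : ∀ k e → k + 0ℤ * e ≡ k
         lemma = solve-∀

       integers-vector : ∀ f → Vec.map (fill₂ ρ) (integerVector f) ≡ Vec.map τ (integers f)
       integers-vector []            = trans (Vecₚ.map-replicate (fill₂ ρ) (constant 0ℤ , constant 0ℤ) 21) (trans (cong (replicate 21) (sym (τ-ℤ 0ℤ))) (sym (Vecₚ.map-replicate τ 0ᴱ 21)))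
       integers-vector ((k , i) ∷ f) = trans (Vecₚ.map-[]≔ (fill₂ ρ) (integerVector f) i)
         (trans (cong₂ (λ cs c → cs [ i ]≔ c) (integers-vector f) (sym (τ-ℤ (fill ρ k)))) (sym (Vecₚ.map-[]≔ τ (integers f) i)))

       dot-integers : ∀ {f} → Distinct f → ∀ xs → dot (integers f) xs ≡ (total f xs , 0ℤ)
       dot-integers []                            xs = dot-0 xs
       dot-integers (_∷_ {k} {i} {f} eq distinct) xs = trans (dot-≔ (integers f) i (fill ρ k , 0ℤ) xs eq)
         (trans (cong (lookup xs i · (fill ρ k , 0ℤ) ⊕_) (dot-integers distinct xs))
           (pair (cong (λ y → y + total f xs) (ℤₚ.*-comm (lookup xs i) (fill ρ k))) (trans (ℤₚ.+-identityʳ _) (ℤₚ.*-zeroʳ (lookup xs i)))))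

     module _ {f : IntegerForm} (distinct : Distinct f) (c : Coefficient) (xs : Vec ℤ 21) where
       private
         Atom : Vec ℤ[α] 21 → ℤ[α] → Set
         Atom cs b = linear α cs xs ≤ᴿ ⟦ b ⟧ α
         value-eq : (fill ρ c , 0ℤ) ⊖ dot (integers f) xs ≡ (fill ρ c - total f xs , 0ℤ)
         value-eq = trans (cong ((fill ρ c , 0ℤ) ⊖_) (dot-integers distinct xs))
           (pair (cong (λ y → fill ρ c + y) (ℤₚ.-1*i≡-i (total f xs))) refl)

       ≤ⁱ⇒ : Sat (f ≤ⁱ c) xs → total f xs ℤ.≤ fill ρ c
       ≤ⁱ⇒ h = ℤₚ.0≤i-j⇒j≤i (P-ℤ⁻¹ (subst P value-eq (atom⇒P (integers f) (fill ρ c , 0ℤ) xs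
         (subst₂ Atom (integers-vector f) (sym (τ-ℤ (fill ρ c))) h))))

       ⇒≤ⁱ : total f xs ℤ.≤ fill ρ c → Sat (f ≤ⁱ c) xs
       ⇒≤ⁱ h = subst₂ Atom (sym (integers-vector f)) (τ-ℤ (fill ρ c))
         (P⇒atom (integers f) (fill ρ c , 0ℤ) xs (subst P (sym value-eq) (P-ℤ (ℤₚ.i≤j⇒0≤j-i h))))

     private
       fill-opposite : ∀ k → fill ρ (opposite k) ≡ - fill ρ k
       fill-opposite (constant i) = refl
       fill-opposite (plus h)     = refl
       fill-opposite (minus h)    = sym (ℤₚ.neg-involutive (+ ρ h))

       total-negative : ∀ f xs → total (negative f) xs ≡ - total f xs
       total-negative []            xs = refl
       total-negative ((k , i) ∷ f) xs = trans (cong₂ (λ p q → p * lookup xs i + q) (fill-opposite k) (total-negative f xs))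
         (lemma (fill ρ k) (lookup xs i) (total f xs))
         where
         lemma : ∀ k x y → - k * x + - y ≡ - (k * x + y)
         lemma = solve-∀

       distinct-negative : ∀ {f} → Distinct f → Distinct (negative f)
       distinct-negative []                            = []
       distinct-negative (_∷_ {k} {i} {f} eq distinct) = unset f i eq ∷ distinct-negative distinct
         where
         unset : ∀ f i → lookup (integers f) i ≡ 0ᴱ → lookup (integers (negative f)) i ≡ 0ᴱ
         unset []            i eq = eq
         unset ((k , j) ∷ f) i eq with i Fin.≟ j
         ... | yes refl = trans (Vecₚ.lookup∘update i (integers (negative f)) _)
                 (pair (trans (fill-opposite k) (cong -_ (cong proj₁ (trans (sym (Vecₚ.lookup∘update i (integers f) (fill ρ k , 0ℤ))) eq)))) refl)
         ... | no i≢j  = trans (Vecₚ.lookup∘update′ i≢j (integers (negative f)) _)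
                 (unset f i (trans (sym (Vecₚ.lookup∘update′ i≢j (integers f) _)) eq))

     module _ {f : IntegerForm} (distinct : Distinct f) (c : Coefficient) (xs : Vec ℤ 21) where

       ≐⇒ : Sat (f ≐ c) xs → total f xs ≡ fill ρ c
       ≐⇒ (h , h′) = ℤₚ.≤-antisym (≤ⁱ⇒ distinct c xs h) (ℤₚ.neg-cancel-≤
         (subst₂ ℤ._≤_ (total-negative f xs) (fill-opposite c) (≤ⁱ⇒ (distinct-negative distinct) (opposite c) xs h′)))

       ⇒≐ : total f xs ≡ fill ρ c → Sat (f ≐ c) xs
       ⇒≐ eq = ⇒≤ⁱ distinct c xs (ℤₚ.≤-reflexive eq) , ⇒≤ⁱ (distinct-negative distinct) (opposite c) xs
         (ℤₚ.≤-reflexive (trans (total-negative f xs) (trans (cong -_ eq) (sym (fill-opposite c)))))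

     ¬falseᵗ : ∀ xs → ¬ Sat falseᵗ xs
     ¬falseᵗ xs h = h (⇒≤ⁱ [] (constant 0ℤ) xs ℤₚ.≤-refl)

     ⋁⇒ : ∀ m (φ : Fin m → Template 21) xs → Sat (⋁ m φ) xs → ∃ λ i → Sat (φ i) xs
     ⋁⇒ zero    φ xs h        = ⊥-elim (¬falseᵗ xs h)
     ⋁⇒ (suc m) φ xs (inj₁ h) = zero , h
     ⋁⇒ (suc m) φ xs (inj₂ h) = let i , h′ = ⋁⇒ m (λ i → φ (suc i)) xs h in suc i , h′

     ⇒⋁ : ∀ m (φ : Fin m → Template 21) xs i → Sat (φ i) xs → Sat (⋁ m φ) xs
     ⇒⋁ (suc m) φ xs zero    h = inj₁ h
     ⇒⋁ (suc m) φ xs (suc i) h = inj₂ (⇒⋁ m (λ i → φ (suc i)) xs i h)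

     module _ (c : ℕ) (X u L : Variable) (xs : Vec ℤ 21) where
       private
         low₁ : ∀ z → 0ᴱ ⊕ (1ℤ · z ⊕ 0ᴱ) ≡ z
         low₁ (x , y) = pair (lemma x) (lemma y)
           where
           lemma : ∀ x → 0ℤ + (1ℤ * x + 0ℤ) ≡ x
           lemma = solve-∀
         low₂ : ∀ z w → 0ᴱ ⊕ (1ℤ · z ⊕ (- (+ 2) · w ⊕ 0ᴱ)) ≡ z ⊕ - (+ 2) · w
         low₂ (x , y) (p , q) = pair (lemma x p) (lemma y q)
           where
           lemma : ∀ x p → 0ℤ + (1ℤ * x + (- (+ 2) * p + 0ℤ)) ≡ x + - (+ 2) * p
           lemma = solve-∀
         high₁ : ∀ X u L → 0ᴱ ⊕ conj (1ℤ · X ⊕ (-1ℤ · L ⊕ (- (+ c) · u ⊕ 0ᴱ))) ≡ conj (above c X u L)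
         high₁ (X , X′) (u , u′) (L , L′) = pair (lemma (+ c) X u L) (lemma′ (+ c) X′ u′ L′)
           where
           lemma : ∀ c X u L → 0ℤ + (1ℤ * X + (-1ℤ * L + (- c * u + 0ℤ))) ≡ (X + -1ℤ * L) + - c * u
           lemma = solve-∀
           lemma′ : ∀ c X u L → 0ℤ + - (1ℤ * X + (-1ℤ * L + (- c * u + 0ℤ))) ≡ - ((X + -1ℤ * L) + - c * u)
           lemma′ = solve-∀
         high₂ : ∀ X u L → 0ᴱ ⊕ conj (1ℤ · u ⊕ (- (+ 2) · X ⊕ (+ 2 · L ⊕ ((+ 2 * + c) · u ⊕ 0ᴱ)))) ≡ conj (u ⊕ - (+ 2) · above c X u L)
         high₂ (X , X′) (u , u′) (L , L′) = pair (lemma (+ c) X u L) (lemma′ (+ c) X′ u′ L′)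
           where
           lemma : ∀ c X u L → 0ℤ + (1ℤ * u + (- (+ 2) * X + (+ 2 * L + ((+ 2 * c) * u + 0ℤ)))) ≡ u + - (+ 2) * ((X + -1ℤ * L) + - c * u)
           lemma = solve-∀
           lemma′ : ∀ c X u L → 0ℤ + - (1ℤ * u + (- (+ 2) * X + (+ 2 * L + ((+ 2 * c) * u + 0ℤ)))) ≡ - (u + - (+ 2) * ((X + -1ℤ * L) + - c * u))
           lemma′ = solve-∀
         f₁ f₂ f₃ f₄ : ElementForm
         f₁ = (1ℤ , L) ∷ []
         f₂ = (1ℤ , u) ∷ (- (+ 2) , L) ∷ []
         f₃ = (1ℤ , X) ∷ (-1ℤ , L) ∷ (- (+ c) , u) ∷ []
         f₄ = (1ℤ , u) ∷ (- (+ 2) , X) ∷ (+ 2 , L) ∷ (+ 2 * + c , u) ∷ []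

       reading⇒ : Sat (reading c X u L) xs → Reads c (at X xs) (at u xs) (at L xs)
       reading⇒ (p , q , r , s) = reads
         (subst P (low₁ (at L xs)) (positive⇒ false f₁ 0ᴱ xs p))
         (subst P (low₂ (at u xs) (at L xs)) (positive⇒ false f₂ 0ᴱ xs q))
         (subst P (high₁ (at X xs) (at u xs) (at L xs)) (positive⇒ true f₃ 0ᴱ xs r))
         (subst P (high₂ (at X xs) (at u xs) (at L xs)) (positive⇒ true f₄ 0ᴱ xs s))

       ⇒reading : Reads c (at X xs) (at u xs) (at L xs) → Sat (reading c X u L) xs
       ⇒reading (reads p q r s) =
         ⇒positive false f₁ 0ᴱ xs (subst P (sym (low₁ (at L xs))) p) ,
         ⇒positive false f₂ 0ᴱ xs (subst P (sym (low₂ (at u xs) (at L xs))) q) ,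
         ⇒positive true f₃ 0ᴱ xs (subst P (sym (high₁ (at X xs) (at u xs) (at L xs))) r) ,
         ⇒positive true f₄ 0ᴱ xs (subst P (sym (high₂ (at X xs) (at u xs) (at L xs))) s)

     module _ (R : ℕ → ℕ → Bool) (X u Y y : Variable) (xs : Vec ℤ 21) where

       window⇒ : Sat (window R X u Y y) xs → ∃₂ λ c d → c ℕ.< radix × d ℕ.< radix × R c d ≡ true ×
                 Reads c (at X xs) (at u xs) (at L xs) × Reads d (at Y xs) (at y xs) (at L′ xs)
       window⇒ h = let c , h₁ = ⋁⇒ radix (λ c → ⋁ radix (windowFor R X u Y y c)) xs h
                       d , h₂ = ⋁⇒ radix (windowFor R X u Y y c) xs h₁
                   in toℕ c , toℕ d , Finₚ.toℕ<n c , Finₚ.toℕ<n d , unpack c d (R (toℕ c) (toℕ d)) refl h₂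
         where
         unpack : ∀ c d b → R (toℕ c) (toℕ d) ≡ b → Sat (if b then reading (toℕ c) X u L ∧ᵗ reading (toℕ d) Y y L′ else falseᵗ) xs →
                  R (toℕ c) (toℕ d) ≡ true × Reads (toℕ c) (at X xs) (at u xs) (at L xs) × Reads (toℕ d) (at Y xs) (at y xs) (at L′ xs)
         unpack c d true  eq (p , q) = eq , reading⇒ (toℕ c) X u L xs p , reading⇒ (toℕ d) Y y L′ xs q
         unpack c d false eq h       = ⊥-elim (¬falseᵗ xs h)

       ⇒window : ∀ {c d} → c ℕ.< radix → d ℕ.< radix → R c d ≡ true →
                 Reads c (at X xs) (at u xs) (at L xs) → Reads d (at Y xs) (at y xs) (at L′ xs) → Sat (window R X u Y y) xs
       ⇒window {c} {d} c< d< eq p q = ⇒⋁ radix (λ c → ⋁ radix (windowFor R X u Y y c)) xs i (⇒⋁ radix (windowFor R X u Y y i) xs j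
           (pack (R (toℕ i) (toℕ j)) (trans (cong₂ R (Finₚ.toℕ-fromℕ< c<) (Finₚ.toℕ-fromℕ< d<)) eq)
             (subst (λ c → Reads c (at X xs) (at u xs) (at L xs)) (sym (Finₚ.toℕ-fromℕ< c<)) p)
             (subst (λ d → Reads d (at Y xs) (at y xs) (at L′ xs)) (sym (Finₚ.toℕ-fromℕ< d<)) q)))
         where
         i = Fin.fromℕ< c<
         j = Fin.fromℕ< d<
         pack : ∀ b → b ≡ true → Reads (toℕ i) (at X xs) (at u xs) (at L xs) → Reads (toℕ j) (at Y xs) (at y xs) (at L′ xs) →
                Sat (if b then reading (toℕ i) X u L ∧ᵗ reading (toℕ j) Y y L′ else falseᵗ) xs
         pack true _ p q = ⇒reading (toℕ i) X u L xs p , ⇒reading (toℕ j) Y y L′ xs q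

     private
       above-1 : ∀ u → (-1ℤ , 0ℤ) ⊕ (1ℤ · u ⊕ 0ᴱ) ≡ u ⊖ 1ᴱ
       above-1 (x , y) = pair (lemma x) (lemma′ y)
         where
         lemma : ∀ x → -1ℤ + (1ℤ * x + 0ℤ) ≡ x + -1ℤ * 1ℤ
         lemma = solve-∀
         lemma′ : ∀ y → 0ℤ + (1ℤ * y + 0ℤ) ≡ y + -1ℤ * 0ℤ
         lemma′ = solve-∀
       negated : ∀ v → 0ᴱ ⊕ (-1ℤ · v ⊕ 0ᴱ) ≡ ⊝ v
       negated (x , y) = pair (lemma x) (lemma y)
         where
         lemma : ∀ x → 0ℤ + (-1ℤ * x + 0ℤ) ≡ - x
         lemma = solve-∀
       negated-conj : ∀ v → 0ᴱ ⊕ conj (-1ℤ · v ⊕ 0ᴱ) ≡ ⊝ conj v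
       negated-conj (x , y) = pair (lemma x) (lemma′ y)
         where
         lemma : ∀ x → 0ℤ + (-1ℤ * x + 0ℤ) ≡ - x
         lemma = solve-∀
         lemma′ : ∀ y → 0ℤ + - (-1ℤ * y + 0ℤ) ≡ - - y
         lemma′ = solve-∀
       subtracted : ∀ u v → 0ᴱ ⊕ (1ℤ · u ⊕ (-1ℤ · v ⊕ 0ᴱ)) ≡ u ⊖ v
       subtracted (x , y) (p , q) = pair (lemma x p) (lemma y q)
         where
         lemma : ∀ x p → 0ℤ + (1ℤ * x + (-1ℤ * p + 0ℤ)) ≡ x + -1ℤ * p
         lemma = solve-∀
       subtracted-conj : ∀ u v → 0ᴱ ⊕ conj (1ℤ · u ⊕ (-1ℤ · v ⊕ 0ᴱ)) ≡ conj u ⊖ conj v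
       subtracted-conj (x , y) (p , q) = pair (lemma x p) (lemma′ y q)
         where
         lemma : ∀ x p → 0ℤ + (1ℤ * x + (-1ℤ * p + 0ℤ)) ≡ x + -1ℤ * p
         lemma = solve-∀
         lemma′ : ∀ y q → 0ℤ + - (1ℤ * y + (-1ℤ * q + 0ℤ)) ≡ - y + -1ℤ * - q
         lemma′ = solve-∀
       equal : ∀ x y → 1ℤ * x + (-1ℤ * y + 0ℤ) ≡ x - y
       equal = solve-∀

     ¬excuse : ∀ i xs → at u xs ≡ pow i → ¬ Sat excuse xs
     ¬excuse i xs eq (inj₁ h) = h (⇒positive false ((1ℤ , u) ∷ []) (-1ℤ , 0ℤ) xs
       (subst P (sym (trans (above-1 (at u xs)) (cong (_⊖ 1ᴱ) eq))) (pow≥1 i)))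
     ¬excuse i xs eq (inj₂ (inj₁ h)) = ¬⊝conj-pow i (subst P (trans (negated-conj (at u xs)) (cong (λ z → ⊝ conj z) eq))
       (positive⇒ true ((-1ℤ , u) ∷ []) 0ᴱ xs h))
     ¬excuse i xs eq (inj₂ (inj₂ (p , q , r , s , ¬same))) = ¬same
       ( ⇒≐ {(k₊ 1ℤ , proj₁ u) ∷ (k₊ -1ℤ , proj₁ v) ∷ []} (refl ∷ refl ∷ []) (constant 0ℤ) xs
           (trans (equal (proj₁ (at u xs)) (proj₁ (at v xs))) (ℤₚ.i≡j⇒i-j≡0 (cong proj₁ u≡v)))
       , ⇒≐ {(k₊ 1ℤ , proj₂ u) ∷ (k₊ -1ℤ , proj₂ v) ∷ []} (refl ∷ refl ∷ []) (constant 0ℤ) xs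
           (trans (equal (proj₂ (at u xs)) (proj₂ (at v xs))) (ℤₚ.i≡j⇒i-j≡0 (cong proj₂ u≡v))) )
       where
       u≡v : at u xs ≡ at v xs
       u≡v = trans eq (sym (power-minimal i (at v xs)
         (λ h → p (⇒positive false ((-1ℤ , v) ∷ []) 0ᴱ xs (subst P (sym (negated (at v xs))) h)))
         (subst P (trans (subtracted (at u xs) (at v xs)) (cong (_⊖ at v xs) eq)) (positive⇒ false ((1ℤ , u) ∷ (-1ℤ , v) ∷ []) 0ᴱ xs q))
         (λ h → r (⇒positive true ((-1ℤ , v) ∷ []) 0ᴱ xs (subst P (sym (negated-conj (at v xs))) h)))
         (subst P (trans (subtracted-conj (at u xs) (at v xs)) (cong (λ z → conj z ⊖ conj (at v xs)) eq))
           (positive⇒ true ((1ℤ , u) ∷ (-1ℤ , v) ∷ []) 0ᴱ xs s))))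

     excuse-small : ∀ xs → ¬ P (at u xs ⊖ 1ᴱ) → Sat excuse xs
     excuse-small xs h = inj₁ λ p → h (subst P (above-1 (at u xs)) (positive⇒ false ((1ℤ , u) ∷ []) (-1ℤ , 0ℤ) xs p))

     excuse-conj : ∀ xs → P (⊝ conj (at u xs)) → Sat excuse xs
     excuse-conj xs h = inj₂ (inj₁ (⇒positive true ((-1ℤ , u) ∷ []) 0ᴱ xs (subst P (sym (negated-conj (at u xs))) h)))

     excuse-dominated : ∀ j xs → at v xs ≡ pow j → at u xs ≢ pow j → P (at u xs ⊖ pow j) → P (conj (at u xs) ⊖ conj (pow j)) → Sat excuse xs
     excuse-dominated j xs eq neq p q = inj₂ (inj₂
       ( (λ h → ¬⊝pow j (subst P (trans (negated (at v xs)) (cong ⊝_ eq)) (positive⇒ false ((-1ℤ , v) ∷ []) 0ᴱ xs h)))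
       , ⇒positive false ((1ℤ , u) ∷ (-1ℤ , v) ∷ []) 0ᴱ xs (subst P (sym (trans (subtracted (at u xs) (at v xs)) (cong (at u xs ⊖_) eq))) p)
       , (λ h → ¬⊝conj-pow j (subst P (trans (negated-conj (at v xs)) (cong (λ z → ⊝ conj z) eq)) (positive⇒ true ((-1ℤ , v) ∷ []) 0ᴱ xs h)))
       , ⇒positive true ((1ℤ , u) ∷ (-1ℤ , v) ∷ []) 0ᴱ xs
           (subst P (sym (trans (subtracted-conj (at u xs) (at v xs)) (cong (λ z → conj (at u xs) ⊖ conj z) eq))) q)
       , λ (h , h′) → neq (trans (pair
           (ℤₚ.i-j≡0⇒i≡j _ _ (trans (sym (equal (proj₁ (at u xs)) (proj₁ (at v xs)))) (≐⇒ {(k₊ 1ℤ , proj₁ u) ∷ (k₊ -1ℤ , proj₁ v) ∷ []} (refl ∷ refl ∷ []) (constant 0ℤ) xs h)))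
           (ℤₚ.i-j≡0⇒i≡j _ _ (trans (sym (equal (proj₂ (at u xs)) (proj₂ (at v xs)))) (≐⇒ {(k₊ 1ℤ , proj₂ u) ∷ (k₊ -1ℤ , proj₂ v) ∷ []} (refl ∷ refl ∷ []) (constant 0ℤ) xs h′)))) eq)))

     module Truth (radix≡ : radix ≡ suc maxDigit) (shift : Fin 4 → ℕ) (ρ-shift : ∀ k → (+ ρ (U k) , + ρ (V k)) ≡ pow (shift k))
                  (C : List ℕ) (C≤ : All (ℕ._≤ maxDigit) C) (ρ-C : (+ ρ C₁ , + ρ C₂) ≡ eval C)
                  (R₀ : ℕ → ℕ → Bool) (R : Fin 4 → ℕ → ℕ → Bool) where

       Admissible : (ℕ → ℕ) → Set
       Admissible d = ∀ i → R₀ (d i) (digit C i) ≡ true × ∀ k → R k (d i) (d (shift k ℕ.+ i)) ≡ true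

       φ : Sentence ∃′ (6 ∷ 4 ∷ 11 ∷ [])
       φ = sentence (instantiate ρ (whole R₀ R))

       private
         below : ∀ {c} → c ℕ.< radix → c ℕ.≤ maxDigit
         below c< = ℕₚ.≤-pred (subst (_ ℕ.<_) radix≡ c<)

         below⁻¹ : ∀ {c} → c ℕ.≤ maxDigit → c ℕ.< radix
         below⁻¹ c≤ = subst (_ ℕ.<_) (sym radix≡) (s≤s c≤)

         single : ∀ k x → k * x + 0ℤ ≡ k * x
         single k x = ℤₚ.+-identityʳ (k * x)

         selected-check : ∀ xs i k → at u xs ≡ pow i → lookup xs t ≡ + toℕ k → Sat (whole R₀ R) xs → Sat (check R₀ R k) xs
         selected-check xs i k eq teq (inj₁ h) = ⊥-elim (¬excuse i xs eq h)
         selected-check xs i k eq teq (inj₂ (inj₁ h)) = ⊥-elim (h (⇒≤ⁱ {(k₊ -1ℤ , t) ∷ []} (refl ∷ []) (constant 0ℤ) xs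
           (subst (λ x → -1ℤ * x + 0ℤ ℤ.≤ 0ℤ) (sym teq) (subst (ℤ._≤ 0ℤ) (sym (trans (single -1ℤ (+ toℕ k)) (ℤₚ.-1*i≡-i (+ toℕ k)))) ℤₚ.neg-≤-pos))))
         selected-check xs i k eq teq (inj₂ (inj₂ (inj₁ h))) = ⊥-elim (h (⇒≤ⁱ {(k₊ 1ℤ , t) ∷ []} (refl ∷ []) (constant (+ 4)) xs
           (subst (λ x → 1ℤ * x + 0ℤ ℤ.≤ + 4) (sym teq) (subst (ℤ._≤ + 4) (sym (trans (single 1ℤ (+ toℕ k)) (ℤₚ.*-identityˡ (+ toℕ k))))
             (ℤ.+≤+ (ℕₚ.≤-pred (Finₚ.toℕ<n k)))))))
         selected-check xs i k eq teq (inj₂ (inj₂ (inj₂ h))) = let j , h₁ , h₂ = ⋁⇒ 5 (selected R₀ R) xs h in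
           subst (λ k → Sat (check R₀ R k) xs)
             (Finₚ.toℕ-injective (ℤₚ.+-injective (trans (sym (≐⇒ {(k₊ 1ℤ , t) ∷ []} (refl ∷ []) (constant (+ toℕ j)) xs h₁))
               (trans (trans (single 1ℤ (lookup xs t)) (ℤₚ.*-identityˡ _)) teq)))) h₂

         initial-check : ∀ xs → Sat (check R₀ R zero) xs → at w xs ≡ eval C × Sat (window R₀ X u w u) xs
         initial-check xs (h , h′ , h″) = trans (pair (coordinate (proj₁ w) C₁ h) (coordinate (proj₂ w) C₂ h′)) ρ-C , h″
           where
           coordinate : ∀ i c → Sat (((k₊ 1ℤ , i) ∷ []) ≐ plus c) xs → lookup xs i ≡ + ρ c
           coordinate i c h = trans (sym (trans (single 1ℤ (lookup xs i)) (ℤₚ.*-identityˡ _)))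
             (≐⇒ {(k₊ 1ℤ , i) ∷ []} (Vecₚ.lookup-replicate i 0ᴱ ∷ []) (plus c) xs h)

         solve-z : ∀ d z y → 1ℤ * z + (- d * y + 0ℤ) ≡ z - d * y
         solve-z = solve-∀

         solve-w : ∀ w p x q y → -1ℤ * w + (p * x + (q * y + 0ℤ)) ≡ (p * x + q * y) - w
         solve-w = solve-∀

         times : ∀ U V d x y → U * x + d * (V * y) ≡ U * x + V * (d * y)
         times = solve-∀

         times-ε^s : ∀ k x y → (+ ρ (U k) * x + + ρ (V k) * (D * y) , + ρ (V k) * x + + ρ (U k) * y) ≡ act (shift k) (x , y)
         times-ε^s k x y = sym (trans (act-⊗ (shift k) x y) (trans (cong (_⊗ (x , y)) (sym (ρ-shift k)))
           (pair (times (+ ρ (U k)) (+ ρ (V k)) D x y) (ℤₚ.+-comm (+ ρ (U k) * y) (+ ρ (V k) * x)))))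

         shift-check : ∀ xs k → Sat (check R₀ R (suc k)) xs → at w xs ≡ act (shift k) (at u xs) × Sat (window (R k) X u X w) xs
         shift-check xs k (h₁ , h₂ , h₃ , h) = trans (pair
             (sym (trans (cong (λ s → + ρ (U k) * x + + ρ (V k) * s) (sym z≡))
               (ℤₚ.i-j≡0⇒i≡j _ _ (trans (sym (solve-w (proj₁ (at w xs)) (+ ρ (U k)) x (+ ρ (V k)) (lookup xs z)))
                 (≐⇒ {(k₊ -1ℤ , proj₁ w) ∷ (plus (U k) , proj₁ u) ∷ (plus (V k) , z) ∷ []} (refl ∷ refl ∷ refl ∷ []) (constant 0ℤ) xs h₂)))))
             (sym (ℤₚ.i-j≡0⇒i≡j _ _ (trans (sym (solve-w (proj₂ (at w xs)) (+ ρ (V k)) x (+ ρ (U k)) y))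
                 (≐⇒ {(k₊ -1ℤ , proj₂ w) ∷ (plus (V k) , proj₁ u) ∷ (plus (U k) , proj₂ u) ∷ []} (refl ∷ refl ∷ refl ∷ []) (constant 0ℤ) xs h₃)))))
           (times-ε^s k x y) , h
           where
           x = proj₁ (at u xs)
           y = proj₂ (at u xs)
           z≡ : lookup xs z ≡ D * y
           z≡ = ℤₚ.i-j≡0⇒i≡j _ _ (trans (sym (solve-z D (lookup xs z) y))
             (≐⇒ {(k₊ 1ℤ , z) ∷ (k₊ (- D) , proj₂ u) ∷ []} (refl ∷ refl ∷ []) (constant 0ℤ) xs h₁))

       private
         module Extraction (x₁ x₂ : ℤ) where
           Ξ : ℤ[α]
           Ξ = x₁ , x₂

           Digit : ℕ → ℕ → Set
           Digit i c = c ℕ.≤ maxDigit × ∃ λ L → Reads c Ξ (pow i) L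

           unique : ∀ {i c d} → Digit i c → Digit i d → c ≡ d
           unique {i} {c} {d} (c≤ , L , r) (d≤ , L′ , r′) = reads-unique i c d Ξ L L′ c≤ d≤ r r′

           atPower : ℕ → Fin 5 → Vec ℤ 4
           atPower i k = proj₁ (pow i) ∷ proj₂ (pow i) ∷ + toℕ k ∷ 0ℤ ∷ []

           environment : (x₃ x₄ x₅ x₆ : ℤ) → Vec ℤ 4 → Vec ℤ 11 → Vec ℤ 21
           environment x₃ x₄ x₅ x₆ y zs = (x₁ ∷ x₂ ∷ x₃ ∷ x₄ ∷ x₅ ∷ x₆ ∷ []) Vec.++ (y Vec.++ (zs Vec.++ []))

           Assigns : Vec ℤ 21 → ℕ → Fin 5 → Set
           Assigns xs i k = at X xs ≡ Ξ × at u xs ≡ pow i × lookup xs t ≡ + toℕ k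

           digit≤ : ∀ ds → All (ℕ._≤ maxDigit) ds → ∀ i → digit ds i ℕ.≤ maxDigit
           digit≤ []       _             i       = z≤n
           digit≤ (d ∷ ds) (d≤ All.∷ _)  zero    = d≤
           digit≤ (d ∷ ds) (_ All.∷ ds≤) (suc i) = digit≤ ds ds≤ i

           initial-digits : ∀ xs i → Assigns xs i zero → Sat (whole R₀ R) xs → ∃ λ c → Digit i c × R₀ c (digit C i) ≡ true
           initial-digits xs i (X≡ , u≡ , t≡) sat =
             let w≡ , h = initial-check xs (selected-check xs i zero u≡ t≡ sat)
                 c , d , c< , d< , eq , r , r′ = window⇒ R₀ X u w u xs h
                 M , r″ = eval-reads C C≤ i
             in c , (below c< , at L xs , subst₂ (λ Y y → Reads c Y y (at L xs)) X≡ u≡ r) ,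
                trans (cong (R₀ c) (sym (reads-unique i d (digit C i) (eval C) (at L′ xs) M (below d<) (digit≤ C C≤ i)
                  (subst₂ (λ W y → Reads d W y (at L′ xs)) w≡ u≡ r′) r″))) eq

           shift-digits : ∀ xs i k → Assigns xs i (suc k) → Sat (whole R₀ R) xs →
                          ∃₂ λ c d → Digit i c × Digit (shift k ℕ.+ i) d × R k c d ≡ true
           shift-digits xs i k (X≡ , u≡ , t≡) sat =
             let w≡ , h = shift-check xs k (selected-check xs i (suc k) u≡ t≡ sat)
                 c , d , c< , d< , eq , r , r′ = window⇒ (R k) X u X w xs h
             in c , d , (below c< , at L xs , subst₂ (λ Y y → Reads c Y y (at L xs)) X≡ u≡ r) ,
                (below d< , at L′ xs , subst₂ (λ Y W → Reads d Y W (at L′ xs)) X≡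
                  (trans w≡ (trans (cong (act (shift k)) u≡) (sym (pow-+ (shift k) i)))) r′) , eq

       true⇒admissible : IsTrue α φ → ∃ λ d → (∀ i → d i ℕ.≤ maxDigit) × Admissible d
       true⇒admissible (x₁ ∷ x₂ ∷ x₃ ∷ x₄ ∷ x₅ ∷ x₆ ∷ [] , h) = d , (λ i → proj₁ (d-digit i)) , λ i →
         proj₂ (proj₂ (first i)) , λ k → shifted i k (later i k)
         where
         open Extraction x₁ x₂
         environmentAt : ℕ → Fin 5 → Vec ℤ 21
         environmentAt i k = environment x₃ x₄ x₅ x₆ (atPower i k) (proj₁ (h (atPower i k)))
         first : ∀ i → ∃ λ c → Digit i c × R₀ c (digit C i) ≡ true
         first i = initial-digits (environmentAt i zero) i (refl , refl , refl) (proj₂ (h (atPower i zero)))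
         later : ∀ i k → ∃₂ λ c d → Digit i c × Digit (shift k ℕ.+ i) d × R k c d ≡ true
         later i k = shift-digits (environmentAt i (suc k)) i k (refl , refl , refl) (proj₂ (h (atPower i (suc k))))
         d : ℕ → ℕ
         d i = proj₁ (first i)
         d-digit : ∀ i → Digit i (d i)
         d-digit i = proj₁ (proj₂ (first i))
         shifted : ∀ i k → (∃₂ λ c d → Digit i c × Digit (shift k ℕ.+ i) d × R k c d ≡ true) → R k (d i) (d (shift k ℕ.+ i)) ≡ true
         shifted i k (c , c′ , p , q , eq) = trans (cong₂ (R k) (unique (d-digit i) p) (unique (d-digit (shift k ℕ.+ i)) q)) eq

       private
         outside : Vec ℤ 11
         outside = replicate 11 0ℤ

         select : ∀ xs k → lookup xs t ≡ + toℕ k → Sat (check R₀ R k) xs → Sat (whole R₀ R) xs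
         select xs k eq h = inj₂ (inj₂ (inj₂ (⇒⋁ 5 (selected R₀ R) xs k
           (⇒≐ {(k₊ 1ℤ , t) ∷ []} (refl ∷ []) (constant (+ toℕ k)) xs (trans (trans (single 1ℤ (lookup xs t)) (ℤₚ.*-identityˡ _)) eq) , h))))

         build-initial : ∀ xs i {c d} → at u xs ≡ pow i → at w xs ≡ eval C → c ℕ.≤ maxDigit → d ℕ.≤ maxDigit → R₀ c d ≡ true →
                         Reads c (at X xs) (at u xs) (at L xs) → Reads d (eval C) (at u xs) (at L′ xs) → Sat (check R₀ R zero) xs
         build-initial xs i u≡ w≡ c≤ d≤ eq r r′ = coordinate (proj₁ w) C₁ (trans (cong proj₁ w≡) (sym (cong proj₁ ρ-C))) ,
           coordinate (proj₂ w) C₂ (trans (cong proj₂ w≡) (sym (cong proj₂ ρ-C))) ,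
           ⇒window R₀ X u w u xs (below⁻¹ c≤) (below⁻¹ d≤) eq r (subst (λ W → Reads _ W (at u xs) (at L′ xs)) (sym w≡) r′)
           where
           coordinate : ∀ i c → lookup xs i ≡ + ρ c → Sat (((k₊ 1ℤ , i) ∷ []) ≐ plus c) xs
           coordinate i c eq = ⇒≐ {(k₊ 1ℤ , i) ∷ []} (Vecₚ.lookup-replicate i 0ᴱ ∷ []) (plus c) xs
             (trans (trans (single 1ℤ (lookup xs i)) (ℤₚ.*-identityˡ _)) eq)

         build-shift : ∀ xs k {c d} → lookup xs z ≡ D * proj₂ (at u xs) → at w xs ≡ act (shift k) (at u xs) →
                       c ℕ.≤ maxDigit → d ℕ.≤ maxDigit → R k c d ≡ true →
                       Reads c (at X xs) (at u xs) (at L xs) → Reads d (at X xs) (at w xs) (at L′ xs) → Sat (check R₀ R (suc k)) xs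
         build-shift xs k z≡ w≡ c≤ d≤ eq r r′ =
           ⇒≐ {(k₊ 1ℤ , z) ∷ (k₊ (- D) , proj₂ u) ∷ []} (refl ∷ refl ∷ []) (constant 0ℤ) xs
             (trans (solve-z D (lookup xs z) y) (ℤₚ.i≡j⇒i-j≡0 z≡)) ,
           ⇒≐ {(k₊ -1ℤ , proj₁ w) ∷ (plus (U k) , proj₁ u) ∷ (plus (V k) , z) ∷ []} (refl ∷ refl ∷ refl ∷ []) (constant 0ℤ) xs
             (trans (solve-w (proj₁ (at w xs)) (+ ρ (U k)) x (+ ρ (V k)) (lookup xs z))
               (ℤₚ.i≡j⇒i-j≡0 (trans (cong (λ s → + ρ (U k) * x + + ρ (V k) * s) z≡) (cong proj₁ w≡′)))) ,
           ⇒≐ {(k₊ -1ℤ , proj₂ w) ∷ (plus (V k) , proj₁ u) ∷ (plus (U k) , proj₂ u) ∷ []} (refl ∷ refl ∷ refl ∷ []) (constant 0ℤ) xs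
             (trans (solve-w (proj₂ (at w xs)) (+ ρ (V k)) x (+ ρ (U k)) y) (ℤₚ.i≡j⇒i-j≡0 (cong proj₂ w≡′))) ,
           ⇒window (R k) X u X w xs (below⁻¹ c≤) (below⁻¹ d≤) eq r r′
           where
           x = proj₁ (at u xs)
           y = proj₂ (at u xs)
           w≡′ : (+ ρ (U k) * x + + ρ (V k) * (D * y) , + ρ (V k) * x + + ρ (U k) * y) ≡ at w xs
           w≡′ = trans (times-ε^s k x y) (sym w≡)

       module _ (ds : List ℕ) (ds≤ : All (ℕ._≤ maxDigit) ds) (admissible : Admissible (digit ds)) where
         private
           open Extraction (proj₁ (eval ds)) (proj₂ (eval ds))

           env : ℤ → ℤ → ℤ → ℤ → Vec ℤ 11 → Vec ℤ 21
           env p q s s′ zs = environment 0ℤ 0ℤ 0ℤ 0ℤ (p ∷ q ∷ s ∷ s′ ∷ []) zs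

           Witness : ℤ[α] → ℤ → ℤ → Set
           Witness (p , q) s s′ = ∃ λ zs → Sat (whole R₀ R) (env p q s s′ zs)

           at-power : ∀ i (k : Fin 5) s s′ → s ≡ + toℕ k → Witness (pow i) s s′
           at-power i zero s s′ s≡ = zs , select xs zero s≡
               (build-initial xs i {digit ds i} {digit C i} refl refl (digit≤ ds ds≤ i) (digit≤ C C≤ i) (proj₁ (admissible i))
                 (proj₂ (eval-reads ds ds≤ i)) (proj₂ (eval-reads C C≤ i)))
             where
             M = proj₁ (eval-reads ds ds≤ i)
             N = proj₁ (eval-reads C C≤ i)
             zs = proj₁ M ∷ proj₂ M ∷ proj₁ N ∷ proj₂ N ∷ proj₁ (eval C) ∷ proj₂ (eval C) ∷ 0ℤ ∷ 0ℤ ∷ 0ℤ ∷ 0ℤ ∷ 0ℤ ∷ []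
             xs = env (proj₁ (pow i)) (proj₂ (pow i)) s s′ zs
           at-power i (suc k) s s′ s≡ = zs , select xs (suc k) s≡
               (build-shift xs k {digit ds i} {digit ds (shift k ℕ.+ i)} refl (pow-+ (shift k) i)
                 (digit≤ ds ds≤ i) (digit≤ ds ds≤ (shift k ℕ.+ i)) (proj₂ (admissible i) k)
                 (proj₂ (eval-reads ds ds≤ i)) (proj₂ (eval-reads ds ds≤ (shift k ℕ.+ i))))
             where
             M = proj₁ (eval-reads ds ds≤ i)
             N = proj₁ (eval-reads ds ds≤ (shift k ℕ.+ i))
             W = pow (shift k ℕ.+ i)
             zs = proj₁ M ∷ proj₂ M ∷ proj₁ N ∷ proj₂ N ∷ proj₁ W ∷ proj₂ W ∷ D * proj₂ (pow i) ∷ 0ℤ ∷ 0ℤ ∷ 0ℤ ∷ 0ℤ ∷ []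
             xs = env (proj₁ (pow i)) (proj₂ (pow i)) s s′ zs

           low : ∀ p q n s′ → Witness (p , q) -[1+ n ] s′
           low p q n s′ = outside , inj₂ (inj₁ λ h → absurd (≤ⁱ⇒ {(k₊ -1ℤ , t) ∷ []} (refl ∷ []) (constant 0ℤ) (env p q -[1+ n ] s′ outside) h))
             where
             absurd : ¬ (-1ℤ * -[1+ n ] + 0ℤ ℤ.≤ 0ℤ)
             absurd h with subst (ℤ._≤ 0ℤ) (trans (single -1ℤ -[1+ n ]) (ℤₚ.-1*i≡-i -[1+ n ])) h
             ... | ℤ.+≤+ ()

           beyond-4 : ∀ p q n s′ → 5 ℕ.≤ n → Witness (p , q) (+ n) s′
           beyond-4 p q n s′ 5≤n = outside , inj₂ (inj₂ (inj₁ λ h → ℕₚ.<-irrefl refl (ℕₚ.≤-trans 5≤n (ℤₚ.drop‿+≤+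
             (subst (ℤ._≤ + 4) (trans (single 1ℤ (+ n)) (ℤₚ.*-identityˡ (+ n)))
               (≤ⁱ⇒ {(k₊ 1ℤ , t) ∷ []} (refl ∷ []) (constant (+ 4)) (env p q (+ n) s′ outside) h))))))

           power-witness : ∀ i s s′ → Witness (pow i) s s′
           power-witness i -[1+ n ] s′ = low (proj₁ (pow i)) (proj₂ (pow i)) n s′
           power-witness i (+ n) s′ = cases (n ℕ.<? 5)
             where
             cases : Dec (n ℕ.< 5) → Witness (pow i) (+ n) s′
             cases (yes n<5) = at-power i (Fin.fromℕ< n<5) (+ n) s′ (cong +_ (sym (Finₚ.toℕ-fromℕ< n<5)))
             cases (no n≮5)  = beyond-4 (proj₁ (pow i)) (proj₂ (pow i)) n s′ (ℕₚ.≮⇒≥ n≮5)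

           witness : ∀ p q s s′ → Witness (p , q) s s′
           witness p q s s′ = totally-positive? (P? ((p , q) ⊖ 1ᴱ)) (P? (⊝ conj (p , q)))
             where
             cases : (∃ λ j → (p , q) ≡ pow j) ⊎ (∃ λ j → (p , q) ≢ pow j × P ((p , q) ⊖ pow j) × P (conj (p , q) ⊖ conj (pow j))) → Witness (p , q) s s′
             cases (inj₁ (j , eq)) = subst (λ u → Witness u s s′) (sym eq) (power-witness j s s′)
             cases (inj₂ (j , neq , r , r′)) = zs , inj₁ (excuse-dominated j (env p q s s′ zs) refl neq r r′)
               where
               zs = 0ℤ ∷ 0ℤ ∷ 0ℤ ∷ 0ℤ ∷ 0ℤ ∷ 0ℤ ∷ 0ℤ ∷ proj₁ (pow j) ∷ proj₂ (pow j) ∷ 0ℤ ∷ 0ℤ ∷ []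

             totally-positive? : Dec (P ((p , q) ⊖ 1ᴱ)) → Dec (P (⊝ conj (p , q))) → Witness (p , q) s s′
             totally-positive? (no ¬r) _        = outside , inj₁ (excuse-small (env p q s s′ outside) ¬r)
             totally-positive? (yes r) (yes r′) = outside , inj₁ (excuse-conj (env p q s s′ outside) r′)
             totally-positive? (yes r) (no ¬r′) = cases (power-or-dominated (p , q) r ¬r′)

         admissible⇒true : IsTrue α φ
         admissible⇒true = (proj₁ (eval ds) ∷ proj₂ (eval ds) ∷ 0ℤ ∷ 0ℤ ∷ 0ℤ ∷ 0ℤ ∷ []) ,
           λ { (p ∷ q ∷ s ∷ s′ ∷ []) → witness p q s s′ }

module Transcripts where

 open Digits using (digit; maxDigit)
 open StackPrograms using (Finite; module Finiteness)
 open Finite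
 open Finiteness
 open import Data.Bool using (_∧_; _∨_; not)
 open import Data.Bool.Properties using (∨-conicalˡ)
 open import Data.Fin using (zero; suc)
 open import Data.Fin.Patterns
 open import Data.Nat
 open import Algebra.Properties.CommutativeSemigroup ℕₚ.+-commutativeSemigroup using (x∙yz≈yx∙z; x∙yz≈y∙xz)
 open import Data.Nat.Tactic.RingSolver using (solve-∀)

 -- The kinds of program symbols. A row is scanned with a flag: reset raises it and test lowers it
 -- where the bit is 0; while the flag is up, set0 … fromLeft prescribe the next value of the bit.
 -- Rows of copy, load0 or load1 replace the bits by their next values.
 data Kind : Set where
   idle test reset set0 set1 unchanged fromRight fromLeft copy load0 load1 accept reject : Kind

 Kind-finite : Finite Kind
 Kind-finite = transport
   (λ { idle → 0F ; test → 1F ; reset → 2F ; set0 → 3F ; set1 → 4F ; unchanged → 5F ; fromRight → 6F ; fromLeft → 7F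
      ; copy → 8F ; load0 → 9F ; load1 → suc 9F ; accept → suc (suc 9F) ; reject → suc (suc (suc 9F)) })
   (λ { 0F → idle ; 1F → test ; 2F → reset ; 3F → set0 ; 4F → set1 ; 5F → unchanged ; 6F → fromRight ; 7F → fromLeft
      ; 8F → copy ; 9F → load0 ; (suc 9F) → load1 ; (suc (suc 9F)) → accept ; _ → reject })
   (λ { idle → refl ; test → refl ; reset → refl ; set0 → refl ; set1 → refl ; unchanged → refl ; fromRight → refl
      ; fromLeft → refl ; copy → refl ; load0 → refl ; load1 → refl ; accept → refl ; reject → refl })
   (λ { 0F → refl ; 1F → refl ; 2F → refl ; 3F → refl ; 4F → refl ; 5F → refl ; 6F → refl ; 7F → refl ; 8F → refl ; 9F → refl
      ; (suc 9F) → refl ; (suc (suc 9F)) → refl ; (suc (suc (suc 9F))) → refl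
      ; (suc (suc (suc (suc (suc (suc (suc (suc (suc (suc (suc (suc (suc ()))))))))))))) })
   (Fin-finite 13)

 -- Program symbol, bit, next bit, flag.
 Letter : Set
 Letter = Kind × Bool × Bool × Bool

 Letter-finite : Finite Letter
 Letter-finite = ×-finite Kind-finite (×-finite Bool-finite (×-finite Bool-finite Bool-finite))

 -- The digit 0 marks the end of a transcript.
 code : Maybe Letter → ℕ
 code nothing  = 0
 code (just l) = suc (toℕ (index Letter-finite l))

 decode : ℕ → Maybe Letter
 decode zero = nothing
 decode (suc n) with n <? maxDigit
 ... | yes n< = just (at Letter-finite (Fin.fromℕ< n<))
 ... | no _   = nothing

 code≤ : ∀ l → code l ≤ maxDigit
 code≤ nothing  = z≤n
 code≤ (just l) = Finₚ.toℕ<n (index Letter-finite l)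

 decode-code : ∀ l → decode (code l) ≡ l
 decode-code nothing = refl
 decode-code (just l) with toℕ (index Letter-finite l) <? maxDigit
 ... | yes n< = cong just (trans (cong (at Letter-finite) (Finₚ.fromℕ<-toℕ (index Letter-finite l) n<)) (at-index Letter-finite l))
 ... | no n≮  = ⊥-elim (n≮ (Finₚ.toℕ<n (index Letter-finite l)))

 infix 4 _==_ _==ᴷ_
 _==_ : Bool → Bool → Bool
 true  == b = b
 false == b = not b

 ==⇒≡ : ∀ {b c} → (b == c) ≡ true → b ≡ c
 ==⇒≡ {true}  {true}  _ = refl
 ==⇒≡ {false} {false} _ = refl

 ==-refl : ∀ b → (b == b) ≡ true
 ==-refl true  = refl
 ==-refl false = refl

 _==ᴷ_ : Kind → Kind → Bool
 κ ==ᴷ κ′ = does (index Kind-finite κ Fin.≟ index Kind-finite κ′)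

 ==ᴷ⇒≡ : ∀ {κ κ′} → (κ ==ᴷ κ′) ≡ true → κ ≡ κ′
 ==ᴷ⇒≡ {κ} {κ′} eq with index Kind-finite κ Fin.≟ index Kind-finite κ′
 ... | yes p = trans (sym (at-index Kind-finite κ)) (trans (cong (at Kind-finite) p) (at-index Kind-finite κ′))
 ==ᴷ⇒≡ {κ} {κ′} () | no _

 ==ᴷ-refl : ∀ κ → (κ ==ᴷ κ) ≡ true
 ==ᴷ-refl κ with index Kind-finite κ Fin.≟ index Kind-finite κ
 ... | yes _ = refl
 ... | no ¬p = ⊥-elim (¬p refl)

 ∧-true : ∀ {b c} → b ∧ c ≡ true → b ≡ true × c ≡ true
 ∧-true {true} {true} _ = refl , refl

 isLoad isCopy : Kind → Bool
 isLoad load0 = true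
 isLoad load1 = true
 isLoad _     = false
 isCopy κ     = isLoad κ ∨ (κ ==ᴷ copy)

 flag : Kind → Bool → Bool → Bool
 flag test  x s = s ∧ x
 flag reset x s = true
 flag _     x s = s

 effect : Kind → Bool → Bool → Bool
 effect set0      x y = not y
 effect set1      x y = y
 effect unchanged x y = x == y
 effect accept    x y = false
 effect reject    x y = false
 effect _         x y = true

 consistent : Kind → Bool → Bool → Bool → Bool
 consistent κ x y s = (not (isLoad κ) ∨ (y == (κ ==ᴷ load1))) ∧ (not s ∨ effect κ x y)

 ends : Kind → Bool → Bool
 ends accept s = s
 ends _      s = false

 adjacent rowwise sideways periodic initial : Maybe Letter → Maybe Letter → Bool
 adjacent nothing               nothing                = true
 adjacent nothing               (just _)               = false
 adjacent (just (κ , _ , _ , s)) nothing               = ends κ s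
 adjacent (just (κ , x , y , s)) (just (_ , _ , _ , s′)) = (s′ == flag κ x s) ∧ consistent κ x y s

 rowwise (just (κ , x , y , _)) (just (_ , x′ , y′ , _)) with isCopy κ
 ... | true  = x′ == y
 ... | false = (x′ == x) ∧ (y′ == y)
 rowwise _ _ = true

 oriented : Kind → Kind → Bool → Bool → Bool → Bool
 oriented ω κ y s x = not (s ∧ (κ ==ᴷ ω)) ∨ (y == x)

 sideways (just (κ , x , y , s)) (just (κ′ , x′ , y′ , s′)) = oriented fromRight κ y s x′ ∧ oriented fromLeft κ′ y′ s′ x
 sideways _ _ = true

 periodic (just (κ , _)) (just (κ′ , _)) = isLoad κ ∨ (κ ==ᴷ κ′)
 periodic _ _ = true

 initial _               nothing         = true
 initial nothing         (just (κ , _)) = not (isLoad κ)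
 initial (just (κ , _)) (just (κ′ , _)) = κ ==ᴷ κ′

 oriented-intro : ∀ ω κ y s x → (s ≡ true → κ ≡ ω → y ≡ x) → oriented ω κ y s x ≡ true
 oriented-intro ω κ y false x h = refl
 oriented-intro ω κ y true  x h with κ ==ᴷ ω in eq
 ... | false = refl
 ... | true  = trans (cong (_== x) (h refl (==ᴷ⇒≡ eq))) (==-refl x)

 relation : Fin 4 → Maybe Letter → Maybe Letter → Bool
 relation 0F = adjacent
 relation 1F = sideways
 relation 2F = rowwise
 relation 3F = periodic

 relationᵈ : Fin 4 → ℕ → ℕ → Bool
 relationᵈ k c d = relation k (decode c) (decode d)

 initialᵈ : ℕ → ℕ → Bool
 initialᵈ c d = initial (decode c) (decode d)

 scan : (ℕ → Kind) → (ℕ → Bool) → Bool → ℕ → Bool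
 scan κ x s zero    = s
 scan κ x s (suc j) = flag (κ j) (x j) (scan κ x s j)

 digit-applyUpTo : ∀ (f : ℕ → ℕ) n i → (i < n × digit (List.applyUpTo f n) i ≡ f i) ⊎ (n ≤ i × digit (List.applyUpTo f n) i ≡ 0)
 digit-applyUpTo f zero    i       = inj₂ (z≤n , refl)
 digit-applyUpTo f (suc n) zero    = inj₁ (z<s , refl)
 digit-applyUpTo f (suc n) (suc i) with digit-applyUpTo (f ∘ suc) n i
 ... | inj₁ (i<n , eq) = inj₁ (s≤s i<n , eq)
 ... | inj₂ (n≤i , eq) = inj₂ (s≤s n≤i , eq)

 -- Quotient and remainder modulo 1 + m.
 module Place (m : ℕ) where

   bump : ℕ × ℕ → ℕ × ℕ
   bump (q , r) with r ≟ m
   ... | yes _ = suc q , 0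
   ... | no _  = q , suc r

   place : ℕ → ℕ × ℕ
   place zero    = 0 , 0
   place (suc n) = bump (place n)

   bump-last : ∀ q → bump (q , m) ≡ (suc q , 0)
   bump-last q with m ≟ m
   ... | yes _ = refl
   ... | no m≢ = ⊥-elim (m≢ refl)

   bump-inner : ∀ q r → r < m → bump (q , r) ≡ (q , suc r)
   bump-inner q r r<m with r ≟ m
   ... | yes refl = ⊥-elim (ℕₚ.<-irrefl refl r<m)
   ... | no _     = refl

   place-at : ∀ q r → r ≤ m → place (r + q * suc m) ≡ (q , r)
   place-at zero    zero    _   = refl
   place-at (suc q) zero    _   = trans (cong bump (place-at q m ℕₚ.≤-refl)) (bump-last q)
   place-at q       (suc r) r<m = trans (cong bump (place-at q r (ℕₚ.<⇒≤ r<m))) (bump-inner q r r<m)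

   private
     bump-sound : ∀ q r → r ≤ m → let q′ , r′ = bump (q , r) in r′ ≤ m × r′ + q′ * suc m ≡ suc (r + q * suc m)
     bump-sound q r r≤m with r ≟ m
     ... | yes refl = z≤n , refl
     ... | no r≢m   = ℕₚ.≤∧≢⇒< r≤m r≢m , refl

   place-sound : ∀ n → let q , r = place n in r ≤ m × r + q * suc m ≡ n
   place-sound zero    = z≤n , refl
   place-sound (suc n) = let r≤m , eq = place-sound n
                             r′≤m , eq′ = bump-sound (proj₁ (place n)) (proj₂ (place n)) r≤m in r′≤m , trans eq′ (cong suc eq)

   place-before : ∀ n q r → place (suc n) ≡ (q , suc r) → place n ≡ (q , r)
   place-before n q r eq with place n
   ... | q′ , r′ with r′ ≟ m
   place-before n q r () | q′ , r′ | yes _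
   place-before n q r refl | q′ , r′ | no _ = refl

 -- Rules e < G, each with a row of guards and a row of updates, and a row of loads; the bits of a
 -- configuration occupy one row. A period consists of the rows of the rules and of a row of copies.
 module Grid (len-1 W G : ℕ) (guard update : ℕ → ℕ → Kind) (load : ℕ → Kind) where

   len period : ℕ
   len    = suc len-1
   period = suc (G * 2)

   open Place (G * 2) public

   rows : ℕ → (ℕ → ℕ → Kind) → (ℕ → ℕ → Kind) → ℕ → ℕ → Kind
   rows zero    g u _             = λ _ → copy
   rows (suc G) g u zero          = g 0
   rows (suc G) g u (suc zero)    = u 0
   rows (suc G) g u (suc (suc r)) = rows G (g ∘ suc) (u ∘ suc) r

   kindAt : ℕ → ℕ → Kind
   kindAt zero    = load
   kindAt (suc ρ) = rows G guard update (proj₂ (place ρ))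

   data Row : ℕ → Set where
     guardRow  : ∀ e → e < G → Row (e * 2)
     updateRow : ∀ e → e < G → Row (suc (e * 2))
     copyRow   : Row (G * 2)

   classify : ∀ r → r ≤ G * 2 → Row r
   classify r r≤ = subst Row (ℕₚ.+-identityʳ r) (go 0 G r refl r≤)
     where
     below : ∀ e H → e + suc H ≡ G → e < G
     below e H refl = ℕₚ.m<m+n e z<s
     go : ∀ e H r → e + H ≡ G → r ≤ H * 2 → Row (r + e * 2)
     go e zero    zero          eq _ = subst (λ k → Row (k * 2)) (trans (sym eq) (ℕₚ.+-identityʳ e)) copyRow
     go e (suc H) zero          eq _ = guardRow e (below e H eq)
     go e (suc H) (suc zero)    eq _ = updateRow e (below e H eq)
     go e (suc H) (suc (suc r)) eq (s≤s (s≤s r≤)) =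
       subst Row (trans (ℕₚ.+-suc r (suc (e * 2))) (cong suc (ℕₚ.+-suc r (e * 2)))) (go (suc e) H r (trans (sym (ℕₚ.+-suc e H)) eq) r≤)

   private
     rows-guard : ∀ G g u e → e < G → rows G g u (e * 2) ≡ g e
     rows-guard (suc G) g u zero    _         = refl
     rows-guard (suc G) g u (suc e) (s≤s e<G) = rows-guard G (g ∘ suc) (u ∘ suc) e e<G

     rows-update : ∀ G g u e → e < G → rows G g u (suc (e * 2)) ≡ u e
     rows-update (suc G) g u zero    _         = refl
     rows-update (suc G) g u (suc e) (s≤s e<G) = rows-update G (g ∘ suc) (u ∘ suc) e e<G

     rows-copy : ∀ G g u → rows G g u (G * 2) ≡ λ _ → copy
     rows-copy zero    g u = refl
     rows-copy (suc G) g u = rows-copy G (g ∘ suc) (u ∘ suc)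

   rowKind : ℕ → ℕ → Kind
   rowKind = rows G guard update

   guard-kind : ∀ e → e < G → rowKind (e * 2) ≡ guard e
   guard-kind = rows-guard G guard update

   update-kind : ∀ e → e < G → rowKind (suc (e * 2)) ≡ update e
   update-kind = rows-update G guard update

   copy-kind : rowKind (G * 2) ≡ λ _ → copy
   copy-kind = rows-copy G guard update

   position : ℕ → ℕ → ℕ
   position ρ j = j + ρ * len

   shift : Fin 4 → ℕ
   shift 0F = 1
   shift 1F = W
   shift 2F = len
   shift 3F = period * len

   data Guard : Kind → Set where
     idle  : Guard idle
     test  : Guard test
     reset : Guard reset

   Update : Kind → Set
   Update κ = isCopy κ ≡ false × ∀ x s → flag κ x s ≡ s

   data Prescribes (x : ℕ → Bool) (j : ℕ) : Kind → Bool → Set where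
     set0      : Prescribes x j set0 false
     set1      : Prescribes x j set1 true
     unchanged : Prescribes x j unchanged (x j)
     fromRight : j + W < len → Prescribes x j fromRight (x (j + W))
     fromLeft  : ∀ {j′} → j ≡ W + j′ → Prescribes x j fromLeft (x j′)

   -- The deterministic computation described by the rules: enc t are the bits at time t, rule t is the
   -- only rule whose guard they satisfy, and rule T accepts or rejects.
   record Computation (T : ℕ) (C : List ℕ) : Set where
     field
       enc          : ℕ → ℕ → Bool
       rule         : ℕ → ℕ
       rule<G       : ∀ t → rule t < G
       W<len        : W < len
       guard-reset  : ∀ e → guard e 0 ≡ reset
       guards       : ∀ e j → Guard (guard e j)
       updates      : ∀ e j → Update (update e j)
       load-bit     : ∀ j → (load j ≡ load0 × enc 0 j ≡ false) ⊎ (load j ≡ load1 × enc 0 j ≡ true)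
       rule-matches : ∀ t → scan (guard (rule t)) (enc t) true len ≡ true
       only-rule    : ∀ t e → e < G → scan (guard e) (enc t) true len ≡ true → e ≡ rule t
       next         : ∀ t → t < T → ∀ j → j < len → Prescribes (enc t) j (update (rule t) j) (enc (suc t) j)
       program      : ∀ ρ j → j < len → (ρ ≤ period × ∃ λ l → decode (digit C (position ρ j)) ≡ just (kindAt ρ j , l))
                                      ⊎ (period < ρ × decode (digit C (position ρ j)) ≡ nothing)

   Admissible : List ℕ → (ℕ → ℕ) → Set
   Admissible C d = ∀ i → initialᵈ (d i) (digit C i) ≡ true × ∀ k → relationᵈ k (d i) (d (shift k + i)) ≡ true

   module Analysis {T : ℕ} {C : List ℕ} (computation : Computation T C) where
     open Computation computation

     load-isLoad : ∀ j → isLoad (load j) ≡ true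
     load-isLoad j with load-bit j
     ... | inj₁ (eq , _) rewrite eq = refl
     ... | inj₂ (eq , _) rewrite eq = refl

     load-isCopy : ∀ j → isCopy (load j) ≡ true
     load-isCopy j with load-bit j
     ... | inj₁ (eq , _) rewrite eq = refl
     ... | inj₂ (eq , _) rewrite eq = refl

     guard-noCopy : ∀ {κ} → Guard κ → isCopy κ ≡ false
     guard-noCopy idle  = refl
     guard-noCopy test  = refl
     guard-noCopy reset = refl

     noCopy⇒noLoad : ∀ κ → isCopy κ ≡ false → isLoad κ ≡ false
     noCopy⇒noLoad κ = ∨-conicalˡ (isLoad κ) (κ ==ᴷ copy)

     inner-noCopy : ∀ r → r < G * 2 → ∀ j → isCopy (rowKind r j) ≡ false
     inner-noCopy r r< j with classify r (ℕₚ.<⇒≤ r<)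
     ... | guardRow e e<G  rewrite guard-kind e e<G  = guard-noCopy (guards e j)
     ... | updateRow e e<G rewrite update-kind e e<G = proj₁ (updates e j)
     ... | copyRow = ⊥-elim (ℕₚ.<-irrefl refl r<)

     row-noLoad : ∀ ρ j → isLoad (kindAt (suc ρ) j) ≡ false
     row-noLoad ρ j with classify (proj₂ (place ρ)) (proj₁ (place-sound ρ))
     ... | row = by-row row
       where
       by-row : ∀ {r} → Row r → isLoad (rowKind r j) ≡ false
       by-row (guardRow e e<G)  rewrite guard-kind e e<G  = noCopy⇒noLoad _ (guard-noCopy (guards e j))
       by-row (updateRow e e<G) rewrite update-kind e e<G = noCopy⇒noLoad _ (proj₁ (updates e j))
       by-row copyRow           rewrite copy-kind = refl

     place-period : ∀ ρ → place (period + ρ) ≡ (suc (proj₁ (place ρ)) , proj₂ (place ρ))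
     place-period ρ = trans (cong place eq) (place-at (suc t) r r≤)
       where
       t = proj₁ (place ρ)
       r = proj₂ (place ρ)
       r≤ = proj₁ (place-sound ρ)
       eq : period + ρ ≡ r + suc t * period
       eq = trans (cong (period +_) (sym (proj₂ (place-sound ρ)))) (x∙yz≈y∙xz period r (t * period))

     kindAt-period : ∀ ρ j → kindAt (period + suc ρ) j ≡ kindAt (suc ρ) j
     kindAt-period ρ j = cong (λ p → rowKind (proj₂ p) j) (trans (cong place (ℕₚ.+-suc (G * 2) ρ)) (place-period ρ))

     scan-reset : ∀ κ x s s′ n → κ 0 ≡ reset → scan κ x s (suc n) ≡ scan κ x s′ (suc n)
     scan-reset κ x s s′ zero    eq rewrite eq = refl
     scan-reset κ x s s′ (suc n) eq = cong (flag (κ (suc n)) (x (suc n))) (scan-reset κ x s s′ n eq)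

     scan-update : ∀ e x s j → scan (update e) x s j ≡ s
     scan-update e x s zero    = refl
     scan-update e x s (suc j) = trans (cong (flag (update e j) (x j)) (scan-update e x s j)) (proj₂ (updates e j) (x j) s)

     time step-in : ℕ → ℕ
     time ρ    = proj₁ (place ρ)
     step-in ρ = proj₂ (place ρ)

     stop : ℕ
     stop = suc (rule T * 2) + T * period

     before-stop : ∀ ρ t → ρ < stop → place ρ ≡ (t , suc (rule t * 2)) → t < T
     before-stop ρ t ρ<stop eq with t <? T
     ... | yes t<T = t<T
     ... | no t≮T  = ⊥-elim (ℕₚ.<⇒≱ ρ<stop (subst (stop ≤_) ρ≡ stop≤))
       where
       ρ≡ : suc (rule t * 2) + t * period ≡ ρ
       ρ≡ = trans (cong (λ p → proj₂ p + proj₁ p * period) (sym eq)) (proj₂ (place-sound ρ))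
       stop≤ : stop ≤ suc (rule t * 2) + t * period
       stop≤ with ℕₚ.m≤n⇒m<n∨m≡n (ℕₚ.≮⇒≥ t≮T)
       ... | inj₂ refl = ℕₚ.≤-refl
       ... | inj₁ T<t  = ℕₚ.≤-trans (ℕₚ.+-monoˡ-≤ (T * period) (ℕₚ.≤-trans (ℕₚ.≤-trans (ℕₚ.n≤1+n _) (ℕₚ.*-monoˡ-≤ 2 (rule<G T))) (ℕₚ.n≤1+n _)))
         (ℕₚ.≤-trans (ℕₚ.*-monoˡ-≤ period T<t) (ℕₚ.m≤n+m (t * period) (suc (rule t * 2))))

     place-stop : place stop ≡ (T , suc (rule T * 2))
     place-stop = place-at T (suc (rule T * 2)) (ℕₚ.<⇒≤ (ℕₚ.*-monoˡ-≤ 2 (rule<G T)))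

     stop-kind : ∀ j → kindAt (suc stop) j ≡ update (rule T) j
     stop-kind j = trans (cong (λ p → rowKind (proj₂ p) j) place-stop) (cong (λ κ → κ j) (update-kind (rule T) (rule<G T)))

     -- The flag at the beginning of row 1 + ρ.
     module Flags (s₁ : Bool) where

       start : ℕ → Bool
       start zero    = s₁
       start (suc ρ) = scan (kindAt (suc ρ)) (enc (time ρ)) (start ρ) len

       flagAt : ℕ → ℕ → Bool
       flagAt ρ = scan (kindAt (suc ρ)) (enc (time ρ)) (start ρ)

       start-update : ∀ ρ t e → e < G → place ρ ≡ (t , suc (e * 2)) → start ρ ≡ scan (guard e) (enc t) true len
       start-update zero    t e e<G ()
       start-update (suc ρ) t e e<G eq = trans (cong (λ p → scan (rowKind (proj₂ p)) (enc (proj₁ p)) (start ρ) len) (place-before ρ t (e * 2) eq))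
         (trans (cong (λ κ → scan κ (enc t) (start ρ) len) (guard-kind e e<G)) (scan-reset (guard e) (enc t) (start ρ) true len-1 (guard-reset e)))

       flagAt-update : ∀ ρ t e j → e < G → place ρ ≡ (t , suc (e * 2)) → flagAt ρ j ≡ scan (guard e) (enc t) true len
       flagAt-update ρ t e j e<G eq = trans (cong (λ r → scan (rowKind r) (enc (time ρ)) (start ρ) j) (cong proj₂ eq))
         (trans (cong (λ κ → scan κ (enc (time ρ)) (start ρ) j) (update-kind e e<G))
           (trans (scan-update e (enc (time ρ)) (start ρ) j) (start-update ρ t e e<G eq)))

       rule-applies : ∀ ρ j e → e < G → ρ < stop → flagAt ρ j ≡ true → step-in ρ ≡ suc (e * 2) → e ≡ rule (time ρ) × time ρ < T
       rule-applies ρ j e e<G ρ<stop s≡ r≡ = e≡ , before-stop ρ (time ρ) ρ<stop (cong (time ρ ,_) (trans r≡ (cong (λ e → suc (e * 2)) e≡)))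
         where
         e≡ : e ≡ rule (time ρ)
         e≡ = only-rule (time ρ) e e<G (trans (sym (flagAt-update ρ (time ρ) e j e<G (cong (time ρ ,_) r≡))) s≡)

       accept-late : ∀ ρ j → j < len → ρ < stop → flagAt ρ j ≡ true → kindAt (suc ρ) j ≢ accept
       accept-late ρ j j<len ρ<stop s≡ = by-row (classify (step-in ρ) (proj₁ (place-sound ρ))) refl
         where
         not-guard : ∀ {κ} → Guard κ → κ ≢ accept
         not-guard idle ()
         not-guard test ()
         not-guard reset ()
         not-prescribed : ∀ {x j b} → ¬ Prescribes x j accept b
         not-prescribed ()
         by-row : ∀ {r} → Row r → step-in ρ ≡ r → kindAt (suc ρ) j ≢ accept
         by-row (guardRow e e<G) r≡ κ≡ = not-guard (guards e j) (trans (cong (λ κ → κ j) (sym (guard-kind e e<G))) (trans (cong (λ r → rowKind r j) (sym r≡)) κ≡))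
         by-row copyRow r≡ κ≡ with trans (cong (λ κ → κ j) (sym copy-kind)) (trans (cong (λ r → rowKind r j) (sym r≡)) κ≡)
         ... | ()
         by-row (updateRow e e<G) r≡ κ≡ = let e≡ , t<T = rule-applies ρ j e e<G ρ<stop s≡ r≡ in
           not-prescribed (subst (λ κ → Prescribes (enc (time ρ)) j κ (enc (suc (time ρ)) j))
             (trans (cong (λ e → update e j) (sym e≡)) (trans (cong (λ κ → κ j) (sym (update-kind e e<G))) (trans (cong (λ r → rowKind r j) (sym r≡)) κ≡)))
             (next (time ρ) t<T j j<len))

     module Rejecting (rejects : update (rule T) 0 ≡ reject) (d : ℕ → ℕ) (admissible : Admissible C d) where

       δ : ℕ → Maybe Letter
       δ i = decode (d i)

       related : ∀ k i → relation k (δ i) (δ (shift k + i)) ≡ true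
       related k i = proj₂ (admissible i) k

       Alive : ℕ → Set
       Alive i = ∃ λ l → δ i ≡ just l

       alive? : ∀ i → Alive i ⊎ δ i ≡ nothing
       alive? i with δ i
       ... | just l  = inj₁ (l , refl)
       ... | nothing = inj₂ refl

       alive-before : ∀ i → Alive (suc i) → Alive i
       alive-before i (l , eq) with alive? i
       ... | inj₁ a = a
       ... | inj₂ n with trans (sym (cong₂ adjacent n eq)) (related 0F i)
       ...   | ()

       alive-below : ∀ k i → Alive (k + i) → Alive i
       alive-below zero    i a = a
       alive-below (suc k) i a = alive-below k i (alive-before (k + i) a)

       position-period : ∀ ρ j → position (period + ρ) j ≡ period * len + position ρ j
       position-period ρ j = lemma period ρ j len
         where
         lemma : ∀ p ρ j l → j + (p + ρ) * l ≡ p * l + (j + ρ * l)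
         lemma = solve-∀

       kind-early : ∀ ρ j → j < len → ρ ≤ period → ∀ {κ l} → δ (position ρ j) ≡ just (κ , l) → κ ≡ kindAt ρ j
       kind-early ρ j j<len ρ≤ eq with program ρ j j<len
       ... | inj₁ (_ , l , eq′) = ==ᴷ⇒≡ (trans (sym (cong₂ initial eq eq′)) (proj₁ (admissible (position ρ j))))
       ... | inj₂ (p<ρ , _)     = ⊥-elim (ℕₚ.<⇒≱ p<ρ ρ≤)

       kind-known : ∀ n ρ j → ρ ≤ n → j < len → ∀ {κ l} → δ (position ρ j) ≡ just (κ , l) → κ ≡ kindAt ρ j
       kind-known n ρ j ρ≤n j<len eq with ρ ≤? period
       ... | yes ρ≤ = kind-early ρ j j<len ρ≤ eq
       kind-known zero    zero j ρ≤n j<len eq | no ρ≰ = ⊥-elim (ρ≰ z≤n)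
       kind-known (suc n) ρ j ρ≤n j<len {κ} eq | no ρ≰ = subst (λ ρ → κ ≡ kindAt ρ j) ρ≡ (trans (sym same) (sym (kindAt-period ρ₁ j)))
         where
         ρ₁ = ρ ∸ suc period
         ρ≡ : period + suc ρ₁ ≡ ρ
         ρ≡ = trans (ℕₚ.+-suc period ρ₁) (ℕₚ.m+[n∸m]≡n (ℕₚ.≰⇒> ρ≰))
         ρ₁≤ : suc ρ₁ ≤ n
         ρ₁≤ = ℕₚ.≤-pred (ℕₚ.≤-trans (s≤s (ℕₚ.m≤n+m (suc ρ₁) (G * 2))) (subst (_≤ suc n) (sym ρ≡) ρ≤n))
         eq′ : δ (period * len + position (suc ρ₁) j) ≡ just (κ , _)
         eq′ = trans (cong δ (trans (sym (position-period (suc ρ₁) j)) (cong (λ ρ → position ρ j) ρ≡))) eq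
         earlier : Alive (position (suc ρ₁) j)
         earlier = alive-below (period * len) _ (_ , eq′)
         κ₁ = proj₁ (proj₁ earlier)
         κ₁≡ : κ₁ ≡ kindAt (suc ρ₁) j
         κ₁≡ = kind-known n (suc ρ₁) j ρ₁≤ j<len (proj₂ earlier)
         same : kindAt (suc ρ₁) j ≡ κ
         same = ==ᴷ⇒≡ (trans (cong (_∨ (kindAt (suc ρ₁) j ==ᴷ κ)) (sym (row-noLoad ρ₁ j)))
           (trans (cong (λ κ₁ → isLoad κ₁ ∨ (κ₁ ==ᴷ κ)) (sym κ₁≡))
             (trans (sym (cong₂ periodic (proj₂ earlier) eq′)) (related 3F (position (suc ρ₁) j)))))

       load-alive : ∀ j → j < len → ∃₂ λ x y → ∃ λ s → δ (position 0 j) ≡ just (load j , x , y , s)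
       load-alive j j<len with alive? (position 0 j) | program 0 j j<len
       ... | inj₂ n | inj₁ (_ , l , eq′) with trans (cong not (sym (load-isLoad j))) (trans (sym (cong₂ initial n eq′)) (proj₁ (admissible (position 0 j))))
       ...   | ()
       load-alive j j<len | inj₁ ((κ , x , y , s) , eq) | inj₁ _ with kind-early 0 j j<len z≤n eq
       ... | refl = x , y , s , eq

       FlaggedAt : ℕ → Bool → Set
       FlaggedAt i s = ∃₂ λ κ x → ∃ λ y → δ i ≡ just (κ , x , y , s)

       advance : ∀ i κ x y s → δ i ≡ just (κ , x , y , s) → ends κ s ≡ false → FlaggedAt (suc i) (flag κ x s) × consistent κ x y s ≡ true
       advance i κ x y s eq no-end with δ (suc i) in eq′ | related 0F i
       ... | just (κ′ , x′ , y′ , s′) | rel rewrite eq =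
         let p , q = ∧-true rel in (κ′ , x′ , y′ , cong (λ s → just (κ′ , x′ , y′ , s)) (==⇒≡ p)) , q
       ... | nothing | rel rewrite eq with trans (sym no-end) rel
       ...   | ()

       load-noEnd : ∀ j s → ends (load j) s ≡ false
       load-noEnd j s with load-bit j
       ... | inj₁ (eq , _) rewrite eq = refl
       ... | inj₂ (eq , _) rewrite eq = refl

       load-next : ∀ j → j < len → ∃₂ λ x s → δ (position 0 j) ≡ just (load j , x , enc 0 j , s)
       load-next j j<len = let x , y , s , eq = load-alive j j<len
                               q = proj₂ (advance _ _ x y s eq (load-noEnd j s))
                           in x , s , trans eq (cong (λ y → just (load j , x , y , s)) (bit-loaded x y s q))
         where
         bit-loaded : ∀ x y s → consistent (load j) x y s ≡ true → y ≡ enc 0 j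
         bit-loaded x y s q with load-bit j
         ... | inj₁ (eq , b) rewrite eq = trans (==⇒≡ (proj₁ (∧-true q))) (sym b)
         ... | inj₂ (eq , b) rewrite eq = trans (==⇒≡ (proj₁ (∧-true q))) (sym b)

       first-flag : ∃ λ s → FlaggedAt (position 1 0) s
       first-flag = let x , s , eq = load-next len-1 ℕₚ.≤-refl in _ , proj₁ (advance _ _ x _ s eq (load-noEnd len-1 s))

       open Flags (proj₁ first-flag)

       Known : ℕ → ℕ → Bool → Bool → Set
       Known ρ j x y = x ≡ enc (time ρ) j × (suc (rule (time ρ) * 2) < step-in ρ → y ≡ enc (suc (time ρ)) j)

       -- The next bit is known only below the update row of the rule that applies.
       Expected : ℕ → Set
       Expected ρ = ∀ j → j < len → ∃ λ y → δ (position (suc ρ) j) ≡ just (kindAt (suc ρ) j , enc (time ρ) j , y , flagAt ρ j)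
                                         × (suc (rule (time ρ) * 2) < step-in ρ → y ≡ enc (suc (time ρ)) j)

       Prepared : ℕ → Set
       Prepared ρ = FlaggedAt (position (suc ρ) 0) (start ρ) ×
         ∀ j → j < len → ∀ {κ x y s} → δ (position (suc ρ) j) ≡ just (κ , x , y , s) → Known ρ j x y

       end-only-accept : ∀ κ s → ends κ s ≡ true → κ ≡ accept × s ≡ true
       end-only-accept accept true _ = refl , refl

       no-end : ∀ ρ → ρ < stop → ∀ j → j < len → ends (kindAt (suc ρ) j) (flagAt ρ j) ≡ false
       no-end ρ ρ<stop j j<len with ends (kindAt (suc ρ) j) (flagAt ρ j) in eq
       ... | false = refl
       ... | true  = let κ≡ , s≡ = end-only-accept (kindAt (suc ρ) j) _ eq in ⊥-elim (accept-late ρ j j<len ρ<stop s≡ κ≡)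

       scan-row : ∀ ρ → ρ < stop → Prepared ρ → ∀ j → j ≤ len → FlaggedAt (j + suc ρ * len) (flagAt ρ j)
       letter : ∀ ρ → ρ < stop → Prepared ρ → ∀ j → j < len →
                ∃ λ y → δ (position (suc ρ) j) ≡ just (kindAt (suc ρ) j , enc (time ρ) j , y , flagAt ρ j) × Known ρ j (enc (time ρ) j) y

       scan-row ρ ρ<stop prep zero    _     = proj₁ prep
       scan-row ρ ρ<stop prep (suc j) j<len = let y , eq , _ = letter ρ ρ<stop prep j j<len in
         proj₁ (advance _ _ _ y _ eq (no-end ρ ρ<stop j j<len))

       letter ρ ρ<stop prep j j<len with scan-row ρ ρ<stop prep j (ℕₚ.<⇒≤ j<len)
       ... | κ , x , y , eq with kind-known (suc ρ) (suc ρ) j ℕₚ.≤-refl j<len eq | proj₂ prep j j<len eq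
       ... | refl | refl , known = y , eq , refl , known

       expected : ∀ ρ → ρ < stop → Prepared ρ → Expected ρ
       expected ρ ρ<stop prep j j<len = let y , eq , _ , known = letter ρ ρ<stop prep j j<len in y , eq , known

       determined : ∀ ρ → ρ < stop → Expected ρ → step-in ρ ≡ suc (rule (time ρ) * 2) →
                    ∀ j → j < len → ∀ {y} → δ (position (suc ρ) j) ≡ just (kindAt (suc ρ) j , enc (time ρ) j , y , flagAt ρ j) → y ≡ enc (suc (time ρ)) j
       determined ρ ρ<stop exp r≡ j j<len {y} eq = by-kind (next t t<T j j<len) refl
         where
         t = time ρ
         e = rule t
         t<T : t < T
         t<T = before-stop ρ t ρ<stop (cong (t ,_) r≡)
         κ≡ : ∀ j → kindAt (suc ρ) j ≡ update e j
         κ≡ j = trans (cong (λ r → rowKind r j) r≡) (cong (λ κ → κ j) (update-kind e (rule<G t)))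
         s≡ : ∀ j → flagAt ρ j ≡ true
         s≡ j = trans (flagAt-update ρ t e j (rule<G t) (cong (t ,_) r≡)) (rule-matches t)
         eq′ : δ (position (suc ρ) j) ≡ just (update e j , enc t j , y , true)
         eq′ = trans eq (cong₂ (λ κ s → just (κ , enc t j , y , s)) (κ≡ j) (s≡ j))
         local : consistent (update e j) (enc t j) y true ≡ true
         local = proj₂ (advance _ _ _ _ _ eq′ (subst₂ (λ κ s → ends κ s ≡ false) (κ≡ j) (s≡ j) (no-end ρ ρ<stop j j<len)))
         at-row : ∀ j → j < len → ∃ λ y → δ (position (suc ρ) j) ≡ just (update e j , enc t j , y , true)
         at-row j j<len = let y , eq , _ = exp j j<len in y , trans eq (cong₂ (λ κ s → just (κ , enc t j , y , s)) (κ≡ j) (s≡ j))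
         by-kind : ∀ {κ b} → Prescribes (enc t) j κ b → update e j ≡ κ → y ≡ b
         by-kind set0 κ≡ = not-true (subst (λ κ → consistent κ (enc t j) y true ≡ true) κ≡ local)
           where
           not-true : ∀ {b} → not b ≡ true → b ≡ false
           not-true {false} _ = refl
         by-kind set1 κ≡ = subst (λ κ → consistent κ (enc t j) y true ≡ true) κ≡ local
         by-kind unchanged κ≡ = sym (==⇒≡ (subst (λ κ → consistent κ (enc t j) y true ≡ true) κ≡ local))
         by-kind (fromRight j+W<) κ≡ = ==⇒≡ (proj₁ (∧-true (trans (sym (cong (λ κ → oriented fromRight κ y true (enc t (j + W)) ∧ oriented fromLeft (update e (j + W)) y′ true (enc t j)) κ≡))
           (trans (sym (cong₂ sideways eq′ (trans (cong δ (lemma W j (suc ρ * len))) (proj₂ (at-row (j + W) j+W<))))) (related 1F (position (suc ρ) j))))))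
           where
           y′ = proj₁ (at-row (j + W) j+W<)
           lemma : ∀ W j p → W + (j + p) ≡ (j + W) + p
           lemma = solve-∀
         by-kind (fromLeft {j′} j≡) κ≡ = ==⇒≡ (proj₂ (∧-true {oriented fromRight (update e j′) y′ true (enc t j)}
           (trans (sym (cong (λ κ → oriented fromRight (update e j′) y′ true (enc t j) ∧ oriented fromLeft κ y true (enc t j′)) κ≡))
             (trans (sym (cong₂ sideways (proj₂ (at-row j′ j′<)) (trans (cong δ (trans (sym (ℕₚ.+-assoc W j′ _)) (cong (λ j → position (suc ρ) j) (sym j≡)))) eq′))) (related 1F (position (suc ρ) j′))))))
           where
           j′< : j′ < len
           j′< = ℕₚ.≤-<-trans (subst (j′ ≤_) (sym j≡) (ℕₚ.m≤n+m j′ W)) j<len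
           y′ = proj₁ (at-row j′ j′<)

       bump-case : ∀ ρ → (step-in ρ ≡ G * 2 × place (suc ρ) ≡ (suc (time ρ) , 0)) ⊎ (step-in ρ < G * 2 × place (suc ρ) ≡ (time ρ , suc (step-in ρ)))
       bump-case ρ = cases (ℕₚ.m≤n⇒m<n∨m≡n (proj₁ (place-sound ρ)))
         where
         cases : step-in ρ < G * 2 ⊎ step-in ρ ≡ G * 2 → _
         cases (inj₁ r<) = inj₂ (r< , bump-inner (time ρ) (step-in ρ) r<)
         cases (inj₂ r≡) = inj₁ (r≡ , trans (cong (λ r → bump (time ρ , r)) r≡) (bump-last (time ρ)))

       rowwise-copy : ∀ κ x y s κ′ x′ y′ s′ → isCopy κ ≡ true → rowwise (just (κ , x , y , s)) (just (κ′ , x′ , y′ , s′)) ≡ true → x′ ≡ y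
       rowwise-copy κ x y s κ′ x′ y′ s′ c rel with isCopy κ
       rowwise-copy κ x y s κ′ x′ y′ s′ refl rel | true = ==⇒≡ rel

       rowwise-keep : ∀ κ x y s κ′ x′ y′ s′ → isCopy κ ≡ false → rowwise (just (κ , x , y , s)) (just (κ′ , x′ , y′ , s′)) ≡ true → x′ ≡ x × y′ ≡ y
       rowwise-keep κ x y s κ′ x′ y′ s′ c rel with isCopy κ
       rowwise-keep κ x y s κ′ x′ y′ s′ refl rel | false = let p , q = ∧-true {x′ == x} rel in ==⇒≡ p , ==⇒≡ q

       below-row : ∀ ρ j → len + position ρ j ≡ position (suc ρ) j
       below-row ρ j = x∙yz≈y∙xz len j (ρ * len)

       prepare-first : Prepared 0
       prepare-first = proj₂ first-flag , λ j j<len {κ′} {x′} {y′} {s′} eq →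
         let x , s , eq₀ = load-next j j<len in
         rowwise-copy (load j) x (enc 0 j) s κ′ x′ y′ s′ (load-isCopy j) (trans (sym (cong₂ rowwise eq₀ (trans (cong δ (below-row 0 j)) eq))) (related 2F (position 0 j))) , λ ()

       prepare-next : ∀ ρ → ρ < stop → Prepared ρ → Prepared (suc ρ)
       prepare-next ρ ρ<stop prep = scan-row ρ ρ<stop prep len ℕₚ.≤-refl , λ j j<len {κ} {x′} {y′} {s′} eq →
         let y , eq₀ , known = expected ρ ρ<stop prep j j<len
             rel = trans (sym (cong₂ rowwise eq₀ (trans (cong δ (below-row (suc ρ) j)) eq))) (related 2F (position (suc ρ) j))
         in by-case (bump-case ρ) j j<len {y} {κ} {x′} {y′} {s′} eq₀ known rel
         where
         suc-rule< : suc (rule (time ρ) * 2) < G * 2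
         suc-rule< = ℕₚ.*-monoˡ-≤ 2 (rule<G (time ρ))
         by-case : (step-in ρ ≡ G * 2 × place (suc ρ) ≡ (suc (time ρ) , 0)) ⊎ (step-in ρ < G * 2 × place (suc ρ) ≡ (time ρ , suc (step-in ρ))) →
           ∀ j → j < len → ∀ {y κ x′ y′ s′} → δ (position (suc ρ) j) ≡ just (kindAt (suc ρ) j , enc (time ρ) j , y , flagAt ρ j) →
           (suc (rule (time ρ) * 2) < step-in ρ → y ≡ enc (suc (time ρ)) j) →
           rowwise (just (kindAt (suc ρ) j , enc (time ρ) j , y , flagAt ρ j)) (just (κ , x′ , y′ , s′)) ≡ true → Known (suc ρ) j x′ y′
         by-case (inj₁ (r≡ , eq)) j j<len {y} {κ} {x′} {y′} {s′} eq₀ known rel =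
           trans (rowwise-copy (kindAt (suc ρ) j) (enc (time ρ) j) y (flagAt ρ j) κ x′ y′ s′ (trans (cong (λ r → isCopy (rowKind r j)) r≡) (cong (λ κ → isCopy (κ j)) copy-kind)) rel)
             (trans (known (subst (suc (rule (time ρ) * 2) <_) (sym r≡) suc-rule<)) (cong (λ p → enc (proj₁ p) j) (sym eq))) ,
           λ lt → ⊥-elim (ℕₚ.n≮0 (subst (suc (rule (time (suc ρ)) * 2) <_) (cong proj₂ eq) lt))
         by-case (inj₂ (r< , eq)) j j<len {y} {κ} {x′} {y′} {s′} eq₀ known rel = trans (proj₁ kept) (cong (λ p → enc (proj₁ p) j) (sym eq)) , later
           where
           kept : x′ ≡ enc (time ρ) j × y′ ≡ y
           kept = rowwise-keep (kindAt (suc ρ) j) (enc (time ρ) j) y (flagAt ρ j) κ x′ y′ s′ (inner-noCopy (step-in ρ) r< j) rel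
           later : suc (rule (time (suc ρ)) * 2) < step-in (suc ρ) → y′ ≡ enc (suc (time (suc ρ))) j
           later lt rewrite eq with ℕₚ.m≤n⇒m<n∨m≡n (ℕₚ.≤-pred lt)
           ... | inj₁ lt′ = trans (proj₂ kept) (known lt′)
           ... | inj₂ r≡  = trans (proj₂ kept) (determined ρ ρ<stop (expected ρ ρ<stop prep) (sym r≡) j j<len eq₀)

       prepared : ∀ ρ → ρ ≤ stop → Prepared ρ
       prepared zero    _      = prepare-first
       prepared (suc ρ) ρ<stop = prepare-next ρ ρ<stop (prepared ρ (ℕₚ.<⇒≤ ρ<stop))

       contradiction : ⊥
       contradiction with proj₁ (prepared stop ℕₚ.≤-refl)
       ... | κ , x , y , eq = absurd (δ (suc (position (suc stop) 0))) (trans (cong (λ l → adjacent l (δ (suc (position (suc stop) 0)))) (sym eq′)) (related 0F (position (suc stop) 0)))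
         where
         s≡ : start stop ≡ true
         s≡ = trans (start-update stop T (rule T) (rule<G T) place-stop) (rule-matches T)
         κ≡ : κ ≡ reject
         κ≡ = trans (kind-known (suc stop) (suc stop) 0 ℕₚ.≤-refl z<s eq) (trans (stop-kind 0) rejects)
         eq′ : δ (position (suc stop) 0) ≡ just (reject , x , y , true)
         eq′ = trans eq (cong₂ (λ κ s → just (κ , x , y , s)) κ≡ s≡)
         absurd : ∀ l → adjacent (just (reject , x , y , true)) l ≢ true
         absurd nothing ()
         absurd (just (_ , _ , _ , true)) ()
         absurd (just (_ , _ , _ , false)) ()

     module Accepting (accepts : update (rule T) 0 ≡ accept) where
       open Flags true
       private module Columns = Place len-1

       letterAt : ℕ → ℕ → Letter
       letterAt zero    j = load j , false , enc 0 j , true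
       letterAt (suc ρ) j = kindAt (suc ρ) j , enc (time ρ) j , enc (suc (time ρ)) j , flagAt ρ j

       final : ℕ
       final = position (suc stop) 0

       δ : ℕ → Maybe Letter
       δ i with i ≤? final
       ... | yes _ = just (letterAt (proj₁ (Columns.place i)) (proj₂ (Columns.place i)))
       ... | no _  = nothing

       δ-alive : ∀ ρ j → j < len → position ρ j ≤ final → δ (position ρ j) ≡ just (letterAt ρ j)
       δ-alive ρ j j<len p≤ with position ρ j ≤? final
       ... | yes _ = cong (λ p → just (letterAt (proj₁ p) (proj₂ p))) (Columns.place-at ρ j (ℕₚ.≤-pred j<len))
       ... | no p≰ = ⊥-elim (p≰ p≤)

       δ-dead : ∀ i → final < i → δ i ≡ nothing
       δ-dead i final<i with i ≤? final
       ... | yes i≤ = ⊥-elim (ℕₚ.<⇒≱ final<i i≤)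
       ... | no _   = refl

       transcript : List ℕ
       transcript = List.applyUpTo (λ i → code (δ i)) (suc final)

       transcript≤ : All (_≤ maxDigit) transcript
       transcript≤ = go (λ i → δ i) (suc final)
         where
         go : ∀ (f : ℕ → Maybe Letter) n → All (_≤ maxDigit) (List.applyUpTo (λ i → code (f i)) n)
         go f zero    = []
         go f (suc n) = code≤ (f 0) ∷ go (f ∘ suc) n

       transcript-δ : ∀ i → decode (digit transcript i) ≡ δ i
       transcript-δ i with digit-applyUpTo (λ i → code (δ i)) (suc final) i
       ... | inj₁ (_ , eq)  = trans (cong decode eq) (decode-code (δ i))
       ... | inj₂ (f<i , eq) = trans (cong decode eq) (sym (δ-dead i f<i))

       data Shape (t j : ℕ) : Kind → Set where
         guarded    : ∀ {κ} → Guard κ → Shape t j κ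
         copy       : Shape t j copy
         load0      : Shape t j load0
         load1      : Shape t j load1
         accept     : Shape t j accept
         prescribes : ∀ {κ} → Prescribes (enc t) j κ (enc (suc t) j) → Shape t j κ

       shape : ∀ ρ j → j < len → ρ < stop → flagAt ρ j ≡ true → Shape (time ρ) j (kindAt (suc ρ) j)
       shape ρ j j<len ρ<stop s≡ = by-row (classify (step-in ρ) (proj₁ (place-sound ρ))) refl
         where
         by-row : ∀ {r} → Row r → step-in ρ ≡ r → Shape (time ρ) j (rowKind r j)
         by-row (guardRow e e<G) r≡ rewrite guard-kind e e<G = guarded (guards e j)
         by-row copyRow r≡ rewrite copy-kind = copy
         by-row (updateRow e e<G) r≡ rewrite update-kind e e<G =
           let e≡ , t<T = rule-applies ρ j e e<G ρ<stop s≡ r≡ in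
           prescribes (subst (λ e → Prescribes (enc (time ρ)) j (update e j) (enc (suc (time ρ)) j)) (sym e≡) (next (time ρ) t<T j j<len))

       before-final : ∀ ρ j → position (suc ρ) j < final → ρ < stop
       before-final ρ j lt = ℕₚ.≤-pred (ℕₚ.*-cancelʳ-< len (suc ρ) (suc stop) (ℕₚ.≤-<-trans (ℕₚ.m≤n+m (suc ρ * len) j) lt))

       final-shape : Shape T 0 (kindAt (suc stop) 0)
       final-shape = subst (Shape T 0) (sym (trans (stop-kind 0) accepts)) accept

       alive-shape : ∀ ρ j → j < len → position (suc ρ) j ≤ final → flagAt ρ j ≡ true → Shape (time ρ) j (kindAt (suc ρ) j)
       alive-shape ρ j j<len p≤ s≡ with ℕₚ.m≤n⇒m<n∨m≡n p≤
       ... | inj₁ p<  = shape ρ j j<len (before-final ρ j p<) s≡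
       ... | inj₂ eq  = by-place (trans (sym (Columns.place-at (suc ρ) j (ℕₚ.≤-pred j<len))) (trans (cong Columns.place eq) (Columns.place-at (suc stop) 0 z≤n)))
         where
         by-place : (suc ρ , j) ≡ (suc stop , 0) → Shape (time ρ) j (kindAt (suc ρ) j)
         by-place refl = subst (λ t → Shape t 0 (kindAt (suc stop) 0)) (sym (cong proj₁ place-stop)) final-shape

       right-shape : ∀ {t j} → Shape t j fromRight → j + W < len × enc (suc t) j ≡ enc t (j + W)
       right-shape (guarded ())
       right-shape {t} {j} (prescribes p) with enc (suc t) j | p
       ... | _ | fromRight lt = lt , refl

       left-shape : ∀ {t j} → Shape t j fromLeft → ∃ λ j′ → j ≡ W + j′ × enc (suc t) j ≡ enc t j′
       left-shape (guarded ())
       left-shape {t} {j} (prescribes p) with enc (suc t) j | p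
       ... | _ | fromLeft eq = _ , eq , refl

       consistent-row : ∀ ρ j → j < len → ρ < stop → consistent (kindAt (suc ρ) j) (enc (time ρ) j) (enc (suc (time ρ)) j) (flagAt ρ j) ≡ true
       consistent-row ρ j j<len ρ<stop with flagAt ρ j in s≡
       ... | true = by-shape (shape ρ j j<len ρ<stop s≡) (accept-late ρ j j<len ρ<stop s≡) (row-noLoad ρ j)
         where
         by-shape : ∀ {κ t} → Shape t j κ → κ ≢ accept → isLoad κ ≡ false → consistent κ (enc t j) (enc (suc t) j) true ≡ true
         by-shape (guarded idle)  _ _ = refl
         by-shape (guarded test)  _ _ = refl
         by-shape (guarded reset) _ _ = refl
         by-shape copy   _ _  = refl
         by-shape load0  _ ()
         by-shape load1  _ ()
         by-shape accept ≢ _ = ⊥-elim (≢ refl)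
         by-shape {κ} {t} (prescribes p) _ _ with enc (suc t) j | p
         ... | .false | set0 = refl
         ... | .true  | set1 = refl
         ... | _ | unchanged = ==-refl (enc t j)
         ... | _ | fromRight _ = refl
         ... | _ | fromLeft _ = refl
       ... | false = flag-down (kindAt (suc ρ) j) (enc (time ρ) j) (enc (suc (time ρ)) j) (row-noLoad ρ j)
         where
         flag-down : ∀ κ x y → isLoad κ ≡ false → consistent κ x y false ≡ true
         flag-down κ x y h rewrite h = refl

       data Cell : ℕ → Set where
         cell : ∀ ρ j → j < len → Cell (position ρ j)

       locate : ∀ i → Cell i
       locate i = let j≤ , eq = Columns.place-sound i in subst Cell eq (cell (proj₁ (Columns.place i)) (proj₂ (Columns.place i)) (s≤s j≤))

       dead-relation : ∀ k l → k ≢ 0F → relation k l nothing ≡ true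
       dead-relation 0F l k≢0 = ⊥-elim (k≢0 refl)
       dead-relation 1F nothing  _ = refl
       dead-relation 1F (just _) _ = refl
       dead-relation 2F nothing  _ = refl
       dead-relation 2F (just _) _ = refl
       dead-relation 3F nothing  _ = refl
       dead-relation 3F (just _) _ = refl

       flag-load : ∀ j → flag (load j) false true ≡ true
       flag-load j with load-bit j
       ... | inj₁ (eq , _) rewrite eq = refl
       ... | inj₂ (eq , _) rewrite eq = refl

       consistent-load : ∀ j → consistent (load j) false (enc 0 j) true ≡ true
       consistent-load j with load-bit j
       ... | inj₁ (eq , b) rewrite eq | b = refl
       ... | inj₂ (eq , b) rewrite eq | b = refl

       letter-flag : ℕ → ℕ → Bool
       letter-flag zero    j = true
       letter-flag (suc ρ) j = flagAt ρ j

       flag-row : ∀ ρ → letter-flag (suc ρ) 0 ≡ letter-flag ρ len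
       flag-row zero    = refl
       flag-row (suc ρ) = refl

       letter-flag-correct : ∀ ρ j → letterAt ρ j ≡ (kindAt ρ j , proj₁ (proj₂ (letterAt ρ j)) , proj₁ (proj₂ (proj₂ (letterAt ρ j))) , letter-flag ρ j)
       letter-flag-correct zero    j = refl
       letter-flag-correct (suc ρ) j = refl

       adjacent-intro : ∀ ρ j l′ → j < len → position ρ j < final → proj₂ (proj₂ (proj₂ l′)) ≡ letter-flag ρ (suc j) → adjacent (just (letterAt ρ j)) (just l′) ≡ true
       adjacent-intro zero j l′ j<len lt eq = cong₂ _∧_ (trans (cong₂ _==_ eq (flag-load j)) refl) (consistent-load j)
       adjacent-intro (suc ρ) j l′ j<len lt eq = cong₂ _∧_ (trans (cong (_== flagAt ρ (suc j)) eq) (==-refl (flagAt ρ (suc j))))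
         (consistent-row ρ j j<len (before-final ρ j lt))

       adjacent-δ : ∀ {i} → Cell i → i < final → adjacent (δ i) (δ (suc i)) ≡ true
       adjacent-δ (cell ρ j j<len) lt = by-end (ℕₚ.m≤n⇒m<n∨m≡n j<len)
         where
         here : δ (position ρ j) ≡ just (letterAt ρ j)
         here = δ-alive ρ j j<len (ℕₚ.<⇒≤ lt)
         flag-of : ∀ ρ j → proj₂ (proj₂ (proj₂ (letterAt ρ j))) ≡ letter-flag ρ j
         flag-of ρ j = cong (λ l → proj₂ (proj₂ (proj₂ l))) (letter-flag-correct ρ j)
         by-end : suc j < len ⊎ suc j ≡ len → adjacent (δ (position ρ j)) (δ (suc (position ρ j))) ≡ true
         by-end (inj₁ lt′) = trans (cong₂ adjacent here (δ-alive ρ (suc j) lt′ lt)) (adjacent-intro ρ j (letterAt ρ (suc j)) j<len lt (flag-of ρ (suc j)))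
         by-end (inj₂ eq)  = trans (cong₂ adjacent here (trans (cong (λ k → δ (k + ρ * len)) eq) (δ-alive (suc ρ) 0 z<s (subst (λ k → k + ρ * len ≤ final) eq lt))))
           (adjacent-intro ρ j (letterAt (suc ρ) 0) j<len lt (trans (flag-of (suc ρ) 0) (trans (flag-row ρ) (cong (letter-flag ρ) (sym eq)))))

       adjacent-final : ∀ i → i ≡ final → adjacent (δ i) (δ (suc i)) ≡ true
       adjacent-final i refl = trans (cong₂ adjacent (δ-alive (suc stop) 0 z<s ℕₚ.≤-refl) (δ-dead (suc final) ℕₚ.≤-refl))
         (cong₂ ends (trans (stop-kind 0) accepts) final-flag)
         where
         final-flag : flagAt stop 0 ≡ true
         final-flag = trans (flagAt-update stop T (rule T) 0 (rule<G T) place-stop) (rule-matches T)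

       rowwise-intro : ∀ κ x y s κ′ x′ y′ s′ → (isCopy κ ≡ true × x′ ≡ y) ⊎ (isCopy κ ≡ false × x′ ≡ x × y′ ≡ y) →
                       rowwise (just (κ , x , y , s)) (just (κ′ , x′ , y′ , s′)) ≡ true
       rowwise-intro κ x y s κ′ x′ y′ s′ h with isCopy κ
       rowwise-intro κ x y s κ′ x′ y′ s′ (inj₁ (_ , refl)) | true = ==-refl x′
       rowwise-intro κ x y s κ′ x′ y′ s′ (inj₂ (() , _)) | true
       rowwise-intro κ x y s κ′ x′ y′ s′ (inj₁ (() , _)) | false
       rowwise-intro κ x y s κ′ x′ y′ s′ (inj₂ (_ , refl , refl)) | false = cong₂ _∧_ (==-refl x′) (==-refl y′)

       rowwise-letters : ∀ ρ j → rowwise (just (letterAt ρ j)) (just (letterAt (suc ρ) j)) ≡ true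
       rowwise-letters zero j = rowwise-intro (load j) false (enc 0 j) true (kindAt 1 j) (enc 0 j) (enc 1 j) (flagAt 0 j) (inj₁ (load-isCopy j , refl))
       rowwise-letters (suc ρ) j = rowwise-intro (kindAt (suc ρ) j) (enc (time ρ) j) (enc (suc (time ρ)) j) (flagAt ρ j) (kindAt (suc (suc ρ)) j)
         (enc (time (suc ρ)) j) (enc (suc (time (suc ρ))) j) (flagAt (suc ρ) j)
         (by-case (ℕₚ.m≤n⇒m<n∨m≡n (proj₁ (place-sound ρ))))
         where
         by-case : step-in ρ < G * 2 ⊎ step-in ρ ≡ G * 2 →
           (isCopy (kindAt (suc ρ) j) ≡ true × enc (time (suc ρ)) j ≡ enc (suc (time ρ)) j) ⊎
           (isCopy (kindAt (suc ρ) j) ≡ false × enc (time (suc ρ)) j ≡ enc (time ρ) j × enc (suc (time (suc ρ))) j ≡ enc (suc (time ρ)) j)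
         by-case (inj₁ r<) = inj₂ (inner-noCopy (step-in ρ) r< j , cong (λ p → enc (proj₁ p) j) eq , cong (λ p → enc (suc (proj₁ p)) j) eq)
           where
           eq : place (suc ρ) ≡ (time ρ , suc (step-in ρ))
           eq = bump-inner (time ρ) (step-in ρ) r<
         by-case (inj₂ r≡) = inj₁ (trans (cong (λ r → isCopy (rowKind r j)) r≡) (cong (λ κ → isCopy (κ j)) copy-kind) ,
           cong (λ p → enc (proj₁ p) j) (trans (cong (λ r → bump (time ρ , r)) r≡) (bump-last (time ρ))))

       load-oriented : ∀ ω j y s x → isLoad ω ≡ false → oriented ω (load j) y s x ≡ true
       load-oriented ω j y s x unloaded = oriented-intro ω (load j) y s x λ _ κ≡ → ⊥-elim (absurd (trans (sym unloaded) (trans (cong isLoad (sym κ≡)) (load-isLoad j))))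
         where
         absurd : false ≢ true
         absurd ()

       right-ok : ∀ ρ j x′ → j < len → position (suc ρ) j ≤ final → (j + W < len → x′ ≡ enc (time ρ) (j + W)) →
                  oriented fromRight (kindAt (suc ρ) j) (enc (suc (time ρ)) j) (flagAt ρ j) x′ ≡ true
       right-ok ρ j x′ j<len p≤ h = oriented-intro fromRight (kindAt (suc ρ) j) (enc (suc (time ρ)) j) (flagAt ρ j) x′ λ s≡ κ≡ →
         let lt , eq = right-shape (subst (Shape (time ρ) j) κ≡ (alive-shape ρ j j<len p≤ s≡)) in trans eq (sym (h lt))

       left-ok : ∀ ρ j x → j < len → position (suc ρ) j ≤ final → (∀ j′ → j ≡ W + j′ → x ≡ enc (time ρ) j′) →
                 oriented fromLeft (kindAt (suc ρ) j) (enc (suc (time ρ)) j) (flagAt ρ j) x ≡ true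
       left-ok ρ j x j<len p≤ h = oriented-intro fromLeft (kindAt (suc ρ) j) (enc (suc (time ρ)) j) (flagAt ρ j) x λ s≡ κ≡ →
         let j′ , eq , y≡ = left-shape (subst (Shape (time ρ) j) κ≡ (alive-shape ρ j j<len p≤ s≡)) in trans y≡ (sym (h j′ eq))

       sideways-same : ∀ ρ j → j < len → j + W < len → position ρ (j + W) ≤ final →
                       sideways (just (letterAt ρ j)) (just (letterAt ρ (j + W))) ≡ true
       sideways-same zero j j<len j+W< p≤ = cong₂ _∧_ (load-oriented fromRight j (enc 0 j) true false refl) (load-oriented fromLeft (j + W) (enc 0 (j + W)) true false refl)
       sideways-same (suc ρ) j j<len j+W< p≤ = cong₂ _∧_
         (right-ok ρ j _ j<len (ℕₚ.≤-trans (ℕₚ.+-monoˡ-≤ (suc ρ * len) (ℕₚ.m≤m+n j W)) p≤) (λ _ → refl))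
         (left-ok ρ (j + W) _ j+W< p≤ (λ j′ eq → cong (enc (time ρ)) (ℕₚ.+-cancelˡ-≡ W j j′ (trans (ℕₚ.+-comm W j) eq))))

       sideways-next : ∀ ρ j j₂ → j < len → j₂ < len → j + W ≡ len + j₂ → position (suc ρ) j₂ ≤ final → position ρ j ≤ final →
                       sideways (just (letterAt ρ j)) (just (letterAt (suc ρ) j₂)) ≡ true
       sideways-next ρ j j₂ j<len j₂<len eq p₂≤ p≤ = cong₂ _∧_ (right ρ _ p≤) (left-ok ρ j₂ _ j₂<len p₂≤ λ j′ eq′ →
           ⊥-elim (ℕₚ.<⇒≱ j<len (subst (len ≤_) (ℕₚ.+-cancelʳ-≡ W (len + j′) j (trans (rearrange eq′) (sym eq))) (ℕₚ.m≤m+n len j′))))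
         where
         rearrange : ∀ {j′} → j₂ ≡ W + j′ → (len + j′) + W ≡ len + j₂
         rearrange {j′} refl = lemma len j′ W
           where
           lemma : ∀ l j w → (l + j) + w ≡ l + (w + j)
           lemma = solve-∀
         right : ∀ ρ x′ → position ρ j ≤ final → oriented fromRight (proj₁ (letterAt ρ j)) (proj₁ (proj₂ (proj₂ (letterAt ρ j)))) (proj₂ (proj₂ (proj₂ (letterAt ρ j)))) x′ ≡ true
         right zero    x′ p≤ = load-oriented fromRight j (enc 0 j) true x′ refl
         right (suc ρ) x′ p≤ = right-ok ρ j x′ j<len p≤ λ j+W< → ⊥-elim (ℕₚ.<⇒≱ j+W< (subst (len ≤_) (sym eq) (ℕₚ.m≤m+n len j₂)))

       alive-relation : ∀ k {i} → Cell i → i ≤ final → shift k + i ≤ final → relation k (δ i) (δ (shift k + i)) ≡ true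
       alive-relation 0F c i≤ i′≤ = adjacent-δ c i′≤
       alive-relation 1F (cell ρ j j<len) i≤ i′≤ with j + W <? len
       ... | yes j+W< = trans (cong₂ sideways (δ-alive ρ j j<len i≤) (trans (cong δ move) (δ-alive ρ (j + W) j+W< (subst (_≤ final) move i′≤))))
                          (sideways-same ρ j j<len j+W< (subst (_≤ final) move i′≤))
         where
         move : W + position ρ j ≡ position ρ (j + W)
         move = x∙yz≈yx∙z W j (ρ * len)
       ... | no j+W≮ = trans (cong₂ sideways (δ-alive ρ j j<len i≤) (trans (cong δ move) (δ-alive (suc ρ) j₂ j₂<len (subst (_≤ final) move i′≤))))
                         (sideways-next ρ j j₂ j<len j₂<len eq (subst (_≤ final) move i′≤) i≤)
         where
         j₂ = (j + W) ∸ len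
         eq : j + W ≡ len + j₂
         eq = sym (ℕₚ.m+[n∸m]≡n (ℕₚ.≮⇒≥ j+W≮))
         j₂<len : j₂ < len
         j₂<len = ℕₚ.+-cancelˡ-< len j₂ len (subst (_< len + len) eq (ℕₚ.+-mono-< j<len W<len))
         move : W + position ρ j ≡ position (suc ρ) j₂
         move = trans (lemma W j (ρ * len)) (trans (cong (_+ ρ * len) eq) (lemma′ len j₂ (ρ * len)))
           where
           lemma : ∀ w j p → w + (j + p) ≡ (j + w) + p
           lemma = solve-∀
           lemma′ : ∀ l j p → (l + j) + p ≡ j + (l + p)
           lemma′ = solve-∀
       alive-relation 2F (cell ρ j j<len) i≤ i′≤ = trans (cong₂ rowwise (δ-alive ρ j j<len i≤) (trans (cong δ move) (δ-alive (suc ρ) j j<len (subst (_≤ final) move i′≤))))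
           (rowwise-letters ρ j)
         where
         move : len + position ρ j ≡ position (suc ρ) j
         move = x∙yz≈y∙xz len j (ρ * len)
       alive-relation 3F (cell ρ j j<len) i≤ i′≤ = trans (cong₂ periodic (δ-alive ρ j j<len i≤) (trans (cong δ move) (δ-alive (period + ρ) j j<len (subst (_≤ final) move i′≤))))
           (same ρ)
         where
         move : period * len + position ρ j ≡ position (period + ρ) j
         move = lemma period ρ j len
           where
           lemma : ∀ p ρ j l → p * l + (j + ρ * l) ≡ j + (p + ρ) * l
           lemma = solve-∀
         same : ∀ ρ → periodic (just (letterAt ρ j)) (just (letterAt (period + ρ) j)) ≡ true
         same zero    = cong (_∨ (load j ==ᴷ kindAt (period + 0) j)) (load-isLoad j)
         same (suc ρ) = cong₂ _∨_ (row-noLoad ρ j) (trans (cong (kindAt (suc ρ) j ==ᴷ_) (kindAt-period ρ j)) (==ᴷ-refl (kindAt (suc ρ) j)))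

       letters-related : ∀ k i → relation k (δ i) (δ (shift k + i)) ≡ true
       letters-related k i = cases k (i ≤? final) (shift k + i ≤? final)
         where
         both-dead : ∀ k {l l′} → l ≡ nothing → l′ ≡ nothing → relation k l l′ ≡ true
         both-dead 0F refl refl = refl
         both-dead 1F refl refl = refl
         both-dead 2F refl refl = refl
         both-dead 3F refl refl = refl
         cases : ∀ k → Dec (i ≤ final) → Dec (shift k + i ≤ final) → relation k (δ i) (δ (shift k + i)) ≡ true
         cases k         (yes i≤) (yes i′≤) = alive-relation k (locate i) i≤ i′≤
         cases k         (no i≰)  _         = both-dead k (δ-dead i (ℕₚ.≰⇒> i≰)) (δ-dead (shift k + i) (ℕₚ.<-≤-trans (ℕₚ.≰⇒> i≰) (ℕₚ.m≤n+m i (shift k))))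
         cases 0F        (yes i≤) (no i′≰)  = adjacent-final i (ℕₚ.≤-antisym i≤ (ℕₚ.≤-pred (ℕₚ.≰⇒> i′≰)))
         cases k@(suc _) (yes i≤) (no i′≰)  = trans (cong (relation k (δ i)) (δ-dead (shift k + i) (ℕₚ.≰⇒> i′≰))) (dead-relation k (δ i) λ ())

       letters-initial : ∀ {i} → Cell i → initial (δ i) (decode (digit C i)) ≡ true
       letters-initial (cell ρ j j<len) = cases ρ (program ρ j j<len) (position ρ j ≤? final)
         where
         unconstrained : ∀ l → initial l nothing ≡ true
         unconstrained nothing  = refl
         unconstrained (just _) = refl
         cases : ∀ ρ → (ρ ≤ period × ∃ λ l → decode (digit C (position ρ j)) ≡ just (kindAt ρ j , l))
                        ⊎ (period < ρ × decode (digit C (position ρ j)) ≡ nothing) →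
                 Dec (position ρ j ≤ final) → initial (δ (position ρ j)) (decode (digit C (position ρ j))) ≡ true
         cases ρ       (inj₂ (_ , eq))     _        = trans (cong (initial (δ (position ρ j))) eq) (unconstrained (δ (position ρ j)))
         cases ρ       (inj₁ (_ , l , eq)) (yes p≤) = trans (cong₂ initial (δ-alive ρ j j<len p≤) eq)
           (trans (cong (_==ᴷ kindAt ρ j) (cong proj₁ (letter-flag-correct ρ j))) (==ᴷ-refl (kindAt ρ j)))
         cases zero    (inj₁ (_ , l , eq)) (no p≰) =
           ⊥-elim (p≰ (subst (_≤ final) (sym (ℕₚ.+-identityʳ j)) (ℕₚ.≤-trans (ℕₚ.<⇒≤ j<len) (ℕₚ.m≤m+n len (stop * len)))))
         cases (suc ρ) (inj₁ (_ , l , eq)) (no p≰) =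
           trans (cong₂ initial (δ-dead _ (ℕₚ.≰⇒> p≰)) eq) (cong not (row-noLoad ρ j))

       admissible : Admissible C (digit transcript)
       admissible i = trans (cong (λ l → initial l (decode (digit C i))) (transcript-δ i)) (letters-initial (locate i)) ,
         λ k → trans (cong₂ (relation k) (transcript-δ i) (transcript-δ (shift k + i))) (letters-related k i)

module Rows where

 open import Defs using (Symbol; blank; bit; Move; left; stay; right; Tape; tape; TM; module Run)
 open StackPrograms using (Finite; module Finiteness)
 open Finite
 open Finiteness
 open Transcripts
 open import Data.Fin using (zero; suc)
 open import Data.Integer using (+_)
 open import Data.List using (length)
 open import Data.Nat
 open import Data.Nat.Tactic.RingSolver using (solve-∀)
 open import Data.Product using (uncurry)

 module _ {g : ℕ} where

   nth : List (Symbol g) → ℕ → Symbol g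
   nth []       _       = blank
   nth (x ∷ _)  zero    = x
   nth (_ ∷ xs) (suc i) = nth xs i

   nth-beyond : ∀ xs i → length xs ≤ i → nth xs i ≡ blank
   nth-beyond []       i       _        = refl
   nth-beyond (_ ∷ xs) (suc i) (s≤s le) = nth-beyond xs i le

   cell : Tape g → ℤ → Symbol g
   cell (tape l h r) (+ zero)   = h
   cell (tape l h r) (+ suc i)  = nth r i
   cell (tape l h r) -[1+ i ]   = nth l i

   cell-right : ∀ (T : Tape g) z → cell (Defs.move right T) z ≡ cell T (ℤ.suc z)
   cell-right (tape l h [])      (+ zero)     = refl
   cell-right (tape l h [])      (+ suc i)    = refl
   cell-right (tape l h (_ ∷ _)) (+ zero)     = refl
   cell-right (tape l h (_ ∷ _)) (+ suc i)    = refl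
   cell-right (tape l h [])      -[1+ zero ]  = refl
   cell-right (tape l h [])      -[1+ suc i ] = refl
   cell-right (tape l h (_ ∷ _)) -[1+ zero ]  = refl
   cell-right (tape l h (_ ∷ _)) -[1+ suc i ] = refl

   cell-left : ∀ (T : Tape g) z → cell (Defs.move left T) (ℤ.suc z) ≡ cell T z
   cell-left (tape [] h r)      (+ zero)     = refl
   cell-left (tape [] h r)      (+ suc i)    = refl
   cell-left (tape (_ ∷ _) h r) (+ zero)     = refl
   cell-left (tape (_ ∷ _) h r) (+ suc i)    = refl
   cell-left (tape [] h r)      -[1+ zero ]  = refl
   cell-left (tape [] h r)      -[1+ suc i ] = refl
   cell-left (tape (_ ∷ _) h r) -[1+ zero ]  = refl
   cell-left (tape (_ ∷ _) h r) -[1+ suc i ] = refl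

   cell-write : ∀ s (T : Tape g) z → z ≢ + 0 → cell (Defs.write s T) z ≡ cell T z
   cell-write s (tape l h r) (+ zero)  z≢0 = ⊥-elim (z≢0 refl)
   cell-write s (tape l h r) (+ suc i) _   = refl
   cell-write s (tape l h r) -[1+ i ]  _   = refl

   cell-written : ∀ s (T : Tape g) → cell (Defs.write s T) (+ 0) ≡ s
   cell-written s (tape l h r) = refl

 -- offset b r is r − b.
 offset : ℕ → ℕ → ℤ
 offset zero    r       = + r
 offset (suc b) zero    = -[1+ b ]
 offset (suc b) (suc r) = offset b r

 offset-suc : ∀ b r → offset b (suc r) ≡ ℤ.suc (offset b r)
 offset-suc zero          r       = refl
 offset-suc (suc zero)    zero    = refl
 offset-suc (suc (suc b)) zero    = refl
 offset-suc (suc b)       (suc r) = offset-suc b r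

 offset-+ : ∀ b i → offset b (b + i) ≡ + i
 offset-+ zero    i = refl
 offset-+ (suc b) i = offset-+ b i

 data Region : Set where
   leftEnd inner beforeHead atHead afterHead rightEnd : Region

 does⇒ : ∀ {A : Set} (d : Dec A) → does d ≡ true → A
 does⇒ (yes a) _ = a

 ⇒does : ∀ {A : Set} (d : Dec A) → A → does d ≡ true
 ⇒does (yes _) _ = refl
 ⇒does (no ¬a) a = ⊥-elim (¬a a)

 ¬does : ∀ {A : Set} (d : Dec A) → does d ≡ false → ¬ A
 ¬does (no ¬a) _ = ¬a

 setTo : Bool → Kind
 setTo true  = set1
 setTo false = set0

 scan-intro : ∀ κ x n → (∀ j → j < n → κ j ≡ test → x j ≡ true) → (∀ j → κ j ≡ idle ⊎ κ j ≡ test ⊎ κ j ≡ reset) → scan κ x true n ≡ true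
 scan-intro κ x zero    _ _ = refl
 scan-intro κ x (suc n) h G with scan-intro κ x n (λ j j<n → h j (ℕₚ.m<n⇒m<1+n j<n)) G | G n
 ... | eq | inj₁ κ≡ rewrite κ≡ = eq
 ... | eq | inj₂ (inj₁ κ≡) rewrite κ≡ | eq = h n (ℕₚ.n<1+n n) κ≡
 ... | eq | inj₂ (inj₂ κ≡) rewrite κ≡ = refl

 scan-elim : ∀ κ x s n → (∀ j → κ j ≡ idle ⊎ κ j ≡ test ⊎ κ j ≡ reset) → (∀ j → κ (suc j) ≢ reset) → κ 0 ≢ test →
             scan κ x s n ≡ true → ∀ j → j < n → κ j ≡ test → x j ≡ true
 scan-elim κ x s (suc n) G no-reset first eq j j<n κ≡ with G n
 ... | inj₁ idle≡ rewrite idle≡ with ℕₚ.m≤n⇒m<n∨m≡n (ℕₚ.≤-pred j<n)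
 ...   | inj₁ j<n′ = scan-elim κ x s n G no-reset first eq j j<n′ κ≡
 ...   | inj₂ refl with trans (sym idle≡) κ≡
 ...     | ()
 scan-elim κ x s (suc n) G no-reset first eq j j<n κ≡ | inj₂ (inj₁ test≡) rewrite test≡ with ℕₚ.m≤n⇒m<n∨m≡n (ℕₚ.≤-pred j<n)
 ... | inj₁ j<n′ = scan-elim κ x s n G no-reset first (proj₁ (∧-true eq)) j j<n′ κ≡
 ... | inj₂ refl = proj₂ (∧-true {scan κ x s n} eq)
 scan-elim κ x s (suc zero) G no-reset first eq zero j<n κ≡ | inj₂ (inj₂ reset≡) = ⊥-elim (first κ≡)
 scan-elim κ x s (suc (suc n)) G no-reset first eq j j<n κ≡ | inj₂ (inj₂ reset≡) = ⊥-elim (no-reset n reset≡)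
 scan-elim κ x s (suc zero) G no-reset first eq (suc j) (s≤s ()) κ≡ | inj₂ (inj₂ reset≡)

 module Alphabet (M : TM) where
   open TM M

   γ : ℕ
   γ = size (Symbol-finite g)

   Rule : Set
   Rule = Fin states × Vec (Symbol g) (suc m)

   Rule-finite : Finite Rule
   Rule-finite = ×-finite (Fin-finite states) (Vec-finite (Symbol-finite g) (suc m))

   G W-1 W : ℕ
   G   = size Rule-finite
   W-1 = states + suc m * γ
   W   = suc W-1

   module Slots = Place W-1

   slot : ∀ {A : Set} → (Fin (suc m) → Fin γ → A) → A → ℕ → A
   slot f d k with k <? suc m * γ
   ... | yes k< = uncurry f (Fin.remQuot γ (Fin.fromℕ< k<))
   ... | no _   = d

   is : Symbol g → Fin γ → Bool
   is s i = does (index (Symbol-finite g) s Fin.≟ i)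

   record Columns : Set where
     constructor columns
     field
       control : ℕ → Kind
       tapes   : Region → ℕ → Kind

   open Columns

   guardColumns : Rule → Columns
   guardColumns (q , ss) = columns
     (λ { zero → reset ; (suc k) → if does (toℕ q ≟ k) then test else idle })
     (λ { atHead → slot (λ τ i → if is (lookup ss τ) i then test else idle) idle ; _ → λ _ → idle })

   moveKind : Region → Symbol g × Move → Fin γ → Kind
   moveKind atHead    (s , stay)  i = setTo (is s i)
   moveKind _         (s , stay)  i = unchanged
   moveKind beforeHead    (s , right) i = setTo (is s i)
   moveKind rightEnd (s , right) i = setTo (is blank i)
   moveKind _         (s , right) i = fromRight
   moveKind afterHead     (s , left)  i = setTo (is s i)
   moveKind leftEnd  (s , left)  i = setTo (is blank i)
   moveKind _         (s , left)  i = fromLeft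

   outcomeColumns : Bool → Maybe (Fin states × Vec (Symbol g × Move) (suc m)) → Columns
   outcomeColumns b (just (q , as)) = columns
     (λ { zero → set0 ; (suc k) → setTo (does (toℕ q ≟ k)) })
     (λ ρ → slot (λ τ i → moveKind ρ (lookup as τ) i) set0)
   outcomeColumns b nothing = columns (λ { zero → if b then accept else reject ; (suc _) → idle }) (λ _ _ → idle)

   updateColumns : Rule → Columns
   updateColumns (q , ss) = outcomeColumns (accepting q) (δ q ss)

   ruleAt : ℕ → Rule
   ruleAt e with e <? G
   ... | yes e< = at Rule-finite (Fin.fromℕ< e<)
   ... | no _   = start , Vec.replicate (suc m) blank

   ruleNumber : Rule → ℕ
   ruleNumber ρ = toℕ (index Rule-finite ρ)

   ruleNumber<G : ∀ ρ → ruleNumber ρ < G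
   ruleNumber<G ρ = Finₚ.toℕ<n (index Rule-finite ρ)

   ruleAt-number : ∀ ρ → ruleAt (ruleNumber ρ) ≡ ρ
   ruleAt-number ρ with ruleNumber ρ <? G
   ... | yes e< = trans (cong (at Rule-finite) (Finₚ.fromℕ<-toℕ (index Rule-finite ρ) e<)) (at-index Rule-finite ρ)
   ... | no e≮  = ⊥-elim (e≮ (ruleNumber<G ρ))

   number-ruleAt : ∀ e → e < G → ruleNumber (ruleAt e) ≡ e
   number-ruleAt e e<G with e <? G
   ... | yes e< = trans (cong toℕ (index-at Rule-finite (Fin.fromℕ< e<))) (Finₚ.toℕ-fromℕ< e<)
   ... | no e≮  = ⊥-elim (e≮ e<G)

   slot-at : ∀ {A : Set} (f : Fin (suc m) → Fin γ → A) d τ i → slot f d (toℕ (Fin.combine τ i)) ≡ f τ i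
   slot-at f d τ i with toℕ (Fin.combine τ i) <? suc m * γ
   ... | yes k< = trans (cong (λ k → uncurry f (Fin.remQuot γ k)) (Finₚ.fromℕ<-toℕ (Fin.combine τ i) k<)) (cong (uncurry f) (Finₚ.remQuot-combine τ i))
   ... | no k≮  = ⊥-elim (k≮ (Finₚ.toℕ<n (Fin.combine τ i)))

   slot-cases : ∀ k → (∃₂ λ τ i → ∀ {A : Set} (f : Fin (suc m) → Fin γ → A) d → slot f d k ≡ f τ i) ⊎ (∀ {A : Set} (f : Fin (suc m) → Fin γ → A) d → slot f d k ≡ d)
   slot-cases k with k <? suc m * γ
   ... | yes k< = inj₁ (proj₁ (Fin.remQuot γ (Fin.fromℕ< k<)) , proj₂ (Fin.remQuot γ (Fin.fromℕ< k<)) , λ f d → refl)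
   ... | no _   = inj₂ λ f d → refl

 -- Bits of a configuration: column 0 holds the state in unary and column 1 + r the symbols of all tapes at
 -- offset r ⊖ (N + 2), in unary; N bounds the space and n is the length of the input.
 module Layout (M : TM) (N n : ℕ) where
   open TM M
   open Run M

   open Alphabet M public
   open Columns

   base total len-1 : ℕ
   base  = suc (suc N)
   total = base + (3 + (n + N))
   len-1 = W-1 + total * W

   region : ℤ → Region
   region (+ zero)          = atHead
   region (+ suc zero)      = afterHead
   region (+ suc (suc k))   = if does (k ≟ n + N) then rightEnd else inner
   region -[1+ zero ]       = beforeHead
   region -[1+ suc k ]      = if does (k ≟ N) then leftEnd else inner

   columnKind : Columns → ℕ → ℕ → Kind
   columnKind C zero    k = control C k
   columnKind C (suc r) k = tapes C (region (offset base r)) k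

   rowOf : Columns → ℕ → Kind
   rowOf C j = columnKind C (proj₁ (Slots.place j)) (proj₂ (Slots.place j))

   guardRow updateRow : ℕ → ℕ → Kind
   guardRow e  = rowOf (guardColumns (ruleAt e))
   updateRow e = rowOf (updateColumns (ruleAt e))

   columnBit : Configuration → ℕ → ℕ → Bool
   columnBit c zero    zero    = false
   columnBit c zero    (suc k) = does (toℕ (state c) ≟ k)
   columnBit c (suc r) k       = slot (λ τ i → is (cell (lookup (Configuration.tapes c) τ) (offset base r)) i) false k

   bits : Configuration → ℕ → Bool
   bits c j = columnBit c (proj₁ (Slots.place j)) (proj₂ (Slots.place j))

   loadRow : Configuration → ℕ → Kind
   loadRow c j = if bits c j then load1 else load0

   currentRule : Configuration → Rule
   currentRule c = state c , Vec.map Tape.head (Configuration.tapes c)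

   data IsGuard : Kind → Set where
     idle  : IsGuard idle
     test  : IsGuard test

   private
     choose-guard : ∀ b → IsGuard (if b then test else idle)
     choose-guard true  = test
     choose-guard false = idle

   guard-column : ∀ ρ c k → IsGuard (columnKind (guardColumns ρ) c (suc k)) × (∀ r → IsGuard (columnKind (guardColumns ρ) (suc r) k))
   guard-column (q , ss) c k = anywhere c (suc k) (λ ()) , λ r → anywhere (suc r) k (λ ())
     where
     in-region : ∀ ζ k → IsGuard (tapes (guardColumns (q , ss)) ζ k)
     in-region leftEnd  k = idle
     in-region inner    k = idle
     in-region beforeHead    k = idle
     in-region afterHead     k = idle
     in-region rightEnd k = idle
     in-region atHead    k with slot-cases k
     ... | inj₁ (τ , i , eq) = subst IsGuard (sym (eq _ idle)) (choose-guard (is (lookup ss τ) i))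
     ... | inj₂ eq           = subst IsGuard (sym (eq (λ τ i → if is (lookup ss τ) i then test else idle) idle)) idle
     anywhere : ∀ c k → (c , k) ≢ (0 , 0) → IsGuard (columnKind (guardColumns (q , ss)) c k)
     anywhere zero    zero    ≢ = ⊥-elim (≢ refl)
     anywhere zero    (suc k) _ = choose-guard (does (toℕ q ≟ k))
     anywhere (suc r) k       _ = in-region (region (offset base r)) k

   slots-nonzero : ∀ j → (∃ λ k → Slots.place (suc j) ≡ (proj₁ (Slots.place (suc j)) , suc k)) ⊎ (∃ λ r → Slots.place (suc j) ≡ (suc r , proj₂ (Slots.place (suc j))))
   slots-nonzero j with Slots.place (suc j) in eq
   ... | zero , zero   = ⊥-elim (absurd (trans (sym (cong (λ p → proj₂ p + proj₁ p * W) eq)) (proj₂ (Slots.place-sound (suc j)))))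
     where
     absurd : 0 ≢ suc j
     absurd ()
   ... | c , suc k     = inj₁ (k , refl)
   ... | suc r , zero  = inj₂ (r , refl)

   guard-later : ∀ e j → IsGuard (guardRow e (suc j))
   guard-later e j with slots-nonzero j
   ... | inj₁ (k , eq) = subst (λ p → IsGuard (columnKind (guardColumns (ruleAt e)) (proj₁ p) (proj₂ p))) (sym eq) (proj₁ (guard-column (ruleAt e) (proj₁ (Slots.place (suc j))) k))
   ... | inj₂ (r , eq) = subst (λ p → IsGuard (columnKind (guardColumns (ruleAt e)) (proj₁ p) (proj₂ p))) (sym eq) (proj₂ (guard-column (ruleAt e) 0 (proj₂ (Slots.place (suc j)))) r)

   guard-kinds : ∀ e j → guardRow e j ≡ idle ⊎ guardRow e j ≡ test ⊎ guardRow e j ≡ reset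
   guard-kinds e zero    = inj₂ (inj₂ refl)
   guard-kinds e (suc j) = split (guard-later e j) refl
     where
     split : ∀ {κ} → IsGuard κ → guardRow e (suc j) ≡ κ → guardRow e (suc j) ≡ idle ⊎ guardRow e (suc j) ≡ test ⊎ guardRow e (suc j) ≡ reset
     split idle eq = inj₁ eq
     split test eq = inj₂ (inj₁ eq)

   guard-no-reset : ∀ e j → guardRow e (suc j) ≢ reset
   guard-no-reset e j eq with guardRow e (suc j) | guard-later e j
   guard-no-reset e j () | .idle | idle
   guard-no-reset e j () | .test | test

   len : ℕ
   len = suc len-1

   place-column : ∀ c k → k < W → Slots.place (k + c * W) ≡ (c , k)
   place-column c k k<W = Slots.place-at c k (ℕₚ.≤-pred k<W)

   column<len : ∀ c k → c ≤ total → k < W → k + c * W < len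
   column<len c k c≤ k<W = ℕₚ.+-mono-≤ k<W (ℕₚ.*-monoˡ-≤ W c≤)

   slot<W : ∀ (τ : Fin (suc m)) (i : Fin γ) → toℕ (Fin.combine τ i) < W
   slot<W τ i = ℕₚ.<-≤-trans (Finₚ.toℕ<n (Fin.combine τ i)) (ℕₚ.≤-trans (ℕₚ.m≤n+m (suc m * γ) states) (ℕₚ.n≤1+n W-1))

   state<W : ∀ (q : Fin states) → suc (toℕ q) < W
   state<W q = s≤s (ℕₚ.≤-trans (Finₚ.toℕ<n q) (ℕₚ.m≤m+n states (suc m * γ)))

   head≤total : suc base ≤ total
   head≤total = ℕₚ.≤-trans (ℕₚ.≤-reflexive (ℕₚ.+-comm 1 base)) (ℕₚ.+-monoʳ-≤ base (s≤s z≤n))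

   region-head : region (offset base base) ≡ atHead
   region-head = cong region (trans (cong (offset base) (sym (ℕₚ.+-identityʳ base))) (offset-+ base 0))

   cell-head : ∀ (T : Tape g) → cell T (offset base base) ≡ Tape.head T
   cell-head T = trans (cong (cell T) (trans (cong (offset base) (sym (ℕₚ.+-identityʳ base))) (offset-+ base 0))) (head T)
     where
     head : ∀ (T : Tape g) → cell T (+ 0) ≡ Tape.head T
     head (tape _ _ _) = refl

   private
     is-true : ∀ s s′ → is s (index (Symbol-finite g) s′) ≡ true → s ≡ s′
     is-true s s′ eq = trans (sym (at-index (Symbol-finite g) s)) (trans (cong (at (Symbol-finite g)) (does⇒ (index (Symbol-finite g) s Fin.≟ index (Symbol-finite g) s′) eq)) (at-index (Symbol-finite g) s′))

     is-same : ∀ s → is s (index (Symbol-finite g) s) ≡ true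
     is-same s = ⇒does (index (Symbol-finite g) s Fin.≟ index (Symbol-finite g) s) refl

     chosen : ∀ b → _≡_ {A = Kind} (if b then test else idle) test → b ≡ true
     chosen true _ = refl

   matches⇒rule : ∀ c e s → scan (guardRow e) (bits c) s len ≡ true → ruleAt e ≡ currentRule c
   matches⇒rule c e s eq = cong₂ _,_ (Finₚ.toℕ-injective state-eq) (vec-ext _ _ heads-eq)
     where
     q = proj₁ (ruleAt e)
     ss = proj₂ (ruleAt e)
     tested : ∀ c′ k → c′ ≤ total → k < W → columnKind (guardColumns (ruleAt e)) c′ k ≡ test → columnBit c c′ k ≡ true
     tested c′ k c≤ k<W κ≡ = subst (λ p → columnBit c (proj₁ p) (proj₂ p) ≡ true) (place-column c′ k k<W)
       (scan-elim (guardRow e) (bits c) s len (guard-kinds e) (guard-no-reset e) (λ ()) eq (k + c′ * W) (column<len c′ k c≤ k<W)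
         (trans (cong (λ p → columnKind (guardColumns (ruleAt e)) (proj₁ p) (proj₂ p)) (place-column c′ k k<W)) κ≡))
     state-eq : toℕ q ≡ toℕ (state c)
     state-eq = sym (does⇒ (toℕ (state c) ≟ toℕ q) (tested 0 (suc (toℕ q)) z≤n (state<W q) (cong (λ b → if b then test else idle) (⇒does (toℕ q ≟ toℕ q) refl))))
     heads-eq : ∀ τ → lookup ss τ ≡ lookup (Vec.map Tape.head (Configuration.tapes c)) τ
     heads-eq τ = sym (trans (Vecₚ.lookup-map τ Tape.head (Configuration.tapes c)) (trans (sym (cell-head (lookup (Configuration.tapes c) τ)))
       (is-true _ _ (trans (sym (slot-at (λ τ i → is (cell (lookup (Configuration.tapes c) τ) (offset base base)) i) false τ i))
         (tested (suc base) (toℕ (Fin.combine τ i)) head≤total (slot<W τ i)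
           (trans (cong (λ ζ → Columns.tapes (guardColumns (ruleAt e)) ζ (toℕ (Fin.combine τ i))) region-head)
             (trans (slot-at (λ τ i → if is (lookup ss τ) i then test else idle) idle τ i) (cong (λ b → if b then test else idle) (is-same (lookup ss τ))))))))))
       where
       i = index (Symbol-finite g) (lookup ss τ)
     vec-ext : ∀ {k} (xs ys : Vec (Symbol g) k) → (∀ i → lookup xs i ≡ lookup ys i) → xs ≡ ys
     vec-ext []       []       _ = refl
     vec-ext (x ∷ xs) (y ∷ ys) h = cong₂ _∷_ (h zero) (vec-ext xs ys (λ i → h (suc i)))

   rule-matches : ∀ c → scan (guardRow (ruleNumber (currentRule c))) (bits c) true len ≡ true
   rule-matches c = scan-intro _ (bits c) len (λ j _ κ≡ → tested (proj₁ (Slots.place j)) (proj₂ (Slots.place j))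
       (subst (λ ρ → columnKind (guardColumns ρ) (proj₁ (Slots.place j)) (proj₂ (Slots.place j)) ≡ test) (ruleAt-number (currentRule c)) κ≡))
       (guard-kinds (ruleNumber (currentRule c)))
     where
     heads = Vec.map Tape.head (Configuration.tapes c)
     tested : ∀ c′ k → columnKind (guardColumns (currentRule c)) c′ k ≡ test → columnBit c c′ k ≡ true
     tested zero    zero    ()
     tested zero    (suc k) κ≡ = chosen _ κ≡
     tested (suc r) k       κ≡ = by-offset (offset base r) κ≡
       where
       by-offset : ∀ z → Columns.tapes (guardColumns (currentRule c)) (region z) k ≡ test →
                   slot (λ τ i → is (cell (lookup (Configuration.tapes c) τ) z) i) false k ≡ true
       by-offset (+ zero) κ≡ with slot-cases k
       ... | inj₁ (τ , i , eq) = trans (eq (λ τ i → is (cell (lookup (Configuration.tapes c) τ) (+ 0)) i) false)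
               (trans (cong (λ s → is s i) (trans (head (lookup (Configuration.tapes c) τ)) (sym (Vecₚ.lookup-map τ Tape.head (Configuration.tapes c)))))
                 (chosen (is (lookup heads τ) i) (trans (sym (eq (λ τ i → if is (lookup heads τ) i then test else idle) idle)) κ≡)))
         where
         head : ∀ (T : Tape g) → cell T (+ 0) ≡ Tape.head T
         head (tape _ _ _) = refl
       ... | inj₂ eq with trans (sym (eq (λ τ i → if is (lookup heads τ) i then test else idle) idle)) κ≡
       ...   | ()
       by-offset (+ suc zero) ()
       by-offset (+ suc (suc i)) κ≡ with does (i ≟ n + N)
       by-offset (+ suc (suc i)) () | true
       by-offset (+ suc (suc i)) () | false
       by-offset -[1+ zero ] ()
       by-offset -[1+ suc i ] κ≡ with does (i ≟ N)
       by-offset -[1+ suc i ] () | true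
       by-offset -[1+ suc i ] () | false

   only-rule : ∀ c e → e < G → scan (guardRow e) (bits c) true len ≡ true → e ≡ ruleNumber (currentRule c)
   only-rule c e e<G eq = trans (sym (number-ruleAt e e<G)) (cong ruleNumber (matches⇒rule c e true eq))

   update-kinds : ∀ b o c k → ∀ {ℓ} → (U : Kind → Set ℓ) → U idle → U set0 → U set1 → U unchanged → U fromRight → U fromLeft → U accept → U reject →
                  U (columnKind (outcomeColumns b o) c k)
   update-kinds true  nothing  zero    zero    U i s₀ s₁ u r l a j = a
   update-kinds false nothing  zero    zero    U i s₀ s₁ u r l a j = j
   update-kinds b     nothing  zero    (suc k) U i s₀ s₁ u r l a j = i
   update-kinds b     nothing  (suc c) k       U i s₀ s₁ u r l a j = i
   update-kinds b (just (q , as)) zero    zero    U i s₀ s₁ u r l a j = s₀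
   update-kinds b (just (q , as)) zero    (suc k) U i s₀ s₁ u r l a j with does (toℕ q ≟ k)
   ... | true  = s₁
   ... | false = s₀
   update-kinds b (just (q , as)) (suc c) k       U i s₀ s₁ u r l a j with slot-cases k
   ... | inj₂ eq            = subst U (sym (eq (λ τ i → moveKind (region (offset base c)) (lookup as τ) i) set0)) s₀
   ... | inj₁ (τ , i′ , eq) = subst U (sym (eq (λ τ i → moveKind (region (offset base c)) (lookup as τ) i) set0)) (move-kinds (region (offset base c)) (lookup as τ))
     where
     setTo-kinds : ∀ b → U (setTo b)
     setTo-kinds true  = s₁
     setTo-kinds false = s₀
     move-kinds : ∀ ζ a → U (moveKind ζ a i′)
     move-kinds atHead     (s , stay)  = setTo-kinds (is s i′)
     move-kinds leftEnd    (s , stay)  = u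
     move-kinds inner      (s , stay)  = u
     move-kinds beforeHead (s , stay)  = u
     move-kinds afterHead  (s , stay)  = u
     move-kinds rightEnd   (s , stay)  = u
     move-kinds beforeHead (s , right) = setTo-kinds (is s i′)
     move-kinds rightEnd   (s , right) = setTo-kinds (is blank i′)
     move-kinds leftEnd    (s , right) = r
     move-kinds inner      (s , right) = r
     move-kinds atHead     (s , right) = r
     move-kinds afterHead  (s , right) = r
     move-kinds afterHead  (s , left)  = setTo-kinds (is s i′)
     move-kinds leftEnd    (s , left)  = setTo-kinds (is blank i′)
     move-kinds inner      (s , left)  = l
     move-kinds beforeHead (s , left)  = l
     move-kinds atHead     (s , left)  = l
     move-kinds rightEnd   (s , left)  = l

   offset-negative : ∀ b r {i} → offset b r ≡ -[1+ i ] → r + suc i ≡ b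
   offset-negative (suc b) zero    refl = refl
   offset-negative (suc b) (suc r) eq   = cong suc (offset-negative b r eq)

   offset-positive : ∀ b r {i} → offset b r ≡ + i → r ≡ b + i
   offset-positive zero    r       refl = refl
   offset-positive (suc b) (suc r) eq   = cong suc (offset-positive b r eq)

   Within : Configuration → Set
   Within c = ∀ τ → let tape l _ r = lookup (Configuration.tapes c) τ in length l ≤ N × length r ≤ N

   module Step (load : ℕ → Kind) (c : Configuration) (within : Within c) where
     open Grid len-1 W G guardRow updateRow load using (Prescribes; set0; set1; unchanged; fromRight; fromLeft)

     prescribes-setTo : ∀ {x j} b → Prescribes x j (setTo b) b
     prescribes-setTo true  = set1
     prescribes-setTo false = set0

     module _ (τ : Fin (suc m)) (i : Fin γ) (k : ℕ) (k<W : k < W)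
              (slot-k : ∀ {A : Set} (f : Fin (suc m) → Fin γ → A) d → slot f d k ≡ f τ i) where
       private
         T : Tape g
         T = lookup (Configuration.tapes c) τ

         at-column : ℕ → ℕ
         at-column r = k + suc r * W

         bit-at : ∀ r → bits c (at-column r) ≡ is (cell T (offset base r)) i
         bit-at r = trans (cong (λ p → columnBit c (proj₁ p) (proj₂ p)) (place-column (suc r) k k<W))
           (slot-k (λ τ i → is (cell (lookup (Configuration.tapes c) τ) (offset base r)) i) false)

         keeps : ∀ s r z → offset base r ≡ z → z ≢ + 0 → Prescribes (bits c) (at-column r) unchanged (is (cell (Defs.write s T) z) i)
         keeps s r z eq z≢0 = subst (Prescribes (bits c) (at-column r) unchanged)
           (trans (bit-at r) (cong (λ s → is s i) (trans (cong (cell T) eq) (sym (cell-write s T z z≢0))))) unchanged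

         sets : ∀ r {s s′} → s ≡ s′ → Prescribes (bits c) (at-column r) (setTo (is s i)) (is s′ i)
         sets r {s = s} refl = prescribes-setTo (is s i)

         stay-next : ∀ s r z → offset base r ≡ z → Prescribes (bits c) (at-column r) (moveKind (region z) (s , stay) i) (is (cell (Defs.write s T) z) i)
         stay-next s r (+ zero)  eq = sets r (sym (cell-written s T))
         stay-next s r (+ suc zero) eq = keeps s r _ eq λ ()
         stay-next s r (+ suc (suc k′)) eq with does (k′ ≟ n + N)
         ... | true  = keeps s r _ eq λ ()
         ... | false = keeps s r _ eq λ ()
         stay-next s r -[1+ zero ] eq = keeps s r _ eq λ ()
         stay-next s r -[1+ suc k′ ] eq with does (k′ ≟ N)
         ... | true  = keeps s r _ eq λ ()
         ... | false = keeps s r _ eq λ ()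

         shifts-left : ∀ s r z → offset base r ≡ z → suc r < total → ℤ.suc z ≢ + 0 →
                       Prescribes (bits c) (at-column r) fromRight (is (cell (Defs.move right (Defs.write s T)) z) i)
         shifts-left s r z eq r< z≢ = subst (Prescribes (bits c) (at-column r) fromRight)
           (trans (cong (bits c) right-column) (trans (bit-at (suc r)) (cong (λ s → is s i)
             (trans (cong (cell T) (trans (offset-suc base r) (cong ℤ.suc eq))) (sym (trans (cell-right (Defs.write s T) z) (cell-write s T (ℤ.suc z) z≢)))))))
           (fromRight (subst (_< len) (sym right-column) (column<len (suc (suc r)) k r< k<W)))
           where
           right-column : at-column r + W ≡ at-column (suc r)
           right-column = lemma k (suc r * W) W
             where
             lemma : ∀ k p w → (k + p) + w ≡ k + (w + p)
             lemma = solve-∀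

         room : ∀ r k′ → offset base r ≡ + k′ → k′ < 2 + (n + N) → suc r < total
         room r k′ eq k′< = subst (_< total) (sym (trans (cong suc (offset-positive base r eq)) (sym (ℕₚ.+-suc base k′)))) (ℕₚ.+-monoʳ-< base (s≤s k′<))

         room⁻ : ∀ r k′ → offset base r ≡ -[1+ k′ ] → suc r < total
         room⁻ r k′ eq = ℕₚ.≤-<-trans (subst (suc r ≤_) (offset-negative base r eq) (subst (suc r ≤_) (sym (ℕₚ.+-suc r k′)) (s≤s (ℕₚ.m≤m+n r k′))))
           (ℕₚ.m<m+n base z<s)

         blank-right : ∀ s → cell (Defs.write s T) (+ (3 + (n + N))) ≡ blank
         blank-right s with T | within τ
         ... | tape l h r | _ , r≤ = nth-beyond r (2 + (n + N)) (ℕₚ.≤-trans r≤ (ℕₚ.≤-trans (ℕₚ.m≤n+m N n) (ℕₚ.≤-trans (ℕₚ.n≤1+n _) (ℕₚ.n≤1+n _))))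

         blank-left : ∀ s → cell (Defs.write s T) -[1+ base ] ≡ blank
         blank-left s with T | within τ
         ... | tape l h r | l≤ , _ = nth-beyond l base (ℕₚ.≤-trans l≤ (ℕₚ.≤-trans (ℕₚ.n≤1+n _) (ℕₚ.n≤1+n _)))

         right-next : ∀ s r z → offset base r ≡ z → r < total → Prescribes (bits c) (at-column r) (moveKind (region z) (s , right) i) (is (cell (Defs.move right (Defs.write s T)) z) i)
         right-next s r (+ zero)  eq r< = shifts-left s r _ eq (room r 0 eq z<s) λ ()
         right-next s r (+ suc zero) eq r< = shifts-left s r _ eq (room r 1 eq (s≤s z<s)) λ ()
         right-next s r (+ suc (suc k′)) eq r< with does (k′ ≟ n + N) in d
         ... | true  = sets r (sym (trans (cell-right (Defs.write s T) (+ (2 + k′)))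
                         (trans (cong (λ k → cell (Defs.write s T) (+ (3 + k))) (does⇒ (k′ ≟ n + N) d)) (blank-right s))))
         ... | false = shifts-left s r _ eq (room r _ eq (s≤s (s≤s (ℕₚ.≤∧≢⇒< k′≤ (¬does (k′ ≟ n + N) d))))) λ ()
           where
           k′≤ : k′ ≤ n + N
           k′≤ = ℕₚ.≤-pred (ℕₚ.≤-pred (ℕₚ.≤-pred (ℕₚ.+-cancelˡ-≤ base (3 + k′) (3 + (n + N)) (subst (_≤ total) (trans (cong suc (offset-positive base r eq)) (sym (ℕₚ.+-suc base (2 + k′)))) r<))))
         right-next s r -[1+ zero ] eq r< = sets r (sym (trans (cell-right (Defs.write s T) -[1+ 0 ]) (cell-written s T)))
         right-next s r -[1+ suc k′ ] eq r< with does (k′ ≟ N)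
         ... | true  = shifts-left s r _ eq (room⁻ r (suc k′) eq) λ ()
         ... | false = shifts-left s r _ eq (room⁻ r (suc k′) eq) λ ()

         shifts-right : ∀ s r z → offset base (suc r) ≡ z → z ≢ + 1 → Prescribes (bits c) (at-column (suc r)) fromLeft (is (cell (Defs.move left (Defs.write s T)) z) i)
         shifts-right s r z eq z≢1 = subst (Prescribes (bits c) (at-column (suc r)) fromLeft)
           (trans (bit-at r) (cong (λ s → is s i) (sym (trans (cong (cell (Defs.move left (Defs.write s T))) z≡) (trans (cell-left (Defs.write s T) (offset base r)) (cell-write s T _ z′≢0))))))
           (fromLeft (lemma k W (suc r * W)))
           where
           z≡ : z ≡ ℤ.suc (offset base r)
           z≡ = trans (sym eq) (offset-suc base r)
           z′≢0 : offset base r ≢ + 0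
           z′≢0 eq′ = z≢1 (trans z≡ (cong ℤ.suc eq′))
           lemma : ∀ k w p → k + (w + p) ≡ w + (k + p)
           lemma = solve-∀

         left-next : ∀ s r z → offset base r ≡ z → Prescribes (bits c) (at-column r) (moveKind (region z) (s , left) i) (is (cell (Defs.move left (Defs.write s T)) z) i)
         left-next s zero    .(-[1+ suc N ]) refl with does (N ≟ N) in d
         ... | true  = sets 0 (sym (trans (cell-left (Defs.write s T) -[1+ base ]) (blank-left s)))
         ... | false = ⊥-elim (¬does (N ≟ N) d refl)
         left-next s (suc r) (+ zero)  eq = shifts-right s r _ eq λ ()
         left-next s (suc r) (+ suc zero) eq = sets (suc r) (sym (trans (cell-left (Defs.write s T) (+ 0)) (cell-written s T)))
         left-next s (suc r) (+ suc (suc k′)) eq with does (k′ ≟ n + N)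
         ... | true  = shifts-right s r _ eq λ ()
         ... | false = shifts-right s r _ eq λ ()
         left-next s (suc r) -[1+ zero ] eq = shifts-right s r _ eq λ ()
         left-next s (suc r) -[1+ suc k′ ] eq with does (k′ ≟ N) in d
         ... | false = shifts-right s r _ eq λ ()
         ... | true  = ⊥-elim (ℕₚ.m+1+n≢n r (ℕₚ.suc-injective (ℕₚ.suc-injective (trans (cong suc (sym (ℕₚ.+-suc r (suc N))))
                         (trans (cong (λ k → suc r + suc (suc k)) (sym (does⇒ (k′ ≟ N) d))) (offset-negative base (suc r) eq))))))

       tape-next : ∀ a r → r < total → Prescribes (bits c) (k + suc r * W) (moveKind (region (offset base r)) a i) (is (cell (Defs.act a T) (offset base r)) i)
       tape-next (s , stay)  r r< = stay-next s r _ refl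
       tape-next (s , right) r r< = right-next s r _ refl r<
       tape-next (s , left)  r r< = left-next s r _ refl

     step-prescribes : ∀ q as → δ (state c) (Vec.map Tape.head (Configuration.tapes c)) ≡ just (q , as) → ∀ j → j < len →
       Prescribes (bits c) j (rowOf (updateColumns (currentRule c)) j) (bits ⟨ q , Vec.zipWith Defs.act as (Configuration.tapes c) ⟩ j)
     step-prescribes q as δ≡ j j<len = subst (λ o → Prescribes (bits c) j (rowOf (outcomeColumns (accepting (state c)) o) j) (bits c′ j)) (sym δ≡)
       (by-place (proj₁ (Slots.place j)) (proj₂ (Slots.place j)) (proj₂ (Slots.place-sound j)) (s≤s (proj₁ (Slots.place-sound j))))
       where
       c′ = ⟨ q , Vec.zipWith Defs.act as (Configuration.tapes c) ⟩
       C = outcomeColumns (accepting (state c)) (just (q , as))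
       by-place : ∀ c₀ k → k + c₀ * W ≡ j → k < W → Prescribes (bits c) j (columnKind C c₀ k) (columnBit c′ c₀ k)
       by-place zero    zero    eq k<W = set0
       by-place zero    (suc k) eq k<W = prescribes-setTo _
       by-place (suc r) k       eq k<W with slot-cases k
       ... | inj₂ unused = subst₂ (Prescribes (bits c) j) (sym (unused (λ τ i → moveKind (region (offset base r)) (lookup as τ) i) set0))
               (sym (unused (λ τ i → is (cell (lookup (Configuration.tapes c′) τ) (offset base r)) i) false)) set0
       ... | inj₁ (τ , i , used) = subst₂ (Prescribes (bits c) j) (sym (used (λ τ i → moveKind (region (offset base r)) (lookup as τ) i) set0))
               (sym (trans (used (λ τ i → is (cell (lookup (Configuration.tapes c′) τ) (offset base r)) i) false)
                 (cong (λ T → is (cell T (offset base r)) i) (Vecₚ.lookup-zipWith Defs.act τ as (Configuration.tapes c)))))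
               (subst (λ j → Prescribes (bits c) j _ _) eq (tape-next τ i k k<W used (lookup as τ) r r<total))
         where
         r<total : r < total
         r<total = ℕₚ.≤-pred (ℕₚ.*-cancelʳ-< W (suc r) (suc total) (ℕₚ.≤-<-trans (subst (suc r * W ≤_) eq (ℕₚ.m≤n+m (suc r * W) k)) j<len))

module Words where

 open import Defs using (Word; Symbol; blank; bit; Tape; tape; inputTape; blankTape; TM; module Run; cells)
 open Digits using (digit; maxDigit)
 open StackPrograms using (Finite)
 open Finite
 open Transcripts hiding (initial)
 open Rows
 open import Data.Fin using (zero; suc)
 open import Data.Integer using (+_)
 open import Data.List using (length; replicate; concat; concatMap; applyUpTo; map)
 open import Data.Nat
 open import Algebra.Properties.CommutativeSemigroup ℕₚ.+-commutativeSemigroup using (x∙yz≈y∙xz)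
 open import Data.Nat.Tactic.RingSolver using (solve-∀)

 applyUpTo-cong : ∀ {A : Set} (f h : ℕ → A) n → (∀ i → i < n → f i ≡ h i) → applyUpTo f n ≡ applyUpTo h n
 applyUpTo-cong f h zero    _  = refl
 applyUpTo-cong f h (suc n) eq = cong₂ _∷_ (eq 0 z<s) (applyUpTo-cong (f ∘ suc) (h ∘ suc) n (λ i i<n → eq (suc i) (s≤s i<n)))

 applyUpTo-+ : ∀ {A : Set} (f : ℕ → A) a b → applyUpTo f (a + b) ≡ applyUpTo f a ++ applyUpTo (λ i → f (a + i)) b
 applyUpTo-+ f zero    b = refl
 applyUpTo-+ f (suc a) b = cong (f 0 ∷_) (applyUpTo-+ (f ∘ suc) a b)

 applyUpTo-blocks : ∀ {A : Set} (f : ℕ → A) q b → applyUpTo f (q * b) ≡ concat (applyUpTo (λ c → applyUpTo (λ k → f (k + c * b)) b) q)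
 applyUpTo-blocks f zero    b = refl
 applyUpTo-blocks f (suc q) b = trans (applyUpTo-+ f b (q * b)) (cong₂ _++_
   (applyUpTo-cong f (λ k → f (k + 0)) b (λ k _ → cong f (sym (ℕₚ.+-identityʳ k))))
   (trans (applyUpTo-blocks (λ i → f (b + i)) q b) (cong concat (applyUpTo-cong _ _ q λ c _ → applyUpTo-cong _ _ b λ k _ → cong f (x∙yz≈y∙xz b k (c * b))))))

 applyUpTo-const : ∀ {A : Set} (x : A) n → applyUpTo (λ _ → x) n ≡ replicate n x
 applyUpTo-const x zero    = refl
 applyUpTo-const x (suc n) = cong (x ∷_) (applyUpTo-const x n)

 replicate-+ : ∀ {A : Set} a b (x : A) → replicate (a + b) x ≡ replicate a x ++ replicate b x
 replicate-+ zero    b x = refl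
 replicate-+ (suc a) b x = cong (x ∷_) (replicate-+ a b x)

 concat-replicate : ∀ {A : Set} a b (x : A) → concat (replicate a (replicate b x)) ≡ replicate (a * b) x
 concat-replicate zero    b x = refl
 concat-replicate (suc a) b x = trans (cong (replicate b x ++_) (concat-replicate a b x)) (sym (replicate-+ b (a * b) x))

 concatMap-const : ∀ {A B : Set} (x : List B) (w : List A) → concatMap (λ _ → x) w ≡ concat (replicate (length w) x)
 concatMap-const x []      = refl
 concatMap-const x (_ ∷ w) = cong (x ++_) (concatMap-const x w)

 -- Digit strings that depend on the input and on a number N.
 data Segment : Set where
   fixed    : List ℕ → Segment
   timesN   : List ℕ → Segment
   perInput : (Bool → List ℕ) → Segment

 expand : ℕ → Word → Segment → List ℕ
 expand N w (fixed ds)   = ds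
 expand N w (timesN ds)  = concat (replicate N ds)
 expand N w (perInput f) = concatMap f w

 expandAll : ℕ → Word → List Segment → List ℕ
 expandAll N w = concatMap (expand N w)

 expandAll-++ : ∀ N w xs ys → expandAll N w (xs ++ ys) ≡ expandAll N w xs ++ expandAll N w ys
 expandAll-++ N w = Listₚ.concatMap-++ (expand N w)

 kindDigit : Kind → ℕ
 kindDigit κ = code (just (κ , false , false , false))

 module Program (M : TM) where
   open TM M

   open Alphabet M
   open Columns

   word : (ℕ → Kind) → List ℕ
   word κ = applyUpTo (λ k → kindDigit (κ k)) W

   rowSegments : Columns → List Segment
   rowSegments C =
     fixed (word (control C) ++ word (tapes C leftEnd)) ∷
     timesN (word (tapes C inner)) ∷
     fixed (word (tapes C beforeHead) ++ word (tapes C atHead) ++ word (tapes C afterHead)) ∷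
     perInput (λ _ → word (tapes C inner)) ∷
     timesN (word (tapes C inner)) ∷
     fixed (word (tapes C rightEnd)) ∷ []

   loading : Bool → Kind
   loading b = if b then load1 else load0

   controlBit : ℕ → Bool
   controlBit zero    = false
   controlBit (suc k) = does (toℕ start ≟ k)

   onInputTape : Symbol g → Fin (suc m) → Symbol g
   onInputTape s zero    = s
   onInputTape s (suc _) = blank

   symbolWord : Symbol g → List ℕ
   symbolWord s = word (λ k → loading (slot (λ τ i → is (onInputTape s τ) i) false k))

   loadSegments : List Segment
   loadSegments =
     fixed (word (λ k → loading (controlBit k))) ∷
     fixed (symbolWord blank ++ symbolWord blank) ∷
     timesN (symbolWord blank) ∷
     perInput (λ b → symbolWord (bit b)) ∷
     timesN (symbolWord blank) ∷
     fixed (symbolWord blank ++ symbolWord blank ++ symbolWord blank) ∷ []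

   copyColumns : Columns
   copyColumns = columns (λ _ → copy) (λ _ _ → copy)

   columnsRow : ℕ → (ℕ → Columns) → (ℕ → Columns) → ℕ → Columns
   columnsRow zero    gs us _             = copyColumns
   columnsRow (suc G) gs us zero          = gs 0
   columnsRow (suc G) gs us (suc zero)    = us 0
   columnsRow (suc G) gs us (suc (suc r)) = columnsRow G (gs ∘ suc) (us ∘ suc) r

   period : ℕ
   period = suc (G * 2)

   rowColumns : ℕ → Columns
   rowColumns = columnsRow G (λ e → guardColumns (ruleAt e)) (λ e → updateColumns (ruleAt e))

   programSegments : List Segment
   programSegments = loadSegments ++ concat (applyUpTo (λ r → rowSegments (rowColumns r)) period)

   module On (N : ℕ) (w : Word) where
     private n = length w
     module L = Layout M N n
     open L using (region; base; total; len-1; len; columnKind; rowOf)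

     columnsAll : (Region → List ℕ) → List (List ℕ)
     columnsAll f = f leftEnd ∷ replicate N (f inner) ++ f beforeHead ∷ f atHead ∷ f afterHead ∷ replicate n (f inner) ++ replicate N (f inner) ++ f rightEnd ∷ []

     private
       left-columns : ∀ (f : Region → List ℕ) k → k ≤ N → applyUpTo (λ r → f (region (offset (suc k) r))) (suc k) ≡ replicate k (f inner) ++ f beforeHead ∷ []
       left-columns f zero    _   = refl
       left-columns f (suc k) k<N = cong₂ _∷_ (cong f (first (k ≟ N))) (left-columns f k (ℕₚ.<⇒≤ k<N))
         where
         first : (d : Dec (k ≡ N)) → (if does d then leftEnd else inner) ≡ inner
         first (yes refl) = ⊥-elim (ℕₚ.<-irrefl refl k<N)
         first (no _)     = refl

       right-columns : ∀ (f : Region → List ℕ) j k → j + k ≡ n + N → applyUpTo (λ i → f (region (+ suc (suc (j + i))))) (suc k) ≡ replicate k (f inner) ++ f rightEnd ∷ []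
       right-columns f j zero eq = cong (λ ζ → f ζ ∷ []) (last ((j + 0) ≟ n + N))
         where
         last : (d : Dec (j + 0 ≡ n + N)) → (if does d then rightEnd else inner) ≡ rightEnd
         last (yes _) = refl
         last (no ≢)  = ⊥-elim (≢ eq)
       right-columns f j (suc k) eq = cong₂ _∷_ (cong f (inside ((j + 0) ≟ n + N)))
         (trans (applyUpTo-cong _ _ (suc k) (λ i _ → cong (λ p → f (region (+ suc (suc p)))) (ℕₚ.+-suc j i))) (right-columns f (suc j) k (trans (sym (ℕₚ.+-suc j k)) eq)))
         where
         inside : (d : Dec (j + 0 ≡ n + N)) → (if does d then rightEnd else inner) ≡ inner
         inside (yes eq′) = ⊥-elim (ℕₚ.m≢1+m+n (j + 0) (trans (trans eq′ (sym eq)) (trans (ℕₚ.+-suc j k) (cong (λ p → suc (p + k)) (sym (ℕₚ.+-identityʳ j))))))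
         inside (no _)    = refl

     regions-listed : ∀ (f : Region → List ℕ) → applyUpTo (λ r → f (region (offset base r))) total ≡ columnsAll f
     regions-listed f = trans (trans (applyUpTo-+ (λ r → f (region (offset base r))) base (3 + (n + N))) (cong₂ _++_ left-part right-part)) reassociate
       where
       left-part : applyUpTo (λ r → f (region (offset base r))) base ≡ f leftEnd ∷ (replicate N (f inner) ++ f beforeHead ∷ [])
       left-part = cong₂ _∷_ (cong f (first (N ≟ N))) (left-columns f N ℕₚ.≤-refl)
         where
         first : (d : Dec (N ≡ N)) → (if does d then leftEnd else inner) ≡ leftEnd
         first (yes _) = refl
         first (no ≢)  = ⊥-elim (≢ refl)
       right-part : applyUpTo (λ i → f (region (offset base (base + i)))) (3 + (n + N)) ≡
                    f atHead ∷ f afterHead ∷ replicate n (f inner) ++ replicate N (f inner) ++ f rightEnd ∷ []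
       right-part = trans (applyUpTo-cong _ _ (3 + (n + N)) (λ i _ → cong (λ z → f (region z)) (offset-+ base i)))
         (cong (λ l → f atHead ∷ f afterHead ∷ l) (trans (right-columns f 0 (n + N) refl)
           (trans (cong (_++ f rightEnd ∷ []) (replicate-+ n N (f inner))) (Listₚ.++-assoc (replicate n (f inner)) (replicate N (f inner)) _))))
       reassociate : (f leftEnd ∷ (replicate N (f inner) ++ f beforeHead ∷ [])) ++ (f atHead ∷ f afterHead ∷ replicate n (f inner) ++ replicate N (f inner) ++ f rightEnd ∷ []) ≡ columnsAll f
       reassociate = cong (f leftEnd ∷_) (Listₚ.++-assoc (replicate N (f inner)) (f beforeHead ∷ []) _)

     columns-blocks : ∀ (κ : ℕ → ℕ → Kind) → applyUpTo (λ j → kindDigit (κ (proj₁ (Slots.place j)) (proj₂ (Slots.place j)))) len ≡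
                      word (κ 0) ++ concat (applyUpTo (λ r → word (κ (suc r))) total)
     columns-blocks κ = trans (applyUpTo-blocks (λ j → kindDigit (κ (proj₁ (Slots.place j)) (proj₂ (Slots.place j)))) (suc total) W)
       (cong concat (applyUpTo-cong _ (λ c → word (κ c)) (suc total) λ c _ → applyUpTo-cong _ _ W λ k k<W →
         cong (λ p → kindDigit (κ (proj₁ p) (proj₂ p))) (L.place-column c k k<W)))

     row-expand : ∀ C → expandAll N w (rowSegments C) ≡ applyUpTo (λ j → kindDigit (rowOf C j)) len
     row-expand C = sym (trans (columns-blocks (columnKind C)) (trans (cong (λ l → word (control C) ++ concat l) (regions-listed (λ ζ → word (tapes C ζ)))) regroup))
       where
       c = word (control C)
       l = word (tapes C leftEnd)
       i = word (tapes C inner)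
       b = word (tapes C beforeHead)
       h = word (tapes C atHead)
       a = word (tapes C afterHead)
       r = word (tapes C rightEnd)
       open ≡-Reasoning
       regroup : c ++ concat (columnsAll (λ ζ → word (tapes C ζ))) ≡ expandAll N w (rowSegments C)
       regroup = begin
         c ++ (l ++ concat (replicate N i ++ b ∷ h ∷ a ∷ replicate n i ++ replicate N i ++ r ∷ []))
           ≡⟨ Listₚ.++-assoc c l _ ⟨
         (c ++ l) ++ concat (replicate N i ++ b ∷ h ∷ a ∷ replicate n i ++ replicate N i ++ r ∷ [])
           ≡⟨ cong ((c ++ l) ++_) (Listₚ.concat-++ (replicate N i) _) ⟨
         (c ++ l) ++ (concat (replicate N i) ++ (b ++ (h ++ (a ++ concat (replicate n i ++ replicate N i ++ r ∷ [])))))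
           ≡⟨ cong (λ z → (c ++ l) ++ (concat (replicate N i) ++ (b ++ (h ++ (a ++ z))))) (Listₚ.concat-++ (replicate n i) _) ⟨
         (c ++ l) ++ (concat (replicate N i) ++ (b ++ (h ++ (a ++ (concat (replicate n i) ++ concat (replicate N i ++ r ∷ []))))))
           ≡⟨ cong (λ z → (c ++ l) ++ (concat (replicate N i) ++ (b ++ (h ++ (a ++ (concat (replicate n i) ++ z)))))) (Listₚ.concat-++ (replicate N i) _) ⟨
         (c ++ l) ++ (concat (replicate N i) ++ (b ++ (h ++ (a ++ (concat (replicate n i) ++ (concat (replicate N i) ++ (r ++ [])))))))
           ≡⟨ cong (λ z → (c ++ l) ++ (concat (replicate N i) ++ z)) (trans (cong (b ++_) (sym (Listₚ.++-assoc h a _))) (sym (Listₚ.++-assoc b (h ++ a) _))) ⟩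
         (c ++ l) ++ (concat (replicate N i) ++ ((b ++ h ++ a) ++ (concat (replicate n i) ++ (concat (replicate N i) ++ (r ++ [])))))
           ≡⟨ cong (λ z → (c ++ l) ++ (concat (replicate N i) ++ ((b ++ h ++ a) ++ (z ++ (concat (replicate N i) ++ (r ++ [])))))) (concatMap-const i w) ⟨
         expandAll N w (rowSegments C) ∎

     open Run M using (initial)

     slot-cong : ∀ {A : Set} {f h : Fin (suc m) → Fin γ → A} {d} → (∀ τ i → f τ i ≡ h τ i) → ∀ k → slot f d k ≡ slot h d k
     slot-cong {d = d} eq k with L.slot-cases k
     ... | inj₁ (τ , i , used) = trans (used _ d) (trans (eq τ i) (sym (used _ d)))
     ... | inj₂ unused         = trans (unused _ d) (sym (unused _ d))

     private
       cell-input : ∀ w i → cell {g} (inputTape w) (+ i) ≡ nth (map bit w) i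
       cell-input []       zero    = refl
       cell-input []       (suc i) = refl
       cell-input (b ∷ bs) zero    = refl
       cell-input (b ∷ bs) (suc i) = refl

       cell-input-left : ∀ w i → cell {g} (inputTape w) -[1+ i ] ≡ blank
       cell-input-left []       i = refl
       cell-input-left (b ∷ bs) i = refl

       cell-blank : ∀ z → cell {g} blankTape z ≡ blank
       cell-blank (+ zero)  = refl
       cell-blank (+ suc i) = refl
       cell-blank -[1+ i ]  = refl

       initial-cell : ∀ z τ → cell (lookup (Run.Configuration.tapes (initial w)) τ) z ≡ onInputTape (cell (inputTape w) z) τ
       initial-cell z zero    = refl
       initial-cell z (suc τ) = trans (cong (λ T → cell T z) (Vecₚ.lookup-replicate τ blankTape)) (cell-blank z)

       nths : ∀ (f : Symbol g → List ℕ) (w : Word) k → applyUpTo (λ i → f (nth (map bit w) i)) (length w + k) ≡ map (f ∘ bit) w ++ replicate k (f blank)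
       nths f []      k = applyUpTo-const (f blank) k
       nths f (b ∷ w) k = cong (f (bit b) ∷_) (nths f w k)

     load-columns : applyUpTo (λ r → symbolWord (cell (inputTape w) (offset base r))) total ≡
                    replicate base (symbolWord blank) ++ map (λ b → symbolWord (bit b)) w ++ replicate (3 + N) (symbolWord blank)
     load-columns = trans (applyUpTo-+ (λ r → symbolWord (cell (inputTape w) (offset base r))) base (3 + (n + N))) (cong₂ _++_
       (trans (left base) (applyUpTo-const (symbolWord blank) base))
       (trans (applyUpTo-cong _ _ (3 + (n + N)) (λ i _ → cong symbolWord (trans (cong (cell (inputTape w)) (offset-+ base i)) (cell-input w i))))
         (trans (cong (applyUpTo (λ i → symbolWord (nth (map bit w) i))) (lemma n N)) (nths symbolWord w (3 + N)))))
       where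
       lemma : ∀ n N → 3 + (n + N) ≡ n + (3 + N)
       lemma = solve-∀
       left : ∀ b → applyUpTo (λ r → symbolWord (cell (inputTape w) (offset b r))) b ≡ applyUpTo (λ _ → symbolWord blank) b
       left zero    = refl
       left (suc b) = cong₂ _∷_ (cong symbolWord (cell-input-left w b)) (left b)

     load-expand : expandAll N w loadSegments ≡ applyUpTo (λ j → kindDigit (L.loadRow (initial w) j)) len
     load-expand = sym (trans (columns-blocks (λ c k → loading (L.columnBit (initial w) c k))) (trans (cong₂ _++_
         (applyUpTo-cong (λ k → kindDigit (loading (L.columnBit (initial w) 0 k))) (λ k → kindDigit (loading (controlBit k))) W λ { zero _ → refl ; (suc k) _ → refl })
         (cong concat (trans (applyUpTo-cong (λ r → word (λ k → loading (L.columnBit (initial w) (suc r) k))) (λ r → symbolWord (cell (inputTape w) (offset base r))) total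
           λ r _ → applyUpTo-cong (λ k → kindDigit (loading (L.columnBit (initial w) (suc r) k))) (λ k → kindDigit (loading (slot (λ τ i → is (onInputTape (cell (inputTape w) (offset base r)) τ) i) false k))) W λ k _ → cong (λ b → kindDigit (loading b))
           (slot-cong (λ τ i → cong (λ s → is s i) (initial-cell (offset base r) τ)) k)) load-columns))) regroup))
       where
       c = word (λ k → loading (controlBit k))
       B = symbolWord blank
       ws = map (λ b → symbolWord (bit b)) w
       open ≡-Reasoning
       regroup : c ++ (B ++ (B ++ concat (replicate N B ++ ws ++ replicate (3 + N) B))) ≡ expandAll N w loadSegments
       regroup = cong (c ++_) (begin
         B ++ (B ++ concat (replicate N B ++ ws ++ replicate (3 + N) B))
           ≡⟨ Listₚ.++-assoc B B _ ⟨
         (B ++ B) ++ concat (replicate N B ++ ws ++ replicate (3 + N) B)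
           ≡⟨ cong ((B ++ B) ++_) (trans (sym (Listₚ.concat-++ (replicate N B) _)) (cong (concat (replicate N B) ++_) (sym (Listₚ.concat-++ ws _)))) ⟩
         (B ++ B) ++ (concat (replicate N B) ++ (concat ws ++ concat (replicate (3 + N) B)))
           ≡⟨ cong (λ z → (B ++ B) ++ (concat (replicate N B) ++ (concat ws ++ z))) tail-blocks ⟩
         (B ++ B) ++ (concat (replicate N B) ++ (concat ws ++ (concat (replicate N B) ++ ((B ++ B ++ B) ++ [])))) ∎)
         where
         tail-blocks : concat (replicate (3 + N) B) ≡ concat (replicate N B) ++ ((B ++ B ++ B) ++ [])
         tail-blocks = trans (cong (λ k → concat (replicate k B)) (ℕₚ.+-comm 3 N)) (trans (cong concat (replicate-+ N 3 B))
           (trans (sym (Listₚ.concat-++ (replicate N B) (replicate 3 B))) (cong (concat (replicate N B) ++_)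
             (trans (cong (λ z → B ++ (B ++ z)) refl) (trans (sym (Listₚ.++-assoc B B (B ++ []))) (trans (Listₚ.++-assoc B B (B ++ [])) (trans (cong (B ++_) (sym (Listₚ.++-assoc B B []))) (sym (Listₚ.++-assoc B (B ++ B) [])))))))))

     module Gr = Grid L.len-1 W G L.guardRow L.updateRow (L.loadRow (initial w))

     prescribed : List ℕ
     prescribed = expandAll N w programSegments

     private
       columnsRow-kind : ∀ H gs us r j → rowOf (columnsRow H gs us r) j ≡ Gr.rows H (λ e → rowOf (gs e)) (λ e → rowOf (us e)) r j
       columnsRow-kind zero    gs us r             j = all-copy (proj₁ (Slots.place j)) (proj₂ (Slots.place j))
         where
         all-copy : ∀ c k → columnKind copyColumns c k ≡ copy
         all-copy zero    k = refl
         all-copy (suc c) k = refl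
       columnsRow-kind (suc H) gs us zero          j = refl
       columnsRow-kind (suc H) gs us (suc zero)    j = refl
       columnsRow-kind (suc H) gs us (suc (suc r)) j = columnsRow-kind H (gs ∘ suc) (us ∘ suc) r j

       expandAll-concat : ∀ xss → expandAll N w (concat xss) ≡ concat (map (expandAll N w) xss)
       expandAll-concat []         = refl
       expandAll-concat (xs ∷ xss) = trans (expandAll-++ N w xs (concat xss)) (cong (expandAll N w xs ++_) (expandAll-concat xss))

     open Place (G * 2) using (place; place-at)

     kindOfRow : ℕ → ℕ → Kind
     kindOfRow = Gr.kindAt

     prescribed-rows : prescribed ≡ concat (applyUpTo (λ ρ → applyUpTo (λ j → kindDigit (kindOfRow ρ j)) len) (suc period))
     prescribed-rows = trans (expandAll-++ N w loadSegments (concat (applyUpTo (λ r → rowSegments (rowColumns r)) period))) (cong₂ _++_ load-expand (trans (expandAll-concat (applyUpTo (λ r → rowSegments (rowColumns r)) period))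
       (cong concat (trans (Listₚ.map-applyUpTo (λ r → rowSegments (rowColumns r)) (expandAll N w) period) (applyUpTo-cong _ _ period λ r r< →
         trans (row-expand (rowColumns r)) (applyUpTo-cong (λ j → kindDigit (rowOf (rowColumns r) j)) (λ j → kindDigit (kindOfRow (suc r) j)) len λ j _ →
           cong kindDigit (trans (columnsRow-kind G (λ e → guardColumns (ruleAt e)) (λ e → updateColumns (ruleAt e)) r j)
             (cong (λ p → Gr.rowKind (proj₂ p) j) (sym (trans (cong place (sym (ℕₚ.+-identityʳ r))) (place-at 0 r (ℕₚ.≤-pred r<))))))))))))

     module Cells = Place L.len-1

     prescribed-cells : prescribed ≡ applyUpTo (λ i → kindDigit (kindOfRow (proj₁ (Cells.place i)) (proj₂ (Cells.place i)))) (suc period * len)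
     prescribed-cells = trans prescribed-rows (sym (trans (applyUpTo-blocks (λ i → kindDigit (kindOfRow (proj₁ (Cells.place i)) (proj₂ (Cells.place i)))) (suc period) len)
       (cong concat (applyUpTo-cong _ (λ ρ → applyUpTo (λ j → kindDigit (kindOfRow ρ j)) len) (suc period) λ ρ _ →
         applyUpTo-cong (λ j → kindDigit (kindOfRow (proj₁ (Cells.place (j + ρ * len))) (proj₂ (Cells.place (j + ρ * len))))) (λ j → kindDigit (kindOfRow ρ j)) len λ j j<len →
           cong (λ p → kindDigit (kindOfRow (proj₁ p) (proj₂ p))) (Cells.place-at ρ j (ℕₚ.≤-pred j<len))))))

     prescribed≤ : All (_≤ maxDigit) prescribed
     prescribed≤ = subst (All (_≤ maxDigit)) (sym prescribed-cells)
       (Allₚ.applyUpTo⁺₂ _ (suc period * len) λ i → code≤ (just (kindOfRow (proj₁ (Cells.place i)) (proj₂ (Cells.place i)) , false , false , false)))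

     program-digits : ∀ ρ j → j < len → (ρ ≤ period × ∃ λ l → decode (digit prescribed (Gr.position ρ j)) ≡ just (kindOfRow ρ j , l))
                                       ⊎ (period < ρ × decode (digit prescribed (Gr.position ρ j)) ≡ nothing)
     program-digits ρ j j<len = by-size (digit-applyUpTo letterDigit (suc period * len) (Gr.position ρ j))
       where
       letterDigit : ℕ → ℕ
       letterDigit i = kindDigit (kindOfRow (proj₁ (Cells.place i)) (proj₂ (Cells.place i)))
       digit-eq : ∀ {d} → digit (applyUpTo letterDigit (suc period * len)) (Gr.position ρ j) ≡ d → decode (digit prescribed (Gr.position ρ j)) ≡ decode d
       digit-eq eq = cong decode (trans (cong (λ l → digit l (Gr.position ρ j)) prescribed-cells) eq)
       by-size : _ → _
       by-size (inj₁ (i< , eq)) = inj₁ (ℕₚ.≤-pred (ℕₚ.*-cancelʳ-< len ρ (suc period) (ℕₚ.≤-<-trans (ℕₚ.m≤n+m (ρ * len) j) i<)) , _ ,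
         trans (digit-eq eq) (trans (decode-code _) (cong (λ p → just (kindOfRow (proj₁ p) (proj₂ p) , false , false , false)) (Cells.place-at ρ j (ℕₚ.≤-pred j<len)))))
       by-size (inj₂ (≤i , eq)) = inj₂ (ℕₚ.≰⇒> (λ ρ≤ → ℕₚ.<⇒≱ (ℕₚ.<-≤-trans (ℕₚ.+-monoˡ-< (ρ * len) j<len) (ℕₚ.*-monoˡ-≤ len (s≤s ρ≤))) ≤i) , digit-eq eq)

     open Run M using (Configuration; ⟨_,_⟩; state; step; run; Halted; Accepting; space)
     private
       trace : ℕ → Configuration
       trace t = Run.after M t w

     run-last : ∀ t c {c′} → step (run t c) ≡ just c′ → run (suc t) c ≡ c′
     run-last zero    c eq rewrite eq = refl
     run-last (suc t) c eq with step c in eq₀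
     ... | just c₁ = run-last t c₁ eq
     ... | nothing with trans (sym eq₀) eq
     ...   | ()

     first-halt : ∀ t c → Halted (run t c) → ∃ λ T → Halted (run T c) × (∀ t′ → t′ < T → ∃ λ c′ → step (run t′ c) ≡ just c′) × run T c ≡ run t c
     first-halt zero    c halted = 0 , halted , (λ _ ()) , refl
     first-halt (suc t) c halted = by-step (step c) refl
       where
       by-step : ∀ s → step c ≡ s → ∃ λ T → Halted (run T c) × (∀ t′ → t′ < T → ∃ λ c′ → step (run t′ c) ≡ just c′) × run T c ≡ run (suc t) c
       by-step nothing   eq = 0 , eq , (λ _ ()) , sym (cong (λ s → Maybe.maybe (run t) c s) eq)
       by-step (just c₁) eq = let T , h , before , same = first-halt t c₁ (subst Halted (unfold t) halted) in
         suc T , subst Halted (sym (unfold T)) h , (λ { zero _ → c₁ , eq ; (suc t′) (s≤s t′<T) → proj₁ (before t′ t′<T) , trans (cong step (unfold t′)) (proj₂ (before t′ t′<T)) }) ,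
         trans (unfold T) (trans same (sym (unfold t)))
         where
         unfold : ∀ t → run (suc t) c ≡ run t c₁
         unfold t = cong (λ s → Maybe.maybe (run t) c s) eq

     module Bounded (space≤ : ∀ t → space (trace t) ≤ N) where

       private
         cells≤ : ∀ {k} (ts : Vec (Tape g) k) τ → cells (lookup ts τ) ≤ Vec.sum (Vec.map cells ts)
         cells≤ (T ∷ ts) zero    = ℕₚ.m≤m+n _ _
         cells≤ (T ∷ ts) (suc τ) = ℕₚ.≤-trans (cells≤ ts τ) (ℕₚ.m≤n+m _ _)

       within : ∀ t → L.Within (trace t)
       within t τ with lookup (Configuration.tapes (trace t)) τ | ℕₚ.≤-trans (cells≤ (Configuration.tapes (trace t)) τ) (space≤ t)
       ... | tape l _ r | le = ℕₚ.≤-trans (ℕₚ.m≤m+n (length l) (suc (length r))) le ,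
         ℕₚ.≤-trans (ℕₚ.≤-trans (ℕₚ.n≤1+n (length r)) (ℕₚ.m≤n+m (suc (length r)) (length l))) le

       rule : ℕ → ℕ
       rule t = L.ruleNumber (L.currentRule (trace t))

       update-rule : ∀ t j → L.updateRow (rule t) j ≡ rowOf (updateColumns (L.currentRule (trace t))) j
       update-rule t j = cong (λ ρ → rowOf (updateColumns ρ) j) (L.ruleAt-number (L.currentRule (trace t)))

       private
         step-action : ∀ c {c′} → step c ≡ just c′ → ∃ λ q → ∃ λ as → δ (state c) (Vec.map Tape.head (Configuration.tapes c)) ≡ just (q , as) ×
                       c′ ≡ ⟨ q , Vec.zipWith Defs.act as (Configuration.tapes c) ⟩
         step-action c eq with δ (state c) (Vec.map Tape.head (Configuration.tapes c))
         step-action c refl | just (q , as) = q , as , refl , refl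

         halted-action : ∀ c → Halted c → δ (state c) (Vec.map Tape.head (Configuration.tapes c)) ≡ nothing
         halted-action c eq with δ (state c) (Vec.map Tape.head (Configuration.tapes c))
         ... | nothing = refl

         guard-cases : ∀ {κ} → κ ≡ idle ⊎ κ ≡ test ⊎ κ ≡ reset → Gr.Guard κ
         guard-cases (inj₁ refl)        = Gr.idle
         guard-cases (inj₂ (inj₁ refl)) = Gr.test
         guard-cases (inj₂ (inj₂ refl)) = Gr.reset

       computation : ∀ T → (∀ t → t < T → ∃ λ c′ → step (trace t) ≡ just c′) → Gr.Computation T prescribed
       computation T steps = record
         { enc          = λ t → L.bits (trace t)
         ; rule         = rule
         ; rule<G       = λ t → L.ruleNumber<G (L.currentRule (trace t))
         ; W<len        = ℕₚ.m<m+n W z<s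
         ; guard-reset  = λ e → refl
         ; guards       = λ e j → guard-cases (L.guard-kinds e j)
         ; updates      = λ e j → L.update-kinds (accepting (proj₁ (L.ruleAt e))) (δ (proj₁ (L.ruleAt e)) (proj₂ (L.ruleAt e))) (proj₁ (Slots.place j)) (proj₂ (Slots.place j))
                            Gr.Update (refl , λ _ _ → refl) (refl , λ _ _ → refl) (refl , λ _ _ → refl) (refl , λ _ _ → refl) (refl , λ _ _ → refl) (refl , λ _ _ → refl) (refl , λ _ _ → refl) (refl , λ _ _ → refl)
         ; load-bit     = λ j → load-cases (L.bits (initial w) j)
         ; rule-matches = λ t → L.rule-matches (trace t)
         ; only-rule    = λ t → L.only-rule (trace t)
         ; next         = next
         ; program      = program-digits
         }
         where
         load-cases : ∀ b → (loading b ≡ load0 × b ≡ false) ⊎ (loading b ≡ load1 × b ≡ true)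
         load-cases false = inj₁ (refl , refl)
         load-cases true  = inj₂ (refl , refl)
         next : ∀ t → t < T → ∀ j → j < len → Gr.Prescribes (L.bits (trace t)) j (L.updateRow (rule t) j) (L.bits (trace (suc t)) j)
         next t t<T j j<len = subst₂ (Gr.Prescribes (L.bits (trace t)) j) (sym (update-rule t j))
             (cong (λ c → L.bits c j) (sym (trans (run-last t (initial w) (proj₂ (steps t t<T))) (proj₂ (proj₂ (proj₂ action))))))
             (L.Step.step-prescribes (L.loadRow (initial w)) (trace t) (within t) (proj₁ action) (proj₁ (proj₂ action)) (proj₁ (proj₂ (proj₂ action))) j j<len)
           where
           action = step-action (trace t) (proj₂ (steps t t<T))

       final-kind : ∀ T → Halted (trace T) → L.updateRow (rule T) 0 ≡ (if accepting (state (trace T)) then accept else reject)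
       final-kind T halted = trans (update-rule T 0)
         (cong (λ o → rowOf (L.outcomeColumns (accepting (state (trace T))) o) 0) (halted-action (trace T) halted))

       accepted : ∀ t → Halted (trace t) → Accepting (trace t) → ∃ λ ds → All (_≤ maxDigit) ds × Gr.Admissible prescribed (digit ds)
       accepted t halted accepts = let T , h , steps , same = first-halt t (initial w) halted in
         Gr.Analysis.Accepting.transcript (computation T steps) (kind T h same) , Gr.Analysis.Accepting.transcript≤ (computation T steps) (kind T h same) ,
         Gr.Analysis.Accepting.admissible (computation T steps) (kind T h same)
         where
         kind : ∀ T → Halted (trace T) → trace T ≡ trace t → L.updateRow (rule T) 0 ≡ accept
         kind T h same = trans (final-kind T h) (cong (λ b → if b then accept else reject) (trans (cong (λ c → accepting (state c)) same) accepts))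

       rejected : ∀ t → Halted (trace t) → accepting (state (trace t)) ≡ false → ∀ d → ¬ Gr.Admissible prescribed d
       rejected t halted rejects d admissible = let T , h , steps , same = first-halt t (initial w) halted in
         Gr.Analysis.Rejecting.contradiction (computation T steps)
           (trans (final-kind T h) (cong (λ b → if b then accept else reject) (trans (cong (λ c → accepting (state c)) same) rejects))) d admissible

   rowZeros : List Segment
   rowZeros = fixed (replicate (6 * W) 0) ∷ timesN (replicate W 0) ∷ perInput (λ _ → replicate W 0) ∷ timesN (replicate W 0) ∷ []

   -- Digit strings of the powers ε^s for the four shifts s.
   shiftSegments : Fin 4 → List Segment
   shiftSegments zero                   = fixed (0 ∷ 1 ∷ []) ∷ []
   shiftSegments (suc zero)             = fixed (replicate W 0 ++ 1 ∷ []) ∷ []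
   shiftSegments (suc (suc zero))       = rowZeros ++ fixed (1 ∷ []) ∷ []
   shiftSegments (suc (suc (suc zero))) = concat (replicate period rowZeros) ++ fixed (1 ∷ []) ∷ []

   module Shifts (N : ℕ) (w : Word) where
     open On N w
     open L using (len)

     private
       rows-expand : expandAll N w rowZeros ≡ replicate len 0
       rows-expand = trans (cong₂ (λ x y → replicate (6 * W) 0 ++ (x ++ (y ++ (x ++ [])))) (concat-replicate N W 0)
           (trans (concatMap-const (replicate W 0) w) (concat-replicate (length w) W 0)))
         (trans (cong (λ z → replicate (6 * W) 0 ++ (replicate (N * W) 0 ++ (replicate (length w * W) 0 ++ z))) (Listₚ.++-identityʳ _))
         (trans (cong (λ z → replicate (6 * W) 0 ++ (replicate (N * W) 0 ++ z)) (sym (replicate-+ (length w * W) (N * W) 0)))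
         (trans (cong (replicate (6 * W) 0 ++_) (sym (replicate-+ (N * W) (length w * W + N * W) 0)))
         (trans (sym (replicate-+ (6 * W) (N * W + (length w * W + N * W)) 0)) (cong (λ k → replicate k 0) (lemma N (length w) W))))))
         where
         lemma : ∀ N n W → 6 * W + (N * W + (n * W + N * W)) ≡ suc (suc (suc N) + (3 + (n + N))) * W
         lemma = solve-∀

       periods-expand : ∀ p → expandAll N w (concat (replicate p rowZeros)) ≡ replicate (p * len) 0
       periods-expand zero    = refl
       periods-expand (suc p) = trans (expandAll-++ N w rowZeros (concat (replicate p rowZeros)))
         (trans (cong₂ _++_ rows-expand (periods-expand p)) (sym (replicate-+ len (p * len) 0)))

     shifts-expand : ∀ k → expandAll N w (shiftSegments k) ≡ replicate (Gr.shift k) 0 ++ 1 ∷ []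
     shifts-expand zero                   = refl
     shifts-expand (suc zero)             = Listₚ.++-identityʳ _
     shifts-expand (suc (suc zero))       = trans (expandAll-++ N w rowZeros (fixed (1 ∷ []) ∷ [])) (cong (_++ 1 ∷ []) rows-expand)
     shifts-expand (suc (suc (suc zero))) = trans (expandAll-++ N w (concat (replicate period rowZeros)) (fixed (1 ∷ []) ∷ [])) (cong (_++ 1 ∷ []) (periods-expand period))

module Calculation where

 open import Defs using (Word; Symbol; blank; bit; aux; poly)
 open Digits using (maxDigit)
 open StackPrograms
 open Binary
 open Words using (Segment; fixed; timesN; perInput; expand; expandAll; expandAll-++)
 open import Data.Bool using (not; _∨_)
 open import Data.Fin using (zero; suc; #_)
 open import Data.List using (_ʳ++_; length; map; foldr; replicate; concat; concatMap; reverse)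
 open import Data.Nat
 open import Data.Nat.DivMod using (_mod_; _%_; m<n⇒m%n≡m)
 open import Data.Nat.Tactic.RingSolver using (solve-∀)
 open import Data.Unit using (⊤; tt)
 open import Data.Vec using (_[_]≔_)

 Polynomial : (ℕ → ℕ) → Set
 Polynomial T = ∃ λ d → ∀ n → T n ≤ (2 + n) ^ d

 module Polynomials where

   raise : ∀ {n} d e → (2 + n) ^ d ≤ (2 + n) ^ (d + e)
   raise {n} d e = ℕₚ.^-monoʳ-≤ (2 + n) (ℕₚ.m≤m+n d e)

   constantᵖ : ∀ c → Polynomial (λ _ → c)
   constantᵖ c = c , λ n → ℕₚ.≤-trans (bound c) (ℕₚ.^-monoˡ-≤ c (ℕₚ.m≤m+n 2 n))
     where
     bound : ∀ c → c ≤ 2 ^ c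
     bound zero    = z≤n
     bound (suc c) = ℕₚ.+-mono-≤ (ℕₚ.m^n>0 2 c) (ℕₚ.≤-trans (bound c) (ℕₚ.m≤m+n (2 ^ c) 0))

   identityᵖ : Polynomial (λ n → n)
   identityᵖ = 1 , λ n → ℕₚ.≤-trans (ℕₚ.m≤n+m n 2) (ℕₚ.≤-reflexive (sym (ℕₚ.*-identityʳ (2 + n))))

   _*ᵖ_ : ∀ {S T} → Polynomial S → Polynomial T → Polynomial (λ n → S n * T n)
   (d , S≤) *ᵖ (e , T≤) = d + e , λ n →
     ℕₚ.≤-trans (ℕₚ.*-mono-≤ (S≤ n) (T≤ n)) (ℕₚ.≤-reflexive (sym (ℕₚ.^-distribˡ-+-* (2 + n) d e)))

   _+ᵖ_ : ∀ {S T} → Polynomial S → Polynomial T → Polynomial (λ n → S n + T n)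
   _+ᵖ_ {S} {T} (d , S≤) (e , T≤) = suc (d + e) , λ n → let x = (2 + n) ^ (d + e) in begin
     S n + T n              ≤⟨ ℕₚ.+-mono-≤ (ℕₚ.≤-trans (S≤ n) (raise d e)) (ℕₚ.≤-trans (T≤ n) (subst (λ f → (2 + n) ^ e ≤ (2 + n) ^ f) (ℕₚ.+-comm e d) (raise e d))) ⟩
     x + x                  ≡⟨ cong (λ y → x + y) (ℕₚ.+-identityʳ x) ⟨
     2 * x                  ≤⟨ ℕₚ.*-monoˡ-≤ x (ℕₚ.m≤m+n 2 n) ⟩
     (2 + n) * x            ∎
     where open ℕₚ.≤-Reasoning

   powerᵖ : ∀ {T} → Polynomial T → ∀ k → Polynomial (λ n → T n ^ k)
   powerᵖ T zero    = constantᵖ 1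
   powerᵖ T (suc k) = T *ᵖ powerᵖ T k

   poly-bound : ∀ {T} → Polynomial T → ∃ λ k → ∀ n → T n ≤ poly k n
   poly-bound {T} (d , T≤) = k , λ n → ℕₚ.≤-trans (T≤ n) (bound n)
     where
     k = 2 * d + 3 ^ d
     bound : ∀ n → (2 + n) ^ d ≤ poly k n
     bound zero          = ℕₚ.≤-trans (ℕₚ.^-monoˡ-≤ d {2} {3} (s≤s (s≤s z≤n))) (ℕₚ.≤-trans (ℕₚ.m≤n+m (3 ^ d) (2 * d)) (ℕₚ.m≤n+m k (0 ^ k)))
     bound (suc zero)    = ℕₚ.≤-trans (ℕₚ.m≤n+m (3 ^ d) (2 * d)) (ℕₚ.m≤n+m k (1 ^ k))
     bound n@(suc (suc n-2)) = begin
       (2 + n) ^ d      ≤⟨ ℕₚ.^-monoˡ-≤ d {2 + n} {n ^ 2} square ⟩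
       (n ^ 2) ^ d      ≡⟨ ℕₚ.^-*-assoc n 2 d ⟩
       n ^ (2 * d)      ≤⟨ ℕₚ.^-monoʳ-≤ n (ℕₚ.m≤m+n (2 * d) (3 ^ d)) ⟩
       n ^ k            ≤⟨ ℕₚ.m≤m+n (n ^ k) k ⟩
       n ^ k + k        ∎
       where
       open ℕₚ.≤-Reasoning
       square : 2 + n ≤ n ^ 2
       square = begin
         2 + n              ≡⟨ lemma n-2 ⟩
         2 * 2 + n-2        ≤⟨ ℕₚ.m≤m+n _ (3 * n-2 + n-2 * n-2) ⟩
         2 * 2 + n-2 + (3 * n-2 + n-2 * n-2) ≡⟨ lemma′ n-2 ⟩
         n ^ 2              ∎
         where
         lemma : ∀ x → 2 + suc (suc x) ≡ 2 * 2 + x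
         lemma = solve-∀
         lemma′ : ∀ x → 2 * 2 + x + (3 * x + x * x) ≡ suc (suc x) * (suc (suc x) * 1)
         lemma′ = solve-∀

 odd : ℕ → Bool
 odd zero    = false
 odd (suc n) = not (odd n)

 halving : ∀ n → bitValue (odd n) + ⌊ n /2⌋ * 2 ≡ n
 halving zero          = refl
 halving (suc zero)    = refl
 halving (suc (suc n)) = trans (cong (λ b → bitValue b + suc ⌊ n /2⌋ * 2) (not-not (odd n)))
   (trans (ℕₚ.+-suc (bitValue (odd n)) _) (cong suc (trans (ℕₚ.+-suc (bitValue (odd n)) _) (cong suc (halving n)))))
   where
   not-not : ∀ b → not (not b) ≡ b
   not-not false = refl
   not-not true  = refl

 value : List Bool → ℕ
 value []       = 0
 value (b ∷ bs) = bitValue b + value bs * 2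

 Bin-value : ∀ {bs n} → Bin bs n → value bs ≡ n
 Bin-value []          = refl
 Bin-value one         = refl
 Bin-value (twice b B) = cong (λ v → bitValue b + v * 2) (Bin-value B)

 -- The value after the bits are moved one by one onto a string of value h; with it the invariant of
 -- the addition below needs no powers of two.
 prepended : List Bool → ℕ → ℕ
 prepended []       h = h
 prepended (b ∷ xs) h = prepended xs (bitValue b + h * 2)

 prepended-odd : ∀ s xs h → prepended (odd s ∷ xs) (h + ⌊ s /2⌋) ≡ prepended xs (s + h * 2)
 prepended-odd s xs h = cong (prepended xs) (trans (lemma (bitValue (odd s)) h ⌊ s /2⌋) (cong (_+ h * 2) (halving s)))
   where
   lemma : ∀ b h s → b + (h + s) * 2 ≡ b + s * 2 + h * 2
   lemma = solve-∀

 Bin-prepend : ∀ {bs v} xs → Bin bs (suc v) → Bin (xs ʳ++ bs) (prepended xs (suc v))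
 Bin-prepend []           B = B
 Bin-prepend (false ∷ xs) B = Bin-prepend xs (twice false B)
 Bin-prepend (true ∷ xs)  B = Bin-prepend xs (twice true B)

 Bin-reverse : ∀ xs → Bin ((true ∷ xs) ʳ++ []) (prepended (true ∷ xs) 0)
 Bin-reverse xs = Bin-prepend xs one

 module Arithmetic (a D B : ℕ) where

   M : ℕ
   M = a + D + suc B

   open StackMachine (suc M) 10 public

   -- The digits of numbers lie on u and v; the other places are the input and the part of it that
   -- was read, the two halves of a unary counter, auxiliary copies, carries and the output.
   input read counter counted u v u′ v′ carryᵘ carryᵛ output : Fin 11
   input   = # 0
   read    = # 1
   counter = # 2
   counted = # 3
   u       = # 4
   v       = # 5
   u′      = # 6
   v′      = # 7
   carryᵘ  = # 8
   carryᵛ  = # 9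
   output  = # 10

   memory : (I R C E us vs xs ys : List Bool) (ps qs : List (Fin (suc M))) (O : List Bool) → Stacks
   memory I R C E us vs xs ys ps qs O =
     map bit I ∷ map bit R ∷ map bit C ∷ map bit E ∷ map bit us ∷ map bit vs ∷ map bit xs ∷ map bit ys ∷
     map aux ps ∷ map aux qs ∷ map bit O ∷ []

   nonblank isTrue isFalse positive : Symbol (suc M) → Bool
   nonblank blank = false
   nonblank _     = true
   isTrue (bit true) = true
   isTrue _          = false
   isFalse (bit false) = true
   isFalse _           = false
   positive (aux (suc _)) = true
   positive _             = false

   change : ∀ {f s s′} → Vec.zipWith perform (f (tops s)) s ≡ s′ → Runs (op f) s 1 s′
   change refl = op

   Runs-to : ∀ {P s t s′ s″} → s′ ≡ s″ → Runs P s t s′ → Runs P s t s″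
   Runs-to refl r = r

   Runs-in : ∀ {P s t t′ s′} → t ≡ t′ → Runs P s t s′ → Runs P s t′ s′
   Runs-in refl r = r

   moving : Fin 11 → Fin 11 → Program
   moving i j = while (λ ts → nonblank (lookup ts i)) (op λ ts → idle [ i ]≔ pop [ j ]≔ push (lookup ts i))

   moving-runs : ∀ i j (S : List Bool → List Bool → Stacks) →
     (∀ xs ys → lookup (tops (S xs ys)) i ≡ top (map bit xs)) →
     (∀ x xs ys → Vec.zipWith perform (idle [ i ]≔ pop [ j ]≔ push (bit x)) (S (x ∷ xs) ys) ≡ S xs (x ∷ ys)) →
     ∀ xs ys → Runs (moving i j) (S xs ys) (suc (length xs * 2)) (S [] (xs ʳ++ ys))
   moving-runs i j S top≡ moved []       ys = stop (cong nonblank (top≡ [] ys))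
   moving-runs i j S top≡ moved (x ∷ xs) ys = loop (cong nonblank (top≡ (x ∷ xs) ys))
     (change (trans (cong (λ z → Vec.zipWith perform (idle [ i ]≔ pop [ j ]≔ push z) (S (x ∷ xs) ys)) (top≡ (x ∷ xs) ys)) (moved x xs ys)))
     (moving-runs i j S top≡ moved xs (x ∷ ys))

   discarding : Fin 11 → Program
   discarding i = while (λ ts → nonblank (lookup ts i)) (op λ ts → idle [ i ]≔ pop)

   discarding-runs : ∀ i (S : List Bool → Stacks) →
     (∀ xs → lookup (tops (S xs)) i ≡ top (map bit xs)) →
     (∀ x xs → Vec.zipWith perform (idle [ i ]≔ pop) (S (x ∷ xs)) ≡ S xs) →
     ∀ xs → Runs (discarding i) (S xs) (suc (length xs * 2)) (S [])
   discarding-runs i S top≡ popped []       = stop (cong nonblank (top≡ []))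
   discarding-runs i S top≡ popped (x ∷ xs) = loop (cong nonblank (top≡ (x ∷ xs))) (change (popped x xs)) (discarding-runs i S top≡ popped xs)

   trimming : Fin 11 → Program
   trimming i = while (λ ts → isFalse (lookup ts i)) (op λ ts → idle [ i ]≔ pop)

   trimming-runs : ∀ i (S : List Bool → Stacks) →
     (∀ xs → lookup (tops (S xs)) i ≡ top (map bit xs)) →
     (∀ x xs → Vec.zipWith perform (idle [ i ]≔ pop) (S (x ∷ xs)) ≡ S xs) →
     ∀ xs → ∃ λ t → t ≤ suc (length xs * 2) × ∃ λ xs′ → Runs (trimming i) (S xs) t (S xs′) ×
       length xs′ ≤ length xs × Bin (xs′ ʳ++ []) (prepended xs 0)
   trimming-runs i S top≡ popped []           = 1 , ℕₚ.≤-refl , [] , stop (cong isFalse (top≡ [])) , z≤n , []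
   trimming-runs i S top≡ popped (true ∷ xs)  = 1 , s≤s z≤n , true ∷ xs , stop (cong isFalse (top≡ (true ∷ xs))) , ℕₚ.≤-refl , Bin-reverse xs
   trimming-runs i S top≡ popped (false ∷ xs) =
     let t , t≤ , xs′ , r , shorter , B = trimming-runs i S top≡ popped xs
     in suc (1 + t) , s≤s (s≤s t≤) , xs′ , loop (cong isFalse (top≡ (false ∷ xs))) (change (popped false xs)) r , ℕₚ.m≤n⇒m≤1+n shorter , B

   bitOf carryOf : Symbol (suc M) → ℕ
   bitOf (bit b) = bitValue b
   bitOf _       = 0
   carryOf (aux c) = toℕ c
   carryOf _       = 0

   clamp : ℕ → Fin (suc M)
   clamp s = s mod suc M

   clamp-≤ : ∀ {s} → s ≤ M → toℕ (clamp s) ≡ s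
   clamp-≤ s≤M = trans (Finₚ.toℕ-fromℕ< _) (m<n⇒m%n≡m (s≤s s≤M))

   sumᵘ sumᵛ : ℕ → ℕ → ℕ → ℕ
   sumᵘ x y c = a * x + D * y + c
   sumᵛ x y c = x + a * y + c

   adding : Program
   adding = while (λ ts → nonblank (lookup ts u) ∨ nonblank (lookup ts v) ∨ positive (lookup ts carryᵘ) ∨ positive (lookup ts carryᵛ))
     (op λ ts →
       let x = bitOf (lookup ts u)
           y = bitOf (lookup ts v)
           s = sumᵘ x y (carryOf (lookup ts carryᵘ))
           t = sumᵛ x y (carryOf (lookup ts carryᵛ))
       in idle [ u ]≔ pop [ v ]≔ pop [ u′ ]≔ push (bit (odd s)) [ v′ ]≔ push (bit (odd t))
               [ carryᵘ ]≔ set (aux (clamp ⌊ s /2⌋)) [ carryᵛ ]≔ set (aux (clamp ⌊ t /2⌋)))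

   head : List Bool → ℕ
   head []      = 0
   head (b ∷ _) = bitValue b

   tail : List Bool → List Bool
   tail []       = []
   tail (_ ∷ bs) = bs

   value-split : ∀ bs → value bs ≡ head bs + value (tail bs) * 2
   value-split []       = refl
   value-split (b ∷ bs) = refl

   head≤1 : ∀ bs → head bs ≤ 1
   head≤1 []          = z≤n
   head≤1 (false ∷ _) = z≤n
   head≤1 (true ∷ _)  = ℕₚ.≤-refl

   half≤ : ∀ {s k} → s ≤ k + k → ⌊ s /2⌋ ≤ k
   half≤ {s} {k} s≤ = subst (⌊ s /2⌋ ≤_) (sym (ℕₚ.n≡⌊n+n/2⌋ k)) (ℕₚ.⌊n/2⌋-mono s≤)

   half-< : ∀ {c k} → c ≤ suc k → ⌊ c /2⌋ ≤ k
   half-< {zero}  _  = z≤n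
   half-< {suc c} le = ℕₚ.≤-pred (ℕₚ.≤-trans (ℕₚ.⌊n/2⌋<n c) le)

   sumᵘ≤ : ∀ us vs {c} → c ≤ M → sumᵘ (head us) (head vs) c ≤ M + M
   sumᵘ≤ us vs c≤M = ℕₚ.+-mono-≤ (ℕₚ.≤-trans (ℕₚ.+-mono-≤
       (ℕₚ.≤-trans (ℕₚ.*-monoʳ-≤ a (head≤1 us)) (ℕₚ.≤-reflexive (ℕₚ.*-identityʳ a)))
       (ℕₚ.≤-trans (ℕₚ.*-monoʳ-≤ D (head≤1 vs)) (ℕₚ.≤-reflexive (ℕₚ.*-identityʳ D)))) (ℕₚ.m≤m+n (a + D) (suc B))) c≤M

   sumᵛ≤ : ∀ us vs {c} → c ≤ M → sumᵛ (head us) (head vs) c ≤ M + M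
   sumᵛ≤ us vs c≤M = ℕₚ.+-mono-≤ (ℕₚ.≤-trans (ℕₚ.+-mono-≤ (ℕₚ.≤-trans (head≤1 us) (s≤s z≤n)) (ℕₚ.*-monoʳ-≤ a (head≤1 vs))) (bound a D)) c≤M
     where
     bound : ∀ a D → suc B + a * 1 ≤ a + D + suc B
     bound a D = ℕₚ.≤-trans (ℕₚ.≤-reflexive (ℕₚ.+-comm (suc B) (a * 1)))
       (ℕₚ.+-monoˡ-≤ (suc B) (ℕₚ.≤-trans (ℕₚ.≤-reflexive (ℕₚ.*-identityʳ a)) (ℕₚ.m≤m+n a D)))

   preservedᵘ : ∀ us vs xs c → let s = sumᵘ (head us) (head vs) c in s ≤ M + M →
     prepended (odd s ∷ xs) (sumᵘ (value (tail us)) (value (tail vs)) (toℕ (clamp ⌊ s /2⌋))) ≡ prepended xs (sumᵘ (value us) (value vs) c)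
   preservedᵘ us vs xs c s≤ = trans
     (cong (λ k → prepended (odd s ∷ xs) (sumᵘ (value (tail us)) (value (tail vs)) k)) (clamp-≤ (half≤ s≤)))
     (trans (prepended-odd s xs (a * value (tail us) + D * value (tail vs))) (cong (prepended xs)
       (trans (lemma a D (head us) (head vs) (value (tail us)) (value (tail vs)) c)
         (cong₂ (λ x y → sumᵘ x y c) (sym (value-split us)) (sym (value-split vs))))))
     where
     s = sumᵘ (head us) (head vs) c
     lemma : ∀ a D h k x y c → a * h + D * k + c + (a * x + D * y) * 2 ≡ a * (h + x * 2) + D * (k + y * 2) + c
     lemma = solve-∀

   preservedᵛ : ∀ us vs xs c → let s = sumᵛ (head us) (head vs) c in s ≤ M + M →
     prepended (odd s ∷ xs) (sumᵛ (value (tail us)) (value (tail vs)) (toℕ (clamp ⌊ s /2⌋))) ≡ prepended xs (sumᵛ (value us) (value vs) c)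
   preservedᵛ us vs xs c s≤ = trans
     (cong (λ k → prepended (odd s ∷ xs) (sumᵛ (value (tail us)) (value (tail vs)) k)) (clamp-≤ (half≤ s≤)))
     (trans (prepended-odd s xs (value (tail us) + a * value (tail vs))) (cong (prepended xs)
       (trans (lemma a (head us) (head vs) (value (tail us)) (value (tail vs)) c)
         (cong₂ (λ x y → sumᵛ x y c) (sym (value-split us)) (sym (value-split vs))))))
     where
     s = sumᵛ (head us) (head vs) c
     lemma : ∀ a h k x y c → h + a * k + c + (x + a * y) * 2 ≡ h + x * 2 + a * (k + y * 2) + c
     lemma = solve-∀

   module _ {I R C E O : List Bool} where

     adder : (us vs xs ys : List Bool) (p q : Fin (suc M)) → Stacks
     adder us vs xs ys p q = memory I R C E us vs xs ys (p ∷ []) (q ∷ []) O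

     Adds : ℕ → (us vs xs ys : List Bool) (p q : Fin (suc M)) → Set
     Adds k us vs xs ys p q = ∃ λ j → j ≤ k × ∃ λ xs′ → ∃ λ ys′ →
       Runs adding (adder us vs xs ys p q) (suc (j * 2)) (adder [] [] xs′ ys′ zero zero) ×
       prepended xs′ 0 ≡ prepended xs (sumᵘ (value us) (value vs) (toℕ p)) ×
       prepended ys′ 0 ≡ prepended ys (sumᵛ (value us) (value vs) (toℕ q)) ×
       length xs′ ≡ j + length xs × length ys′ ≡ j + length ys

     Advances : (us vs xs ys : List Bool) (p q : Fin (suc M)) → Set
     Advances us vs xs ys p q = ∀ {k} →
       let s = sumᵘ (head us) (head vs) (toℕ p)
           t = sumᵛ (head us) (head vs) (toℕ q) in
       Adds k (tail us) (tail vs) (odd s ∷ xs) (odd t ∷ ys) (clamp ⌊ s /2⌋) (clamp ⌊ t /2⌋) → Adds (suc k) us vs xs ys p q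

     advance : ∀ us vs xs ys p q →
       (∀ {t s} → Runs adding (adder (tail us) (tail vs) (odd (sumᵘ (head us) (head vs) (toℕ p)) ∷ xs) (odd (sumᵛ (head us) (head vs) (toℕ q)) ∷ ys)
          (clamp ⌊ sumᵘ (head us) (head vs) (toℕ p) /2⌋) (clamp ⌊ sumᵛ (head us) (head vs) (toℕ q) /2⌋)) t s →
        Runs adding (adder us vs xs ys p q) (suc (suc t)) s) →
       Advances us vs xs ys p q
     advance us vs xs ys p q iterate (j , j≤ , xs′ , ys′ , r , eqᵘ , eqᵛ , lenᵘ , lenᵛ) =
       suc j , s≤s j≤ , xs′ , ys′ , iterate r ,
       trans eqᵘ (preservedᵘ us vs xs (toℕ p) (sumᵘ≤ us vs (Finₚ.toℕ≤pred[n] p))) ,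
       trans eqᵛ (preservedᵛ us vs ys (toℕ q) (sumᵛ≤ us vs (Finₚ.toℕ≤pred[n] q))) ,
       trans lenᵘ (ℕₚ.+-suc j (length xs)) , trans lenᵛ (ℕₚ.+-suc j (length ys))

     sumᵘ-0 : ∀ c → sumᵘ 0 0 c ≡ c
     sumᵘ-0 c = lemma a D c
       where
       lemma : ∀ a D c → a * 0 + D * 0 + c ≡ c
       lemma = solve-∀

     sumᵛ-0 : ∀ c → sumᵛ 0 0 c ≡ c
     sumᵛ-0 c = lemma a c
       where
       lemma : ∀ a c → 0 + a * 0 + c ≡ c
       lemma = solve-∀

     nextᵘ : ∀ {k} (p : Fin (suc M)) → toℕ p ≤ suc k → toℕ (clamp ⌊ sumᵘ 0 0 (toℕ p) /2⌋) ≤ k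
     nextᵘ p p≤ = subst (_≤ _) (sym (trans (clamp-≤ (half≤ (sumᵘ≤ [] [] (Finₚ.toℕ≤pred[n] p)))) (cong ⌊_/2⌋ (sumᵘ-0 (toℕ p))))) (half-< p≤)

     nextᵛ : ∀ {k} (p : Fin (suc M)) → toℕ p ≤ suc k → toℕ (clamp ⌊ sumᵛ 0 0 (toℕ p) /2⌋) ≤ k
     nextᵛ p p≤ = subst (_≤ _) (sym (trans (clamp-≤ (half≤ (sumᵛ≤ [] [] (Finₚ.toℕ≤pred[n] p)))) (cong ⌊_/2⌋ (sumᵛ-0 (toℕ p))))) (half-< p≤)

     adds-[] : ∀ k xs ys p q → toℕ p ≤ k → toℕ q ≤ k → Adds k [] [] xs ys p q
     adds-[] k xs ys zero zero _ _ = 0 , z≤n , xs , ys , stop refl ,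
       cong (prepended xs) (sym (sumᵘ-0 0)) , cong (prepended ys) (sym (sumᵛ-0 0)) , refl , refl
     adds-[] (suc k) xs ys p@(suc _) q       p≤ q≤ = advance [] [] xs ys p q (loop refl op) (adds-[] k _ _ _ _ (nextᵘ p p≤) (nextᵛ q q≤))
     adds-[] (suc k) xs ys zero q@(suc _) p≤ q≤ = advance [] [] xs ys zero q (loop refl op) (adds-[] k _ _ _ _ (nextᵘ zero p≤) (nextᵛ q q≤))

     Adds-weaken : ∀ {k k′ us vs xs ys p q} → k ≤ k′ → Adds k us vs xs ys p q → Adds k′ us vs xs ys p q
     Adds-weaken k≤ (j , j≤ , rest) = j , ℕₚ.≤-trans j≤ k≤ , rest

     adds : ∀ ℓ us vs xs ys p q → length us ≤ ℓ → length vs ≤ ℓ → Adds (ℓ + M) us vs xs ys p q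
     adds zero    []         []         xs ys p q _  _  = adds-[] M xs ys p q (Finₚ.toℕ≤pred[n] p) (Finₚ.toℕ≤pred[n] q)
     adds (suc ℓ) []         []         xs ys p q _  _  = Adds-weaken (ℕₚ.n≤1+n (ℓ + M)) (adds ℓ [] [] xs ys p q z≤n z≤n)
     adds (suc ℓ) us@(_ ∷ _) []         xs ys p q u≤ v≤ = advance us [] xs ys p q (loop refl op) (adds ℓ _ _ _ _ _ _ (ℕₚ.≤-pred u≤) z≤n)
     adds (suc ℓ) []         vs@(_ ∷ _) xs ys p q u≤ v≤ = advance [] vs xs ys p q (loop refl op) (adds ℓ _ _ _ _ _ _ z≤n (ℕₚ.≤-pred v≤))
     adds (suc ℓ) us@(_ ∷ _) vs@(_ ∷ _) xs ys p q u≤ v≤ = advance us vs xs ys p q (loop refl op) (adds ℓ _ _ _ _ _ _ (ℕₚ.≤-pred u≤) (ℕₚ.≤-pred v≤))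

   step : ℕ → Program
   step d = op (λ _ → idle [ carryᵘ ]≔ push (aux (clamp d)) [ carryᵛ ]≔ push (aux zero)) ︔
     adding ︔ op (λ _ → idle [ carryᵘ ]≔ pop [ carryᵛ ]≔ pop) ︔
     trimming u′ ︔ trimming v′ ︔ moving u′ u ︔ moving v′ v

   skip : Program
   skip = op (λ _ → idle)

   digitsProgram : List ℕ → Program
   digitsProgram []       = skip
   digitsProgram (d ∷ ds) = digitsProgram ds ︔ step d

   segmentProgram : Segment → Program
   segmentProgram (fixed ds)   = digitsProgram ds
   segmentProgram (timesN ds)  =
     while (λ ts → nonblank (lookup ts counter)) (op (λ ts → idle [ counter ]≔ pop [ counted ]≔ push (lookup ts counter)) ︔ digitsProgram ds) ︔
     moving counted counter
   segmentProgram (perInput f) =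
     moving input read ︔
     while (λ ts → nonblank (lookup ts read)) (if (λ ts → isTrue (lookup ts read))
       (op (λ _ → idle [ read ]≔ pop [ input ]≔ push (bit true)) ︔ digitsProgram (f true))
       (op (λ _ → idle [ read ]≔ pop [ input ]≔ push (bit false)) ︔ digitsProgram (f false)))

   segmentsProgram : List Segment → Program
   segmentsProgram []       = skip
   segmentsProgram (S ∷ Ss) = segmentsProgram Ss ︔ segmentProgram S

   horner : ℕ → ℕ × ℕ → ℕ × ℕ
   horner d (x , y) = sumᵘ x y d , sumᵛ x y 0

   record Numbers (ℓ : ℕ) (z : ℕ × ℕ) (us vs : List Bool) : Set where
     constructor numbers
     field
       Binᵘ : Bin us (proj₁ z)
       Binᵛ : Bin vs (proj₂ z)
       lenᵘ : length us ≤ ℓ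
       lenᵛ : length vs ≤ ℓ

   length-ʳ++ : ∀ (xs : List Bool) → length (xs ʳ++ []) ≡ length xs
   length-ʳ++ xs = trans (Listₚ.length-ʳ++ xs) (ℕₚ.+-identityʳ (length xs))

   calculator : (I R C E us vs O : List Bool) → Stacks
   calculator I R C E us vs O = memory I R C E us vs [] [] [] [] O

   Context : Set₁
   Context = (I R C E : List Bool) → Set

   Anywhere : Context
   Anywhere _ _ _ _ = ⊤

   Ready : Word → ℕ → Context
   Ready w N I R C E = I ≡ w × R ≡ [] × length C ≡ N × E ≡ []

   hornerAll : List ℕ → ℕ × ℕ → ℕ × ℕ
   hornerAll ds z = foldr horner z ds

   Bounds : Segment → Set
   Bounds (fixed ds)   = All (_≤ B) ds
   Bounds (timesN ds)  = All (_≤ B) ds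
   Bounds (perInput f) = ∀ b → All (_≤ B) (f b)

   segmentWeight : ℕ → ℕ → Segment → ℕ
   segmentWeight N n (fixed ds)   = suc (length ds)
   segmentWeight N n (timesN ds)  = N * suc (suc (length ds)) + (2 + N * 2)
   segmentWeight N n (perInput f) = n * suc (suc (length (f true) + length (f false))) + (2 + n * 2)

   segmentsWeight : ℕ → ℕ → List Segment → ℕ
   segmentsWeight N n []       = 1
   segmentsWeight N n (S ∷ Ss) = segmentsWeight N n Ss + segmentWeight N n S

   module Bounded (Z : ℕ) where

     τ : ℕ
     τ = 10 * Z + 7

     -- The weight k bounds the time in multiples of τ and the growth of the numbers in multiples of M.
     Computes : Context → Program → ℕ → (ℕ × ℕ → ℕ × ℕ) → Set
     Computes K P k f = ∀ ℓ z {I R C E O us vs} → K I R C E → ℓ + M * k ≤ Z → Numbers ℓ z us vs → ∃ λ t → t ≤ k * τ × ∃ λ us′ → ∃ λ vs′ →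
       Runs P (calculator I R C E us vs O) t (calculator I R C E us′ vs′ O) × Numbers (ℓ + M * k) (f z) us′ vs′

     step-computes : ∀ d → d ≤ B → Computes Anywhere (step d) 1 (horner d)
     step-computes d d≤ ℓ z {I} {R} {C} {E} {O} {us} {vs} _ ≤Z (numbers Bᵘ Bᵛ lᵘ lᵛ) =
       let j , j≤ , xs , ys , r , eqᵘ , eqᵛ , lenᵘ , lenᵛ = adds ℓ us vs [] [] (clamp d) zero lᵘ lᵛ
           t₁ , t₁≤ , xs′ , r₁ , l₁ , B₁ = trimming-runs u′ (λ xs → memory I R C E [] [] xs ys [] [] O) (λ _ → refl) (λ _ _ → refl) xs
           t₂ , t₂≤ , ys′ , r₂ , l₂ , B₂ = trimming-runs v′ (λ ys → memory I R C E [] [] xs′ ys [] [] O) (λ _ → refl) (λ _ _ → refl) ys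
           r₃ = moving-runs u′ u (λ xs us → memory I R C E us [] xs ys′ [] [] O) (λ _ _ → refl) (λ _ _ _ → refl) xs′ []
           r₄ = moving-runs v′ v (λ ys vs → memory I R C E (xs′ ʳ++ []) vs [] ys [] [] O) (λ _ _ → refl) (λ _ _ _ → refl) ys′ []
           d≡ = clamp-≤ (ℕₚ.≤-trans (ℕₚ.m≤n⇒m≤1+n d≤) (ℕₚ.m≤n+m (suc B) (a + D)))
           x≤j = ℕₚ.≤-reflexive (trans lenᵘ (ℕₚ.+-identityʳ j))
           y≤j = ℕₚ.≤-reflexive (trans lenᵛ (ℕₚ.+-identityʳ j))
           M≡ = cong (λ k → ℓ + k) (sym (ℕₚ.*-identityʳ M))
           j≤′ = ℕₚ.≤-trans j≤ (ℕₚ.≤-reflexive M≡)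
       in _ , time-bound (ℕₚ.≤-trans j≤′ ≤Z) t₁≤ t₂≤ x≤j y≤j (ℕₚ.≤-trans l₁ x≤j) (ℕₚ.≤-trans l₂ y≤j) , xs′ ʳ++ [] , ys′ ʳ++ [] ,
         seq op (seq r (seq op (seq r₁ (seq r₂ (seq r₃ r₄))))) ,
         numbers
           (subst (Bin (xs′ ʳ++ [])) (trans eqᵘ (trans (cong₂ (λ x y → sumᵘ x y (toℕ (clamp d))) (Bin-value Bᵘ) (Bin-value Bᵛ)) (cong (sumᵘ (proj₁ z) (proj₂ z)) d≡))) B₁)
           (subst (Bin (ys′ ʳ++ [])) (trans eqᵛ (cong₂ (λ x y → sumᵛ x y 0) (Bin-value Bᵘ) (Bin-value Bᵛ))) B₂)
           (ℕₚ.≤-trans (ℕₚ.≤-reflexive (length-ʳ++ xs′)) (ℕₚ.≤-trans l₁ (ℕₚ.≤-trans x≤j j≤′)))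
           (ℕₚ.≤-trans (ℕₚ.≤-reflexive (length-ʳ++ ys′)) (ℕₚ.≤-trans l₂ (ℕₚ.≤-trans y≤j j≤′)))
       where
       time-bound : ∀ {j t₁ t₂ x y x′ y′} → j ≤ Z → t₁ ≤ suc (x * 2) → t₂ ≤ suc (y * 2) → x ≤ j → y ≤ j → x′ ≤ j → y′ ≤ j →
         1 + (suc (j * 2) + (1 + (t₁ + (t₂ + (suc (x′ * 2) + suc (y′ * 2)))))) ≤ 1 * τ
       time-bound {j} j≤ t₁≤ t₂≤ x≤ y≤ x′≤ y′≤ = ℕₚ.≤-trans
         (s≤s (s≤s (ℕₚ.+-mono-≤ (ℕₚ.*-monoˡ-≤ 2 j≤) (s≤s (ℕₚ.+-mono-≤ (ℕₚ.≤-trans t₁≤ (twice≤ x≤)) (ℕₚ.+-mono-≤ (ℕₚ.≤-trans t₂≤ (twice≤ y≤)) (ℕₚ.+-mono-≤ (twice≤ x′≤) (twice≤ y′≤))))))))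
         (ℕₚ.≤-reflexive (lemma Z))
         where
         twice≤ : ∀ {k} → k ≤ j → suc (k * 2) ≤ suc (Z * 2)
         twice≤ k≤ = s≤s (ℕₚ.*-monoˡ-≤ 2 (ℕₚ.≤-trans k≤ j≤))
         lemma : ∀ Z → 1 + suc (Z * 2 + suc (suc (Z * 2) + (suc (Z * 2) + (suc (Z * 2) + suc (Z * 2))))) ≡ 1 * (10 * Z + 7)
         lemma = solve-∀

     1≤τ : 1 ≤ τ
     1≤τ = ℕₚ.≤-trans (s≤s z≤n) (ℕₚ.m≤n+m 7 (10 * Z))

     2≤τ : 2 ≤ τ
     2≤τ = ℕₚ.≤-trans (s≤s (s≤s z≤n)) (ℕₚ.m≤n+m 7 (10 * Z))

     3≤τ : 3 ≤ τ
     3≤τ = ℕₚ.≤-trans (s≤s (s≤s (s≤s z≤n))) (ℕₚ.m≤n+m 7 (10 * Z))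

     weight-+ : ∀ ℓ j k → ℓ + M * j + M * k ≡ ℓ + M * (j + k)
     weight-+ ℓ j k = trans (ℕₚ.+-assoc ℓ (M * j) (M * k)) (cong (λ x → ℓ + x) (sym (ℕₚ.*-distribˡ-+ M j k)))

     weight-≤ : ∀ ℓ {j k} → j ≤ k → ℓ + M * j ≤ ℓ + M * k
     weight-≤ ℓ j≤k = ℕₚ.+-monoʳ-≤ ℓ (ℕₚ.*-monoʳ-≤ M j≤k)

     numbers-≤ : ∀ {ℓ ℓ′ z us vs} → ℓ ≤ ℓ′ → Numbers ℓ z us vs → Numbers ℓ′ z us vs
     numbers-≤ ≤ℓ (numbers Bᵘ Bᵛ lᵘ lᵛ) = numbers Bᵘ Bᵛ (ℕₚ.≤-trans lᵘ ≤ℓ) (ℕₚ.≤-trans lᵛ ≤ℓ)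

     skip-computes : ∀ {K} → Computes K skip 1 (λ z → z)
     skip-computes ℓ z {us = us} {vs} _ _ N = 1 , ℕₚ.≤-trans 1≤τ (ℕₚ.≤-reflexive (sym (ℕₚ.*-identityˡ τ))) , us , vs , op , numbers-≤ (ℕₚ.m≤m+n ℓ _) N

     seq-computes : ∀ {K P Q j k f h} → Computes K P j f → Computes K Q k h → Computes K (P ︔ Q) (j + k) (h ∘ f)
     seq-computes {j = j} {k} c c′ ℓ z ok ≤Z N =
       let t , t≤ , _ , _ , r , N₁ = c ℓ z ok (ℕₚ.≤-trans (weight-≤ ℓ (ℕₚ.m≤m+n j k)) ≤Z) N
           t′ , t′≤ , us , vs , r′ , N₂ = c′ (ℓ + M * j) _ ok (ℕₚ.≤-trans (ℕₚ.≤-reflexive (weight-+ ℓ j k)) ≤Z) N₁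
       in t + t′ , ℕₚ.≤-trans (ℕₚ.+-mono-≤ t≤ t′≤) (ℕₚ.≤-reflexive (sym (ℕₚ.*-distribʳ-+ τ j k))) , us , vs , seq r r′ , numbers-≤ (ℕₚ.≤-reflexive (weight-+ ℓ j k)) N₂

     narrow : ∀ {K P k f} → Computes Anywhere P k f → Computes K P k f
     narrow c ℓ z _ = c ℓ z tt

     digits-compute : ∀ {ds} → All (_≤ B) ds → Computes Anywhere (digitsProgram ds) (suc (length ds)) (hornerAll ds)
     digits-compute []                     = skip-computes
     digits-compute (_∷_ {d} {ds} d≤ ds≤) ℓ z = subst (λ k → Computes Anywhere (digitsProgram ds ︔ step d) k (hornerAll (d ∷ ds)))
       (ℕₚ.+-comm (suc (length ds)) 1) (seq-computes (digits-compute ds≤) (step-computes d d≤)) ℓ z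

     times : (ℕ × ℕ → ℕ × ℕ) → ℕ → ℕ × ℕ → ℕ × ℕ
     times f zero    z = z
     times f (suc n) z = times f n (f z)

     -- Loops change the context, so they are stated with their own initial and final stacks.
     Loops : Program → ℕ → ℕ → ℕ × ℕ → ℕ × ℕ → (List Bool → List Bool → List Bool → Stacks) → (List Bool → List Bool → List Bool → Stacks) → Set
     Loops P k ℓ z z′ S S′ = ∀ {us vs O} → ℓ + M * k ≤ Z → Numbers ℓ z us vs → ∃ λ t → t ≤ suc (k * τ) × ∃ λ us′ → ∃ λ vs′ →
       Runs P (S us vs O) t (S′ us′ vs′ O) × Numbers (ℓ + M * k) z′ us′ vs′

     iterate : ∀ {b P k₁ k₂ ℓ z₁ z₂ z₃ S₁ S₂ S₃} →
       (∀ us vs O → b (tops (S₁ us vs O)) ≡ true) →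
       (∀ {us vs O} → ℓ + M * k₁ ≤ Z → Numbers ℓ z₁ us vs → ∃ λ t → suc t ≤ k₁ * τ × ∃ λ us′ → ∃ λ vs′ → Runs P (S₁ us vs O) t (S₂ us′ vs′ O) × Numbers (ℓ + M * k₁) z₂ us′ vs′) →
       Loops (while b P) k₂ (ℓ + M * k₁) z₂ z₃ S₂ S₃ → Loops (while b P) (k₁ + k₂) ℓ z₁ z₃ S₁ S₃
     iterate {k₁ = k₁} {k₂} {ℓ} {S₁ = S₁} busy body rest {us} {vs} {O} ≤Z N =
       let t , t≤ , _ , _ , r , N₁ = body (ℕₚ.≤-trans (weight-≤ ℓ (ℕₚ.m≤m+n k₁ k₂)) ≤Z) N
           t′ , t′≤ , us′ , vs′ , r′ , N₂ = rest (ℕₚ.≤-trans (ℕₚ.≤-reflexive (weight-+ ℓ k₁ k₂)) ≤Z) N₁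
       in suc (t + t′) , ℕₚ.≤-trans (ℕₚ.+-mono-≤ t≤ t′≤) (ℕₚ.≤-reflexive (trans (ℕₚ.+-suc (k₁ * τ) (k₂ * τ)) (cong suc (sym (ℕₚ.*-distribʳ-+ τ k₁ k₂))))) , us′ , vs′ ,
         loop (busy us vs O) r r′ , numbers-≤ (ℕₚ.≤-reflexive (weight-+ ℓ k₁ k₂)) N₂

     counting : ∀ {P k f} → Computes Anywhere P k f → ∀ {I R} C E ℓ z →
       Loops (while (λ ts → nonblank (lookup ts counter)) (op (λ ts → idle [ counter ]≔ pop [ counted ]≔ push (lookup ts counter)) ︔ P))
         (length C * suc k) ℓ z (times f (length C) z) (calculator I R C E) (calculator I R [] (C ʳ++ E))
     counting c []      E ℓ z {us} {vs} _ N = 1 , ℕₚ.≤-refl , us , vs , stop refl , numbers-≤ (ℕₚ.m≤m+n ℓ _) N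
     counting {P} {k} {f} c {I} {R} (x ∷ C) E ℓ z = iterate {S₁ = calculator I R (x ∷ C) E} {calculator I R C (x ∷ E)} {calculator I R [] ((x ∷ C) ʳ++ E)} (λ _ _ _ → refl)
       (λ ≤Z N → let t , t≤ , us , vs , r , N′ = c ℓ z tt (ℕₚ.≤-trans (weight-≤ ℓ (ℕₚ.n≤1+n k)) ≤Z) N
                 in 1 + t , ℕₚ.+-mono-≤ 2≤τ t≤ , us , vs , seq op r , numbers-≤ (weight-≤ ℓ (ℕₚ.n≤1+n k)) N′)
       (counting c {I} {R} C (x ∷ E) (ℓ + M * suc k) (f z))

     through : (Bool → ℕ × ℕ → ℕ × ℕ) → List Bool → ℕ × ℕ → ℕ × ℕ
     through h []      z = z
     through h (b ∷ R) z = through h R (h b z)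

     reading : ∀ {P : Bool → Program} {k h} → (∀ b → Computes Anywhere (P b) k (h b)) → ∀ {C E} R I ℓ z →
       Loops (while (λ ts → nonblank (lookup ts read)) (if (λ ts → isTrue (lookup ts read))
                (op (λ _ → idle [ read ]≔ pop [ input ]≔ push (bit true)) ︔ P true)
                (op (λ _ → idle [ read ]≔ pop [ input ]≔ push (bit false)) ︔ P false)))
         (length R * suc k) ℓ z (through h R z) (calculator I R C E) (calculator (R ʳ++ I) [] C E)
     reading c []      I ℓ z {us} {vs} _ N = 1 , ℕₚ.≤-refl , us , vs , stop refl , numbers-≤ (ℕₚ.m≤m+n ℓ _) N
     reading {P} {k} {h} c {C} {E} (b ∷ R) I ℓ z = iterate {S₁ = calculator I (b ∷ R) C E} {calculator (b ∷ I) R C E} {calculator ((b ∷ R) ʳ++ I) [] C E}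
       (λ _ _ _ → refl) (body b) (reading c {C} {E} R (b ∷ I) (ℓ + M * suc k) (h b z))
       where
       body : ∀ b {us vs O} → ℓ + M * suc k ≤ Z → Numbers ℓ z us vs → ∃ λ t → suc t ≤ suc k * τ × ∃ λ us′ → ∃ λ vs′ →
         Runs (if (λ ts → isTrue (lookup ts read))
                (op (λ _ → idle [ read ]≔ pop [ input ]≔ push (bit true)) ︔ P true)
                (op (λ _ → idle [ read ]≔ pop [ input ]≔ push (bit false)) ︔ P false)) (calculator I (b ∷ R) C E us vs O) t (calculator (b ∷ I) R C E us′ vs′ O) ×
         Numbers (ℓ + M * suc k) (h b z) us′ vs′
       body true ≤Z N = let t , t≤ , us , vs , r , N′ = c true ℓ z tt (ℕₚ.≤-trans (weight-≤ ℓ (ℕₚ.n≤1+n k)) ≤Z) N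
                 in suc (1 + t) , ℕₚ.+-mono-≤ 3≤τ t≤ , us , vs , then refl (seq op r) , numbers-≤ (weight-≤ ℓ (ℕₚ.n≤1+n k)) N′
       body false ≤Z N = let t , t≤ , us , vs , r , N′ = c false ℓ z tt (ℕₚ.≤-trans (weight-≤ ℓ (ℕₚ.n≤1+n k)) ≤Z) N
                 in suc (1 + t) , ℕₚ.+-mono-≤ 3≤τ t≤ , us , vs , else refl (seq op r) , numbers-≤ (weight-≤ ℓ (ℕₚ.n≤1+n k)) N′

     weaken : ∀ {K P j k f} → j ≤ k → Computes K P j f → Computes K P k f
     weaken j≤k c ℓ z ok ≤Z N = let t , t≤ , us , vs , r , N′ = c ℓ z ok (ℕₚ.≤-trans (weight-≤ ℓ j≤k) ≤Z) N
       in t , ℕₚ.≤-trans t≤ (ℕₚ.*-monoˡ-≤ τ j≤k) , us , vs , r , numbers-≤ (weight-≤ ℓ j≤k) N′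

     hornerAll-++ : ∀ ds es z → hornerAll (ds ++ es) z ≡ hornerAll ds (hornerAll es z)
     hornerAll-++ ds es z = Listₚ.foldr-++ horner z ds es

     times-horner : ∀ ds n z → times (hornerAll ds) n z ≡ hornerAll (concat (replicate n ds)) z
     times-horner ds zero    z = refl
     times-horner ds (suc n) z = trans (times-horner ds n (hornerAll ds z))
       (trans (sym (hornerAll-++ (concat (replicate n ds)) ds z)) (cong (λ es → hornerAll es z) (rotate n)))
       where
       rotate : ∀ n → concat (replicate n ds) ++ ds ≡ ds ++ concat (replicate n ds)
       rotate zero    = sym (Listₚ.++-identityʳ ds)
       rotate (suc n) = trans (Listₚ.++-assoc ds _ ds) (cong (ds ++_) (rotate n))

     through-horner : ∀ (f : Bool → List ℕ) R z → through (λ b → hornerAll (f b)) R z ≡ hornerAll (concatMap f (reverse R)) z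
     through-horner f []      z = refl
     through-horner f (b ∷ R) z = trans (through-horner f R (hornerAll (f b) z)) (trans (sym (hornerAll-++ (concatMap f (reverse R)) (f b) z))
       (cong (λ es → hornerAll es z) (trans (cong (concatMap f (reverse R) ++_) (sym (Listₚ.++-identityʳ (f b))))
         (trans (sym (Listₚ.concatMap-++ f (reverse R) (b ∷ []))) (cong (concatMap f) (sym (Listₚ.unfold-reverse b R)))))))

     linear≤τ : ∀ k → k ≤ k * τ
     linear≤τ k = subst (_≤ k * τ) (ℕₚ.*-identityʳ k) (ℕₚ.*-monoʳ-≤ k 1≤τ)

     segment-computes : ∀ {w N} S → Bounds S → Computes (Ready w N) (segmentProgram S) (segmentWeight N (length w) S) (hornerAll (expand N w S))
     segment-computes (fixed ds)  ds≤ = narrow (digits-compute ds≤)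
     segment-computes {w} {N} (timesN ds) ds≤ ℓ z {I} {R} {C} {E} {O} (refl , refl , refl , refl) ≤Z nums =
       let k = length C * suc (suc (length ds))
           t , t≤ , us , vs , r , nums′ = counting (digits-compute ds≤) {I} {[]} C [] ℓ z (ℕₚ.≤-trans (weight-≤ ℓ (ℕₚ.m≤m+n k (2 + length C * 2))) ≤Z) nums
           r′ = moving-runs counted counter (λ E C → calculator I [] C E us vs O) (λ _ _ → refl) (λ _ _ _ → refl) (C ʳ++ []) []
       in _ , bound {k} t≤ (ℕₚ.≤-reflexive (length-ʳ++ C)) , us , vs ,
         Runs-to (cong (λ C → calculator I [] C [] us vs O) (Listₚ.reverse-involutive C)) (seq r r′) ,
         subst (λ z → Numbers _ z us vs) (times-horner ds (length C) z) (numbers-≤ (weight-≤ ℓ (ℕₚ.m≤m+n k (2 + length C * 2))) nums′)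
       where
       bound : ∀ {k t c n} → t ≤ suc (k * τ) → c ≤ n → t + suc (c * 2) ≤ (k + (2 + n * 2)) * τ
       bound {k} {t} {c} {n} t≤ c≤ = ℕₚ.≤-trans (ℕₚ.+-mono-≤ t≤ (s≤s (ℕₚ.*-monoˡ-≤ 2 c≤)))
         (ℕₚ.≤-trans (ℕₚ.≤-reflexive (lemma (k * τ) n)) (ℕₚ.≤-trans (ℕₚ.+-monoʳ-≤ (k * τ) (linear≤τ (2 + n * 2))) (ℕₚ.≤-reflexive (sym (ℕₚ.*-distribʳ-+ τ k (2 + n * 2))))))
         where
         lemma : ∀ k n → suc k + suc (n * 2) ≡ k + (2 + n * 2)
         lemma = solve-∀
     segment-computes {w} {N} (perInput f) f≤ ℓ z {I} {R} {C} {E} {O} {us} {vs} (refl , refl , refl , refl) ≤Z nums =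
       let K = suc (length (f true) + length (f false))
           k = length w * suc K
           r = moving-runs input read (λ I R → calculator I R C [] us vs O) (λ _ _ → refl) (λ _ _ _ → refl) w []
           t , t≤ , us′ , vs′ , r′ , nums′ = reading (λ b → weaken (s≤s (short b)) (digits-compute (f≤ b))) {C} {[]} (w ʳ++ []) [] ℓ z
             (ℕₚ.≤-trans (weight-≤ ℓ (ℕₚ.≤-trans (ℕₚ.*-monoˡ-≤ (suc K) (ℕₚ.≤-reflexive (length-ʳ++ w))) (ℕₚ.m≤m+n k (2 + length w * 2)))) ≤Z) nums
       in _ , bound {K} t≤ (ℕₚ.≤-reflexive (length-ʳ++ w)) , us′ , vs′ ,
         Runs-to (cong (λ I → calculator I [] C [] us′ vs′ O) (Listₚ.reverse-involutive w)) (seq r r′) ,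
         subst (λ z → Numbers _ z us′ vs′) (trans (through-horner f (reverse w) z) (cong (λ R → hornerAll (concatMap f R) z) (Listₚ.reverse-involutive w)))
           (numbers-≤ (weight-≤ ℓ (ℕₚ.≤-trans (ℕₚ.*-monoˡ-≤ (suc K) (ℕₚ.≤-reflexive (length-ʳ++ w))) (ℕₚ.m≤m+n k (2 + length w * 2)))) nums′)
       where
       short : ∀ b → length (f b) ≤ length (f true) + length (f false)
       short true  = ℕₚ.m≤m+n _ _
       short false = ℕₚ.m≤n+m _ _
       bound : ∀ {K t c n} → t ≤ suc (c * suc K * τ) → c ≤ n → suc (n * 2) + t ≤ (n * suc K + (2 + n * 2)) * τ
       bound {K} {t} {c} {n} t≤ c≤ = ℕₚ.≤-trans (ℕₚ.+-monoʳ-≤ (suc (n * 2)) (ℕₚ.≤-trans t≤ (s≤s (ℕₚ.*-monoˡ-≤ τ (ℕₚ.*-monoˡ-≤ (suc K) c≤)))))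
         (ℕₚ.≤-trans (ℕₚ.≤-reflexive (lemma (n * suc K * τ) n)) (ℕₚ.≤-trans (ℕₚ.+-monoʳ-≤ (n * suc K * τ) (linear≤τ (2 + n * 2))) (ℕₚ.≤-reflexive (sym (ℕₚ.*-distribʳ-+ τ (n * suc K) (2 + n * 2))))))
         where
         lemma : ∀ k n → suc (n * 2) + suc k ≡ k + (2 + n * 2)
         lemma = solve-∀

     segments-compute : ∀ {w N Ss} → All Bounds Ss → Computes (Ready w N) (segmentsProgram Ss) (segmentsWeight N (length w) Ss) (hornerAll (expandAll N w Ss))
     segments-compute []                  = skip-computes
     segments-compute {w} {N} (_∷_ {S} {Ss} b bs) ℓ z ok ≤Z nums =
       let t , t≤ , us , vs , r , nums′ = seq-computes (segments-compute bs) (segment-computes S b) ℓ z ok ≤Z nums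
       in t , t≤ , us , vs , r , subst (λ z → Numbers _ z us vs) (sym (hornerAll-++ (expand N w S) (expandAll N w Ss) z)) nums′

module Writing where

 open import Defs using (Word; bit; PolyTimeComputable; poly; Token; zeroᵗ; oneᵗ; digitToken; binary)
 open StackPrograms
 open Binary
 open Encoding
 open Words using (Segment; expandAll; fixed; timesN; perInput)
 open Calculation
 open import Data.List using (_ʳ++_; length; map; concatMap; reverse)
 open import Data.Nat
 open import Data.Nat.Tactic.RingSolver using (solve-∀)
 open import Data.Vec using (_[_]≔_)

 module Output (a D B : ℕ) where
   open Arithmetic a D B hiding (output; else)
   open Arithmetic a D B using () renaming (output to out)
   open Runs using () renaming (else to else′)

   pushing : List Bool → Program
   pushing []       = skip
   pushing (b ∷ bs) = pushing bs ︔ op (λ _ → idle [ out ]≔ push (bit b))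

   pushingTime : List Bool → ℕ
   pushingTime []       = 1
   pushingTime (_ ∷ bs) = pushingTime bs + 1

   pushing-runs : ∀ bs {I R C E us vs xs O} → Runs (pushing bs) (memory I R C E us vs xs [] [] [] O) (pushingTime bs) (memory I R C E us vs xs [] [] [] (bs ++ O))
   pushing-runs []       = op
   pushing-runs (b ∷ bs) = seq (pushing-runs bs) op

   pushingTime-code : ∀ t → pushingTime (Defs.code t) ≡ 5
   pushingTime-code Defs.allᵗ   = refl
   pushingTime-code Defs.someᵗ  = refl
   pushingTime-code Defs.notᵗ   = refl
   pushingTime-code Defs.andᵗ   = refl
   pushingTime-code Defs.orᵗ    = refl
   pushingTime-code Defs.leqᵗ   = refl
   pushingTime-code Defs.minusᵗ = refl
   pushingTime-code Defs.zeroᵗ  = refl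
   pushingTime-code Defs.oneᵗ   = refl
   pushingTime-code Defs.endᵗ   = refl

   bitToken : Bool → Token
   bitToken b = digitToken (toBit b)

   emitting : Program
   emitting = while (λ ts → nonblank (lookup ts u′)) (if (λ ts → isTrue (lookup ts u′))
     (op (λ _ → idle [ u′ ]≔ pop) ︔ pushing (Defs.code oneᵗ))
     (op (λ _ → idle [ u′ ]≔ pop) ︔ pushing (Defs.code zeroᵗ)))

   emitted : List Bool → List Bool → List Bool
   emitted []       O = O
   emitted (x ∷ xs) O = emitted xs (Defs.code (bitToken x) ++ O)

   emitting-runs : ∀ xs {I R C E O} → Runs emitting (memory I R C E [] [] xs [] [] [] O) (suc (length xs * 8)) (calculator I R C E [] [] (emitted xs O))
   emitting-runs []           = stop refl
   emitting-runs (true ∷ xs)  = loop refl (then refl (seq op (pushing-runs (Defs.code oneᵗ)))) (emitting-runs xs)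
   emitting-runs (false ∷ xs) = loop refl (else′ refl (seq op (pushing-runs (Defs.code zeroᵗ)))) (emitting-runs xs)

   emitted-ʳ++ : ∀ us zs O → emitted (us ʳ++ zs) O ≡ emitted zs (concatMap Defs.code (map bitToken us) ++ O)
   emitted-ʳ++ []       zs O = refl
   emitted-ʳ++ (u ∷ us) zs O = trans (emitted-ʳ++ us (u ∷ zs) O)
     (cong (emitted zs) (sym (Listₚ.++-assoc (Defs.code (bitToken u)) (concatMap Defs.code (map bitToken us)) O)))

   Bin-binary : ∀ {bs n} → Bin bs n → n ≢ 0 → map bitToken bs ≡ binary n
   Bin-binary {bs} b n≢0 = trans (Listₚ.map-∘ bs) (cong (map digitToken) (sym (Bin-digits b n≢0)))

   copying : Program
   copying = while (λ ts → nonblank (lookup ts input)) (op λ ts → idle [ input ]≔ pop [ read ]≔ push (lookup ts input) [ counted ]≔ push (bit true))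

   copying-runs : ∀ I R C E → ∃ λ E′ → Runs copying (calculator I R C E [] [] []) (suc (length I * 2)) (calculator [] (I ʳ++ R) C E′ [] [] []) ×
     length E′ ≡ length I + length E
   copying-runs []      R C E = E , stop refl , refl
   copying-runs (i ∷ I) R C E = let E′ , r , eq = copying-runs I (i ∷ R) C (true ∷ E)
     in E′ , loop refl op r , trans eq (ℕₚ.+-suc (length I) (length E))

   multiplying : Program
   multiplying =
     while (λ ts → nonblank (lookup ts counter)) (
       op (λ ts → idle [ counter ]≔ pop [ counted ]≔ push (bit true)) ︔ op (λ ts → idle [ counted ]≔ push (bit true)) ︔ copying ︔ moving read input) ︔
     moving counted counter

   module _ (w : Word) where
     private n = length w

     multiplying-loop : ∀ C E → ∃ λ E′ → Runs (while (λ ts → nonblank (lookup ts counter)) (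
         op (λ ts → idle [ counter ]≔ pop [ counted ]≔ push (bit true)) ︔ op (λ ts → idle [ counted ]≔ push (bit true)) ︔ copying ︔ moving read input))
       (calculator w [] C E [] [] []) (suc (length C * (5 + n * 4))) (calculator w [] [] E′ [] [] []) × length E′ ≡ length C * (2 + n) + length E
     multiplying-loop []      E = E , stop refl , refl
     multiplying-loop (_ ∷ C) E =
       let E₁ , r₁ , eq₁ = copying-runs w [] C (true ∷ true ∷ E)
           r₂ = moving-runs read input (λ R I → calculator I R C E₁ [] [] []) (λ _ _ → refl) (λ _ _ _ → refl) (w ʳ++ []) []
           E₂ , r₃ , eq₂ = multiplying-loop C E₁
       in E₂ , Runs-in (time (length-ʳ++ w))
             (loop refl (seq op (seq op (seq r₁ (Runs-to (cong (λ I → calculator I [] C E₁ [] [] []) (Listₚ.reverse-involutive w)) r₂)))) r₃) ,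
          trans eq₂ (trans (cong (λ k → length C * (2 + n) + k) eq₁) (lemma (length C) n (length E)))
       where
       lemma : ∀ c n e → c * (2 + n) + (n + suc (suc e)) ≡ (1 + c) * (2 + n) + e
       lemma = solve-∀
       time : ∀ {x} → x ≡ n → suc (1 + (1 + (suc (n * 2) + suc (x * 2))) + suc (length C * (5 + n * 4))) ≡ suc (suc (length C) * (5 + n * 4))
       time refl = lemma′ (length C) n
         where
         lemma′ : ∀ c n → suc (1 + (1 + (suc (n * 2) + suc (n * 2))) + suc (c * (5 + n * 4))) ≡ suc ((1 + c) * (5 + n * 4))
         lemma′ = solve-∀

     multiplying-runs : ∀ C → ∃ λ C′ → Runs multiplying (calculator w [] C [] [] [] []) (2 + length C * (9 + n * 6)) (calculator w [] C′ [] [] [] []) ×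
       length C′ ≡ (2 + n) * length C
     multiplying-runs C =
       let E , r , eq = multiplying-loop C []
           r′ = moving-runs counted counter (λ E C → calculator w [] C E [] [] []) (λ _ _ → refl) (λ _ _ _ → refl) E []
           eq′ = trans eq (lemma (length C) n)
       in E ʳ++ [] , Runs-in (trans (cong (λ e → suc (length C * (5 + n * 4)) + suc (e * 2)) eq′) (lemma′ (length C) n)) (seq r r′) ,
          trans (length-ʳ++ E) eq′
       where
       lemma : ∀ c n → c * (2 + n) + 0 ≡ (2 + n) * c
       lemma = solve-∀
       lemma′ : ∀ c n → suc (c * (5 + n * 4)) + suc ((2 + n) * c * 2) ≡ 2 + c * (9 + n * 6)
       lemma′ = solve-∀

   growing : ℕ → Program
   growing zero    = op (λ _ → idle [ counter ]≔ push (bit true))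
   growing (suc k) = growing k ︔ multiplying

   growingTime : ℕ → ℕ → ℕ
   growingTime zero    n = 1
   growingTime (suc k) n = growingTime k n + (2 + (2 + n) ^ k * (9 + n * 6))

   growing-runs : ∀ w k → ∃ λ C → Runs (growing k) (calculator w [] [] [] [] [] []) (growingTime k (length w)) (calculator w [] C [] [] [] []) × length C ≡ (2 + length w) ^ k
   growing-runs w zero    = true ∷ [] , op , refl
   growing-runs w (suc k) =
     let C , r , eq = growing-runs w k
         C′ , r′ , eq′ = multiplying-runs w C
     in C′ , seq r (Runs-in (cong (λ c → 2 + c * (9 + length w * 6)) eq) r′) , trans eq′ (cong (λ c → (2 + length w) * c) eq)

   module Writer (k : ℕ) (Hole : Set) (segments : Hole → List Segment) (side : Hole → Bool) where
     open Templates Hole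

     size : Word → ℕ
     size w = (2 + length w) ^ k

     numbersAt : Word → Hole → ℕ × ℕ
     numbersAt w h = hornerAll (expandAll (size w) w (segments h)) (0 , 0)

     filling : Word → Hole → ℕ
     filling w h = if side h then proj₁ (numbersAt w h) else proj₂ (numbersAt w h)

     selecting : Bool → Program
     selecting true  = discarding v ︔ moving u u′
     selecting false = discarding u ︔ moving v u′

     pieceProgram : Piece → Program
     pieceProgram (fixed t)    = pushing (Defs.code t)
     pieceProgram (digitsOf h) = segmentsProgram (segments h) ︔ selecting (side h) ︔ emitting

     piecesProgram : List Piece → Program
     piecesProgram []       = skip
     piecesProgram (p ∷ ps) = piecesProgram ps ︔ pieceProgram p

     pieceWeight : ℕ → ℕ → Piece → ℕ
     pieceWeight N n (fixed t)    = 1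
     pieceWeight N n (digitsOf h) = segmentsWeight N n (segments h) + 2

     piecesWeight : ℕ → ℕ → List Piece → ℕ
     piecesWeight N n []       = 1
     piecesWeight N n (p ∷ ps) = piecesWeight N n ps + pieceWeight N n p

     module _ (bounds : ∀ h → All Bounds (segments h)) (w : Word) where
       private
         n = length w
         N = size w

       module _ (filling≢0 : ∀ h → filling w h ≢ 0) (C : List Bool) (C≡ : length C ≡ N) (Z : ℕ) where
         open Bounded Z

         emits-word : ∀ {O m} us → Bin us m → m ≢ 0 → emitted (us ʳ++ []) O ≡ concatMap Defs.code (binary m) ++ O
         emits-word {O} us b ≢0 = trans (emitted-ʳ++ us [] O) (cong (λ ts → concatMap Defs.code ts ++ O) (Bin-binary b ≢0))

         emits-time : ∀ {x y z ℓ} → x ≤ ℓ → y ≤ ℓ → z ≤ ℓ → suc (y * 2) + suc (x * 2) + suc (z * 8) ≤ 3 + ℓ * 12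
         emits-time {ℓ = ℓ} x≤ y≤ z≤ = ℕₚ.≤-trans (ℕₚ.+-mono-≤ (ℕₚ.+-mono-≤ (s≤s (ℕₚ.*-monoˡ-≤ 2 y≤)) (s≤s (ℕₚ.*-monoˡ-≤ 2 x≤))) (s≤s (ℕₚ.*-monoˡ-≤ 8 z≤))) (ℕₚ.≤-reflexive (lemma ℓ))
           where
           lemma : ∀ ℓ → suc (ℓ * 2) + suc (ℓ * 2) + suc (ℓ * 8) ≡ 3 + ℓ * 12
           lemma = solve-∀

         idleAt : List Bool → Stacks
         idleAt O = calculator w [] C [] [] [] O

         emits : ∀ {m O us vs ℓ} b → Numbers ℓ m us vs → (if b then proj₁ m else proj₂ m) ≢ 0 →
           ∃ λ t → t ≤ 3 + ℓ * 12 × Runs (selecting b ︔ emitting) (calculator w [] C [] us vs O) t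
             (idleAt (concatMap Defs.code (binary (if b then proj₁ m else proj₂ m)) ++ O))
         emits {O = O} {us} {vs} {ℓ} true (numbers Bᵘ Bᵛ lᵘ lᵛ) ≢0 =
           let r₁ = discarding-runs v (λ vs → calculator w [] C [] us vs O) (λ _ → refl) (λ _ _ → refl) vs
               r₂ = moving-runs u u′ (λ us xs → memory w [] C [] us [] xs [] [] [] O) (λ _ _ → refl) (λ _ _ _ → refl) us []
           in _ , emits-time lᵘ lᵛ (ℕₚ.≤-trans (ℕₚ.≤-reflexive (length-ʳ++ us)) lᵘ) ,
              seq (seq r₁ r₂) (Runs-to (cong idleAt (emits-word us Bᵘ ≢0)) (emitting-runs (us ʳ++ [])))
         emits {O = O} {us} {vs} {ℓ} false (numbers Bᵘ Bᵛ lᵘ lᵛ) ≢0 =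
           let r₁ = discarding-runs u (λ us → calculator w [] C [] us vs O) (λ _ → refl) (λ _ _ → refl) us
               r₂ = moving-runs v u′ (λ vs xs → memory w [] C [] [] vs xs [] [] [] O) (λ _ _ → refl) (λ _ _ _ → refl) vs []
           in _ , emits-time lᵛ lᵘ (ℕₚ.≤-trans (ℕₚ.≤-reflexive (length-ʳ++ vs)) lᵛ) ,
              seq (seq r₁ r₂) (Runs-to (cong idleAt (emits-word vs Bᵛ ≢0)) (emitting-runs (vs ʳ++ [])))

         prefix : Piece → List Bool
         prefix (fixed t)    = Defs.code t
         prefix (digitsOf h) = concatMap Defs.code (binary (filling w h))

         piece-runs : ∀ p O → M * pieceWeight N n p ≤ Z → ∃ λ t → t ≤ pieceWeight N n p * τ × Runs (pieceProgram p) (idleAt O) t (idleAt (prefix p ++ O))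
         piece-runs (fixed t)    O M≤ = pushingTime (Defs.code t) ,
           ℕₚ.≤-trans (ℕₚ.≤-reflexive (pushingTime-code t)) (ℕₚ.≤-trans (ℕₚ.m≤m+n 5 2) (ℕₚ.≤-trans (ℕₚ.m≤n+m 7 (10 * Z)) (ℕₚ.m≤m+n _ 0))) , pushing-runs (Defs.code t)
         piece-runs (digitsOf h) O M≤ =
           let W = segmentsWeight N n (segments h)
               ≤Z = ℕₚ.≤-trans (ℕₚ.*-monoʳ-≤ M (ℕₚ.m≤m+n W 2)) M≤
               t , t≤ , us , vs , r , nums = segments-compute (bounds h) 0 (0 , 0) (refl , refl , C≡ , refl) ≤Z (numbers [] [] z≤n z≤n)
               t′ , t′≤ , r′ = emits (side h) nums (filling≢0 h)
           in t + t′ , ℕₚ.≤-trans (ℕₚ.+-mono-≤ t≤ (ℕₚ.≤-trans t′≤ (ℕₚ.≤-trans (ℕₚ.+-monoʳ-≤ 3 (ℕₚ.*-monoˡ-≤ 12 ≤Z)) (slack Z)))) (ℕₚ.≤-reflexive (sym (ℕₚ.*-distribʳ-+ τ W 2))) ,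
              seq r r′
           where
           slack : ∀ Z → 3 + Z * 12 ≤ 2 * (10 * Z + 7)
           slack Z = ℕₚ.≤-trans (ℕₚ.m≤m+n (3 + Z * 12) (11 + Z * 8)) (ℕₚ.≤-reflexive (lemma Z))
             where
             lemma : ∀ Z → 3 + Z * 12 + (11 + Z * 8) ≡ 2 * (10 * Z + 7)
             lemma = solve-∀

         pieces-run : ∀ ps → M * piecesWeight N n ps ≤ Z →
           ∃ λ t → t ≤ piecesWeight N n ps * τ × Runs (piecesProgram ps) (idleAt []) t (idleAt (concatMap Defs.code (flatten (filling w) ps)))
         pieces-run []       M≤ = 1 , ℕₚ.≤-trans 1≤τ (ℕₚ.m≤m+n τ 0) , op
         pieces-run (p ∷ ps) M≤ =
           let j = piecesWeight N n ps
               k = pieceWeight N n p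
               t , t≤ , r = pieces-run ps (ℕₚ.≤-trans (ℕₚ.*-monoʳ-≤ M (ℕₚ.m≤m+n j k)) M≤)
               t′ , t′≤ , r′ = piece-runs p (concatMap Defs.code (flatten (filling w) ps)) (ℕₚ.≤-trans (ℕₚ.*-monoʳ-≤ M (ℕₚ.m≤n+m k j)) M≤)
           in t + t′ , ℕₚ.≤-trans (ℕₚ.+-mono-≤ t≤ t′≤) (ℕₚ.≤-reflexive (sym (ℕₚ.*-distribʳ-+ τ j k))) , seq r (Runs-to (cong idleAt (prefix-flatten p)) r′)
           where
           prefix-flatten : ∀ p → prefix p ++ concatMap Defs.code (flatten (filling w) ps) ≡ concatMap Defs.code (flatten (filling w) (p ∷ ps))
           prefix-flatten (fixed t)    = refl
           prefix-flatten (digitsOf h) = sym (Listₚ.concatMap-++ Defs.code (binary (filling w h)) (flatten (filling w) ps))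

     whole : List Piece → Program
     whole ps = growing k ︔ piecesProgram ps

     wholeTime : List Piece → ℕ → ℕ
     wholeTime ps n = let W = piecesWeight ((2 + n) ^ k) n ps in growingTime k n + W * (10 * (M * W) + 7)

     open Polynomials

     size-poly : Polynomial (λ n → (2 + n) ^ k)
     size-poly = powerᵖ (constantᵖ 2 +ᵖ identityᵖ) k

     growingTime-poly : ∀ k → Polynomial (growingTime k)
     growingTime-poly zero    = constantᵖ 1
     growingTime-poly (suc k) = growingTime-poly k +ᵖ (constantᵖ 2 +ᵖ (powerᵖ (constantᵖ 2 +ᵖ identityᵖ) k *ᵖ (constantᵖ 9 +ᵖ (identityᵖ *ᵖ constantᵖ 6))))

     segmentWeight-poly : ∀ S → Polynomial (λ n → segmentWeight ((2 + n) ^ k) n S)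
     segmentWeight-poly (fixed ds)   = constantᵖ _
     segmentWeight-poly (timesN ds)  = (size-poly *ᵖ constantᵖ _) +ᵖ (constantᵖ 2 +ᵖ (size-poly *ᵖ constantᵖ 2))
     segmentWeight-poly (perInput f) = (identityᵖ *ᵖ constantᵖ _) +ᵖ (constantᵖ 2 +ᵖ (identityᵖ *ᵖ constantᵖ 2))

     segmentsWeight-poly : ∀ Ss → Polynomial (λ n → segmentsWeight ((2 + n) ^ k) n Ss)
     segmentsWeight-poly []       = constantᵖ 1
     segmentsWeight-poly (S ∷ Ss) = segmentsWeight-poly Ss +ᵖ segmentWeight-poly S

     pieceWeight-poly : ∀ p → Polynomial (λ n → pieceWeight ((2 + n) ^ k) n p)
     pieceWeight-poly (fixed t)    = constantᵖ 1
     pieceWeight-poly (digitsOf h) = segmentsWeight-poly (segments h) +ᵖ constantᵖ 2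

     piecesWeight-poly : ∀ ps → Polynomial (λ n → piecesWeight ((2 + n) ^ k) n ps)
     piecesWeight-poly []       = constantᵖ 1
     piecesWeight-poly (p ∷ ps) = piecesWeight-poly ps +ᵖ pieceWeight-poly p

     wholeTime-poly : ∀ ps → Polynomial (λ n → wholeTime ps n * 2)
     wholeTime-poly ps = (growingTime-poly k +ᵖ (W *ᵖ ((constantᵖ 10 *ᵖ (constantᵖ M *ᵖ W)) +ᵖ constantᵖ 7))) *ᵖ constantᵖ 2
       where
       W = piecesWeight-poly ps

     flatten-computable : (∀ h → All Bounds (segments h)) → (∀ w h → filling w h ≢ 0) → ∀ ps →
       PolyTimeComputable (λ w → concatMap Defs.code (flatten (filling w) ps))
     flatten-computable bounds filling≢0 ps =
       let e , bound = poly-bound (wholeTime-poly ps) in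
       computable (whole ps) e λ w →
         let C , r , C≡ = growing-runs w k
             t , t≤ , r′ = pieces-run bounds w (filling≢0 w) C C≡ (M * piecesWeight (size w) (length w) ps) ps ℕₚ.≤-refl
         in growingTime k (length w) + t ,
            ℕₚ.≤-trans (ℕₚ.*-monoˡ-≤ 2 (ℕₚ.+-monoʳ-≤ (growingTime k (length w)) t≤)) (bound (length w)) ,
            _ , seq r r′ , refl

module Pell where

 open StackPrograms using (Finite; module Finiteness)
 open import Data.Fin using (fromℕ<)
 open import Data.Integer using (+_; ∣_∣; _+_; _*_; -_; _-_)
 import Algebra.Properties.AbelianGroup ℤₚ.+-0-abelianGroup as Groupₚ
 open import Data.Integer.Tactic.RingSolver using (solve-∀)
 import Data.Nat.Tactic.RingSolver as ℕSolver

 open Finite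
 open Finiteness

 -- (a , k , c) stands for the quadratic form (1+a) x² + 2 k x y − (1+c) y².
 Form : Set
 Form = ℕ × ℤ × ℕ

 -- Conway's river of x² − D y²: the value s at the sum of the two basis vectors replaces the basis
 -- vector at which the form has the sign of s.
 module River (D : ℕ) (nonsquare : ∀ d → ¬ D ≡ d ℕ.* d) where

   Valid : Form → Set
   Valid (a , k , c) = k * k + + suc a * + suc c ≡ + D

   total : Form → ℤ
   total (a , k , c) = + suc a + + 2 * k - + suc c

   advance : Form → ℤ → Form
   advance f           (+ zero)  = f
   advance (a , k , c) (+ suc s) = s , k - + suc c , c
   advance (a , k , c) -[1+ s ]  = a , k + + suc a , s

   next : Form → Form
   next f = advance f (total f)

   square-∣∣ : ∀ i → i * i ≡ + (∣ i ∣ ℕ.* ∣ i ∣)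
   square-∣∣ (+ n)    = sym (ℤₚ.pos-* n n)
   square-∣∣ -[1+ n ] = refl

   total≢0 : ∀ f → Valid f → total f ≢ 0ℤ
   total≢0 (a , k , c) valid s≡0 = nonsquare ∣ k + + suc a ∣ (ℤₚ.+-injective (begin
       + D                                       ≡⟨ valid ⟨
       k * k + + suc a * + suc c                 ≡⟨ lemma (+ suc a) k (+ suc c) ⟩
       x * x - + suc a * total (a , k , c)       ≡⟨ cong (λ s → x * x - + suc a * s) s≡0 ⟩
       x * x - + suc a * 0ℤ                      ≡⟨ lemma′ x (+ suc a) ⟩
       x * x                                     ≡⟨ square-∣∣ x ⟩
       + (∣ x ∣ ℕ.* ∣ x ∣)                       ∎))
     where
     open ≡-Reasoning
     x = k + + suc a
     lemma : ∀ a k c → k * k + a * c ≡ (k + a) * (k + a) - a * (a + + 2 * k - c)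
     lemma = solve-∀
     lemma′ : ∀ x a → x * x - a * 0ℤ ≡ x * x
     lemma′ = solve-∀

   data Step (f : Form) : Form → Set where
     first  : ∀ s → total f ≡ + suc s  → Step f (advance f (+ suc s))
     second : ∀ s → total f ≡ -[1+ s ] → Step f (advance f -[1+ s ])

   next-step : ∀ f → Valid f → Step f (next f)
   next-step f valid = by-sign (total f) refl
     where
     by-sign : ∀ s → total f ≡ s → Step f (advance f s)
     by-sign (+ zero)  eq = ⊥-elim (total≢0 f valid eq)
     by-sign (+ suc s) eq = first s eq
     by-sign -[1+ s ]  eq = second s eq

   step-valid : ∀ {f g} → Valid f → Step f g → Valid g
   step-valid {a , k , c} valid (first s eq) = trans (cong (λ s → (k - + suc c) * (k - + suc c) + s * + suc c) (sym eq)) (trans (lemma (+ suc a) k (+ suc c)) valid)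
     where
     lemma : ∀ a k c → (k - c) * (k - c) + (a + + 2 * k - c) * c ≡ k * k + a * c
     lemma = solve-∀
   step-valid {a , k , c} valid (second s eq) = trans (cong (λ s → (k + + suc a) * (k + + suc a) + + suc a * s) (cong -_ (sym eq))) (trans (lemma (+ suc a) k (+ suc c)) valid)
     where
     lemma : ∀ a k c → (k + a) * (k + a) + a * (- (a + + 2 * k - c)) ≡ k * k + a * c
     lemma = solve-∀

   -- The value at the difference of the basis vectors tells which of them was replaced.
   difference : Form → ℤ
   difference (a , k , c) = + suc a - + 2 * k - + suc c

   difference-first : ∀ f s → total f ≡ + suc s → difference (advance f (+ suc s)) ≡ + suc (proj₁ f)
   difference-first (a , k , c) s eq = trans (cong (λ s → s - + 2 * (k - + suc c) - + suc c) (sym eq)) (lemma (+ suc a) k (+ suc c))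
     where
     lemma : ∀ a k c → (a + + 2 * k - c) - + 2 * (k - c) - c ≡ a
     lemma = solve-∀

   difference-second : ∀ f s → total f ≡ -[1+ s ] → difference (advance f -[1+ s ]) ≡ -[1+ proj₂ (proj₂ f) ]
   difference-second (a , k , c) s eq = trans (cong (λ s → + suc a - + 2 * (k + + suc a) + s) (sym eq)) (lemma (+ suc a) k (+ suc c))
     where
     lemma : ∀ a k c → a - + 2 * (k + a) + (a + + 2 * k - c) ≡ - c
     lemma = solve-∀

   step-injective : ∀ {f f′ g} → Step f g → Step f′ g → f ≡ f′
   step-injective {f} {f′} r r′ = go r r′ refl
     where
     go : ∀ {f f′ g g′} → Step f g → Step f′ g′ → g ≡ g′ → f ≡ f′
     go {f@(a , k , c)} {f′@(a′ , k′ , c′)} (first s eq) (first s′ eq′) g≡ = same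
         (ℕₚ.suc-injective (ℤₚ.+-injective (trans (sym (difference-first f s eq)) (trans (cong difference g≡) (difference-first f′ s′ eq′)))))
         (cong (λ g → proj₁ (proj₂ g)) g≡) (cong (λ g → proj₂ (proj₂ g)) g≡)
       where
       same : a ≡ a′ → k - + suc c ≡ k′ - + suc c′ → c ≡ c′ → f ≡ f′
       same refl k≡ refl = cong (λ k → a , k , c) (Groupₚ.∙-cancelʳ (- (+ suc c)) k k′ k≡)
     go {f@(a , k , c)} {f′@(a′ , k′ , c′)} (second s eq) (second s′ eq′) g≡ = same
         (cong proj₁ g≡) (cong (λ g → proj₁ (proj₂ g)) g≡)
         (ℤₚ.-[1+-injective (trans (sym (difference-second f s eq)) (trans (cong difference g≡) (difference-second f′ s′ eq′))))
       where
       same : a ≡ a′ → k + + suc a ≡ k′ + + suc a′ → c ≡ c′ → f ≡ f′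
       same refl k≡ refl = cong (λ k → a , k , c) (Groupₚ.∙-cancelʳ (+ suc a) k k′ k≡)
     go {f} {f′} (first s eq) (second s′ eq′) g≡ with trans (sym (difference-first f s eq)) (trans (cong difference g≡) (difference-second f′ s′ eq′))
     ... | ()
     go {f} {f′} (second s eq) (first s′ eq′) g≡ with trans (sym (difference-second f s eq)) (trans (cong difference g≡) (difference-first f′ s′ eq′))
     ... | ()

   orbit : ℕ → Form → Form
   orbit zero    f = f
   orbit (suc n) f = next (orbit n f)

   orbit-valid : ∀ n f → Valid f → Valid (orbit n f)
   orbit-valid zero    f valid = valid
   orbit-valid (suc n) f valid = step-valid (orbit-valid n f valid) (next-step (orbit n f) (orbit-valid n f valid))

   next-injective : ∀ f g → Valid f → Valid g → next f ≡ next g → f ≡ g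
   next-injective f g vf vg eq = step-injective (next-step f vf) (subst (Step g) (sym eq) (next-step g vg))

   orbit-return : ∀ i d f → Valid f → orbit (i ℕ.+ d) f ≡ orbit i f → orbit d f ≡ f
   orbit-return zero    d f valid eq = eq
   orbit-return (suc i) d f valid eq = orbit-return i d f valid
     (next-injective _ _ (orbit-valid (i ℕ.+ d) f valid) (orbit-valid i f valid) eq)

   Bounded : Form → Set
   Bounded (a , k , c) = a ℕ.< D × ∣ k ∣ ℕ.< suc D × c ℕ.< D

   product≤ : ∀ f → Valid f → ∣ proj₁ (proj₂ f) ∣ ℕ.* ∣ proj₁ (proj₂ f) ∣ ℕ.+ suc (proj₁ f) ℕ.* suc (proj₂ (proj₂ f)) ≡ D
   product≤ (a , k , c) valid = ℤₚ.+-injective (trans (cong₂ _+_ (sym (square-∣∣ k)) (ℤₚ.pos-* (suc a) (suc c))) valid)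

   bounded : ∀ f → Valid f → Bounded f
   bounded f@(a , k , c) valid =
     ℕₚ.≤-trans (ℕₚ.≤-trans (ℕₚ.m≤m*n (suc a) (suc c)) (ℕₚ.m≤n+m _ _)) (ℕₚ.≤-reflexive (product≤ f valid)) ,
     s≤s (ℕₚ.≤-trans (square≥ ∣ k ∣) (ℕₚ.≤-trans (ℕₚ.m≤m+n _ _) (ℕₚ.≤-reflexive (product≤ f valid)))) ,
     ℕₚ.≤-trans (ℕₚ.≤-trans (ℕₚ.m≤n*m (suc c) (suc a)) (ℕₚ.m≤n+m _ _)) (ℕₚ.≤-reflexive (product≤ f valid))
     where
     square≥ : ∀ n → n ℕ.≤ n ℕ.* n
     square≥ zero      = z≤n
     square≥ n@(suc _) = ℕₚ.m≤m*n n n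

   Code : Set
   Code = Fin D × (Fin (suc D) ⊎ Fin (suc D)) × Fin D

   Code-finite : Finite Code
   Code-finite = ×-finite (Fin-finite D) (×-finite (⊎-finite (Fin-finite (suc D)) (Fin-finite (suc D))) (Fin-finite D))

   signed : ∀ k → ∣ k ∣ ℕ.< suc D → Fin (suc D) ⊎ Fin (suc D)
   signed (+ n)    n< = inj₁ (fromℕ< n<)
   signed -[1+ n ] n< = inj₂ (fromℕ< n<)

   signed-injective : ∀ k k′ k< k′< → signed k k< ≡ signed k′ k′< → k ≡ k′
   signed-injective (+ n)    (+ n′)    k< k′< eq = cong +_ (Finₚ.fromℕ<-injective n n′ k< k′< (inj₁-injective eq))
     where open import Data.Sum.Properties using (inj₁-injective)
   signed-injective -[1+ n ] -[1+ n′ ] k< k′< eq = cong -[1+_] (ℕₚ.suc-injective (Finₚ.fromℕ<-injective (suc n) (suc n′) k< k′< (inj₂-injective eq)))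
     where open import Data.Sum.Properties using (inj₂-injective)

   code : ∀ f → Bounded f → Code
   code (a , k , c) (a< , k< , c<) = fromℕ< a< , signed k k< , fromℕ< c<

   code-injective : ∀ f g (bf : Bounded f) (bg : Bounded g) → code f bf ≡ code g bg → f ≡ g
   code-injective (a , k , c) (a′ , k′ , c′) (a< , k< , c<) (a′< , k′< , c′<) eq = cong₂ _,_
     (Finₚ.fromℕ<-injective a a′ a< a′< (cong proj₁ eq))
     (cong₂ _,_ (signed-injective k k′ k< k′< (cong (λ e → proj₁ (proj₂ e)) eq)) (Finₚ.fromℕ<-injective c c′ c< c′< (cong (λ e → proj₂ (proj₂ e)) eq)))

   periodic : ∀ f → Valid f → ∃ λ d → orbit (suc d) f ≡ f
   periodic f valid = from-collision (Finₚ.pigeonhole (ℕₚ.n<1+n (size Code-finite)) (λ i → index Code-finite (coded (toℕ i))))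
     where
     orbit-bounded : ∀ n → Bounded (orbit n f)
     orbit-bounded n = bounded (orbit n f) (orbit-valid n f valid)
     coded : ℕ → Code
     coded n = code (orbit n f) (orbit-bounded n)
     from-collision : _ → _
     from-collision (i , j , i<j , eq) = let d , d≡ = ℕₚ.m≤n⇒∃[o]m+o≡n i<j in
       d , orbit-return (toℕ i) (suc d) f valid (trans (cong (λ n → orbit n f) (trans (ℕₚ.+-suc (toℕ i) d) d≡))
         (sym (code-injective (orbit (toℕ i) f) (orbit (toℕ j) f) (orbit-bounded (toℕ i)) (orbit-bounded (toℕ j))
           (trans (sym (at-index Code-finite (coded (toℕ i)))) (trans (cong (at Code-finite) eq) (at-index Code-finite (coded (toℕ j))))))))

   record Basis (f : Form) : Set where
     constructor basis
     field
       p q r s  : ℕ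
       p>0      : 1 ℕ.≤ p
       value₁   : + suc (proj₁ f) ≡ + p * + p - + D * (+ q * + q)
       value₁₂  : proj₁ (proj₂ f) ≡ + p * + r - + D * (+ q * + s)
       value₂   : - (+ suc (proj₂ (proj₂ f))) ≡ + r * + r - + D * (+ s * + s)

   open Basis

   total-value : ∀ {f} (b : Basis f) → total f ≡ + (p b ℕ.+ r b) * + (p b ℕ.+ r b) - + D * (+ (q b ℕ.+ s b) * + (q b ℕ.+ s b))
   total-value {a , k , c} (basis p q r s p>0 v₁ v₁₂ v₂) = trans (cong₂ (λ x y → x + + 2 * k + y) v₁ v₂)
     (trans (cong (λ k → + p * + p - + D * (+ q * + q) + + 2 * k + (+ r * + r - + D * (+ s * + s))) v₁₂) (lemma (+ p) (+ q) (+ r) (+ s) (+ D)))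
     where
     lemma : ∀ p q r s D → p * p - D * (q * q) + + 2 * (p * r - D * (q * s)) + (r * r - D * (s * s)) ≡ (p + r) * (p + r) - D * ((q + s) * (q + s))
     lemma = solve-∀

   step-basis : ∀ {f g} → Step f g → (b : Basis f) → ∃ λ (b′ : Basis g) → r b ℕ.≤ r b′
   step-basis {a , k , c} (first t eq) b@(basis p q r s p>0 v₁ v₁₂ v₂) = basis (p ℕ.+ r) (q ℕ.+ s) r s (ℕₚ.≤-trans p>0 (ℕₚ.m≤m+n p r))
     (trans (sym eq) (total-value b))
     (trans (cong₂ _+_ v₁₂ v₂) (lemma′ (+ p) (+ q) (+ r) (+ s) (+ D)))
     v₂ , ℕₚ.≤-refl
     where
     lemma′ : ∀ p q r s D → (p * r - D * (q * s)) + (r * r - D * (s * s)) ≡ (p + r) * r - D * ((q + s) * s)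
     lemma′ = solve-∀
   step-basis {a , k , c} (second t eq) b@(basis p q r s p>0 v₁ v₁₂ v₂) = basis p q (p ℕ.+ r) (q ℕ.+ s) p>0
     v₁
     (trans (cong₂ _+_ v₁₂ v₁) (lemma′ (+ p) (+ q) (+ r) (+ s) (+ D)))
     (trans (sym eq) (total-value b)) , ℕₚ.m≤n+m r p
     where
     lemma′ : ∀ p q r s D → (p * r - D * (q * s)) + (p * p - D * (q * q)) ≡ p * (p + r) - D * (q * (q + s))
     lemma′ = solve-∀

 pell : ∀ D → (∀ d → ¬ D ≡ d ℕ.* d) → ∃ λ p → ∃ λ q → p ℕ.* p ≡ 1 ℕ.+ D ℕ.* (q ℕ.* q) × 1 ℕ.≤ q
 pell zero          nonsquare = ⊥-elim (nonsquare 0 refl)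
 pell (suc zero)    nonsquare = ⊥-elim (nonsquare 1 refl)
 pell D@(suc (suc D-2)) nonsquare = from-basis returned
   where
   open River D nonsquare
   open Basis

   Solution : Set
   Solution = ∃ λ p → ∃ λ q → p ℕ.* p ≡ 1 ℕ.+ D ℕ.* (q ℕ.* q) × 1 ℕ.≤ q

   start : Form
   start = 0 , 0ℤ , suc D-2

   valid : Valid start
   valid = cong +_ (ℕₚ.+-identityʳ D)

   second-step : next start ≡ (0 , 1ℤ , D-2)
   second-step = refl

   Advanced : Form → Set
   Advanced f = ∃ λ (b : Basis f) → 1 ℕ.≤ r b

   advanced : ∀ n → Advanced (orbit (suc n) start)
   advanced zero    = subst Advanced (sym second-step) (basis 1 0 1 1 (s≤s z≤n) (lemma₁ (+ D)) (lemma₁ (+ D)) (lemma₂ (+ D-2)) , s≤s z≤n)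
     where
     lemma₁ : ∀ D → 1ℤ ≡ 1ℤ * 1ℤ - D * 0ℤ
     lemma₁ = solve-∀
     lemma₂ : ∀ d → - (1ℤ + d) ≡ 1ℤ * 1ℤ - (+ 2 + d) * (1ℤ * 1ℤ)
     lemma₂ = solve-∀
   advanced (suc n) = let b , r>0 = advanced n
                          b′ , r≤ = step-basis (next-step _ (orbit-valid (suc n) start valid)) b
                      in b′ , ℕₚ.≤-trans r>0 r≤

   returned : Advanced start
   returned = subst Advanced (proj₂ (periodic start valid)) (advanced (proj₁ (periodic start valid)))

   solution : ∀ (b : Basis start) → p b ℕ.* p b ≡ 1 ℕ.+ D ℕ.* (q b ℕ.* q b)
   solution b = ℤₚ.+-injective (trans (ℤₚ.pos-* (p b) (p b)) (trans (lemma (+ p b * + p b) (+ D * (+ q b * + q b)))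
     (trans (cong (_+ (+ D * (+ q b * + q b))) (sym (value₁ b))) (cong (λ x → 1ℤ + x) (trans (cong (λ x → + D * x) (sym (ℤₚ.pos-* (q b) (q b)))) (sym (ℤₚ.pos-* D (q b ℕ.* q b))))))))
     where
     lemma : ∀ x y → x ≡ x - y + y
     lemma = solve-∀

   q>0 : ∀ (b : Basis start) → 1 ℕ.≤ r b → 1 ℕ.≤ q b
   q>0 b r>0 = positive (q b) refl
     where
     positive : ∀ q′ → q b ≡ q′ → 1 ℕ.≤ q′
     positive (suc _) _  = s≤s z≤n
     positive zero    eq = ⊥-elim (ℕₚ.<⇒≢ (ℕₚ.*-mono-≤ (p>0 b) r>0) (sym (ℤₚ.+-injective (trans (ℤₚ.pos-* (p b) (r b))
       (sym (trans (value₁₂ b) (trans (cong (λ q → + p b * + r b - + D * (+ q * + s b)) eq) (lemma (+ p b * + r b) (+ D) (+ s b)))))))))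
       where
       lemma : ∀ x D s → x - D * (0ℤ * s) ≡ x
       lemma = solve-∀

   from-basis : Advanced start → Solution
   from-basis (b , r>0) = p b , q b , solution b , q>0 b r>0

 -- Squaring p + q √D keeps the norm 1 and increases p.
 large-pell : ∀ D → (∀ d → ¬ D ≡ d ℕ.* d) → ∀ n → ∃ λ p → ∃ λ q → p ℕ.* p ≡ 1 ℕ.+ D ℕ.* (q ℕ.* q) × 1 ℕ.≤ q × n ℕ.≤ p
 large-pell D nonsquare zero    = let p , q , eq , q>0 = pell D nonsquare in p , q , eq , q>0 , z≤n
 large-pell D nonsquare (suc n) =
   let p , q , eq , q>0 , n≤ = large-pell D nonsquare n in
   p ℕ.* p ℕ.+ D ℕ.* (q ℕ.* q) , 2 ℕ.* (p ℕ.* q) , square p q eq , grow-q p q eq q>0 , ℕₚ.≤-trans (s≤s n≤) (grow-p p q eq q>0)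
   where
   square : ∀ p q → p ℕ.* p ≡ 1 ℕ.+ D ℕ.* (q ℕ.* q) →
     (p ℕ.* p ℕ.+ D ℕ.* (q ℕ.* q)) ℕ.* (p ℕ.* p ℕ.+ D ℕ.* (q ℕ.* q)) ≡ 1 ℕ.+ D ℕ.* (2 ℕ.* (p ℕ.* q) ℕ.* (2 ℕ.* (p ℕ.* q)))
   square p q eq = trans (cong (λ x → (x ℕ.+ D ℕ.* (q ℕ.* q)) ℕ.* (x ℕ.+ D ℕ.* (q ℕ.* q))) eq)
     (trans (lemma D (q ℕ.* q)) (trans (cong (λ x → 1 ℕ.+ D ℕ.* (4 ℕ.* (x ℕ.* (q ℕ.* q)))) (sym eq)) (lemma′ D p q)))
     where
     lemma : ∀ D y → (1 ℕ.+ D ℕ.* y ℕ.+ D ℕ.* y) ℕ.* (1 ℕ.+ D ℕ.* y ℕ.+ D ℕ.* y) ≡ 1 ℕ.+ D ℕ.* (4 ℕ.* ((1 ℕ.+ D ℕ.* y) ℕ.* y))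
     lemma = ℕSolver.solve-∀
     lemma′ : ∀ D p q → 1 ℕ.+ D ℕ.* (4 ℕ.* (p ℕ.* p ℕ.* (q ℕ.* q))) ≡ 1 ℕ.+ D ℕ.* (2 ℕ.* (p ℕ.* q) ℕ.* (2 ℕ.* (p ℕ.* q)))
     lemma′ = ℕSolver.solve-∀
   p≥1 : ∀ p {x} → p ℕ.* p ≡ 1 ℕ.+ x → 1 ℕ.≤ p
   p≥1 (suc _) _ = s≤s z≤n
   grow-q : ∀ p q → p ℕ.* p ≡ 1 ℕ.+ D ℕ.* (q ℕ.* q) → 1 ℕ.≤ q → 1 ℕ.≤ 2 ℕ.* (p ℕ.* q)
   grow-q p q eq q>0 = ℕₚ.*-mono-≤ {1} {2} {1} (s≤s z≤n) (ℕₚ.*-mono-≤ (p≥1 p eq) q>0)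
   D≥1 : ∀ D → (∀ d → ¬ D ≡ d ℕ.* d) → 1 ℕ.≤ D
   D≥1 zero    nonsquare = ⊥-elim (nonsquare 0 refl)
   D≥1 (suc _) nonsquare = s≤s z≤n
   grow-p : ∀ p q → p ℕ.* p ≡ 1 ℕ.+ D ℕ.* (q ℕ.* q) → 1 ℕ.≤ q → suc p ℕ.≤ p ℕ.* p ℕ.+ D ℕ.* (q ℕ.* q)
   grow-p p q eq q>0 = ℕₚ.≤-trans (ℕₚ.≤-reflexive (ℕₚ.+-comm 1 p))
     (ℕₚ.+-mono-≤ (subst (ℕ._≤ p ℕ.* p) (ℕₚ.*-identityʳ p) (ℕₚ.*-monoʳ-≤ p (p≥1 p eq))) (ℕₚ.*-mono-≤ (D≥1 D nonsquare) (ℕₚ.*-mono-≤ q>0 q>0)))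

module Radicals where

 open import Defs using (ℝ; seq; cauchy; _+ᴿ_; _*ᴿ_; fromℤ; _≤ᴿ_; _≃ᴿ_; 0ᴿ; ⟦_⟧; evaluate; Quadratic; _RootOfDegree_)
 open Reals
 open Pairs using (module Unit)
 open Pell using (large-pell)
 open import Data.Integer using (+_)
 open import Data.Rational using (0ℚ; 1ℚ; _+_; _*_; -_; _-_)

 open NonNeg-lemmas

 1ᴿ 2ᴿ : ℝ
 1ᴿ = fromℤ 1ℤ
 2ᴿ = fromℤ (+ 2)

 square-nn : ∀ x → NonNeg (x *ᴿ x)
 square-nn x ε 0<ε = 0 , λ n _ → ℚₚ.+-mono-≤-< (square≥0 (seq x n)) 0<ε
   where
   square≥0 : ∀ q → 0ℚ ℚ.≤ q * q
   square≥0 q = subst (0ℚ ℚ.≤_) (trans (sym (ℚₚ.∣p*q∣≡∣p∣*∣q∣ q q)) (absolute q)) (ℚₚ.≤-trans (ℚₚ.≤-reflexive (sym (ℚₚ.*-zeroʳ ℚ.∣ q ∣))) (ℚₚ.*-monoˡ-≤-nonNeg ℚ.∣ q ∣ {{ℚₚ.∣-∣-nonNeg q}} (ℚₚ.0≤∣p∣ q)))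
     where
     absolute : ∀ q → ℚ.∣ q * q ∣ ≡ q * q
     absolute q with ℚₚ.∣p∣≡p∨∣p∣≡-p q
     ... | inj₁ eq = trans (ℚₚ.∣p*q∣≡∣p∣*∣q∣ q q) (cong₂ _*_ eq eq)
     ... | inj₂ eq = trans (ℚₚ.∣p*q∣≡∣p∣*∣q∣ q q) (trans (cong₂ _*_ eq eq) (lemma q))
       where
       lemma : ∀ q → - q * - q ≡ q * q
       lemma = Solver.solve-∀ ℚ-ring

 -- An approximation with error 1 separates the two overlapping alternatives.
 locate : ∀ x → NonNeg (x +ᴿ 1ᴿ) ⊎ NonNeg (1ᴿ +ᴿ -ᴿ x)
 locate x = from-sign (ℚₚ.≤-total 0ℚ (seq x N))
   where
   N = proj₁ (cauchy x (ℚₚ.positive⁻¹ 1ℚ))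
   near : ∀ n → N ℕ.≤ n → ℚ.∣ seq x n - seq x N ∣ ℚ.< 1ℚ
   near n N≤n = proj₂ (cauchy x (ℚₚ.positive⁻¹ 1ℚ)) n N N≤n ℕₚ.≤-refl
   from-sign : 0ℚ ℚ.≤ seq x N ⊎ seq x N ℚ.≤ 0ℚ → NonNeg (x +ᴿ 1ᴿ) ⊎ NonNeg (1ᴿ +ᴿ -ᴿ x)
   from-sign (inj₁ 0≤) = inj₁ λ ε 0<ε → N , λ n N≤n → ℚₚ.+-mono-< (above (seq x n) (seq x N) 0≤ (near n N≤n)) 0<ε
     where
     above : ∀ p q → 0ℚ ℚ.≤ q → ℚ.∣ p - q ∣ ℚ.< 1ℚ → 0ℚ ℚ.< p + 1ℚ
     above p q 0≤q h = subst (0ℚ ℚ.<_) (lemma p q) (ℚₚ.+-mono-≤-< 0≤q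
       (subst (ℚ._< p - q + 1ℚ) (ℚₚ.+-inverseʳ (p - q)) (ℚₚ.+-monoʳ-< (p - q) (ℚₚ.≤-<-trans ≤∣ - (p - q) ∣ (subst (ℚ._< 1ℚ) (sym (ℚₚ.∣-p∣≡∣p∣ (p - q))) h)))))
       where
       lemma : ∀ p q → q + (p - q + 1ℚ) ≡ p + 1ℚ
       lemma = Solver.solve-∀ ℚ-ring
   from-sign (inj₂ ≤0) = inj₂ λ ε 0<ε → N , λ n N≤n → ℚₚ.+-mono-< (subst (λ z → 0ℚ ℚ.< 1ℚ + z) (sym (neg-seq x n)) (below (seq x n) (seq x N) ≤0 (near n N≤n))) 0<ε
     where
     below : ∀ p q → q ℚ.≤ 0ℚ → ℚ.∣ p - q ∣ ℚ.< 1ℚ → 0ℚ ℚ.< 1ℚ + - p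
     below p q q≤0 h = subst (0ℚ ℚ.<_) (lemma p q) (ℚₚ.+-mono-≤-< (ℚₚ.neg-antimono-≤ q≤0)
       (subst (ℚ._< - (p - q) + 1ℚ) (ℚₚ.+-inverseˡ (p - q)) (ℚₚ.+-monoʳ-< (- (p - q)) (ℚₚ.≤-<-trans ≤∣ p - q ∣ h))))
       where
       lemma : ∀ p q → - q + (- (p - q) + 1ℚ) ≡ 1ℚ + - p
       lemma = Solver.solve-∀ ℚ-ring

 cancel-null : ∀ x y → NonNeg (x +ᴿ fromℤ -[1+ 0 ]) → Null (x *ᴿ y) → Null y
 cancel-null x y 1≤x (p , q) = cancel-nn x y 1≤x p , cancel-nn x (-ᴿ y) 1≤x
   (≗-nn (-ᴿ (x *ᴿ y)) (x *ᴿ -ᴿ y) (λ n → trans (neg-seq (x *ᴿ y) n) (trans (lemma (seq x n) (seq y n)) (cong (λ z → seq x n * z) (sym (neg-seq y n))))) q)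
   where
   lemma : ∀ a b → - (a * b) ≡ a * - b
   lemma = Solver.solve-∀ ℚ-ring

 ι-suc : ∀ n → ι (+ suc n) ≡ 1ℚ + ι (+ n)
 ι-suc n = ι-+ 1ℤ (+ n)

 positive-root : ∀ x n → Null (x *ᴿ x +ᴿ -ᴿ fromℤ (+ suc n)) → NonNeg (2ᴿ *ᴿ x +ᴿ 1ᴿ) → NonNeg x
 positive-root x n (x²≥ , _) above = ≗-nn ((x +ᴿ fromℤ -1ℤ) +ᴿ 1ᴿ) x (λ i → lemma₀ (seq x i))
   (+-nn (x +ᴿ fromℤ -1ℤ) 1ᴿ x-1≥0 (const-nn 1))
   where
   X = 2ᴿ *ᴿ x +ᴿ 2ᴿ
   lemma₀ : ∀ a → (a + - 1ℚ) + 1ℚ ≡ a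
   lemma₀ = Solver.solve-∀ ℚ-ring
   lemma₁ : ∀ a → (ι (+ 2) * a + 1ℚ) ≡ (ι (+ 2) * a + ι (+ 2)) + - 1ℚ
   lemma₁ a = sym (ℚₚ.+-assoc (ι (+ 2) * a) (ι (+ 2)) (- 1ℚ))
   lemma₂ : ∀ t a m → t * (a * a + - (1ℚ + m)) + t * m ≡ (t * a + t) * (a + - 1ℚ)
   lemma₂ = Solver.solve-∀ ℚ-ring
   x-1≥0 : NonNeg (x +ᴿ fromℤ -1ℤ)
   x-1≥0 = cancel-nn X (x +ᴿ fromℤ -1ℤ) (≗-nn (2ᴿ *ᴿ x +ᴿ 1ᴿ) (X +ᴿ fromℤ -1ℤ) (λ i → lemma₁ (seq x i)) above)
     (≗-nn (2ᴿ *ᴿ (x *ᴿ x +ᴿ -ᴿ fromℤ (+ suc n)) +ᴿ 2ᴿ *ᴿ fromℤ (+ n)) (X *ᴿ (x +ᴿ fromℤ -1ℤ))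
       (λ i → trans (cong (λ z → ι (+ 2) * (seq x i * seq x i + z) + ι (+ 2) * ι (+ n)) (trans (neg-seq (fromℤ (+ suc n)) i) (cong -_ (ι-suc n)))) (lemma₂ (ι (+ 2)) (seq x i) (ι (+ n))))
       (+-nn (2ᴿ *ᴿ (x *ᴿ x +ᴿ -ᴿ fromℤ (+ suc n))) (2ᴿ *ᴿ fromℤ (+ n)) (*-nn 2ᴿ (x *ᴿ x +ᴿ -ᴿ fromℤ (+ suc n)) (const-nn 2) x²≥) (*-nn 2ᴿ (fromℤ (+ n)) (const-nn 2) (const-nn n))))

 zero-root : ∀ x → Null (x *ᴿ x +ᴿ -ᴿ fromℤ 0ℤ) → NonNeg x
 zero-root x (_ , x²≤0) ε 0<ε = let N , h = x²≤0 (ε * ε) (pos-* 0<ε 0<ε) in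
   N , λ n N≤n → ℚₚ.≰⇒> λ x+ε≤0 → ℚₚ.<-irrefl refl (ℚₚ.<-≤-trans (h n N≤n) (bound (seq x n) x+ε≤0 (trans (neg-seq (x *ᴿ x +ᴿ -ᴿ fromℤ 0ℤ) n) (cong (λ z → - (seq x n * seq x n + z)) (neg-seq (fromℤ 0ℤ) n)))))
   where
   -- (− x − ε)(ε − x) = x² − ε² is nonnegative when x + ε ≤ 0.
   lemma : ∀ a e → - (- (a + e) * (e + - a)) ≡ - (a * a + - 0ℚ) + e * e
   lemma = Solver.solve-∀ ℚ-ring
   bound : ∀ a → a + ε ℚ.≤ 0ℚ → ∀ {s} → s ≡ - (a * a + - ι 0ℤ) → s + ε * ε ℚ.≤ 0ℚ
   bound a a+ε≤0 {s} s≡ = ℚₚ.≤-trans (ℚₚ.≤-reflexive (trans (cong (λ z → z + ε * ε) s≡) (sym (lemma a ε)))) (ℚₚ.neg-antimono-≤ (ℚₚ.≤-trans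
     (ℚₚ.≤-reflexive (sym (ℚₚ.*-zeroʳ (- (a + ε))))) (ℚₚ.*-monoˡ-≤-nonNeg (- (a + ε)) {{ℚ.nonNegative (ℚₚ.neg-antimono-≤ a+ε≤0)}} ε-a≥0)))
     where
     2ε≥0 : 0ℚ ℚ.≤ ε + ε
     2ε≥0 = ℚₚ.<⇒≤ (ℚₚ.+-mono-< 0<ε 0<ε)
     ε-a≥0 : 0ℚ ℚ.≤ ε + - a
     ε-a≥0 = subst (0ℚ ℚ.≤_) (lemma′ a ε) (ℚₚ.+-mono-≤ (ℚₚ.neg-antimono-≤ a+ε≤0) 2ε≥0)
       where
       lemma′ : ∀ a e → - (a + e) + (e + e) ≡ e + - a
       lemma′ = Solver.solve-∀ ℚ-ring

 negated-square : ∀ x k → Null (x *ᴿ x +ᴿ -ᴿ fromℤ k) → Null (-ᴿ x *ᴿ -ᴿ x +ᴿ -ᴿ fromℤ k)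
 negated-square x k = null-≗ (x *ᴿ x +ᴿ -ᴿ fromℤ k) (-ᴿ x *ᴿ -ᴿ x +ᴿ -ᴿ fromℤ k)
   λ n → cong (λ z → z + seq (-ᴿ fromℤ k) n) (trans (lemma (seq x n)) (sym (cong₂ _*_ (neg-seq x n) (neg-seq x n))))
   where
   lemma : ∀ a → a * a ≡ - a * - a
   lemma = Solver.solve-∀ ℚ-ring

 integer-root : ∀ x d → Null (x *ᴿ x +ᴿ -ᴿ fromℤ (+ (d ℕ.* d))) → ∃ λ k → Null (x +ᴿ -ᴿ fromℤ k)
 integer-root x zero    x²≡ = 0ℤ , null-≗ x (x +ᴿ -ᴿ fromℤ 0ℤ) (λ n → trans (sym (ℚₚ.+-identityʳ (seq x n))) (cong (λ z → seq x n + z) (sym (neg-seq (fromℤ 0ℤ) n))))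
   (zero-root x x²≡ , zero-root (-ᴿ x) (negated-square x 0ℤ x²≡))
 integer-root x (suc e) x²≡ = from-location (locate (2ᴿ *ᴿ x))
   where
   t = ι (+ 2)
   d = + suc e
   square : ι (+ (suc e ℕ.* suc e)) ≡ (1ℚ + ι (+ e)) * (1ℚ + ι (+ e))
   square = trans (cong ι (ℤₚ.pos-* (suc e) (suc e))) (trans (ι-* d d) (cong₂ _*_ (ι-suc e) (ι-suc e)))
   null : ℝ
   null = x *ᴿ x +ᴿ -ᴿ fromℤ (+ (suc e ℕ.* suc e))
   null-seq : ∀ n → seq null n ≡ seq x n * seq x n + - ((1ℚ + ι (+ e)) * (1ℚ + ι (+ e)))
   null-seq n = cong (λ z → seq x n * seq x n + z) (trans (neg-seq (fromℤ (+ (suc e ℕ.* suc e))) n) (cong -_ square))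
   from-location : NonNeg (2ᴿ *ᴿ x +ᴿ 1ᴿ) ⊎ NonNeg (1ᴿ +ᴿ -ᴿ (2ᴿ *ᴿ x)) → ∃ λ k → Null (x +ᴿ -ᴿ fromℤ k)
   from-location (inj₁ above) = d , cancel-null X (x +ᴿ -ᴿ fromℤ d)
     (≗-nn (2ᴿ *ᴿ x +ᴿ 1ᴿ +ᴿ 2ᴿ *ᴿ fromℤ (+ e)) (X +ᴿ fromℤ -1ℤ) (λ n → trans (lemma₁ (t * seq x n) (t * ι (+ e))) (cong (λ z → z + - 1ℚ) (sym (trans (cong (λ z → t * (seq x n + z)) (ι-suc e)) (lemma₀ t (seq x n) (ι (+ e)))))))
       (+-nn (2ᴿ *ᴿ x +ᴿ 1ᴿ) (2ᴿ *ᴿ fromℤ (+ e)) above (*-nn 2ᴿ (fromℤ (+ e)) (const-nn 2) (const-nn e))))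
     (null-≗ (2ᴿ *ᴿ null) (X *ᴿ (x +ᴿ -ᴿ fromℤ d)) (λ n → trans (cong (λ z → t * z) (null-seq n)) (trans (lemma₂ t (seq x n) (ι (+ e)))
       (sym (cong₂ _*_ (cong (λ z → t * (seq x n + z)) (ι-suc e)) (cong (λ z → seq x n + z) (trans (neg-seq (fromℤ d) n) (cong -_ (ι-suc e)))))))) (null-* (+ 2) null x²≡))
     where
     X = 2ᴿ *ᴿ (x +ᴿ fromℤ d)
     lemma₀ : ∀ t a e → t * (a + (1ℚ + e)) ≡ t * a + t + t * e
     lemma₀ = Solver.solve-∀ ℚ-ring
     lemma₁ : ∀ a e → a + 1ℚ + e ≡ a + t + e + - 1ℚ
     lemma₁ a e = trans (cong (_+ e) (trans (cong (λ z → a + z) {1ℚ} {t + - 1ℚ} refl) (sym (ℚₚ.+-assoc a t (- 1ℚ))))) (swap (a + t) (- 1ℚ) e)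
       where
       swap : ∀ a b c → a + b + c ≡ a + c + b
       swap = Solver.solve-∀ ℚ-ring
     lemma₂ : ∀ t a e → t * (a * a + - ((1ℚ + e) * (1ℚ + e))) ≡ t * (a + (1ℚ + e)) * (a + - (1ℚ + e))
     lemma₂ = Solver.solve-∀ ℚ-ring
   from-location (inj₂ below) = ℤ.- d , cancel-null X (x +ᴿ -ᴿ fromℤ (ℤ.- d))
     (≗-nn (1ᴿ +ᴿ -ᴿ (2ᴿ *ᴿ x) +ᴿ 2ᴿ *ᴿ fromℤ (+ e)) (X +ᴿ fromℤ -1ℤ) (λ n → trans (cong (λ z → 1ℚ + z + t * ι (+ e)) (neg-seq (2ᴿ *ᴿ x) n)) (trans (lemma₁ (t * seq x n) (t * ι (+ e)))
         (cong (λ z → z + - 1ℚ) (sym (trans (cong₂ (λ y z → t * (y + z)) (ι-suc e) (neg-seq x n)) (lemma₀ t (seq x n) (ι (+ e))))))))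
       (+-nn (1ᴿ +ᴿ -ᴿ (2ᴿ *ᴿ x)) (2ᴿ *ᴿ fromℤ (+ e)) below (*-nn 2ᴿ (fromℤ (+ e)) (const-nn 2) (const-nn e))))
     (null-≗ (fromℤ -[1+ 1 ] *ᴿ null) (X *ᴿ (x +ᴿ -ᴿ fromℤ (ℤ.- d))) (λ n → trans (cong (λ z → - t * z) (null-seq n)) (trans (lemma₂ t (seq x n) (ι (+ e)))
       (sym (cong₂ _*_ (cong₂ (λ y z → t * (y + z)) (ι-suc e) (neg-seq x n)) (cong (λ z → seq x n + z) (trans (neg-seq (fromℤ (ℤ.- d)) n) (cong -_ (trans (ι-neg d) (cong -_ (ι-suc e))))))))))
       (null-* -[1+ 1 ] null x²≡))
     where
     X = 2ᴿ *ᴿ (fromℤ d +ᴿ -ᴿ x)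
     lemma₀ : ∀ t a e → t * ((1ℚ + e) + - a) ≡ t + - (t * a) + t * e
     lemma₀ = Solver.solve-∀ ℚ-ring
     lemma₁ : ∀ a e → 1ℚ + - a + e ≡ t + - a + e + - 1ℚ
     lemma₁ a e = trans (cong (λ z → z + - a + e) {1ℚ} {t + - 1ℚ} refl) (swap t (- 1ℚ) (- a) e)
       where
       swap : ∀ t o a e → t + o + a + e ≡ t + a + e + o
       swap = Solver.solve-∀ ℚ-ring
     lemma₂ : ∀ t a e → - t * (a * a + - ((1ℚ + e) * (1ℚ + e))) ≡ t * ((1ℚ + e) + - a) * (a + - (- (1ℚ + e)))
     lemma₂ = Solver.solve-∀ ℚ-ring

 record Radical (α : ℝ) : Set where
   constructor radical
   field
     a         : ℕ
     e₀ e₁     : ℤ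
     500≤a     : 500 ℕ.≤ a
     nonneg    : NonNeg (⟦ e₀ , e₁ ⟧ α)
     square    : ⟦ e₀ , e₁ ⟧ α *ᴿ ⟦ e₀ , e₁ ⟧ α ≃ᴿ fromℤ (Unit.D a)

 module _ (α : ℝ) (A B C : ℤ) (A≢0 : A ≢ 0ℤ) (root : evaluate (C ∷ B ∷ A ∷ []) α ≃ᴿ 0ᴿ) (irrational : ¬ α RootOfDegree 1) where

   private
     x eval : ℝ
     x    = ⟦ B , + 2 ℤ.* A ⟧ α
     eval = evaluate (C ∷ B ∷ A ∷ []) α

     Δ : ℤ
     Δ = B ℤ.* B ℤ.- + 2 ℤ.* (+ 2 ℤ.* (A ℤ.* C))

     t b c l : ℚ
     t = ι (+ 2)
     b = ι B
     c = ι C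
     l = ι A

     x-seq : ∀ n → seq x n ≡ b + t * l * seq α n
     x-seq n = cong (λ z → b + z * seq α n) (ι-* (+ 2) A)

     x²≡Δ : Null (x *ᴿ x +ᴿ -ᴿ fromℤ Δ)
     x²≡Δ = null-≗ (fromℤ (+ 2 ℤ.* (+ 2 ℤ.* A)) *ᴿ (eval +ᴿ -ᴿ 0ᴿ)) (x *ᴿ x +ᴿ -ᴿ fromℤ Δ)
       (λ n → trans (cong₂ _*_ (trans (ι-* (+ 2) (+ 2 ℤ.* A)) (cong (t *_) (ι-* (+ 2) A))) (cong (λ z → seq eval n + z) (neg-seq 0ᴿ n)))
         (trans (lemma (seq α n) l b c) (sym (cong₂ (λ y z → y * y + z) (x-seq n) (trans (neg-seq (fromℤ Δ) n) (cong -_ ιΔ))))))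
       (null-* (+ 2 ℤ.* (+ 2 ℤ.* A)) (eval +ᴿ -ᴿ 0ᴿ) (≃⇒null eval 0ᴿ root))
       where
       lemma : ∀ s l b c → t * (t * l) * (c + s * (b + s * (l + s * 0ℚ)) + - 0ℚ) ≡ (b + t * l * s) * (b + t * l * s) + - (b * b + - (t * (t * (l * c))))
       lemma = identity
         where
         identity : ∀ s l b c → (1ℚ + 1ℚ) * ((1ℚ + 1ℚ) * l) * (c + s * (b + s * (l + s * 0ℚ)) + - 0ℚ) ≡ (b + (1ℚ + 1ℚ) * l * s) * (b + (1ℚ + 1ℚ) * l * s) + - (b * b + - ((1ℚ + 1ℚ) * ((1ℚ + 1ℚ) * (l * c))))
         identity = Solver.solve-∀ ℚ-ring
       ιΔ : ι Δ ≡ b * b + - (t * (t * (l * c)))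
       ιΔ = trans (ι-+ (B ℤ.* B) (ℤ.- (+ 2 ℤ.* (+ 2 ℤ.* (A ℤ.* C))))) (cong₂ _+_ (ι-* B B) (trans (ι-neg (+ 2 ℤ.* (+ 2 ℤ.* (A ℤ.* C))))
         (cong -_ (trans (ι-* (+ 2) (+ 2 ℤ.* (A ℤ.* C))) (cong (t *_) (trans (ι-* (+ 2) (A ℤ.* C)) (cong (t *_) (ι-* A C))))))))

     no-integer-root : ∀ k → ¬ Null (x +ᴿ -ᴿ fromℤ k)
     no-integer-root k x≡k = irrational (((B ℤ.- k) ∷ + 2 ℤ.* A ∷ []) , 2A≢0 , null⇒≃ (evaluate ((B ℤ.- k) ∷ + 2 ℤ.* A ∷ []) α) 0ᴿ
       (null-≗ (x +ᴿ -ᴿ fromℤ k) (evaluate ((B ℤ.- k) ∷ + 2 ℤ.* A ∷ []) α +ᴿ -ᴿ 0ᴿ)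
         (λ n → trans (cong₂ _+_ (x-seq n) (neg-seq (fromℤ k) n)) (trans (lemma (seq α n) t l b (ι k))
           (sym (cong₂ _+_ (cong₂ (λ y z → y + seq α n * (z + seq α n * 0ℚ)) (trans (ι-+ B (ℤ.- k)) (cong (λ z → b + z) (ι-neg k))) (ι-* (+ 2) A)) (neg-seq 0ᴿ n))))) x≡k))
       where
       lemma : ∀ s t l b k → (b + t * l * s) + - k ≡ b + - k + s * (t * l + s * 0ℚ) + - 0ℚ
       lemma = Solver.solve-∀ ℚ-ring
       2A≢0 : + 2 ℤ.* A ≢ 0ℤ
       2A≢0 eq with ℤₚ.i*j≡0⇒i≡0∨j≡0 (+ 2) {A} eq
       ... | inj₂ A≡0 = A≢0 A≡0

     module Scaled (n : ℕ) (Δ≡ : Δ ≡ + suc n) (p q : ℕ) (eq : p ℕ.* p ≡ 1 ℕ.+ suc n ℕ.* (q ℕ.* q)) (500≤p : 500 ℕ.≤ p) where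

       x²≡ : Null (x *ᴿ x +ᴿ -ᴿ fromℤ (+ suc n))
       x²≡ = subst (λ Δ → Null (x *ᴿ x +ᴿ -ᴿ fromℤ Δ)) Δ≡ x²≡Δ

       scaled : ∀ σ → σ ℤ.* σ ≡ + q ℤ.* + q → NonNeg (fromℤ σ *ᴿ x) → Radical α
       scaled σ σ² σx≥0 = radical p (σ ℤ.* B) (σ ℤ.* (+ 2 ℤ.* A)) 500≤p
         (≗-nn (fromℤ σ *ᴿ x) θ θ-seq σx≥0)
         (null⇒≃ (θ *ᴿ θ) (fromℤ (Unit.D p)) (null-≗ (fromℤ (+ q ℤ.* + q) *ᴿ (x *ᴿ x +ᴿ -ᴿ fromℤ (+ suc n))) (θ *ᴿ θ +ᴿ -ᴿ fromℤ (Unit.D p))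
           (λ i → trans (cong₂ _*_ (trans (cong ι (sym σ²)) (ι-* σ σ)) (cong (λ z → seq x i * seq x i + z) (neg-seq (fromℤ (+ suc n)) i)))
             (trans (lemma (ι σ) (seq x i) (ι (+ suc n))) (cong₂ _+_ (cong₂ _*_ (θ-seq i) (θ-seq i)) (sym (trans (neg-seq (fromℤ (Unit.D p)) i) (cong -_ D≡))))))
           (null-* (+ q ℤ.* + q) (x *ᴿ x +ᴿ -ᴿ fromℤ (+ suc n)) x²≡)))
         where
         θ = ⟦ σ ℤ.* B , σ ℤ.* (+ 2 ℤ.* A) ⟧ α
         θ-seq : ∀ i → ι σ * seq x i ≡ seq θ i
         θ-seq i = trans (distribute (ι σ) b (ι (+ 2 ℤ.* A)) (seq α i)) (sym (cong₂ (λ y z → y + z * seq α i) (ι-* σ B) (ι-* σ (+ 2 ℤ.* A))))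
           where
           distribute : ∀ s b l a → s * (b + l * a) ≡ s * b + s * l * a
           distribute = Solver.solve-∀ ℚ-ring
         lemma : ∀ s x d → s * s * (x * x + - d) ≡ s * x * (s * x) + - (s * s * d)
         lemma = Solver.solve-∀ ℚ-ring
         D≡ : ι (Unit.D p) ≡ ι σ * ι σ * ι (+ suc n)
         D≡ = trans (cong ι (trans (cong (ℤ._- 1ℤ) (trans (sym (ℤₚ.pos-* p p)) (trans (cong +_ eq) (cong (λ z → 1ℤ ℤ.+ z) (trans (ℤₚ.pos-* (suc n) (q ℕ.* q)) (cong (+ suc n ℤ.*_) (trans (ℤₚ.pos-* q q) (sym σ²))))))))
           (cancel (+ suc n) (σ ℤ.* σ)))) (trans (ι-* (σ ℤ.* σ) (+ suc n)) (cong (_* ι (+ suc n)) (ι-* σ σ)))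
           where
           cancel : ∀ n s → 1ℤ ℤ.+ n ℤ.* s ℤ.- 1ℤ ≡ s ℤ.* n
           cancel = ℤSolver.solve-∀

       signed : Radical α
       signed = from-location (locate (2ᴿ *ᴿ x))
         where
         from-location : NonNeg (2ᴿ *ᴿ x +ᴿ 1ᴿ) ⊎ NonNeg (1ᴿ +ᴿ -ᴿ (2ᴿ *ᴿ x)) → Radical α
         from-location (inj₁ above) = scaled (+ q) refl (*-nn (fromℤ (+ q)) x (const-nn q) (positive-root x n x²≡ above))
         from-location (inj₂ below) = scaled (ℤ.- + q) (square-neg (+ q))
           (≗-nn (fromℤ (+ q) *ᴿ -ᴿ x) (fromℤ (ℤ.- + q) *ᴿ x) (λ i → trans (cong (λ z → ι (+ q) * z) (neg-seq x i)) (trans (lemma (ι (+ q)) (seq x i)) (cong (_* seq x i) (sym (ι-neg (+ q))))))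
             (*-nn (fromℤ (+ q)) (-ᴿ x) (const-nn q) (positive-root (-ᴿ x) n (negated-square x (+ suc n) x²≡)
               (≗-nn (1ᴿ +ᴿ -ᴿ (2ᴿ *ᴿ x)) (2ᴿ *ᴿ -ᴿ x +ᴿ 1ᴿ) (λ i → trans (cong (λ z → 1ℚ + z) (neg-seq (2ᴿ *ᴿ x) i)) (trans (lemma′ t (seq x i)) (cong (λ z → t * z + 1ℚ) (sym (neg-seq x i))))) below))))
           where
           square-neg : ∀ i → (ℤ.- i) ℤ.* (ℤ.- i) ≡ i ℤ.* i
           square-neg = ℤSolver.solve-∀
           lemma : ∀ a b → a * - b ≡ - a * b
           lemma = Solver.solve-∀ ℚ-ring
           lemma′ : ∀ t a → 1ℚ + - (t * a) ≡ t * - a + 1ℚ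
           lemma′ = Solver.solve-∀ ℚ-ring

   -- The discriminant Δ = x² is positive, and not a square because α is irrational.
   quadratic-radical : Radical α
   quadratic-radical = by-sign Δ refl
     where
     by-sign : ∀ i → Δ ≡ i → Radical α
     by-sign (+ d) eq = from-pell d eq (large-pell d (λ e d≡ → let k , x≡k = integer-root x e (subst (λ i → Null (x *ᴿ x +ᴿ -ᴿ fromℤ i)) (trans eq (cong +_ d≡)) x²≡Δ)
                                                                 in no-integer-root k x≡k) 500)
       where
       from-pell : ∀ d → Δ ≡ + d → (∃ λ p → ∃ λ q → p ℕ.* p ≡ 1 ℕ.+ d ℕ.* (q ℕ.* q) × 1 ℕ.≤ q × 500 ℕ.≤ p) → Radical α
       from-pell zero    eq _                             = let k , x≡k = integer-root x 0 (subst (λ i → Null (x *ᴿ x +ᴿ -ᴿ fromℤ i)) eq x²≡Δ) in ⊥-elim (no-integer-root k x≡k)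
       from-pell (suc n) eq (p , q , pell , q>0 , 500≤p) = Scaled.signed n eq p q pell 500≤p
     by-sign -[1+ n ] eq = ⊥-elim (¬const-nn n (≗-nn (x *ᴿ x +ᴿ -ᴿ (x *ᴿ x +ᴿ -ᴿ fromℤ -[1+ n ])) (fromℤ -[1+ n ])
       (λ i → trans (cong (λ z → seq x i * seq x i + z) (trans (neg-seq (x *ᴿ x +ᴿ -ᴿ fromℤ -[1+ n ]) i) (cong (λ z → - (seq x i * seq x i + z)) (neg-seq (fromℤ -[1+ n ]) i)))) (lemma (seq x i) (ι -[1+ n ])))
       (+-nn (x *ᴿ x) (-ᴿ (x *ᴿ x +ᴿ -ᴿ fromℤ -[1+ n ])) (square-nn x) (proj₂ (subst (λ i → Null (x *ᴿ x +ᴿ -ᴿ fromℤ i)) eq x²≡Δ)))))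
       where
       lemma : ∀ a d → a * a + - (a * a + - d) ≡ d
       lemma = Solver.solve-∀ ℚ-ring

 quadratic⇒radical : ∀ α → Quadratic α → Radical α
 quadratic⇒radical α ((C ∷ B ∷ A ∷ [] , A≢0 , root) , minimal) = quadratic-radical α A B C A≢0 root (minimal 1 (s≤s (s≤s z≤n)))

 √2-radical : ∀ α → 0ᴿ ≤ᴿ α → α *ᴿ α ≃ᴿ fromℤ (+ 2) → Radical α
 √2-radical α 0≤α α²≃2 = radical 577 0ℤ (+ 408) (ℕₚ.m≤m+n 500 77)
   (≗-nn (fromℤ (+ 408) *ᴿ α) θ (λ n → sym (ℚₚ.+-identityˡ (ι (+ 408) * seq α n))) (*-nn (fromℤ (+ 408)) α (const-nn 408) α≥0))
   (null⇒≃ (θ *ᴿ θ) (fromℤ (Unit.D 577)) (null-≗ (fromℤ (+ 166464) *ᴿ (α *ᴿ α +ᴿ -ᴿ fromℤ (+ 2))) (θ *ᴿ θ +ᴿ -ᴿ fromℤ (Unit.D 577))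
     (λ n → trans (cong₂ (λ y z → y * (seq α n * seq α n + z)) (ι-* (+ 408) (+ 408)) (neg-seq (fromℤ (+ 2)) n))
       (trans (lemma (ι (+ 408)) (seq α n) (ι (+ 2))) (cong₂ _+_ (cong₂ _*_ {0ℚ + ι (+ 408) * seq α n} refl refl)
         (sym (trans (neg-seq (fromℤ (Unit.D 577)) n) (cong -_ (trans (ι-* (+ 166464) (+ 2)) (cong (_* ι (+ 2)) (ι-* (+ 408) (+ 408))))))))))
     (null-* (+ 166464) (α *ᴿ α +ᴿ -ᴿ fromℤ (+ 2)) (≃⇒null (α *ᴿ α) (fromℤ (+ 2)) α²≃2))))
   where
   θ = ⟦ 0ℤ , + 408 ⟧ α
   α≥0 : NonNeg α
   α≥0 = ≗-nn (α +ᴿ -ᴿ 0ᴿ) α (λ n → trans (cong (λ z → seq α n + z) (neg-seq 0ᴿ n)) (ℚₚ.+-identityʳ (seq α n))) (≤⇒nn 0ᴿ α 0≤α)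
   lemma : ∀ r a t → r * r * (a * a + - t) ≡ (0ℚ + r * a) * (0ℚ + r * a) + - (r * r * t)
   lemma = Solver.solve-∀ ℚ-ring

module Hardness where

 open import Defs using (ℝ; blank; bit; Quadratic; _≃ᴿ_; _*ᴿ_; fromℤ; _≤ᴿ_; 0ᴿ; ∃′; sentence; IsTrue; encode; Word; Language; Deciding; TM; module Run; Decides; PSPACE; PolyTimeComputable; poly; _≤ₚ_; PSPACE-Hard)
 open Pairs using (module Unit; pair; 0ᴱ; 1ᴱ)
 open Digits using (maxDigit; digit; module Powers)
 open Encoding
 open Sentences using (Hole; U; V; C₁; C₂; module Building; module Semantics; instantiate; sentencePieces; encode-instantiate)
 open Transcripts using (initialᵈ; relationᵈ; code≤; Kind)
 open Rows using (leftEnd; inner; beforeHead; atHead; afterHead; rightEnd; module Alphabet)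
 open Words using (Segment; fixed; timesN; perInput; expandAll; replicate-+; kindDigit; module Program)
 open Calculation using (module Arithmetic; module Polynomials)
 open Writing using (module Output)
 open Radicals using (Radical; quadratic⇒radical; √2-radical)
 open import Data.Fin using (zero; suc)
 open import Data.Integer using (+_; _+_; _*_; _-_)
 open import Data.List using (length; replicate; applyUpTo; concat)
 open import Data.Nat using (_^_)
 open import Function.Bundles using (_⇔_; mk⇔; Equivalence)

 computable-≗ : ∀ {f h} → (∀ w → f w ≡ h w) → PolyTimeComputable f → PolyTimeComputable h
 computable-≗ f≗h (M , k , spec) = M , k , λ w → let t , t≤ , halted , out = spec w in t , t≤ , halted , trans out (f≗h w)

 positive⇒≢0 : ∀ {n} → 1 ℕ.≤ n → n ≢ 0
 positive⇒≢0 (s≤s _) ()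

 poly≤power : ∀ k n → poly k n ℕ.≤ (2 ℕ.+ n) ^ suc k
 poly≤power k n = ℕₚ.≤-trans (ℕₚ.+-mono-≤ (ℕₚ.^-monoˡ-≤ k (ℕₚ.m≤n+m n 2)) (proj₂ (Polynomials.constantᵖ k) n))
   (ℕₚ.≤-trans (ℕₚ.≤-reflexive (cong (λ x → (2 ℕ.+ n) ^ k ℕ.+ x) (sym (ℕₚ.+-identityʳ ((2 ℕ.+ n) ^ k))))) (ℕₚ.*-monoˡ-≤ ((2 ℕ.+ n) ^ k) {2} {2 ℕ.+ n} (ℕₚ.m≤m+n 2 n)))

 module Evaluation (a D : ℕ) (D≡ : + D ≡ Unit.D a) (1≤a : 1 ℕ.≤ a) (1≤D : 1 ℕ.≤ D) where
   open Arithmetic a D maxDigit using (horner; hornerAll)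
   open Powers a

   horner-eval : ∀ ds → (+ proj₁ (hornerAll ds (0 , 0)) , + proj₂ (hornerAll ds (0 , 0))) ≡ eval ds
   horner-eval []       = refl
   horner-eval (d ∷ ds) = trans (pair (first (proj₁ z) (proj₂ z)) (second (proj₁ z) (proj₂ z))) (cong (λ e → (+ d , 0ℤ) Pairs.⊕ Unit.ε· a e) (horner-eval ds))
     where
     z = hornerAll ds (0 , 0)
     lemma : ∀ x y d → x + y + d ≡ d + (x + y)
     lemma = ℤSolver.solve-∀
     first : ∀ x y → + (a ℕ.* x ℕ.+ D ℕ.* y ℕ.+ d) ≡ + d + (+ a * + x + Unit.D a * + y)
     first x y = trans (cong₂ (λ p q → p + q + + d) (ℤₚ.pos-* a x) (trans (ℤₚ.pos-* D y) (cong (_* + y) D≡))) (lemma (+ a * + x) (Unit.D a * + y) (+ d))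
     second : ∀ x y → + (x ℕ.+ a ℕ.* y ℕ.+ 0) ≡ 0ℤ + (+ x + + a * + y)
     second x y = trans (cong (λ q → + x + q + 0ℤ) (ℤₚ.pos-* a y)) (lemma (+ x) (+ a * + y) 0ℤ)

   eval-power : ∀ s → eval (replicate s 0 ++ 1 ∷ []) ≡ pow s
   eval-power zero    = pair (lemma (+ a) (Unit.D a)) (lemma′ (+ a))
     where
     lemma′ : ∀ a → 0ℤ + (0ℤ + a * 0ℤ) ≡ 0ℤ
     lemma′ = ℤSolver.solve-∀
     lemma : ∀ a D → 1ℤ + (a * 0ℤ + D * 0ℤ) ≡ 1ℤ
     lemma = ℤSolver.solve-∀
   eval-power (suc s) = trans (pair (ℤₚ.+-identityˡ _) (ℤₚ.+-identityˡ _)) (cong (Unit.ε· a) (eval-power s))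

   positive₁ : ∀ d z → 1 ℕ.≤ d → 1 ℕ.≤ proj₁ (horner d z)
   positive₁ d z 1≤d = ℕₚ.≤-trans 1≤d (ℕₚ.m≤n+m d _)

   positive-horner : ∀ d z → 1 ℕ.≤ proj₁ z → 1 ℕ.≤ proj₁ (horner d z) × 1 ℕ.≤ proj₂ (horner d z)
   positive-horner d (x , y) 1≤x =
     ℕₚ.≤-trans (ℕₚ.*-mono-≤ 1≤a 1≤x) (ℕₚ.≤-trans (ℕₚ.m≤m+n (a ℕ.* x) (D ℕ.* y)) (ℕₚ.m≤m+n _ d)) ,
     ℕₚ.≤-trans 1≤x (ℕₚ.≤-trans (ℕₚ.m≤m+n x (a ℕ.* y)) (ℕₚ.m≤m+n _ 0))

   positive-power : ∀ s → 1 ℕ.≤ proj₁ (hornerAll (replicate s 0 ++ 1 ∷ []) (0 , 0))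
   positive-power zero    = positive₁ 1 (0 , 0) (s≤s z≤n)
   positive-power (suc s) = proj₁ (positive-horner 0 _ (positive-power s))

 module Reduction (α : ℝ) (root : Radical α) (radix : ℕ) (radix≡ : radix ≡ suc maxDigit) (K : ℕ)
                  (K≥ : 12 ℕ.+ (5 ℕ.* (8 ℕ.+ (radix ℕ.* (radix ℕ.* 8 ℕ.+ 1) ℕ.+ 1)) ℕ.+ 1) ℕ.≤ K)
                  (M : TM) (k : ℕ) (space≤ : ∀ w t → Run.space M (Run.after M t w) ℕ.≤ poly k (length w)) where
   open Radical root
   open Building a e₀ e₁ radix
   open Program M
   open Alphabet M using (module Columns; slot; is; W)

   D : ℕ
   D = a ℕ.* a ℕ.∸ 1

   1≤a : 1 ℕ.≤ a
   1≤a = ℕₚ.≤-trans (s≤s z≤n) 500≤a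

   D+1 : 1 ℕ.+ D ≡ a ℕ.* a
   D+1 = ℕₚ.m+[n∸m]≡n (ℕₚ.*-mono-≤ 1≤a 1≤a)

   D≡ : + D ≡ Unit.D a
   D≡ = trans (lemma (+ D)) (cong (_- 1ℤ) (trans (cong +_ D+1) (ℤₚ.pos-* a a)))
     where
     lemma : ∀ d → d ≡ 1ℤ + d - 1ℤ
     lemma = ℤSolver.solve-∀

   1≤D : 1 ℕ.≤ D
   1≤D = ℕₚ.≤-pred (ℕₚ.≤-trans (s≤s (s≤s z≤n)) (ℕₚ.≤-trans (ℕₚ.*-mono-≤ 500≤a 1≤a) (ℕₚ.≤-reflexive (sym D+1))))

   open Evaluation a D D≡ 1≤a 1≤D
   open Arithmetic a D maxDigit using (hornerAll; Bounds)
   open Powers a using (pow; eval)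

   segments : Hole → List Segment
   segments (U i) = shiftSegments i
   segments (V i) = shiftSegments i
   segments C₁    = programSegments
   segments C₂    = programSegments

   side : Hole → Bool
   side (U _) = true
   side (V _) = false
   side C₁    = true
   side C₂    = false

   open Output.Writer a D maxDigit (suc k) Hole segments side using (size; numbersAt; filling; flatten-computable)

   word≤ : ∀ κ → All (ℕ._≤ maxDigit) (word κ)
   word≤ κ = Allₚ.applyUpTo⁺₂ (λ i → kindDigit (κ i)) W (λ i → code≤ (just (κ i , false , false , false)))

   columns≤ : ∀ C ζ → All (ℕ._≤ maxDigit) (word (Columns.tapes C ζ))
   columns≤ C ζ = word≤ (Columns.tapes C ζ)

   row-bounds : ∀ C → All Bounds (rowSegments C)
   row-bounds C = Allₚ.++⁺ (word≤ (Columns.control C)) (columns≤ C leftEnd) ∷ columns≤ C inner ∷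
     Allₚ.++⁺ (columns≤ C beforeHead) (Allₚ.++⁺ (columns≤ C atHead) (columns≤ C afterHead)) ∷ (λ _ → columns≤ C inner) ∷ columns≤ C inner ∷ columns≤ C rightEnd ∷ []

   symbol≤ : ∀ s → All (ℕ._≤ maxDigit) (symbolWord s)
   symbol≤ s = word≤ (λ k → loading (slot (λ τ i → is (onInputTape s τ) i) false k))

   load-bounds : All Bounds loadSegments
   load-bounds = word≤ (λ k → loading (controlBit k)) ∷ Allₚ.++⁺ (symbol≤ blank) (symbol≤ blank) ∷ symbol≤ blank ∷ (λ b → symbol≤ (bit b)) ∷ symbol≤ blank ∷
     Allₚ.++⁺ (symbol≤ blank) (Allₚ.++⁺ (symbol≤ blank) (symbol≤ blank)) ∷ []

   program-bounds : All Bounds programSegments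
   program-bounds = Allₚ.++⁺ load-bounds (Allₚ.concat⁺ (Allₚ.applyUpTo⁺₂ (λ r → rowSegments (rowColumns r)) period (λ r → row-bounds (rowColumns r))))

   zeros≤ : ∀ n → All (ℕ._≤ maxDigit) (replicate n 0)
   zeros≤ n = Allₚ.replicate⁺ n z≤n

   rowZeros-bounds : All Bounds rowZeros
   rowZeros-bounds = zeros≤ (6 ℕ.* W) ∷ zeros≤ W ∷ (λ _ → zeros≤ W) ∷ zeros≤ W ∷ []

   shift-bounds : ∀ i → All Bounds (shiftSegments i)
   shift-bounds zero                   = (z≤n ∷ s≤s z≤n ∷ []) ∷ []
   shift-bounds (suc zero)             = Allₚ.++⁺ (zeros≤ W) (s≤s z≤n ∷ []) ∷ []
   shift-bounds (suc (suc zero))       = Allₚ.++⁺ rowZeros-bounds ((s≤s z≤n ∷ []) ∷ [])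
   shift-bounds (suc (suc (suc zero))) = Allₚ.++⁺ (Allₚ.concat⁺ (Allₚ.replicate⁺ period rowZeros-bounds)) ((s≤s z≤n ∷ []) ∷ [])

   bounds : ∀ h → All Bounds (segments h)
   bounds (U i) = shift-bounds i
   bounds (V i) = shift-bounds i
   bounds C₁    = program-bounds
   bounds C₂    = program-bounds

   module At (w : Word) where
     open On (size w) w
     open Shifts (size w) w using (shifts-expand)

     shift-positive : ∀ i → ∃ λ s → Gr.shift i ≡ suc s
     shift-positive zero                   = _ , refl
     shift-positive (suc zero)             = _ , refl
     shift-positive (suc (suc zero))       = _ , refl
     shift-positive (suc (suc (suc zero))) = _ , refl

     shift-filling : ∀ i → (+ filling w (U i) , + filling w (V i)) ≡ pow (Gr.shift i)
     shift-filling i = trans (horner-eval (expandAll (size w) w (shiftSegments i))) (trans (cong eval (shifts-expand i)) (eval-power (Gr.shift i)))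

     program-filling : (+ filling w C₁ , + filling w C₂) ≡ eval prescribed
     program-filling = horner-eval prescribed

     shift-numbers : ∀ i → 1 ℕ.≤ filling w (U i) × 1 ℕ.≤ filling w (V i)
     shift-numbers i = let s , s≡ = shift-positive i in
       subst (λ ds → 1 ℕ.≤ proj₁ (hornerAll ds (0 , 0)) × 1 ℕ.≤ proj₂ (hornerAll ds (0 , 0))) (sym (trans (shifts-expand i) (cong (λ s → replicate s 0 ++ 1 ∷ []) s≡)))
         (positive-horner 0 _ (positive-power s))

     program-numbers : 1 ℕ.≤ filling w C₁ × 1 ℕ.≤ filling w C₂
     program-numbers = subst (λ ds → 1 ℕ.≤ proj₁ (hornerAll ds (0 , 0)) × 1 ℕ.≤ proj₂ (hornerAll ds (0 , 0))) (sym prescribed-cells)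
       (two (suc period ℕ.* L.len) (λ i → kindDigit (κ i)) (λ i → positive-kind (κ i)) (ℕₚ.+-mono-≤ {1} {L.len} {1} (s≤s z≤n) (ℕₚ.*-mono-≤ {1} {period} {1} {L.len} (s≤s z≤n) (s≤s z≤n))))
       where
       κ : ℕ → Kind
       κ i = kindOfRow (proj₁ (Cells.place i)) (proj₂ (Cells.place i))
       positive-kind : ∀ κ → 1 ℕ.≤ kindDigit κ
       positive-kind _ = s≤s z≤n
       two : ∀ n (f : ℕ → ℕ) → (∀ i → 1 ℕ.≤ f i) → 2 ℕ.≤ n → 1 ℕ.≤ proj₁ (hornerAll (applyUpTo f n) (0 , 0)) × 1 ℕ.≤ proj₂ (hornerAll (applyUpTo f n) (0 , 0))
       two (suc (suc n)) f f>0 _ = positive-horner (f 0) _ (positive₁ (f 1) (hornerAll (applyUpTo (λ i → f (suc (suc i))) n) (0 , 0)) (f>0 1))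
       two (suc zero)    f f>0 (s≤s ())

     filling≢0 : ∀ h → filling w h ≢ 0
     filling≢0 (U i) = positive⇒≢0 (proj₁ (shift-numbers i))
     filling≢0 (V i) = positive⇒≢0 (proj₂ (shift-numbers i))
     filling≢0 C₁    = positive⇒≢0 (proj₁ program-numbers)
     filling≢0 C₂    = positive⇒≢0 (proj₂ program-numbers)

     open Bounded (λ t → ℕₚ.≤-trans (space≤ w t) (poly≤power k (length w))) public using (accepted; rejected)
     open Semantics.Atoms.Truth α e₀ e₁ a 500≤a nonneg square (filling w) radix radix≡ Gr.shift shift-filling prescribed prescribed≤ program-filling initialᵈ relationᵈ public
       using (φ; true⇒admissible; admissible⇒true)

   image : Word → Word
   image w = encode (At.φ w)

   image-computable : PolyTimeComputable image
   image-computable = computable-≗ (λ w → encode-instantiate (filling w) (At.filling≢0 w) {∃′} {6 ∷ 4 ∷ 11 ∷ []} (whole initialᵈ relationᵈ))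
     (flatten-computable bounds At.filling≢0 (sentencePieces ∃′ (6 ∷ 4 ∷ 11 ∷ []) (whole initialᵈ relationᵈ)))

   module _ {L : Language} (decides : Decides M L) where
     open Run M using (after; state; Accepting; Halted)
     open TM M using (accepting)

     correct : ∀ w → L w ⇔ Deciding α ∃′ (6 ∷ 4 ∷ 11 ∷ []) K (image w)
     correct w = from-run (decides w)
       where
       from-run : (∃ λ t → Halted (after t w) × (L w ⇔ Accepting (after t w))) → L w ⇔ Deciding α ∃′ (6 ∷ 4 ∷ 11 ∷ []) K (image w)
       from-run (t , halted , L⇔) = mk⇔ there back
         where
         there : L w → Deciding α ∃′ (6 ∷ 4 ∷ 11 ∷ []) K (image w)
         there Lw = let ds , ds≤ , admissible = At.accepted w t halted (Equivalence.to L⇔ Lw) in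
           At.φ w , refl , ℕₚ.≤-trans (count-whole initialᵈ relationᵈ (filling w)) K≥ , At.admissible⇒true w ds ds≤ admissible
         by-answer : ∀ b → accepting (state (after t w)) ≡ b → IsTrue α (At.φ w) → L w
         by-answer true  eq _    = Equivalence.from L⇔ eq
         by-answer false eq true′ = let d , _ , admissible = At.true⇒admissible w true′ in ⊥-elim (At.rejected w t halted eq d admissible)
         back : Deciding α ∃′ (6 ∷ 4 ∷ 11 ∷ []) K (image w) → L w
         back (φ′ , eq , _ , true′) = by-answer _ refl (subst (IsTrue α) (sym (encode-injective (At.φ w) φ′ eq)) true′)

 hard : ∀ α → Radical α → ∀ K → 12 ℕ.+ (5 ℕ.* (8 ℕ.+ (105 ℕ.* (105 ℕ.* 8 ℕ.+ 1) ℕ.+ 1)) ℕ.+ 1) ℕ.≤ K → PSPACE-Hard (Deciding α ∃′ (6 ∷ 4 ∷ 11 ∷ []) K)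
 hard α root K K≥ L (M , decides , k , space≤) = image , image-computable , correct decides
   where
   open Reduction α root 105 refl K K≥ M k space≤

open Radicals using (quadratic⇒radical; √2-radical)
open Hardness using (hard)
open import Defs
open import Data.Integer using (+_)
open import Data.List using ([]; _∷_)
open import Data.Nat using (ℕ; _^_)
open import Data.Product using (_×_; ∃)

theorem1p4 : (∀ (α : ℝ) → Quadratic α →
    ∃ λ (K : ℕ) → PSPACE-Hard (Deciding α ∃′ (6 ∷ 4 ∷ 11 ∷ []) K))
    ×
    (∀ (α : ℝ) → 0ᴿ ≤ᴿ α → α *ᴿ α ≃ᴿ fromℤ (+ 2) →
    PSPACE-Hard (Deciding α ∃′ (6 ∷ 4 ∷ 11 ∷ []) (10 ^ 6)))
theorem1p4 =
  (λ α quadratic → _ , hard α (quadratic⇒radical α quadratic) _ ℕₚ.≤-refl) ,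
  (λ α 0≤α α²≃2 → hard α (√2-radical α 0≤α α²≃2) (10 ^ 6) (ℕₚ.≤ᵇ⇒≤ _ _ _))
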